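{- Let $K=\mathbb Q(\sqrt2)$ with ring of integers $\mathcal O_K=\mathbb Z[\sqrt2]$, and in $\left(\frac{ -1,-1}{K}\right)$ let $$\mathcal G=\mathcal O_K\oplus\mathcal O_K2\mathbf i\oplus\mathcal O_K\tfrac{\mathbf i+\mathbf j}{\sqrt2}\oplus\mathcal O_K\tfrac{(1+\sqrt2)+(\sqrt2-1)\mathbf i+\mathbf j+\mathbf k}{2}.$$ Let $\alpha\in\mathcal O_K$ be totally positive with $\alpha\in(\sqrt2)^e\mathcal O_K\setminus(\sqrt2)^{e+1}\mathcal O_K$. Then $$r_{\mathcal G}(\alpha)=4\sum_{\substack{\delta\mathcal O_K\mid\alpha\mathcal O_K\\ \sqrt2\mathcal O_K\nmid\delta\mathcal O_K}}\operatorname{Nm}(\delta\mathcal O_K)\cdot\begin{cases}1,&e=0,\\2\cdot2,&e=1,\\3\cdot2^2,&e=2,\\2(2^2+\dots+2^e)+2\cdot2^e-2^2,&e\ge3.\end{cases}$$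
   Context: $\left(\frac{ -1,-1}{K}\right)$ has $K$-basis $1,\mathbf i,\mathbf j,\mathbf k$ with $\mathbf i^2=\mathbf j^2=-1$, $\mathbf k=\mathbf i\mathbf j=-\mathbf j\mathbf i$, and reduced norm $\operatorname{nrd}(t+x\mathbf i+y\mathbf j+z\mathbf k)=t^2+x^2+y^2+z^2$. $r_{\mathcal G}(\alpha)=\#\{\mathbf q\in\mathcal G:\operatorname{nrd}\mathbf q=\alpha\}$; the sum runs over ideals of $\mathcal O_K$ dividing $\alpha\mathcal O_K$ not divisible by $\sqrt2\mathcal O_K$; $\operatorname{Nm}$ is the absolute norm. -}

module Defs where

open import Data.Nat as ℕ using (ℕ; zero; suc)
open import Data.Integer as ℤ using (ℤ; +_; -[1+_])
open import Data.Rational as ℚ using (ℚ; ½; 0ℚ; 1ℚ)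
open import Data.Product using (Σ; ∃; _×_; _,_)
open import Data.Sum using (_⊎_)
open import Data.List using (List; map; length)
open import Data.List.Relation.Unary.All using (All)
open import Data.List.Relation.Unary.Any using (Any)
open import Data.List.Relation.Unary.AllPairs using (AllPairs)
open import Data.List.Relation.Unary.Unique.Propositional using (Unique)
open import Data.List.Membership.Propositional using (_∈_)
open import Relation.Binary.PropositionalEquality using (_≡_)
open import Relation.Nullary using (¬_)
open import Function.Bundles using (_⇔_)

-- The ring of integers O_K = ℤ[√2] of K = ℚ(√2):  ok a b  =  a + b√2

record OK : Set where
  constructor ok
  field
    a : ℤ
    b : ℤ
open OK public

infixl 6 _+ₒ_
infixl 7 _*ₒ_

_+ₒ_ : OK → OK → OK
ok a₁ b₁ +ₒ ok a₂ b₂ = ok (a₁ ℤ.+ a₂) (b₁ ℤ.+ b₂)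

_*ₒ_ : OK → OK → OK
ok a₁ b₁ *ₒ ok a₂ b₂ =
  ok (a₁ ℤ.* a₂ ℤ.+ + 2 ℤ.* b₁ ℤ.* b₂) (a₁ ℤ.* b₂ ℤ.+ b₁ ℤ.* a₂)

√2ₒ : OK
√2ₒ = ok (+ 0) (+ 1)

√2^ : ℕ → OK
√2^ zero = ok (+ 1) (+ 0)
√2^ (suc n) = √2ₒ *ₒ √2^ n

-- divisibility in O_K;  δ ∣ α  iff  the ideal αO_K ⊆ δO_K, i.e. δO_K ∣ αO_K
_∣ₒ_ : OK → OK → Set
δ ∣ₒ α = Σ OK λ γ → α ≡ δ *ₒ γ

InPow√2 : ℕ → OK → Set
InPow√2 e α = √2^ e ∣ₒ α

SameIdeal : OK → OK → Set
SameIdeal δ δ' = (δ ∣ₒ δ') × (δ' ∣ₒ δ)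

Nm : OK → ℕ
Nm (ok x y) = ℤ.∣ x ℤ.* x ℤ.- + 2 ℤ.* y ℤ.* y ∣

-- positivity of the real number x + y√2, decided using only integers
Positive√2 : ℤ → ℤ → Set
Positive√2 x y =
    (ℤ.0ℤ ℤ.≤ x × ℤ.0ℤ ℤ.≤ y × ¬ (x ≡ ℤ.0ℤ × y ≡ ℤ.0ℤ))
  ⊎ (ℤ.0ℤ ℤ.< x × y ℤ.< ℤ.0ℤ × + 2 ℤ.* y ℤ.* y ℤ.< x ℤ.* x)
  ⊎ (x ℤ.< ℤ.0ℤ × ℤ.0ℤ ℤ.< y × x ℤ.* x ℤ.< + 2 ℤ.* y ℤ.* y)

TotallyPositive : OK → Set
TotallyPositive (ok x y) = Positive√2 x y × Positive√2 x (ℤ.- y)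

-- The field K = ℚ(√2):  r + s√2  with r s ∈ ℚ

record K : Set where
  constructor mkK
  field
    re : ℚ
    im : ℚ

_+ₖ_ : K → K → K
mkK r₁ s₁ +ₖ mkK r₂ s₂ = mkK (r₁ ℚ.+ r₂) (s₁ ℚ.+ s₂)

_*ₖ_ : K → K → K
mkK r₁ s₁ *ₖ mkK r₂ s₂ =
  mkK (r₁ ℚ.* r₂ ℚ.+ (+ 2 ℚ./ 1) ℚ.* s₁ ℚ.* s₂) (r₁ ℚ.* s₂ ℚ.+ s₁ ℚ.* r₂)

ι : OK → K
ι (ok x y) = mkK (x ℚ./ 1) (y ℚ./ 1)

-- The quaternion algebra (-1,-1 / K): t + x i + y j + z k

record H : Set where
  constructor quat
  field
    t x y z : K

_+ₕ_ : H → H → H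
quat t₁ x₁ y₁ z₁ +ₕ quat t₂ x₂ y₂ z₂ =
  quat (t₁ +ₖ t₂) (x₁ +ₖ x₂) (y₁ +ₖ y₂) (z₁ +ₖ z₂)

_·ₕ_ : K → H → H
c ·ₕ quat t x y z = quat (c *ₖ t) (c *ₖ x) (c *ₖ y) (c *ₖ z)

nrd : H → K
nrd (quat t x y z) = ((t *ₖ t) +ₖ (x *ₖ x)) +ₖ ((y *ₖ y) +ₖ (z *ₖ z))

0K 1K : K
0K = mkK 0ℚ 0ℚ
1K = mkK 1ℚ 0ℚ

g₀ g₁ g₂ g₃ : H
g₀ = quat 1K 0K 0K 0K
g₁ = quat 0K (mkK (+ 2 ℚ./ 1) 0ℚ) 0K 0K
-- 1/√2 = (1/2)√2
g₂ = quat 0K (mkK 0ℚ ½) (mkK 0ℚ ½) 0K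
g₃ = quat (mkK ½ ½) (mkK (ℚ.- ½) ½) (mkK ½ 0ℚ) (mkK ½ 0ℚ)

In𝒢 : H → Set
In𝒢 q = Σ OK λ c₀ → Σ OK λ c₁ → Σ OK λ c₂ → Σ OK λ c₃ →
  q ≡ ((ι c₀ ·ₕ g₀) +ₕ (ι c₁ ·ₕ g₁)) +ₕ ((ι c₂ ·ₕ g₂) +ₕ (ι c₃ ·ₕ g₃))

-- qs is an exact duplicate-free enumeration of {q ∈ 𝒢 : nrd q = α};
-- then r_𝒢(α) = length qs
Enumerates-r𝒢 : OK → List H → Set
Enumerates-r𝒢 α qs =
  Unique qs × (∀ q → (q ∈ qs) ⇔ (In𝒢 q × nrd q ≡ ι α))

-- ds is a list of generators of the ideals δO_K with δO_K ∣ αO_K and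
-- √2 O_K ∤ δO_K, each such ideal occurring exactly once
DivisorIdeals : OK → List OK → Set
DivisorIdeals α ds =
    All (λ δ → δ ∣ₒ α × ¬ (√2ₒ ∣ₒ δ)) ds
  × AllPairs (λ δ δ' → ¬ SameIdeal δ δ') ds
  × (∀ δ → δ ∣ₒ α → ¬ (√2ₒ ∣ₒ δ) → Any (SameIdeal δ) ds)

sumPow2From2 : ℕ → ℕ
sumPow2From2 zero = 0
sumPow2From2 (suc zero) = 0
sumPow2From2 (suc (suc n)) = sumPow2From2 (suc n) ℕ.+ 2 ℕ.^ (suc (suc n))

factor2 : ℕ → ℕ
factor2 zero = 1
factor2 (suc zero) = 2 ℕ.* 2
factor2 (suc (suc zero)) = 3 ℕ.* 2 ℕ.^ 2
factor2 e@(suc (suc (suc _))) =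
  (2 ℕ.* sumPow2From2 e ℕ.+ 2 ℕ.* 2 ℕ.^ e) ℕ.∸ 2 ℕ.^ 2

{-# OPTIONS --safe #-}
-- The order 𝒪 generated by f = (1 + i) / √2 and g = (1 + j) / √2 is maximal and norm-Euclidean, and at √2 the
-- order 𝒢 consists of the matrices whose lower left entry is divisible by √2³; call this level 3. For odd α, choose
-- n odd and divisible by α²; a solution of a² + b² + 1 ≡ 0 modulo n gives 𝒪 / n ≅ M₂(ℤ[√2] / n), under which the
-- left ideals of 𝒪 of norm α become the row lattices of Hermite forms ((γ , t) , (0 , δ)) with γ δ = α and t modulo δ.
-- There are Nm δ of them for each δ, all principal by Euclid's algorithm and with a generator in 𝒢. Hence for N ≤ 3
-- the elements of norm α and level N number (units of level N) · Σ Nm δ. For even α, right division by elements of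
-- norm π = 2 + √2, which is totally positive and generates √2 ℤ[√2], relates the counts at level N and norm π β to
-- those at level N - 1 and norm β, and the case distinction in e is the solution of the resulting recursion.
module Submission where

open import Data.Nat as ℕ using (ℕ; zero; suc; z≤n; s≤s)
import Data.Nat.Properties as ℕₚ
open import Data.Integer as ℤ using (ℤ; -[1+_]; 0ℤ; 1ℤ; +≤+; +<+)
import Data.Integer.Properties as ℤₚ
import Data.Integer.Tactic.RingSolver as ℤ-Solver
open import Data.Product using (∃; ∃₂; _×_; _,_; proj₁; proj₂)
open import Data.Sum using (_⊎_; inj₁; inj₂)
open import Relation.Binary.PropositionalEquality
open import Relation.Nullary using (¬_; Dec; yes; no; contradiction)

-- The Euclidean property is tight. As a ℤ-lattice 𝒪 is a product of two four-dimensional lattices,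
-- one carrying the rational and one the irrational coordinates, and their covering radii alone only
-- bound the norm of a remainder by that of the divisor, with equality possible. The cross term
-- between the two parts decides the critical case, so ties in the rounding must be broken with the
-- other part in view. Euclid's algorithm determines the reduced norm of a generator only up to a
-- unit of ℤ[√2]. Because 1 + √2 has norm -1, every totally positive unit is a square, and rescaling
-- the generator makes its norm exactly α. The bound N ≤ 3 comes from integral linear forms that
-- imitate matrix entries at √2: their product rule has an error divisible by √2³. The units of
-- levels 0 to 3 number 48, 16, 8 and 4. The indices 3, 6 and 12 are the sizes of the projective
-- lines over ℤ[√2] modulo √2, √2² and √2³, so the units act transitively on them; this is why an
-- ideal of odd norm has a generator in 𝒢.

module Quadruple where
  data Quat (A : Set) : Set where
    ⟪_,_,_,_⟫ : A → A → A → A → Quat A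

  co₀ co₁ co₂ co₃ : {A : Set} → Quat A → A
  co₀ ⟪ a , b , c , d ⟫ = a
  co₁ ⟪ a , b , c , d ⟫ = b
  co₂ ⟪ a , b , c , d ⟫ = c
  co₃ ⟪ a , b , c , d ⟫ = d

  Quat-ext : {A : Set} {x y : Quat A} → co₀ x ≡ co₀ y → co₁ x ≡ co₁ y → co₂ x ≡ co₂ y → co₃ x ≡ co₃ y → x ≡ y
  Quat-ext {x = ⟪ _ , _ , _ , _ ⟫} {⟪ _ , _ , _ , _ ⟫} refl refl refl refl = refl

-- Rounding vectors of ℤ⁴ to two lattices, with a strict bound.

module IntegerRounding where
  open Quadruple
  open import Relation.Binary.Definitions using (tri<; tri≈; tri>)
  open import Data.Integer using (+_)
  open import Data.Integer using (_+_; _*_; -_; _≤_; _<_; ∣_∣)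
  open import Data.Integer.DivMod using (_/ℕ_; _%ℕ_; a≡a%ℕn+[a/ℕn]*n; n%ℕd<d)
  open import Data.Integer.Tactic.RingSolver using (solve-∀)
  open ℤₚ using (_<?_; _≟_; ≤-refl; ≤-trans; <⇒≤; ≮⇒≥)

  ≤-by : ∀ {x y} z → 0ℤ ≤ z → y ≡ x + z → x ≤ y
  ≤-by {x} z 0≤z refl = subst (_≤ x + z) (ℤₚ.+-identityʳ x) (ℤₚ.+-monoʳ-≤ x 0≤z)

  <-by : ∀ {x y} z → 0ℤ < z → y ≡ x + z → x < y
  <-by {x} z 0<z refl = subst (_< x + z) (ℤₚ.+-identityʳ x) (ℤₚ.+-monoʳ-< x 0<z)

  0≤+ : ∀ {x y} → 0ℤ ≤ x → 0ℤ ≤ y → 0ℤ ≤ x + y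
  0≤+ = ℤₚ.+-mono-≤

  0≤* : ∀ {x y} → 0ℤ ≤ x → 0ℤ ≤ y → 0ℤ ≤ x * y
  0≤* {+ m} {+ n} _ _ = subst (0ℤ ≤_) (ℤₚ.pos-* m n) (+≤+ z≤n)

  0<* : ∀ {x y} → 0ℤ < x → 0ℤ < y → 0ℤ < x * y
  0<* {+ suc m} {+ suc n} _ _ = +<+ (s≤s z≤n)
  0<* {+ zero} (+<+ ()) _
  0<* {+ suc m} {+ zero} _ (+<+ ())

  0≤sq : ∀ x → 0ℤ ≤ x * x
  0≤sq (+ n) = 0≤* {+ n} (+≤+ z≤n) (+≤+ z≤n)
  0≤sq -[1+ n ] = +≤+ z≤n

  sq≡0 : ∀ x → x * x ≡ 0ℤ → x ≡ 0ℤ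
  sq≡0 (+ zero) _ = refl

  0<sq : ∀ {x} → x ≢ 0ℤ → 0ℤ < x * x
  0<sq {+ zero} x≢0 = contradiction refl x≢0
  0<sq {+ suc n} _ = +<+ (s≤s z≤n)
  0<sq { -[1+ n ]} _ = +<+ (s≤s z≤n)

  sum≡0 : ∀ {x y} → 0ℤ ≤ x → 0ℤ ≤ y → x + y ≡ 0ℤ → x ≡ 0ℤ × y ≡ 0ℤ
  sum≡0 {+ zero} {+ zero} _ _ refl = refl , refl

  sq-mono-< : ∀ {x y} → 0ℤ ≤ x → x < y → x * x < y * y
  sq-mono-< {+ m} {+ n} _ (+<+ m<n) =
    subst₂ _<_ (ℤₚ.pos-* m m) (ℤₚ.pos-* n n) (+<+ (ℕₚ.*-mono-< m<n m<n))

  sq-mono-≤ : ∀ {x y} → 0ℤ ≤ x → x ≤ y → x * x ≤ y * y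
  sq-mono-≤ {+ m} {+ n} _ (+≤+ m≤n) =
    subst₂ _≤_ (ℤₚ.pos-* m m) (ℤₚ.pos-* n n) (+≤+ (ℕₚ.*-mono-≤ m≤n m≤n))

  -- The residuals of v to the nearest even and to the nearest odd multiple of N have absolute
  -- values adding up to N; a tie is broken by the sign of s.
  data Residuals (N v s : ℤ) : Set where
    residuals : ∀ k k' w w' → v ≡ w + (+ 2 * k + 0ℤ) * N → v ≡ w' + (+ 2 * k' + 1ℤ) * N →
      (w * w + w' * w' < N * N) ⊎ (w * w + w' * w' ≡ N * N × (w + w') * s ≡ N * + ∣ s ∣) →
      Residuals N v s

  private
    v₀ : ∀ q N → + 0 + q * (N + N) ≡ + 0 + (+ 2 * q + 0ℤ) * N
    v₀ = solve-∀
    v₀₋ : ∀ q N → + 0 + q * (N + N) ≡ N + (+ 2 * (q + - 1ℤ) + 1ℤ) * N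
    v₀₋ = solve-∀
    v₀₊ : ∀ q N → + 0 + q * (N + N) ≡ - N + (+ 2 * q + 1ℤ) * N
    v₀₊ = solve-∀
    vₙ : ∀ q N → N + q * (N + N) ≡ + 0 + (+ 2 * q + 1ℤ) * N
    vₙ = solve-∀
    vₙ₋ : ∀ q N → N + q * (N + N) ≡ N + (+ 2 * q + 0ℤ) * N
    vₙ₋ = solve-∀
    vₙ₊ : ∀ q N → N + q * (N + N) ≡ - N + (+ 2 * (q + 1ℤ) + 0ℤ) * N
    vₙ₊ = solve-∀
    gap-w₁ : ∀ q M N → M + q * (N + N) ≡ M + (+ 2 * q + 0ℤ) * N
    gap-w₁ = solve-∀
    gap-w₂ : ∀ q M N → M + q * (N + N) ≡ (M + - N) + (+ 2 * q + 1ℤ) * N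
    gap-w₂ = solve-∀
    gap-w₃ : ∀ q M N → M + q * (N + N) ≡ (M + - (N + N)) + (+ 2 * (q + 1ℤ) + 0ℤ) * N
    gap-w₃ = solve-∀
    gap-e₁ : ∀ M P → (M + P) * (M + P) ≡ (M * M + (M + - (M + P)) * (M + - (M + P))) + + 2 * (M * P)
    gap-e₁ = solve-∀
    gap-e₂ : ∀ P Q → let N = P + Q ; M = N + P in N * N ≡ ((M + - (N + N)) * (M + - (N + N)) + (M + - N) * (M + - N)) + + 2 * (P * Q)
    gap-e₂ = solve-∀
    t₀₊ : ∀ N → 0ℤ * 0ℤ + N * N ≡ N * N
    t₀₊ = solve-∀
    t₀₋ : ∀ N → 0ℤ * 0ℤ + - N * - N ≡ N * N
    t₀₋ = solve-∀
    tₙ₊ : ∀ N → N * N + 0ℤ * 0ℤ ≡ N * N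
    tₙ₊ = solve-∀
    tₙ₋ : ∀ N → - N * - N + 0ℤ * 0ℤ ≡ N * N
    tₙ₋ = solve-∀
    tie-u₁ : ∀ N s → (0ℤ + N) * s ≡ N * s
    tie-u₁ = solve-∀
    tie-u₂ : ∀ N s → (0ℤ + - N) * s ≡ N * - s
    tie-u₂ = solve-∀
    tie-u₃ : ∀ N s → (N + 0ℤ) * s ≡ N * s
    tie-u₃ = solve-∀
    tie-u₄ : ∀ N s → (- N + 0ℤ) * s ≡ N * - s
    tie-u₄ = solve-∀

  -- The squares of the residuals add up to less than N² exactly when neither residual is 0.
  -- Otherwise v is a multiple of N and the nonzero residual can be taken as N or as -N, which is
  -- where the sign of s enters.
  residual : ∀ n → .{{_ : ℕ.NonZero n}} → ∀ v s → Residuals (+ n) v s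
  residual n@(suc _) v s = go s (v %ℕ (n ℕ.+ n)) (v /ℕ (n ℕ.+ n)) (n%ℕd<d v (n ℕ.+ n)) (a≡a%ℕn+[a/ℕn]*n v (n ℕ.+ n))
    where
    N = + n
    go : ∀ s m q → m ℕ.< n ℕ.+ n → v ≡ + m + q * (N + N) → Residuals N v s
    go s m q m<2n refl with ℕₚ.<-cmp m n
    go s zero q _ refl | tri< _ _ _ with s
    ... | + t = residuals q (q + - 1ℤ) 0ℤ N (v₀ q N) (v₀₋ q N) (inj₂ (t₀₊ N , tie-u₁ N (+ t)))
    ... | -[1+ t ] = residuals q q 0ℤ (- N) (v₀ q N) (v₀₊ q N) (inj₂ (t₀₋ N , tie-u₂ N -[1+ t ]))
    go s m@(suc m') q _ refl | tri< m<n _ _ with ℕₚ.m≤n⇒∃[o]m+o≡n m<n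
    ... | p , eq = residuals q q (+ m) (+ m + - N) (gap-w₁ q (+ m) N) (gap-w₂ q (+ m) N)
      (inj₁ (subst (λ N → (+ m * + m + (+ m + - N) * (+ m + - N)) < N * N) N≡
        (<-by (+ 2 * (+ m * + suc p)) (0<* {+ 2} (+<+ (s≤s z≤n)) (0<* {+ m} {+ suc p} (+<+ (s≤s z≤n)) (+<+ (s≤s z≤n)))) (gap-e₁ (+ m) (+ suc p)))))
      where
      N≡ : + m + + suc p ≡ N
      N≡ = cong +_ (trans (ℕₚ.+-suc m p) eq)
    go s m q _ refl | tri≈ _ refl _ with s
    ... | + t = residuals q q N 0ℤ (vₙ₋ q N) (vₙ q N) (inj₂ (tₙ₊ N , tie-u₃ N (+ t)))
    ... | -[1+ t ] = residuals (q + 1ℤ) q (- N) 0ℤ (vₙ₊ q N) (vₙ q N) (inj₂ (tₙ₋ N , tie-u₄ N -[1+ t ]))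
    go s m q m<2n refl | tri> _ _ n<m with ℕₚ.m≤n⇒∃[o]m+o≡n n<m | ℕₚ.m≤n⇒∃[o]m+o≡n m<2n
    ... | p , eq | r , eq' = residuals (q + 1ℤ) q (+ m + - (N + N)) (+ m + - N) (gap-w₃ q (+ m) N) (gap-w₂ q (+ m) N)
      (inj₁ (subst₂ (λ M N → ((M + - (N + N)) * (M + - (N + N)) + (M + - N) * (M + - N)) < N * N) M≡ N≡
        (<-by (+ 2 * (+ suc p * + suc r)) (0<* {+ 2} (+<+ (s≤s z≤n)) (0<* {+ suc p} {+ suc r} (+<+ (s≤s z≤n)) (+<+ (s≤s z≤n)))) (gap-e₂ (+ suc p) (+ suc r)))))
      where
      m≡ : n ℕ.+ suc p ≡ m
      m≡ = trans (ℕₚ.+-suc n p) eq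
      n≡ : suc p ℕ.+ suc r ≡ n
      n≡ = ℕₚ.+-cancelˡ-≡ n _ _ (trans (sym (ℕₚ.+-assoc n (suc p) (suc r))) (trans (cong (ℕ._+ suc r) m≡) (trans (ℕₚ.+-suc m r) eq')))
      N≡ : + suc p + + suc r ≡ N
      N≡ = cong +_ n≡
      M≡ : (+ suc p + + suc r) + + suc p ≡ + m
      M≡ = cong +_ (trans (cong (ℕ._+ suc p) n≡) m≡)

  infix 9 _·_
  _·_ : Quat ℤ → Quat ℤ → ℤ
  ⟪ a , b , c , d ⟫ · ⟪ a' , b' , c' , d' ⟫ = a * a' + b * b' + c * c' + d * d'

  shift : ℤ → ℤ → Quat ℤ → Quat ℤ → Quat ℤ
  shift N κ ⟪ k₀ , k₁ , k₂ , k₃ ⟫ ⟪ w₀ , w₁ , w₂ , w₃ ⟫ =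
    ⟪ w₀ + (+ 2 * k₀ + κ) * N , w₁ + (+ 2 * k₁ + κ) * N , w₂ + (+ 2 * k₂ + κ) * N , w₃ + (+ 2 * k₃ + κ) * N ⟫

  -- The vectors with coordinates 2k + κ form the lattice of integer vectors whose coordinates have
  -- one parity; its squared covering radius is 2. At a deepest hole the bound is attained, and the
  -- second alternative records that w is then not orthogonal to s unless s vanishes.
  data Rounded (N : ℤ) (v s : Quat ℤ) : Set where
    rounded : ∀ κ k w → v ≡ shift N κ k w →
      (w · w < + 2 * (N * N)) ⊎ (w · w ≡ + 2 * (N * N) × (w · s ≢ 0ℤ ⊎ s · s ≡ 0ℤ)) →
      Rounded N v s

  private
    tie-≤ : ∀ {e M} {P : Set} → (e < M) ⊎ (e ≡ M × P) → e ≤ M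
    tie-≤ (inj₁ e<M) = <⇒≤ e<M
    tie-≤ (inj₂ (refl , _)) = ≤-refl

    all-ties : ∀ {a b c d M} {P Q R S : Set} →
      (a < M) ⊎ (a ≡ M × P) → (b < M) ⊎ (b ≡ M × Q) → (c < M) ⊎ (c ≡ M × R) → (d < M) ⊎ (d ≡ M × S) →
      (a + b + c + d < M + M + M + M) ⊎ ((a ≡ M × P) × (b ≡ M × Q) × (c ≡ M × R) × (d ≡ M × S))
    all-ties (inj₂ a) (inj₂ b) (inj₂ c) (inj₂ d) = inj₂ (a , b , c , d)
    all-ties (inj₁ a) b c d = inj₁ (ℤₚ.+-mono-<-≤ (ℤₚ.+-mono-<-≤ (ℤₚ.+-mono-<-≤ a (tie-≤ b)) (tie-≤ c)) (tie-≤ d))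
    all-ties a (inj₁ b) c d = inj₁ (ℤₚ.+-mono-<-≤ (ℤₚ.+-mono-<-≤ (ℤₚ.+-mono-≤-< (tie-≤ a) b) (tie-≤ c)) (tie-≤ d))
    all-ties a b (inj₁ c) d = inj₁ (ℤₚ.+-mono-<-≤ (ℤₚ.+-mono-≤-< (ℤₚ.+-mono-≤ (tie-≤ a) (tie-≤ b)) c) (tie-≤ d))
    all-ties a b c (inj₁ d) = inj₁ (ℤₚ.+-mono-≤-< (ℤₚ.+-mono-≤ (ℤₚ.+-mono-≤ (tie-≤ a) (tie-≤ b)) (tie-≤ c)) d)

    regroup : ∀ a b c d a' b' c' d' →
      (a * a + a' * a') + (b * b + b' * b') + (c * c + c' * c') + (d * d + d' * d')
        ≡ (a * a + b * b + c * c + d * d) + (a' * a' + b' * b' + c' * c' + d' * d')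
    regroup = solve-∀

    regroup-· : ∀ a b c d a' b' c' d' s t u v →
      (a * s + b * t + c * u + d * v) + (a' * s + b' * t + c' * u + d' * v)
        ≡ (a + a') * s + (b + b') * t + (c + c') * u + (d + d') * v
    regroup-· = solve-∀

    4M : ∀ M → M + M + M + M ≡ + 2 * M + + 2 * M
    4M = solve-∀

    halves : ∀ {a b M} → + 2 * M ≤ a → + 2 * M ≤ b → a + b ≡ M + M + M + M → a ≡ + 2 * M × b ≡ + 2 * M
    halves {a} {b} {M} p q eq = ℤₚ.≤-antisym (ℤₚ.≮⇒≥ λ lt → ℤₚ.<-irrefl (sym (trans eq (4M M))) (ℤₚ.+-mono-<-≤ lt q)) p
                              , ℤₚ.≤-antisym (ℤₚ.≮⇒≥ λ lt → ℤₚ.<-irrefl (sym (trans eq (4M M))) (ℤₚ.+-mono-≤-< p lt)) q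

    0≤n∣x∣ : ∀ n x → 0ℤ ≤ + n * + ∣ x ∣
    0≤n∣x∣ n x = 0≤* {+ n} {+ ∣ x ∣} (+≤+ z≤n) (+≤+ z≤n)

    n∣x∣≡0 : ∀ n → .{{_ : ℕ.NonZero n}} → ∀ x → + n * + ∣ x ∣ ≡ 0ℤ → x ≡ 0ℤ
    n∣x∣≡0 n@(suc _) x eq = ℤₚ.∣i∣≡0⇒i≡0 (ℤₚ.+-injective (ℤₚ.*-cancelˡ-≡ (+ n) (+ ∣ x ∣) 0ℤ (trans eq (sym (ℤₚ.*-zeroʳ (+ n))))))

    abs-sum≡0 : ∀ n → .{{_ : ℕ.NonZero n}} → ∀ s t u v →
      + n * + ∣ s ∣ + + n * + ∣ t ∣ + + n * + ∣ u ∣ + + n * + ∣ v ∣ ≡ 0ℤ →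
      s * s + t * t + u * u + v * v ≡ 0ℤ
    abs-sum≡0 n s t u v eq with sum≡0 (0≤+ (0≤+ (0≤n∣x∣ n s) (0≤n∣x∣ n t)) (0≤n∣x∣ n u)) (0≤n∣x∣ n v) eq
    ... | eq₁ , v≡0 with sum≡0 (0≤+ (0≤n∣x∣ n s) (0≤n∣x∣ n t)) (0≤n∣x∣ n u) eq₁
    ... | eq₂ , u≡0 with sum≡0 (0≤n∣x∣ n s) (0≤n∣x∣ n t) eq₂
    ... | s≡0 , t≡0 rewrite n∣x∣≡0 n s s≡0 | n∣x∣≡0 n t t≡0 | n∣x∣≡0 n u u≡0 | n∣x∣≡0 n v v≡0 = refl

  -- The even and the odd candidate have squared lengths adding up to at most 4N², so one of them is
  -- at most 2N². If neither is smaller, every coordinate is a tie, and by the choice of signs w · s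
  -- + w' · s is N times the sum of the absolute values of the coordinates of s. Both products
  -- therefore vanish only for s = 0.
  round : ∀ n → .{{_ : ℕ.NonZero n}} → ∀ v s → Rounded (+ n) v s
  round n ⟪ v₀ , v₁ , v₂ , v₃ ⟫ ⟪ s₀ , s₁ , s₂ , s₃ ⟫
    with residual n v₀ s₀ | residual n v₁ s₁ | residual n v₂ s₂ | residual n v₃ s₃
  ... | residuals a a' w₀ w₀' eq₀ eq₀' t₀ | residuals b b' w₁ w₁' eq₁ eq₁' t₁
      | residuals c c' w₂ w₂' eq₂ eq₂' t₂ | residuals d d' w₃ w₃' eq₃ eq₃' t₃ = choose (w · w <? 2M) (w' · w' <? 2M)
    where
    M = + n * + n
    2M = + 2 * M
    k = ⟪ a , b , c , d ⟫
    k' = ⟪ a' , b' , c' , d' ⟫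
    w = ⟪ w₀ , w₁ , w₂ , w₃ ⟫
    w' = ⟪ w₀' , w₁' , w₂' , w₃' ⟫
    v = ⟪ v₀ , v₁ , v₂ , v₃ ⟫
    s = ⟪ s₀ , s₁ , s₂ , s₃ ⟫
    even : v ≡ shift (+ n) 0ℤ k w
    even = Quat-ext eq₀ eq₁ eq₂ eq₃
    odd : v ≡ shift (+ n) 1ℤ k' w'
    odd = Quat-ext eq₀' eq₁' eq₂' eq₃'
    sum≡ = regroup w₀ w₁ w₂ w₃ w₀' w₁' w₂' w₃'
    choose : Dec (w · w < 2M) → Dec (w' · w' < 2M) → Rounded (+ n) v s
    choose (yes lt) _ = rounded 0ℤ k w even (inj₁ lt)
    choose (no _) (yes lt) = rounded 1ℤ k' w' odd (inj₁ lt)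
    choose (no ge) (no ge') with all-ties t₀ t₁ t₂ t₃
    ... | inj₁ lt = contradiction (subst₂ _<_ sum≡ (4M M) lt) (ℤₚ.≤⇒≯ (ℤₚ.+-mono-≤ (≮⇒≥ ge) (≮⇒≥ ge')))
    ... | inj₂ ((e₀ , r₀) , (e₁ , r₁) , (e₂ , r₂) , (e₃ , r₃)) = tie (w · s ≟ 0ℤ) (w' · s ≟ 0ℤ)
      where
      both = halves (≮⇒≥ ge) (≮⇒≥ ge') (trans (sym sum≡) (cong₂ _+_ (cong₂ _+_ (cong₂ _+_ e₀ e₁) e₂) e₃))
      ·sum : w · s + w' · s ≡ + n * + ∣ s₀ ∣ + + n * + ∣ s₁ ∣ + + n * + ∣ s₂ ∣ + + n * + ∣ s₃ ∣
      ·sum = trans (regroup-· w₀ w₁ w₂ w₃ w₀' w₁' w₂' w₃' s₀ s₁ s₂ s₃) (cong₂ _+_ (cong₂ _+_ (cong₂ _+_ r₀ r₁) r₂) r₃)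
      tie : Dec (w · s ≡ 0ℤ) → Dec (w' · s ≡ 0ℤ) → Rounded (+ n) v s
      tie (no ≢0) _ = rounded 0ℤ k w even (inj₂ (proj₁ both , inj₁ ≢0))
      tie (yes _) (no ≢0) = rounded 1ℤ k' w' odd (inj₂ (proj₂ both , inj₁ ≢0))
      tie (yes p) (yes q) = rounded 0ℤ k w even (inj₂ (proj₁ both , inj₂ (abs-sum≡0 n s₀ s₁ s₂ s₃ (trans (sym ·sum) (cong₂ _+_ p q)))))

  private
    -- E, F, M and B stand for w · w, u · u, N² and w · u. Equality would need E = 2M, F = M and B =
    -- 0 at once, which the last hypothesis excludes, because F = 0 contradicts F = M.
    E²-bound : ∀ E F M B → 0ℤ ≤ E → 0ℤ ≤ F → 0ℤ < M → F ≤ M →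
      (E < + 2 * M) ⊎ (E ≡ + 2 * M × (B ≢ 0ℤ ⊎ F ≡ 0ℤ)) →
      (E + + 2 * F) * (E + + 2 * F) + - (+ 8 * (B * B)) < (+ 4 * M) * (+ 4 * M)
    E²-bound E F M B 0≤E 0≤F 0<M F≤M c = go c
      where
      2F≤ : + 2 * F ≤ + 2 * M
      2F≤ = ℤₚ.*-monoˡ-≤-nonNeg (+ 2) F≤M
      0≤A : 0ℤ ≤ E + + 2 * F
      0≤A = 0≤+ 0≤E (0≤* {+ 2} (+≤+ z≤n) 0≤F)
      4M≡ : ∀ M → + 2 * M + + 2 * M ≡ + 4 * M
      4M≡ = solve-∀
      8B≤ : (E + + 2 * F) * (E + + 2 * F) + - (+ 8 * (B * B)) ≤ (E + + 2 * F) * (E + + 2 * F)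
      8B≤ = ≤-by (+ 8 * (B * B)) (0≤* {+ 8} (+≤+ z≤n) (0≤sq B)) (e ((E + + 2 * F) * (E + + 2 * F)) (+ 8 * (B * B)))
        where e : ∀ x y → x ≡ (x + - y) + y
              e = solve-∀
      strict : E + + 2 * F < + 4 * M → (E + + 2 * F) * (E + + 2 * F) + - (+ 8 * (B * B)) < (+ 4 * M) * (+ 4 * M)
      strict lt = ℤₚ.≤-<-trans 8B≤ (sq-mono-< 0≤A lt)
      go : (E < + 2 * M) ⊎ (E ≡ + 2 * M × (B ≢ 0ℤ ⊎ F ≡ 0ℤ)) →
        (E + + 2 * F) * (E + + 2 * F) + - (+ 8 * (B * B)) < (+ 4 * M) * (+ 4 * M)
      go (inj₁ lt) = strict (subst (E + + 2 * F <_) (4M≡ M) (ℤₚ.+-mono-<-≤ lt 2F≤))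
      go (inj₂ (refl , inj₂ refl)) = strict (<-by (+ 2 * M) (0<* {+ 2} (+<+ (s≤s z≤n)) 0<M) (e M))
        where e : ∀ M → + 4 * M ≡ (+ 2 * M + + 2 * 0ℤ) + + 2 * M
              e = solve-∀
      go (inj₂ (refl , inj₁ B≢0)) = ℤₚ.<-≤-trans
        (<-by (+ 8 * (B * B)) (0<* {+ 8} (+<+ (s≤s z≤n)) (0<sq B≢0)) (e ((+ 2 * M + + 2 * F) * (+ 2 * M + + 2 * F)) (+ 8 * (B * B))))
        (sq-mono-≤ 0≤A (subst (+ 2 * M + + 2 * F ≤_) (4M≡ M) (ℤₚ.+-monoʳ-≤ (+ 2 * M) 2F≤)))
        where e : ∀ x y → x ≡ (x + - y) + y
              e = solve-∀

  0≤· : ∀ w → 0ℤ ≤ w · w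
  0≤· ⟪ a , b , c , d ⟫ = 0≤+ (0≤+ (0≤+ (0≤sq a) (0≤sq b)) (0≤sq c)) (0≤sq d)

  -- Q (w , u) is 16 times the absolute norm of the reduced norm of (w + √2 u) / 2.
  Q : Quat ℤ → Quat ℤ → ℤ
  Q w u = (w · w + + 2 * u · u) * (w · w + + 2 * u · u) + - (+ 8 * (w · u * w · u))

  -- the elements of the lattice D₄, parametrised through (x , y) ↦ (x + y , x - y)
  D₄ : ℤ → Quat ℤ → Quat ℤ
  D₄ κ ⟪ l₀ , l₁ , l₂ , l₃ ⟫ = ⟪ l₀ + l₁ + κ , l₀ + - l₁ , l₂ + l₃ + κ , l₂ + - l₃ ⟫

  translate : ℤ → Quat ℤ → Quat ℤ → Quat ℤ
  translate N ⟪ σ₀ , σ₁ , σ₂ , σ₃ ⟫ ⟪ u₀ , u₁ , u₂ , u₃ ⟫ = ⟪ u₀ + σ₀ * N , u₁ + σ₁ * N , u₂ + σ₂ * N , u₃ + σ₃ * N ⟫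

  private
    rotated : ∀ a b c d →
      (a + b) * (a + b) + (a + - b) * (a + - b) + (c + d) * (c + d) + (c + - d) * (c + - d) ≡ + 2 * (a * a + b * b + c * c + d * d)
    rotated = solve-∀
    rot₊ : ∀ S₀ S₁ l₀ l₁ κ N → (S₀ + - ((l₀ + l₁ + κ) * N)) + (S₁ + - ((l₀ + - l₁) * N)) ≡ (S₀ + S₁) + - ((+ 2 * l₀ + κ) * N)
    rot₊ = solve-∀
    rot₋ : ∀ S₀ S₁ l₀ l₁ κ N → (S₀ + - ((l₀ + l₁ + κ) * N)) + - (S₁ + - ((l₀ + - l₁) * N)) ≡ (S₀ + - S₁) + - ((+ 2 * l₁ + κ) * N)
    rot₋ = solve-∀
    untranslate : ∀ x y → x ≡ (x + - y) + y
    untranslate = solve-∀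
    cancel : ∀ x y → (x + y) + - y ≡ x
    cancel = solve-∀

  data D₄-Rounded (N : ℤ) (s : Quat ℤ) : Set where
    d₄-rounded : ∀ κ l u → s ≡ translate N (D₄ κ l) u → u · u ≤ N * N → D₄-Rounded N s

  -- The map (x , y) ↦ (x + y , x - y) on both pairs of coordinates doubles squared lengths and
  -- carries D₄ to the vectors with coordinates of one parity, so the bound 2N² of `round` becomes
  -- N². Equality is allowed here, hence the zero vector for breaking ties.
  D₄-round : ∀ n → .{{_ : ℕ.NonZero n}} → ∀ s → D₄-Rounded (+ n) s
  D₄-round n ⟪ S₀ , S₁ , S₂ , S₃ ⟫ with round n ⟪ S₀ + S₁ , S₀ + - S₁ , S₂ + S₃ , S₂ + - S₃ ⟫ ⟪ 0ℤ , 0ℤ , 0ℤ , 0ℤ ⟫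
  ... | rounded κ ⟪ l₀ , l₁ , l₂ , l₃ ⟫ ⟪ t₀ , t₁ , t₂ , t₃ ⟫ eq bound =
    d₄-rounded κ ⟪ l₀ , l₁ , l₂ , l₃ ⟫ ⟪ u₀ , u₁ , u₂ , u₃ ⟫
      (Quat-ext (untranslate S₀ _) (untranslate S₁ _) (untranslate S₂ _) (untranslate S₃ _))
      (ℤₚ.*-cancelˡ-≤-pos _ _ (+ 2) (subst (_≤ + 2 * (N * N)) (trans (sym ≡t) (rotated u₀ u₁ u₂ u₃)) (tie-≤ bound)))
    where
    N = + n
    u₀ = S₀ + - ((l₀ + l₁ + κ) * N)
    u₁ = S₁ + - ((l₀ + - l₁) * N)
    u₂ = S₂ + - ((l₂ + l₃ + κ) * N)
    u₃ = S₃ + - ((l₂ + - l₃) * N)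
    back : ∀ {x} t c → x ≡ t + c → x + - c ≡ t
    back t c refl = cancel t c
    e₀ : u₀ + u₁ ≡ t₀
    e₀ = trans (rot₊ S₀ S₁ l₀ l₁ κ N) (back t₀ _ (cong co₀ eq))
    e₁ : u₀ + - u₁ ≡ t₁
    e₁ = trans (rot₋ S₀ S₁ l₀ l₁ κ N) (back t₁ _ (cong co₁ eq))
    e₂ : u₂ + u₃ ≡ t₂
    e₂ = trans (rot₊ S₂ S₃ l₂ l₃ κ N) (back t₂ _ (cong co₂ eq))
    e₃ : u₂ + - u₃ ≡ t₃
    e₃ = trans (rot₋ S₂ S₃ l₂ l₃ κ N) (back t₃ _ (cong co₃ eq))
    sq : ∀ {x y} → x ≡ y → x * x ≡ y * y
    sq refl = refl
    ≡t : (u₀ + u₁) * (u₀ + u₁) + (u₀ + - u₁) * (u₀ + - u₁) + (u₂ + u₃) * (u₂ + u₃) + (u₂ + - u₃) * (u₂ + - u₃)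
           ≡ ⟪ t₀ , t₁ , t₂ , t₃ ⟫ · ⟪ t₀ , t₁ , t₂ , t₃ ⟫
    ≡t = cong₂ _+_ (cong₂ _+_ (cong₂ _+_ (sq e₀) (sq e₁)) (sq e₂)) (sq e₃)

  data Approximated (N : ℤ) (v s : Quat ℤ) : Set where
    approximated : ∀ κ k κ' l w u → v ≡ shift N κ k w → s ≡ translate N (D₄ κ' l) u →
      Q w u < (+ 4 * (N * N)) * (+ 4 * (N * N)) → Approximated N v s

  approximate : ∀ n → .{{_ : ℕ.NonZero n}} → ∀ v s → Approximated (+ n) v s
  approximate n@(suc _) v s with D₄-round n s
  -- Ties in v are broken against u, the remainder of the other part, because w · u is the cross
  -- term of `Q`.
  ... | d₄-rounded κ' l u eq' F≤ with round n v u
  ... | rounded κ k w eq bound = approximated κ k κ' l w u eq eq'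
    (E²-bound (w · w) (u · u) (+ n * + n) (w · u) (0≤· w) (0≤· u) (0<* {+ n} {+ n} (+<+ (s≤s z≤n)) (+<+ (s≤s z≤n))) F≤ bound)

  private
    -- Lagrange's identity: (w · w)(u · u) - (w · u)² is the sum of the squares of the 2 × 2 minors
    -- of w and u.
    lagrange : ∀ a b c d s t u v → let E = a * a + b * b + c * c + d * d ; F = s * s + t * t + u * u + v * v ; B = a * s + b * t + c * u + d * v in
      (E + + 2 * F) * (E + + 2 * F) + - (+ 8 * (B * B)) ≡ (E + - (+ 2 * F)) * (E + - (+ 2 * F))
        + + 8 * ((a * t + - (b * s)) * (a * t + - (b * s)) + (a * u + - (c * s)) * (a * u + - (c * s)) + (a * v + - (d * s)) * (a * v + - (d * s))
               + (b * u + - (c * t)) * (b * u + - (c * t)) + (b * v + - (d * t)) * (b * v + - (d * t)) + (c * v + - (d * u)) * (c * v + - (d * u)))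
    lagrange = solve-∀

  0≤Q : ∀ w u → 0ℤ ≤ Q w u
  0≤Q ⟪ a , b , c , d ⟫ ⟪ s , t , u , v ⟫ = subst (0ℤ ≤_) (sym (lagrange a b c d s t u v))
    (0≤+ (0≤sq (a * a + b * b + c * c + d * d + - (+ 2 * (s * s + t * t + u * u + v * v)))) (0≤* {+ 8} (+≤+ z≤n)
      (0≤+ (0≤+ (0≤+ (0≤+ (0≤+ (0≤sq (a * t + - (b * s))) (0≤sq (a * u + - (c * s)))) (0≤sq (a * v + - (d * s)))) (0≤sq (b * u + - (c * t)))) (0≤sq (b * v + - (d * t)))) (0≤sq (c * v + - (d * u))))))

-- The ring ℤ[√2].

module QuadraticIntegers where
  open import Data.Integer using (+_)
  open import Data.Maybe using (Maybe; just; nothing)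
  open import Algebra.Bundles using (CommutativeRing)
  open import Algebra.Structures using (IsCommutativeRing)
  open import Tactic.RingSolver using (solve-∀)
  open import Tactic.RingSolver.Core.AlmostCommutativeRing using (AlmostCommutativeRing; fromCommutativeRing)

  infix 5 _⊕√2_
  data ℤ[√2] : Set where
    _⊕√2_ : ℤ → ℤ → ℤ[√2]

  infixl 6 _+_ _-_
  infixl 7 _*_
  infix  8 -_

  _+_ _*_ : ℤ[√2] → ℤ[√2] → ℤ[√2]
  (a ⊕√2 b) + (c ⊕√2 d) = (a ℤ.+ c) ⊕√2 (b ℤ.+ d)
  (a ⊕√2 b) * (c ⊕√2 d) = (a ℤ.* c ℤ.+ + 2 ℤ.* b ℤ.* d) ⊕√2 (a ℤ.* d ℤ.+ b ℤ.* c)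

  -_ : ℤ[√2] → ℤ[√2]
  - (a ⊕√2 b) = (ℤ.- a) ⊕√2 (ℤ.- b)

  _-_ : ℤ[√2] → ℤ[√2] → ℤ[√2]
  x - y = x + - y

  0R 1R 2R √2 : ℤ[√2]
  0R = 0ℤ ⊕√2 0ℤ
  1R = 1ℤ ⊕√2 0ℤ
  2R = (+ 2) ⊕√2 0ℤ
  √2 = 0ℤ ⊕√2 1ℤ

  private
    *-assoc₁ : ∀ a b c d e f →
      (a ℤ.* c ℤ.+ + 2 ℤ.* b ℤ.* d) ℤ.* e ℤ.+ + 2 ℤ.* (a ℤ.* d ℤ.+ b ℤ.* c) ℤ.* f
        ≡ a ℤ.* (c ℤ.* e ℤ.+ + 2 ℤ.* d ℤ.* f) ℤ.+ + 2 ℤ.* b ℤ.* (c ℤ.* f ℤ.+ d ℤ.* e)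
    *-assoc₁ = ℤ-Solver.solve-∀

    *-assoc₂ : ∀ a b c d e f →
      (a ℤ.* c ℤ.+ + 2 ℤ.* b ℤ.* d) ℤ.* f ℤ.+ (a ℤ.* d ℤ.+ b ℤ.* c) ℤ.* e
        ≡ a ℤ.* (c ℤ.* f ℤ.+ d ℤ.* e) ℤ.+ b ℤ.* (c ℤ.* e ℤ.+ + 2 ℤ.* d ℤ.* f)
    *-assoc₂ = ℤ-Solver.solve-∀

    *-comm₁ : ∀ a b c d → a ℤ.* c ℤ.+ + 2 ℤ.* b ℤ.* d ≡ c ℤ.* a ℤ.+ + 2 ℤ.* d ℤ.* b
    *-comm₁ = ℤ-Solver.solve-∀

    *-comm₂ : ∀ a b c d → a ℤ.* d ℤ.+ b ℤ.* c ≡ c ℤ.* b ℤ.+ d ℤ.* a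
    *-comm₂ = ℤ-Solver.solve-∀

    distribʳ₁ : ∀ a b c d e f → (c ℤ.+ e) ℤ.* a ℤ.+ + 2 ℤ.* (d ℤ.+ f) ℤ.* b
      ≡ (c ℤ.* a ℤ.+ + 2 ℤ.* d ℤ.* b) ℤ.+ (e ℤ.* a ℤ.+ + 2 ℤ.* f ℤ.* b)
    distribʳ₁ = ℤ-Solver.solve-∀

    distribʳ₂ : ∀ a b c d e f → (c ℤ.+ e) ℤ.* b ℤ.+ (d ℤ.+ f) ℤ.* a
      ≡ (c ℤ.* b ℤ.+ d ℤ.* a) ℤ.+ (e ℤ.* b ℤ.+ f ℤ.* a)
    distribʳ₂ = ℤ-Solver.solve-∀

    1*₁ : ∀ a b → 1ℤ ℤ.* a ℤ.+ + 2 ℤ.* 0ℤ ℤ.* b ≡ a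
    1*₁ = ℤ-Solver.solve-∀

    1*₂ : ∀ a b → 1ℤ ℤ.* b ℤ.+ 0ℤ ℤ.* a ≡ b
    1*₂ = ℤ-Solver.solve-∀

  *-comm : ∀ x y → x * y ≡ y * x
  *-comm (a ⊕√2 b) (c ⊕√2 d) = cong₂ _⊕√2_ (*-comm₁ a b c d) (*-comm₂ a b c d)

  *-identityˡ : ∀ x → 1R * x ≡ x
  *-identityˡ (a ⊕√2 b) = cong₂ _⊕√2_ (1*₁ a b) (1*₂ a b)

  *-distribʳ-+ : ∀ x y z → (y + z) * x ≡ y * x + z * x
  *-distribʳ-+ (a ⊕√2 b) (c ⊕√2 d) (e ⊕√2 f) = cong₂ _⊕√2_ (distribʳ₁ a b c d e f) (distribʳ₂ a b c d e f)

  ℤ[√2]-isCommutativeRing : IsCommutativeRing _≡_ _+_ _*_ (λ x → - x) 0R 1R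
  ℤ[√2]-isCommutativeRing = record
    { isRing = record
      { +-isAbelianGroup = record
        { isGroup = record
          { isMonoid = record
            { isSemigroup = record
              { isMagma = record { isEquivalence = isEquivalence ; ∙-cong = cong₂ _+_ }
              ; assoc = λ { (a ⊕√2 b) (c ⊕√2 d) (e ⊕√2 f) → cong₂ _⊕√2_ (ℤₚ.+-assoc a c e) (ℤₚ.+-assoc b d f) }
              }
            ; identity = (λ { (a ⊕√2 b) → cong₂ _⊕√2_ (ℤₚ.+-identityˡ a) (ℤₚ.+-identityˡ b) })
                       , (λ { (a ⊕√2 b) → cong₂ _⊕√2_ (ℤₚ.+-identityʳ a) (ℤₚ.+-identityʳ b) })
            }
          ; inverse = (λ { (a ⊕√2 b) → cong₂ _⊕√2_ (ℤₚ.+-inverseˡ a) (ℤₚ.+-inverseˡ b) })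
                    , (λ { (a ⊕√2 b) → cong₂ _⊕√2_ (ℤₚ.+-inverseʳ a) (ℤₚ.+-inverseʳ b) })
          ; ⁻¹-cong = cong (λ x → - x)
          }
        ; comm = λ { (a ⊕√2 b) (c ⊕√2 d) → cong₂ _⊕√2_ (ℤₚ.+-comm a c) (ℤₚ.+-comm b d) }
        }
      ; *-cong = cong₂ _*_
      ; *-assoc = λ { (a ⊕√2 b) (c ⊕√2 d) (e ⊕√2 f) → cong₂ _⊕√2_ (*-assoc₁ a b c d e f) (*-assoc₂ a b c d e f) }
      ; *-identity = *-identityˡ , (λ x → trans (*-comm x 1R) (*-identityˡ x))
      ; distrib = (λ x y z → trans (*-comm x (y + z)) (trans (*-distribʳ-+ x y z) (cong₂ _+_ (*-comm y x) (*-comm z x))))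
                , *-distribʳ-+
      }
    ; *-comm = *-comm
    }

  ℤ[√2]-commutativeRing : CommutativeRing _ _
  ℤ[√2]-commutativeRing = record { isCommutativeRing = ℤ[√2]-isCommutativeRing }

  module R = CommutativeRing ℤ[√2]-commutativeRing

  0≟ : (x : ℤ[√2]) → Maybe (0R ≡ x)
  0≟ (+ 0 ⊕√2 + 0) = just refl
  0≟ _ = nothing

  RR : AlmostCommutativeRing _ _
  RR = fromCommutativeRing ℤ[√2]-commutativeRing 0≟

-- The maximal order 𝒪 in the basis 1, f, g, fg.

module QuaternionOps where
  open import Tactic.RingSolver.Core.Expression using (Expr; Κ; _⊕_; _⊗_; ⊝_)
  open Quadruple
  open QuadraticIntegers

  -- Operations without laws, so that one formula can be read over ℤ[√2], over syntax trees, over 𝔽₂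
  -- and over K.
  record RingOps (A : Set) : Set where
    infixl 6 _⊞_ _⊟_
    infixl 7 _⊠_
    field
      _⊞_ _⊠_ : A → A → A
      neg : A → A
      nil one root2 : A
    _⊟_ : A → A → A
    x ⊟ y = x ⊞ neg y

  module Quaternions {A : Set} (ops : RingOps A) where
    open RingOps ops

    scalar : A → Quat A
    scalar t = ⟪ t , nil , nil , nil ⟫

    -- The multiplication table follows from f² = √2 f - 1, g² = √2 g - 1 and gf = √2 (f + g) - 1 -
    -- fg.
    add mul : Quat A → Quat A → Quat A
    add ⟪ a , b , c , d ⟫ ⟪ a' , b' , c' , d' ⟫ = ⟪ a ⊞ a' , b ⊞ b' , c ⊞ c' , d ⊞ d' ⟫
    mul ⟪ a , b , c , d ⟫ ⟪ a' , b' , c' , d' ⟫ =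
      ⟪ a ⊠ a' ⊟ b ⊠ b' ⊟ c ⊠ b' ⊟ c ⊠ c' ⊟ d ⊠ d' ⊟ root2 ⊠ (c ⊠ d' ⊞ d ⊠ b')
      , a ⊠ b' ⊞ b ⊠ a' ⊞ c ⊠ d' ⊞ d ⊠ b' ⊟ d ⊠ c' ⊞ root2 ⊠ (b ⊠ b' ⊞ c ⊠ b')
      , a ⊠ c' ⊞ c ⊠ a' ⊞ c ⊠ d' ⊞ d ⊠ b' ⊟ b ⊠ d' ⊞ root2 ⊠ (c ⊠ b' ⊞ c ⊠ c')
      , a ⊠ d' ⊞ d ⊠ a' ⊞ b ⊠ c' ⊞ d ⊠ d' ⊟ c ⊠ b' ⊞ root2 ⊠ (b ⊠ d' ⊞ d ⊠ c')
      ⟫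

    opp conj : Quat A → Quat A
    opp ⟪ a , b , c , d ⟫ = ⟪ neg a , neg b , neg c , neg d ⟫
    conj ⟪ a , b , c , d ⟫ = ⟪ a ⊞ root2 ⊠ (b ⊞ c) ⊞ d , neg b , neg c , neg d ⟫

    scale : A → Quat A → Quat A
    scale t ⟪ a , b , c , d ⟫ = ⟪ t ⊠ a , t ⊠ b , t ⊠ c , t ⊠ d ⟫

    -- `ul`, `ℓ` and `lr` play the upper left, lower left and lower right entries of a 2 × 2 matrix:
    -- `ℓ` obeys the rule for matrix products modulo √2³ (`ℓ-mul`), and conjugation exchanges `ul`
    -- with `lr`, as it does for matrices.
    norm ℓ ul lr : Quat A → A
    norm ⟪ a , b , c , d ⟫ =
      a ⊠ a ⊞ b ⊠ b ⊞ c ⊠ c ⊞ d ⊠ d ⊞ a ⊠ d ⊞ b ⊠ c ⊞ root2 ⊠ (a ⊞ d) ⊠ (b ⊞ c)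
    ℓ ⟪ a , b , c , d ⟫ = b ⊟ c ⊟ (one ⊟ root2) ⊠ d
    ul ⟪ a , b , c , d ⟫ = a ⊟ c ⊞ d
    lr ⟪ a , b , c , d ⟫ = a ⊞ root2 ⊠ b ⊞ (one ⊞ root2) ⊠ c

  ℤ[√2]-ops : RingOps ℤ[√2]
  ℤ[√2]-ops = record { _⊞_ = _+_ ; _⊠_ = _*_ ; neg = λ x → - x ; nil = 0R ; one = 1R ; root2 = √2 }

  Expr-ops : ∀ n → RingOps (Expr ℤ[√2] n)
  Expr-ops n = record { _⊞_ = _⊕_ ; _⊠_ = _⊗_ ; neg = ⊝_ ; nil = Κ 0R ; one = Κ 1R ; root2 = Κ √2 }

  open Quaternions ℤ[√2]-ops public

  𝒪 : Set
  𝒪 = Quat ℤ[√2]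

-- Polynomial identities between quaternions by reflection.

module IdentitySolver where
  open import Data.Fin using (Fin; zero; suc; _↑ʳ_)
  open import Data.Fin.Patterns using (0F; 1F; 2F; 3F)
  open import Data.Vec as Vec using (Vec; []; _∷_; lookup)
  open import Tactic.RingSolver.Core.Expression using (Expr; Κ; Ι; _⊕_; _⊗_; ⊝_)
  import Tactic.RingSolver.Core.Polynomial.Parameters
  open Quadruple
  open QuadraticIntegers
  open QuaternionOps
  open import Tactic.RingSolver.NonReflective RR using (module Ops)
  open import Tactic.RingSolver.Core.Polynomial.Base (Tactic.RingSolver.Core.Polynomial.Parameters.Homomorphism.from Ops.homo) using (Poly)
  open import Tactic.RingSolver.Core.Polynomial.Semantics Ops.homo using () renaming (⟦_⟧ to ⟦_⟧ₚ)

  private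
    ⟦_⟧ : ∀ {n} → Expr ℤ[√2] n → Vec ℤ[√2] n → ℤ[√2]
    ⟦_⟧ = Ops.⟦_⟧

    ⟦_⟧Q : ∀ {n} → Quat (Expr ℤ[√2] n) → Vec ℤ[√2] n → 𝒪
    ⟦ ⟪ a , b , c , d ⟫ ⟧Q ρ = ⟪ ⟦ a ⟧ ρ , ⟦ b ⟧ ρ , ⟦ c ⟧ ρ , ⟦ d ⟧ ρ ⟫

  -- Polynomial operations, given uniformly in the ring. Evaluation commutes with them definitionally.
  record QOp : Set₁ where
    field
      fun : ∀ {A} → RingOps A → Quat A → Quat A
      natural : ∀ {n} ρ (p : Quat (Expr ℤ[√2] n)) → ⟦ fun (Expr-ops n) p ⟧Q ρ ≡ fun ℤ[√2]-ops (⟦ p ⟧Q ρ)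

  record QQOp : Set₁ where
    field
      fun : ∀ {A} → RingOps A → Quat A → Quat A → Quat A
      natural : ∀ {n} ρ (p q : Quat (Expr ℤ[√2] n)) → ⟦ fun (Expr-ops n) p q ⟧Q ρ ≡ fun ℤ[√2]-ops (⟦ p ⟧Q ρ) (⟦ q ⟧Q ρ)

  -- Two scalar arguments, as needed for the matrix parameters of the maps `ψ` and `ψ⁻¹`.
  record SSQOp : Set₁ where
    field
      fun : ∀ {A} → RingOps A → A → A → Quat A → Quat A
      natural : ∀ {n} ρ s t (p : Quat (Expr ℤ[√2] n)) → ⟦ fun (Expr-ops n) s t p ⟧Q ρ ≡ fun ℤ[√2]-ops (⟦ s ⟧ ρ) (⟦ t ⟧ ρ) (⟦ p ⟧Q ρ)

  record Form : Set₁ where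
    field
      fun : ∀ {A} → RingOps A → Quat A → A
      natural : ∀ {n} ρ (p : Quat (Expr ℤ[√2] n)) → ⟦ fun (Expr-ops n) p ⟧ ρ ≡ fun ℤ[√2]-ops (⟦ p ⟧Q ρ)

  infixl 6 _:+_ _:-_
  infixl 7 _:*_
  infix 8 :neg_
  mutual
    -- Quaternion operations stay single nodes in a term; only `exprQ` spreads each of the k
    -- quaternion variables over four polynomial variables, in front of the m scalar ones.
    data QTerm (k m : ℕ) : Set₁ where
      qvar : Fin k → QTerm k m
      qop : QOp → QTerm k m → QTerm k m
      qqop : QQOp → QTerm k m → QTerm k m → QTerm k m
      ssqop : SSQOp → STerm k m → STerm k m → QTerm k m → QTerm k m
      :⟪_,_,_,_⟫ : (s t u v : STerm k m) → QTerm k m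

    data STerm (k m : ℕ) : Set₁ where
      svar : Fin m → STerm k m
      con : ℤ[√2] → STerm k m
      _:+_ _:*_ : STerm k m → STerm k m → STerm k m
      :neg_ : STerm k m → STerm k m
      form : Form → QTerm k m → STerm k m

  _:-_ : ∀ {k m} → STerm k m → STerm k m → STerm k m
  s :- t = s :+ :neg t

  module _ {k m : ℕ} (qs : Vec 𝒪 k) (ss : Vec ℤ[√2] m) where
    evalQ : QTerm k m → 𝒪
    evalS : STerm k m → ℤ[√2]
    evalQ (qvar i) = lookup qs i
    evalQ (qop f p) = QOp.fun f ℤ[√2]-ops (evalQ p)
    evalQ (qqop f p q) = QQOp.fun f ℤ[√2]-ops (evalQ p) (evalQ q)
    evalQ (ssqop f s t p) = SSQOp.fun f ℤ[√2]-ops (evalS s) (evalS t) (evalQ p)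
    evalQ :⟪ s , t , u , v ⟫ = ⟪ evalS s , evalS t , evalS u , evalS v ⟫
    evalS (svar i) = lookup ss i
    evalS (con c) = c
    evalS (s :+ t) = evalS s + evalS t
    evalS (s :* t) = evalS s * evalS t
    evalS (:neg s) = - evalS s
    evalS (form f p) = Form.fun f ℤ[√2]-ops (evalQ p)

  module _ {k m : ℕ} where
    private
      shift : ∀ {n} → Quat (Fin n) → Quat (Fin (4 ℕ.+ n))
      shift ⟪ a , b , c , d ⟫ = ⟪ 4 ↑ʳ a , 4 ↑ʳ b , 4 ↑ʳ c , 4 ↑ʳ d ⟫

      positions : ∀ k {m} → Fin k → Quat (Fin (k ℕ.* 4 ℕ.+ m))
      positions (suc k) zero = ⟪ 0F , 1F , 2F , 3F ⟫
      positions (suc k) (suc i) = shift (positions k i)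

      variable-at : ∀ {n} → Quat (Fin n) → Quat (Expr ℤ[√2] n)
      variable-at ⟪ a , b , c , d ⟫ = ⟪ Ι a , Ι b , Ι c , Ι d ⟫

      coordinates : ∀ {k} → Vec 𝒪 k → Vec ℤ[√2] m → Vec ℤ[√2] (k ℕ.* 4 ℕ.+ m)
      coordinates [] ss = ss
      coordinates (q ∷ qs) ss = co₀ q ∷ co₁ q ∷ co₂ q ∷ co₃ q ∷ coordinates qs ss

      exprQ : QTerm k m → Quat (Expr ℤ[√2] (k ℕ.* 4 ℕ.+ m))
      exprS : STerm k m → Expr ℤ[√2] (k ℕ.* 4 ℕ.+ m)
      exprQ (qvar i) = variable-at (positions k i)
      exprQ (qop f p) = QOp.fun f (Expr-ops _) (exprQ p)
      exprQ (qqop f p q) = QQOp.fun f (Expr-ops _) (exprQ p) (exprQ q)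
      exprQ (ssqop f s t p) = SSQOp.fun f (Expr-ops _) (exprS s) (exprS t) (exprQ p)
      exprQ :⟪ s , t , u , v ⟫ = ⟪ exprS s , exprS t , exprS u , exprS v ⟫
      exprS (svar i) = Ι (k ℕ.* 4 ↑ʳ i)
      exprS (con c) = Κ c
      exprS (s :+ t) = exprS s ⊕ exprS t
      exprS (s :* t) = exprS s ⊗ exprS t
      exprS (:neg s) = ⊝ exprS s
      exprS (form f p) = Form.fun f (Expr-ops _) (exprQ p)

      qvar-correct : ∀ {k} (qs : Vec 𝒪 k) ss i → ⟦ variable-at (positions k i) ⟧Q (coordinates qs ss) ≡ lookup qs i
      qvar-correct (⟪ _ , _ , _ , _ ⟫ ∷ qs) ss zero = refl
      qvar-correct {suc k} (q ∷ qs) ss (suc i) = trans (shifted (positions k i)) (qvar-correct qs ss i)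
        where
        shifted : ∀ p → ⟦ variable-at (shift p) ⟧Q (coordinates (q ∷ qs) ss) ≡ ⟦ variable-at p ⟧Q (coordinates qs ss)
        shifted ⟪ _ , _ , _ , _ ⟫ = refl

      svar-correct : ∀ {k} (qs : Vec 𝒪 k) ss i → lookup (coordinates qs ss) (k ℕ.* 4 ↑ʳ i) ≡ lookup ss i
      svar-correct [] ss i = refl
      svar-correct (q ∷ qs) ss i = svar-correct qs ss i

      module _ (qs : Vec 𝒪 k) (ss : Vec ℤ[√2] m) where
        ρ = coordinates qs ss
        exprQ-correct : ∀ p → ⟦ exprQ p ⟧Q ρ ≡ evalQ qs ss p
        exprS-correct : ∀ s → ⟦ exprS s ⟧ ρ ≡ evalS qs ss s
        exprQ-correct (qvar i) = qvar-correct qs ss i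
        exprQ-correct (qop f p) = trans (QOp.natural f ρ (exprQ p)) (cong (QOp.fun f ℤ[√2]-ops) (exprQ-correct p))
        exprQ-correct (qqop f p q) = trans (QQOp.natural f ρ (exprQ p) (exprQ q)) (cong₂ (QQOp.fun f ℤ[√2]-ops) (exprQ-correct p) (exprQ-correct q))
        exprQ-correct (ssqop f s t p) = trans (SSQOp.natural f ρ (exprS s) (exprS t) (exprQ p))
          (trans (cong₂ (λ s t → SSQOp.fun f ℤ[√2]-ops s t (⟦ exprQ p ⟧Q ρ)) (exprS-correct s) (exprS-correct t)) (cong (SSQOp.fun f ℤ[√2]-ops (evalS qs ss s) (evalS qs ss t)) (exprQ-correct p)))
        exprQ-correct :⟪ s , t , u , v ⟫ = Quat-ext (exprS-correct s) (exprS-correct t) (exprS-correct u) (exprS-correct v)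
        exprS-correct (svar i) = svar-correct qs ss i
        exprS-correct (con c) = refl
        exprS-correct (s :+ t) = cong₂ _+_ (exprS-correct s) (exprS-correct t)
        exprS-correct (s :* t) = cong₂ _*_ (exprS-correct s) (exprS-correct t)
        exprS-correct (:neg s) = cong (λ x → - x) (exprS-correct s)
        exprS-correct (form f p) = trans (Form.natural f ρ (exprQ p)) (cong (Form.fun f ℤ[√2]-ops) (exprQ-correct p))

      normalQ : QTerm k m → Quat (Poly (k ℕ.* 4 ℕ.+ m))
      normalQ p = ⟪ Ops.norm (co₀ (exprQ p)) , Ops.norm (co₁ (exprQ p)) , Ops.norm (co₂ (exprQ p)) , Ops.norm (co₃ (exprQ p)) ⟫

      ⟦⟧Q-cong : ∀ {n} (p q : Quat (Expr ℤ[√2] n)) ρ → ⟦ co₀ p ⟧ ρ ≡ ⟦ co₀ q ⟧ ρ → ⟦ co₁ p ⟧ ρ ≡ ⟦ co₁ q ⟧ ρ → ⟦ co₂ p ⟧ ρ ≡ ⟦ co₂ q ⟧ ρ → ⟦ co₃ p ⟧ ρ ≡ ⟦ co₃ q ⟧ ρ → ⟦ p ⟧Q ρ ≡ ⟦ q ⟧Q ρ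
      ⟦⟧Q-cong ⟪ _ , _ , _ , _ ⟫ ⟪ _ , _ , _ , _ ⟫ ρ = Quat-ext

      by-norm : ∀ {n} (e e' : Expr ℤ[√2] n) → Ops.norm e ≡ Ops.norm e' → ∀ ρ → ⟦ e ⟧ ρ ≡ ⟦ e' ⟧ ρ
      by-norm e e' eq ρ = trans (sym (Ops.correct e ρ)) (trans (cong (λ p → ⟦ p ⟧ₚ ρ) eq) (Ops.correct e' ρ))

    -- abstract, so that normalisation never unfolds the solver
    abstract
      solveQ : ∀ (p q : QTerm k m) → normalQ p ≡ normalQ q → ∀ qs ss → evalQ qs ss p ≡ evalQ qs ss q
      solveQ p q eq qs ss = trans (sym (exprQ-correct qs ss p)) (trans (⟦⟧Q-cong (exprQ p) (exprQ q) (coordinates qs ss)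
        (by-norm (co₀ (exprQ p)) (co₀ (exprQ q)) (cong co₀ eq) (coordinates qs ss)) (by-norm (co₁ (exprQ p)) (co₁ (exprQ q)) (cong co₁ eq) (coordinates qs ss))
        (by-norm (co₂ (exprQ p)) (co₂ (exprQ q)) (cong co₂ eq) (coordinates qs ss)) (by-norm (co₃ (exprQ p)) (co₃ (exprQ q)) (cong co₃ eq) (coordinates qs ss)))
        (exprQ-correct qs ss q))

      solveS : ∀ (s t : STerm k m) → Ops.norm (exprS s) ≡ Ops.norm (exprS t) → ∀ qs ss → evalS qs ss s ≡ evalS qs ss t
      solveS s t eq qs ss = trans (sym (exprS-correct qs ss s)) (trans (by-norm (exprS s) (exprS t) eq (coordinates qs ss)) (exprS-correct qs ss t))

  module _ {k m : ℕ} where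
    mulᵗ addᵗ : QTerm k m → QTerm k m → QTerm k m
    mulᵗ = qqop record { fun = λ ops → Quaternions.mul ops ; natural = λ { ρ ⟪ _ , _ , _ , _ ⟫ ⟪ _ , _ , _ , _ ⟫ → refl } }
    addᵗ = qqop record { fun = λ ops → Quaternions.add ops ; natural = λ { ρ ⟪ _ , _ , _ , _ ⟫ ⟪ _ , _ , _ , _ ⟫ → refl } }

    conjᵗ oppᵗ : QTerm k m → QTerm k m
    conjᵗ = qop record { fun = λ ops → Quaternions.conj ops ; natural = λ { ρ ⟪ _ , _ , _ , _ ⟫ → refl } }
    oppᵗ = qop record { fun = λ ops → Quaternions.opp ops ; natural = λ { ρ ⟪ _ , _ , _ , _ ⟫ → refl } }

    scaleᵗ : STerm k m → QTerm k m → QTerm k m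
    scaleᵗ s = ssqop record { fun = λ ops s _ → Quaternions.scale ops s ; natural = λ { ρ s t ⟪ _ , _ , _ , _ ⟫ → refl } } s s

    scalarᵗ : STerm k m → QTerm k m
    scalarᵗ s = :⟪ s , con 0R , con 0R , con 0R ⟫

    normᵗ ℓᵗ ulᵗ lrᵗ co₀ᵗ co₁ᵗ co₂ᵗ co₃ᵗ : QTerm k m → STerm k m
    normᵗ = form record { fun = λ ops → Quaternions.norm ops ; natural = λ { ρ ⟪ _ , _ , _ , _ ⟫ → refl } }
    ℓᵗ = form record { fun = λ ops → Quaternions.ℓ ops ; natural = λ { ρ ⟪ _ , _ , _ , _ ⟫ → refl } }
    ulᵗ = form record { fun = λ ops → Quaternions.ul ops ; natural = λ { ρ ⟪ _ , _ , _ , _ ⟫ → refl } }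
    lrᵗ = form record { fun = λ ops → Quaternions.lr ops ; natural = λ { ρ ⟪ _ , _ , _ , _ ⟫ → refl } }
    co₀ᵗ = form record { fun = λ _ → co₀ ; natural = λ { ρ ⟪ _ , _ , _ , _ ⟫ → refl } }
    co₁ᵗ = form record { fun = λ _ → co₁ ; natural = λ { ρ ⟪ _ , _ , _ , _ ⟫ → refl } }
    co₂ᵗ = form record { fun = λ _ → co₂ ; natural = λ { ρ ⟪ _ , _ , _ , _ ⟫ → refl } }
    co₃ᵗ = form record { fun = λ _ → co₃ ; natural = λ { ρ ⟪ _ , _ , _ , _ ⟫ → refl } }

  q₀ : ∀ {k m} → QTerm (suc k) m
  q₀ = qvar 0F

  q₁ : ∀ {k m} → QTerm (suc (suc k)) m
  q₁ = qvar 1F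

  q₂ : ∀ {k m} → QTerm (suc (suc (suc k))) m
  q₂ = qvar 2F

  q₃ : ∀ {k m} → QTerm (suc (suc (suc (suc k)))) m
  q₃ = qvar 3F

  s₀ : ∀ {k m} → STerm k (suc m)
  s₀ = svar 0F

  s₁ : ∀ {k m} → STerm k (suc (suc m))
  s₁ = svar 1F

  s₂ : ∀ {k m} → STerm k (suc (suc (suc m)))
  s₂ = svar 2F

  s₃ : ∀ {k m} → STerm k (suc (suc (suc (suc m))))
  s₃ = svar 3F

-- Ring structure, conjugation and reduced norm of 𝒪.

module MaximalOrder where
  open import Data.Vec using ([]; _∷_)
  open import Algebra.Bundles using (Ring)
  open QuadraticIntegers
  open QuaternionOps public
  open IdentitySolver

  mul-assoc : ∀ x y z → mul (mul x y) z ≡ mul x (mul y z)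
  mul-assoc x y z = solveQ {3} {0} (mulᵗ (mulᵗ q₀ q₁) q₂) (mulᵗ q₀ (mulᵗ q₁ q₂)) refl (x ∷ y ∷ z ∷ []) []

  mul-distribˡ : ∀ x y z → mul x (add y z) ≡ add (mul x y) (mul x z)
  mul-distribˡ x y z = solveQ {3} {0} (mulᵗ q₀ (addᵗ q₁ q₂)) (addᵗ (mulᵗ q₀ q₁) (mulᵗ q₀ q₂)) refl (x ∷ y ∷ z ∷ []) []

  mul-distribʳ : ∀ x y z → mul (add y z) x ≡ add (mul y x) (mul z x)
  mul-distribʳ x y z = solveQ {3} {0} (mulᵗ (addᵗ q₁ q₂) q₀) (addᵗ (mulᵗ q₁ q₀) (mulᵗ q₂ q₀)) refl (x ∷ y ∷ z ∷ []) []

  scalar-mul : ∀ x t → mul (scalar t) x ≡ scale t x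
  scalar-mul x t = solveQ {1} {1} (mulᵗ (scalarᵗ s₀) q₀) (scaleᵗ s₀ q₀) refl (x ∷ []) (t ∷ [])

  mul-scalar : ∀ x t → mul x (scalar t) ≡ scale t x
  mul-scalar x t = solveQ {1} {1} (mulᵗ q₀ (scalarᵗ s₀)) (scaleᵗ s₀ q₀) refl (x ∷ []) (t ∷ [])

  scale-one : ∀ x → scale 1R x ≡ x
  scale-one x = solveQ {1} {0} (scaleᵗ (con 1R) q₀) q₀ refl (x ∷ []) []

  conj-conj : ∀ x → conj (conj x) ≡ x
  conj-conj x = solveQ {1} {0} (conjᵗ (conjᵗ q₀)) q₀ refl (x ∷ []) []

  mul-conj : ∀ x → mul x (conj x) ≡ scalar (norm x)
  mul-conj x = solveQ {1} {0} (mulᵗ q₀ (conjᵗ q₀)) (scalarᵗ (normᵗ q₀)) refl (x ∷ []) []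

  conj-mul-self : ∀ x → mul (conj x) x ≡ scalar (norm x)
  conj-mul-self x = solveQ {1} {0} (mulᵗ (conjᵗ q₀) q₀) (scalarᵗ (normᵗ q₀)) refl (x ∷ []) []

  norm-mul : ∀ x y → norm (mul x y) ≡ norm x * norm y
  norm-mul x y = solveS {2} {0} (normᵗ (mulᵗ q₀ q₁)) (normᵗ q₀ :* normᵗ q₁) refl (x ∷ y ∷ []) []

  norm-conj : ∀ x → norm (conj x) ≡ norm x
  norm-conj x = solveS {1} {0} (normᵗ (conjᵗ q₀)) (normᵗ q₀) refl (x ∷ []) []

  norm-scale : ∀ x t → norm (scale t x) ≡ t * t * norm x
  norm-scale x t = solveS {1} {1} (normᵗ (scaleᵗ s₀ q₀)) (s₀ :* s₀ :* normᵗ q₀) refl (x ∷ []) (t ∷ [])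

  norm-scalar : ∀ t → norm (scalar t) ≡ t * t
  norm-scalar t = solveS {0} {1} (normᵗ (scalarᵗ s₀)) (s₀ :* s₀) refl [] (t ∷ [])

  add-assoc : ∀ x y z → add (add x y) z ≡ add x (add y z)
  add-assoc x y z = solveQ {3} {0} (addᵗ (addᵗ q₀ q₁) q₂) (addᵗ q₀ (addᵗ q₁ q₂)) refl (x ∷ y ∷ z ∷ []) []

  add-comm : ∀ x y → add x y ≡ add y x
  add-comm x y = solveQ {2} {0} (addᵗ q₀ q₁) (addᵗ q₁ q₀) refl (x ∷ y ∷ []) []

  add-zeroˡ : ∀ x → add (scalar 0R) x ≡ x
  add-zeroˡ x = solveQ {1} {0} (addᵗ (scalarᵗ (con 0R)) q₀) q₀ refl (x ∷ []) []

  add-oppˡ : ∀ x → add (opp x) x ≡ scalar 0R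
  add-oppˡ x = solveQ {1} {0} (addᵗ (oppᵗ q₀) q₀) (scalarᵗ (con 0R)) refl (x ∷ []) []

  𝒪-ring : Ring _ _
  𝒪-ring = record
    { Carrier = 𝒪 ; _≈_ = _≡_ ; _+_ = add ; _*_ = mul ; -_ = opp ; 0# = scalar 0R ; 1# = scalar 1R
    ; isRing = record
      { +-isAbelianGroup = record
        { isGroup = record
          { isMonoid = record
            { isSemigroup = record
              { isMagma = record { isEquivalence = isEquivalence ; ∙-cong = cong₂ add }
              ; assoc = add-assoc
              }
            ; identity = add-zeroˡ , (λ x → trans (add-comm x _) (add-zeroˡ x))
            }
          ; inverse = add-oppˡ , (λ x → trans (add-comm x _) (add-oppˡ x))
          ; ⁻¹-cong = cong opp
          }
        ; comm = add-comm
        }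
      ; *-cong = cong₂ mul
      ; *-assoc = mul-assoc
      ; *-identity = (λ x → trans (scalar-mul x 1R) (scale-one x)) , (λ x → trans (mul-scalar x 1R) (scale-one x))
      ; distrib = mul-distribˡ , mul-distribʳ
      }
    }

  module 𝒪 = Ring 𝒪-ring

-- Euclid's algorithm for left ideals; parity of integers.

module BezoutAndParity where
  open import Data.Nat.Induction using (<-wellFounded; Acc; acc)
  open import Data.Bool using (Bool; true; false; _xor_; _∧_)
  open import Data.Integer using (+_)
  open import Data.Integer.DivMod using (_/ℕ_; _%ℕ_; a≡a%ℕn+[a/ℕn]*n; n%ℕd<d)
  open import Algebra.Bundles using (Ring)
  open import Tactic.RingSolver using (solve-∀)
  open import Level using (_⊔_)
  open QuadraticIntegers
  module LeftBezout {c ℓ} (A : Ring c ℓ) where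
    private module A = Ring A
    open A using (Carrier; _≈_; 0#; 1#)
    open import Relation.Binary.Reasoning.Setoid A.setoid
    import Algebra.Properties.Ring A as Aₚ

    -- The left ideal generated by a and b is principal with generator d. Stated for noncommutative
    -- rings, so that one algorithm serves ℤ, ℤ[√2] and 𝒪.
    record LeftGcd (a b : Carrier) : Set (c ⊔ ℓ) where
      field
        d u v a' b' : Carrier
        bezout : d ≈ u A.* a A.+ v A.* b
        a≈ : a ≈ a' A.* d
        b≈ : b ≈ b' A.* d

    module _ (size : Carrier → ℕ)
      (divide : ∀ a b → b ≈ 0# ⊎ ∃ λ q → size (a A.- q A.* b) ℕ.< size b) where

      leftGcd : ∀ a b → LeftGcd a b
      leftGcd a b = go a b (<-wellFounded (size b))
        where
        go : ∀ a b → Acc ℕ._<_ (size b) → LeftGcd a b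
        go a b (acc rec) with divide a b
        ... | inj₁ b≈0 = record
          { d = a ; u = 1# ; v = 0# ; a' = 1# ; b' = 0#
          ; bezout = A.sym (A.trans (A.+-cong (A.*-identityˡ a) (A.zeroˡ b)) (A.+-identityʳ a))
          ; a≈ = A.sym (A.*-identityˡ a)
          ; b≈ = A.trans b≈0 (A.sym (A.zeroˡ a)) }
        ... | inj₂ (q , lt) = record
          { d = d ; u = v ; v = u A.- v A.* q ; a' = b' A.+ q A.* a' ; b' = a'
          ; bezout = begin
              d                                             ≈⟨ bezout ⟩
              u A.* b A.+ v A.* (a A.- q A.* b)             ≈⟨ A.+-congˡ (A.distribˡ v a _) ⟩
              u A.* b A.+ (v A.* a A.+ v A.* (A.- (q A.* b))) ≈⟨ A.+-congˡ (A.+-congˡ (A.sym (Aₚ.-‿distribʳ-* v _))) ⟩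
              u A.* b A.+ (v A.* a A.- v A.* (q A.* b))     ≈⟨ A.+-congˡ (A.+-congˡ (A.-‿cong (A.sym (A.*-assoc v q b)))) ⟩
              u A.* b A.+ (v A.* a A.- v A.* q A.* b)       ≈⟨ A.+-comm _ _ ⟩
              v A.* a A.- v A.* q A.* b A.+ u A.* b         ≈⟨ A.+-assoc _ _ _ ⟩
              v A.* a A.+ (A.- (v A.* q A.* b) A.+ u A.* b) ≈⟨ A.+-congˡ (A.+-comm _ _) ⟩
              v A.* a A.+ (u A.* b A.- v A.* q A.* b)       ≈⟨ A.+-congˡ (A.+-congˡ (Aₚ.-‿distribˡ-* _ b)) ⟩
              v A.* a A.+ (u A.* b A.+ (A.- (v A.* q)) A.* b) ≈⟨ A.+-congˡ (A.sym (A.distribʳ b u _)) ⟩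
              v A.* a A.+ (u A.- v A.* q) A.* b             ∎
          ; a≈ = begin
              a                                             ≈⟨ A.sym (A.+-identityʳ a) ⟩
              a A.+ 0#                                      ≈⟨ A.+-congˡ (A.sym (A.-‿inverseˡ _)) ⟩
              a A.+ (A.- (q A.* b) A.+ q A.* b)             ≈⟨ A.sym (A.+-assoc _ _ _) ⟩
              a A.- q A.* b A.+ q A.* b                     ≈⟨ A.+-cong b≈ (A.*-congˡ a≈) ⟩
              b' A.* d A.+ q A.* (a' A.* d)                 ≈⟨ A.+-congˡ (A.sym (A.*-assoc q a' d)) ⟩
              b' A.* d A.+ q A.* a' A.* d                   ≈⟨ A.sym (A.distribʳ d b' _) ⟩
              (b' A.+ q A.* a') A.* d                       ∎
          ; b≈ = a≈ }
          where open LeftGcd (go b (a A.- q A.* b) (rec lt))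

  ⟦_⟧ᵇ : Bool → ℤ
  ⟦ false ⟧ᵇ = 0ℤ
  ⟦ true ⟧ᵇ = 1ℤ

  private
    2*≢1 : ∀ z → + 2 ℤ.* z ≢ 1ℤ
    2*≢1 (+ zero) ()
    2*≢1 (+ suc zero) ()
    2*≢1 (+ suc (suc n)) ()
    2*≢1 -[1+ zero ] ()
    2*≢1 -[1+ suc n ] ()

    difference : ∀ k l x y → + 2 ℤ.* k ℤ.+ x ≡ + 2 ℤ.* l ℤ.+ y → + 2 ℤ.* (k ℤ.+ ℤ.- l) ≡ y ℤ.+ ℤ.- x
    difference k l x y eq = trans (e₁ k l x) (trans (cong (λ z → z ℤ.+ (ℤ.- x ℤ.+ ℤ.- (+ 2 ℤ.* l))) eq) (e₂ l x y))
      where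
      e₁ : ∀ k l x → + 2 ℤ.* (k ℤ.+ ℤ.- l) ≡ (+ 2 ℤ.* k ℤ.+ x) ℤ.+ (ℤ.- x ℤ.+ ℤ.- (+ 2 ℤ.* l))
      e₁ = ℤ-Solver.solve-∀
      e₂ : ∀ l x y → (+ 2 ℤ.* l ℤ.+ y) ℤ.+ (ℤ.- x ℤ.+ ℤ.- (+ 2 ℤ.* l)) ≡ y ℤ.+ ℤ.- x
      e₂ = ℤ-Solver.solve-∀

  bit-unique : ∀ b c k l → + 2 ℤ.* k ℤ.+ ⟦ b ⟧ᵇ ≡ + 2 ℤ.* l ℤ.+ ⟦ c ⟧ᵇ → b ≡ c
  bit-unique false false k l eq = refl
  bit-unique true true k l eq = refl
  bit-unique false true k l eq = contradiction (difference k l 0ℤ 1ℤ eq) (2*≢1 _)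
  bit-unique true false k l eq = contradiction (difference l k 0ℤ 1ℤ (sym eq)) (2*≢1 _)

  data Halved (x : ℤ) : Set where
    halved : ∀ b k → x ≡ + 2 ℤ.* k ℤ.+ ⟦ b ⟧ᵇ → Halved x

  halve : ∀ x → Halved x
  halve x = go (x %ℕ 2) (n%ℕd<d x 2) (a≡a%ℕn+[a/ℕn]*n x 2)
    where
    e : ∀ r q → r ℤ.+ q ℤ.* + 2 ≡ + 2 ℤ.* q ℤ.+ r
    e = ℤ-Solver.solve-∀
    go : ∀ r → r ℕ.< 2 → x ≡ + r ℤ.+ (x /ℕ 2) ℤ.* + 2 → Halved x
    go 0 _ eq = halved false (x /ℕ 2) (trans eq (e 0ℤ (x /ℕ 2)))
    go 1 _ eq = halved true (x /ℕ 2) (trans eq (e 1ℤ (x /ℕ 2)))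
    go (suc (suc _)) (s≤s (s≤s ())) _

  parityℤ : ℤ → Bool
  parityℤ x with halve x
  ... | halved b _ _ = b

  parityℤ-unique : ∀ {x} b k → x ≡ + 2 ℤ.* k ℤ.+ ⟦ b ⟧ᵇ → parityℤ x ≡ b
  parityℤ-unique {x} b k eq with halve x
  ... | halved c l eq' = bit-unique c b l k (trans (sym eq') eq)

  parityℤ-+ : ∀ x y → parityℤ (x ℤ.+ y) ≡ parityℤ x xor parityℤ y
  parityℤ-+ x y with halve x | halve y
  ... | halved b k refl | halved c l refl = go b c
    where
    e : ∀ k l b c → (+ 2 ℤ.* k ℤ.+ b) ℤ.+ (+ 2 ℤ.* l ℤ.+ c) ≡ + 2 ℤ.* (k ℤ.+ l) ℤ.+ (b ℤ.+ c)
    e = ℤ-Solver.solve-∀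
    e' : ∀ k l → (+ 2 ℤ.* k ℤ.+ 1ℤ) ℤ.+ (+ 2 ℤ.* l ℤ.+ 1ℤ) ≡ + 2 ℤ.* (k ℤ.+ l ℤ.+ 1ℤ) ℤ.+ 0ℤ
    e' = ℤ-Solver.solve-∀
    go : ∀ b c → parityℤ ((+ 2 ℤ.* k ℤ.+ ⟦ b ⟧ᵇ) ℤ.+ (+ 2 ℤ.* l ℤ.+ ⟦ c ⟧ᵇ)) ≡ b xor c
    go false false = parityℤ-unique false (k ℤ.+ l) (e k l 0ℤ 0ℤ)
    go false true = parityℤ-unique true (k ℤ.+ l) (e k l 0ℤ 1ℤ)
    go true false = parityℤ-unique true (k ℤ.+ l) (e k l 1ℤ 0ℤ)
    go true true = parityℤ-unique false (k ℤ.+ l ℤ.+ 1ℤ) (e' k l)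

  parityℤ-* : ∀ x y → parityℤ (x ℤ.* y) ≡ parityℤ x ∧ parityℤ y
  parityℤ-* x y with halve x | halve y
  ... | halved b k refl | halved c l refl = go b c
    where
    e : ∀ k y → (+ 2 ℤ.* k ℤ.+ 0ℤ) ℤ.* y ≡ + 2 ℤ.* (k ℤ.* y) ℤ.+ 0ℤ
    e = ℤ-Solver.solve-∀
    e' : ∀ k l c → (+ 2 ℤ.* k ℤ.+ 1ℤ) ℤ.* (+ 2 ℤ.* l ℤ.+ c) ≡ + 2 ℤ.* (k ℤ.* (+ 2 ℤ.* l ℤ.+ c) ℤ.+ l) ℤ.+ c
    e' = ℤ-Solver.solve-∀
    go : ∀ b c → parityℤ ((+ 2 ℤ.* k ℤ.+ ⟦ b ⟧ᵇ) ℤ.* (+ 2 ℤ.* l ℤ.+ ⟦ c ⟧ᵇ)) ≡ b ∧ c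
    go false c = parityℤ-unique false (k ℤ.* (+ 2 ℤ.* l ℤ.+ ⟦ c ⟧ᵇ)) (e k (+ 2 ℤ.* l ℤ.+ ⟦ c ⟧ᵇ))
    go true c = parityℤ-unique c (k ℤ.* (+ 2 ℤ.* l ℤ.+ ⟦ c ⟧ᵇ) ℤ.+ l) (e' k l ⟦ c ⟧ᵇ)

  parityℤ-neg : ∀ x → parityℤ (ℤ.- x) ≡ parityℤ x
  parityℤ-neg x = trans (cong parityℤ (e x)) (parityℤ-* -[1+ 0 ] x)
    where e : ∀ x → ℤ.- x ≡ -[1+ 0 ] ℤ.* x
          e = ℤ-Solver.solve-∀

  even⇒double : ∀ x → parityℤ x ≡ false → ∃ λ k → x ≡ + 2 ℤ.* k
  even⇒double x eq with halve x
  even⇒double x refl | halved false k eq' = k , trans eq' (ℤₚ.+-identityʳ _)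

  -- Descent: a is even, hence so is b, and the halves satisfy the same equation. The fuel bounds
  -- the absolute value of a, which drops strictly unless it is 0.
  sq≡2sq : ∀ a b → a ℤ.* a ≡ + 2 ℤ.* (b ℤ.* b) → a ≡ 0ℤ
  sq≡2sq a b = go (suc ℤ.∣ a ∣) a b (ℕₚ.n<1+n _)
    where
    half-sq : ∀ x y → (+ 2 ℤ.* x) ℤ.* (+ 2 ℤ.* x) ≡ + 2 ℤ.* y → + 2 ℤ.* (x ℤ.* x) ≡ y
    half-sq x y eq = ℤₚ.*-cancelˡ-≡ (+ 2) _ _ (trans (e x) eq)
      where e : ∀ x → + 2 ℤ.* (+ 2 ℤ.* (x ℤ.* x)) ≡ (+ 2 ℤ.* x) ℤ.* (+ 2 ℤ.* x)
            e = ℤ-Solver.solve-∀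
    sq-even : ∀ x y → x ℤ.* x ≡ + 2 ℤ.* y → ∃ λ k → x ≡ + 2 ℤ.* k
    sq-even x y eq = even⇒double x (∧-self _ (trans (sym (parityℤ-* x x)) (trans (cong parityℤ eq) (parityℤ-* (+ 2) y))))
      where ∧-self : ∀ b → b ∧ b ≡ false → b ≡ false
            ∧-self false _ = refl
    small : ∀ k → ℤ.∣ + 2 ℤ.* k ∣ ≢ 0 → ℤ.∣ k ∣ ℕ.< ℤ.∣ + 2 ℤ.* k ∣
    small k ≢0 rewrite ℤₚ.abs-* (+ 2) k with ℤ.∣ k ∣
    ... | zero = contradiction refl ≢0
    ... | suc n = ℕₚ.m<m+n (suc n) (s≤s z≤n)
    go : ∀ fuel a b → ℤ.∣ a ∣ ℕ.< fuel → a ℤ.* a ≡ + 2 ℤ.* (b ℤ.* b) → a ≡ 0ℤ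
    go (suc fuel) a b lt eq with sq-even a _ eq
    ... | k , refl with sq-even b _ (sym (half-sq k (b ℤ.* b) eq))
    ... | l , refl with ℤ.∣ + 2 ℤ.* k ∣ ℕ.≟ 0
    ... | yes ≡0 = ℤₚ.∣i∣≡0⇒i≡0 ≡0
    ... | no ≢0 = trans (cong (+ 2 ℤ.*_) (go fuel k l (ℕₚ.<-≤-trans (small k ≢0) (ℕₚ.≤-pred lt)) k²)) refl
      where
      e : ∀ l → (+ 2 ℤ.* l) ℤ.* (+ 2 ℤ.* l) ≡ + 2 ℤ.* (+ 2 ℤ.* (l ℤ.* l))
      e = ℤ-Solver.solve-∀
      k² : k ℤ.* k ≡ + 2 ℤ.* (l ℤ.* l)
      k² = ℤₚ.*-cancelˡ-≡ (+ 2) _ _ (trans (half-sq k _ eq) (e l))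

-- ℤ[√2] is norm-Euclidean.

module EuclideanRing where
  open import Data.Integer using (+_)
  open import Data.Integer.DivMod using (_/ℕ_; _%ℕ_; a≡a%ℕn+[a/ℕn]*n; n%ℕd<d)
  open import Tactic.RingSolver using (solve-∀)
  open QuadraticIntegers
  open BezoutAndParity

  re im : ℤ[√2] → ℤ
  re (a ⊕√2 b) = a
  im (a ⊕√2 b) = b

  int : ℤ → ℤ[√2]
  int n = n ⊕√2 0ℤ

  bar : ℤ[√2] → ℤ[√2]
  bar (a ⊕√2 b) = a ⊕√2 (ℤ.- b)

  nm : ℤ[√2] → ℤ
  nm (a ⊕√2 b) = a ℤ.* a ℤ.+ ℤ.- (+ 2 ℤ.* (b ℤ.* b))

  nm-* : ∀ x y → nm (x * y) ≡ nm x ℤ.* nm y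
  nm-* (a ⊕√2 b) (c ⊕√2 d) = eq a b c d
    where
    eq : ∀ a b c d → (a ℤ.* c ℤ.+ + 2 ℤ.* b ℤ.* d) ℤ.* (a ℤ.* c ℤ.+ + 2 ℤ.* b ℤ.* d)
        ℤ.+ ℤ.- (+ 2 ℤ.* ((a ℤ.* d ℤ.+ b ℤ.* c) ℤ.* (a ℤ.* d ℤ.+ b ℤ.* c)))
      ≡ (a ℤ.* a ℤ.+ ℤ.- (+ 2 ℤ.* (b ℤ.* b))) ℤ.* (c ℤ.* c ℤ.+ ℤ.- (+ 2 ℤ.* (d ℤ.* d)))
    eq = ℤ-Solver.solve-∀

  nm-int : ∀ n → nm (int n) ≡ n ℤ.* n
  nm-int n = eq n
    where eq : ∀ n → n ℤ.* n ℤ.+ ℤ.- (+ 2 ℤ.* (0ℤ ℤ.* 0ℤ)) ≡ n ℤ.* n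
          eq = ℤ-Solver.solve-∀

  nm-bar : ∀ x → nm (bar x) ≡ nm x
  nm-bar (a ⊕√2 b) = eq a b
    where eq : ∀ a b → a ℤ.* a ℤ.+ ℤ.- (+ 2 ℤ.* (ℤ.- b ℤ.* ℤ.- b)) ≡ a ℤ.* a ℤ.+ ℤ.- (+ 2 ℤ.* (b ℤ.* b))
          eq = ℤ-Solver.solve-∀

  *-bar : ∀ x → x * bar x ≡ int (nm x)
  *-bar (a ⊕√2 b) = cong₂ _⊕√2_ (e₁ a b) (e₂ a b)
    where
    e₁ : ∀ a b → a ℤ.* a ℤ.+ + 2 ℤ.* b ℤ.* ℤ.- b ≡ a ℤ.* a ℤ.+ ℤ.- (+ 2 ℤ.* (b ℤ.* b))
    e₁ = ℤ-Solver.solve-∀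
    e₂ : ∀ a b → a ℤ.* ℤ.- b ℤ.+ b ℤ.* a ≡ 0ℤ
    e₂ = ℤ-Solver.solve-∀

  int-* : ∀ n a b → int n * (a ⊕√2 b) ≡ n ℤ.* a ⊕√2 n ℤ.* b
  int-* n a b = cong₂ _⊕√2_ (e₁ n a b) (e₂ n a b)
    where
    e₁ : ∀ n a b → n ℤ.* a ℤ.+ + 2 ℤ.* 0ℤ ℤ.* b ≡ n ℤ.* a
    e₁ = ℤ-Solver.solve-∀
    e₂ : ∀ n a b → n ℤ.* b ℤ.+ 0ℤ ℤ.* a ≡ n ℤ.* b
    e₂ = ℤ-Solver.solve-∀

  int-int : ∀ m n → int m * int n ≡ int (m ℤ.* n)
  int-int m n = trans (int-* m n 0ℤ) (cong (m ℤ.* n ⊕√2_) (ℤₚ.*-zeroʳ m))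

  infix 4 _≟ᴿ_
  _≟ᴿ_ : (x y : ℤ[√2]) → Dec (x ≡ y)
  (a ⊕√2 b) ≟ᴿ (c ⊕√2 d) with a ℤ.≟ c | b ℤ.≟ d
  ... | yes refl | yes refl = yes refl
  ... | no ≢ | _ = no λ { refl → ≢ refl }
  ... | _ | no ≢ = no λ { refl → ≢ refl }

  nm≡0⇒≡0 : ∀ x → nm x ≡ 0ℤ → x ≡ 0R
  nm≡0⇒≡0 (a ⊕√2 b) eq with sq≡2sq a b (ℤₚ.i-j≡0⇒i≡j _ _ eq)
  ... | refl with ℤₚ.i*j≡0⇒i≡0∨j≡0 (+ 2) (sym (ℤₚ.i-j≡0⇒i≡j 0ℤ (+ 2 ℤ.* (b ℤ.* b)) eq))
  ... | inj₂ b²≡0 = cong (0ℤ ⊕√2_) (IntegerRounding.sq≡0 b b²≡0)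

  x*y≡0⇒y≡0 : ∀ {x y} → x ≢ 0R → x * y ≡ 0R → y ≡ 0R
  x*y≡0⇒y≡0 {x} {y} x≢0 eq with ℤₚ.i*j≡0⇒i≡0∨j≡0 (nm x) (trans (sym (nm-* x y)) (cong nm eq))
  ... | inj₁ nx = contradiction (nm≡0⇒≡0 x nx) x≢0
  ... | inj₂ ny = nm≡0⇒≡0 y ny

  x-y≡0⇒x≡y : ∀ {x y} → x - y ≡ 0R → x ≡ y
  x-y≡0⇒x≡y {x} {y} eq = trans (e x y) (trans (cong (_+ y) eq) (R.+-identityˡ y))
    where e : ∀ x y → x ≡ (x - y) + y
          e = solve-∀ RR

  *-cancelˡ : ∀ {c x y} → c ≢ 0R → c * x ≡ c * y → x ≡ y
  *-cancelˡ {c} {x} {y} c≢0 eq = x-y≡0⇒x≡y (x*y≡0⇒y≡0 c≢0 (trans (e c x y) (trans (cong (_- (c * y)) eq) (R.-‿inverseʳ (c * y)))))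
    where e : ∀ c x y → c * (x - y) ≡ c * x - c * y
          e = solve-∀ RR

  private
    open IntegerRounding

    data Nearest (N : ℤ) (v : ℤ) : Set where
      nearest : ∀ k w → v ≡ w ℤ.+ k ℤ.* N → + 4 ℤ.* (w ℤ.* w) ℤ.≤ N ℤ.* N → Nearest N v

    nearest? : ∀ n → .{{_ : ℕ.NonZero n}} → ∀ v → Nearest (+ n) v
    nearest? n v with v %ℕ n | v /ℕ n | n%ℕd<d v n | a≡a%ℕn+[a/ℕn]*n v n
    ... | m | q | m<n | eq with ℕₚ.≤-total (m ℕ.+ m) n
    ... | inj₁ 2m≤n = nearest q (+ m) eq (subst (ℤ._≤ + n ℤ.* + n) (e (+ m)) (sq-mono-≤ (+≤+ z≤n) (+≤+ 2m≤n)))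
      where e : ∀ m → (m ℤ.+ m) ℤ.* (m ℤ.+ m) ≡ + 4 ℤ.* (m ℤ.* m)
            e = ℤ-Solver.solve-∀
    ... | inj₂ n≤2m with ℕₚ.m≤n⇒∃[o]m+o≡n (ℕₚ.<⇒≤ m<n)
    ... | p , refl = nearest (q ℤ.+ 1ℤ) (ℤ.- + p) (trans eq (e₁ (+ m) (+ p) q))
        (subst (ℤ._≤ (+ m ℤ.+ + p) ℤ.* (+ m ℤ.+ + p)) (e (+ p)) (sq-mono-≤ (+≤+ z≤n) (+≤+ (ℕₚ.+-monoˡ-≤ p (ℕₚ.+-cancelˡ-≤ m p m n≤2m)))))
      where e : ∀ m → (m ℤ.+ m) ℤ.* (m ℤ.+ m) ≡ + 4 ℤ.* (ℤ.- m ℤ.* ℤ.- m)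
            e = ℤ-Solver.solve-∀
            e₁ : ∀ m p q → m ℤ.+ q ℤ.* (m ℤ.+ p) ≡ ℤ.- p ℤ.+ (q ℤ.+ 1ℤ) ℤ.* (m ℤ.+ p)
            e₁ = ℤ-Solver.solve-∀

    -- w² - 2u² lies between -N²/2 and N²/4.
    nm-small : ∀ n → .{{_ : ℕ.NonZero n}} → ∀ w u → + 4 ℤ.* (w ℤ.* w) ℤ.≤ + n ℤ.* + n → + 4 ℤ.* (u ℤ.* u) ℤ.≤ + n ℤ.* + n →
      ℤ.∣ nm (w ⊕√2 u) ∣ ℕ.< n ℕ.* n
    nm-small n@(suc _) w u 4w²≤ 4u²≤ = bound (nm (w ⊕√2 u)) upper lower
      where
      N² = + n ℤ.* + n
      0<N² : 0ℤ ℤ.< N²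
      0<N² = +<+ (s≤s z≤n)
      scaled : ∀ {x} → + 4 ℤ.* x ℤ.< + 4 ℤ.* N² → x ℤ.< N²
      scaled = ℤₚ.*-cancelˡ-<-nonNeg (+ 4)
      1→4 : N² ℤ.< + 4 ℤ.* N²
      1→4 = <-by (+ 3 ℤ.* N²) (0<* {+ 3} (+<+ (s≤s z≤n)) 0<N²) (e N²)
        where e : ∀ x → + 4 ℤ.* x ≡ x ℤ.+ + 3 ℤ.* x
              e = ℤ-Solver.solve-∀
      2→4 : + 2 ℤ.* N² ℤ.< + 4 ℤ.* N²
      2→4 = <-by (+ 2 ℤ.* N²) (0<* {+ 2} (+<+ (s≤s z≤n)) 0<N²) (e N²)
        where e : ∀ x → + 4 ℤ.* x ≡ + 2 ℤ.* x ℤ.+ + 2 ℤ.* x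
              e = ℤ-Solver.solve-∀
      upper : nm (w ⊕√2 u) ℤ.< N²
      upper = ℤₚ.≤-<-trans (≤-by (+ 2 ℤ.* (u ℤ.* u)) (0≤* {+ 2} (+≤+ z≤n) (0≤sq u)) (e (w ℤ.* w) (+ 2 ℤ.* (u ℤ.* u))))
                           (scaled (ℤₚ.≤-<-trans 4w²≤ 1→4))
        where e : ∀ x y → x ≡ (x ℤ.+ ℤ.- y) ℤ.+ y
              e = ℤ-Solver.solve-∀
      lower : ℤ.- nm (w ⊕√2 u) ℤ.< N²
      lower = ℤₚ.≤-<-trans (≤-by (w ℤ.* w) (0≤sq w) (e (w ℤ.* w) (+ 2 ℤ.* (u ℤ.* u))))
                           (scaled (ℤₚ.≤-<-trans (subst (ℤ._≤ + 2 ℤ.* N²) (e' (u ℤ.* u)) (ℤₚ.*-monoˡ-≤-nonNeg (+ 2) 4u²≤)) 2→4))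
        where e : ∀ x y → y ≡ ℤ.- (x ℤ.+ ℤ.- y) ℤ.+ x
              e = ℤ-Solver.solve-∀
              e' : ∀ u → + 2 ℤ.* (+ 4 ℤ.* u) ≡ + 4 ℤ.* (+ 2 ℤ.* u)
              e' = ℤ-Solver.solve-∀
      bound : ∀ z → z ℤ.< N² → ℤ.- z ℤ.< N² → ℤ.∣ z ∣ ℕ.< n ℕ.* n
      bound (+ m) (+<+ lt) _ = lt
      bound -[1+ m ] _ (+<+ lt) = lt

  -- The conjugate of y, with the sign that makes the product with y positive.
  adjugate : ∀ y → ∃ λ y' → y * y' ≡ int (+ ℤ.∣ nm y ∣) × ℤ.∣ nm y' ∣ ≡ ℤ.∣ nm y ∣
  adjugate y with nm y | *-bar y | nm-bar y
  ... | + n | eq | eq' = bar y , eq , cong ℤ.∣_∣ eq'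
  ... | -[1+ n ] | eq | eq' = - bar y , trans (e y (bar y)) (cong (λ z → - z) eq) , trans (cong ℤ.∣_∣ (nm-neg (bar y))) (cong ℤ.∣_∣ eq')
    where
    e : ∀ x y → x * - y ≡ - (x * y)
    e = solve-∀ RR
    nm-neg : ∀ x → nm (- x) ≡ nm x
    nm-neg (a ⊕√2 b) = e' a b
      where e' : ∀ a b → ℤ.- a ℤ.* ℤ.- a ℤ.+ ℤ.- (+ 2 ℤ.* (ℤ.- b ℤ.* ℤ.- b)) ≡ a ℤ.* a ℤ.+ ℤ.- (+ 2 ℤ.* (b ℤ.* b))
            e' = ℤ-Solver.solve-∀

  ∣nm∣≢0 : ∀ {y} → y ≢ 0R → ℤ.∣ nm y ∣ ≢ 0
  ∣nm∣≢0 y≢0 eq = y≢0 (nm≡0⇒≡0 _ (ℤₚ.∣i∣≡0⇒i≡0 eq))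

  -- The quotient of x by y is x y' / n with an integer denominator n. Rounding both coordinates
  -- leaves a remainder r for which the norm of r y' is below n² in absolute value, and the norm of
  -- y' has absolute value n.
  divideᴿ : ∀ x y → y ≡ 0R ⊎ ∃ λ q → ℤ.∣ nm (x - q * y) ∣ ℕ.< ℤ.∣ nm y ∣
  divideᴿ x y with y ≟ᴿ 0R
  ... | yes y≡0 = inj₁ y≡0
  ... | no y≢0 with ℤ.∣ nm y ∣ | adjugate y | ∣nm∣≢0 y≢0
  ... | zero | _ | ≢0 = contradiction refl ≢0
  ... | n@(suc _) | y' , yy'≡n , ∣nmy'∣≡n | _ = inj₂ (go (x * y') refl)
    where
    go : ∀ X → X ≡ x * y' → ∃ λ q → ℤ.∣ nm (x - q * y) ∣ ℕ.< n
    go (a ⊕√2 b) X≡ with nearest? n a | nearest? n b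
    ... | nearest k w refl bw | nearest l u refl bu = q , ℕₚ.*-cancelʳ-< n _ n (subst (ℕ._< n ℕ.* n) nm≡ (nm-small n w u bw bu))
      where
      q = k ⊕√2 l
      e : ∀ x q y y' → (x - q * y) * y' ≡ x * y' - (y * y') * q
      e = solve-∀ RR
      e' : ∀ w k n → (w ℤ.+ k ℤ.* n) ℤ.+ ℤ.- (n ℤ.* k) ≡ w
      e' = ℤ-Solver.solve-∀
      rem≡ : (x - q * y) * y' ≡ w ⊕√2 u
      rem≡ = trans (e x q y y') (trans (cong₂ _-_ (sym X≡) (trans (cong (_* q) yy'≡n) (int-* (+ n) k l)))
        (cong₂ _⊕√2_ (e' w k (+ n)) (e' u l (+ n))))
      nm≡ : ℤ.∣ nm (w ⊕√2 u) ∣ ≡ ℤ.∣ nm (x - q * y) ∣ ℕ.* n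
      nm≡ = trans (cong (λ z → ℤ.∣ nm z ∣) (sym rem≡)) (trans (cong ℤ.∣_∣ (nm-* (x - q * y) y'))
        (trans (ℤₚ.abs-* (nm (x - q * y)) (nm y')) (cong (ℤ.∣ nm (x - q * y) ∣ ℕ.*_) ∣nmy'∣≡n)))

  module Bezoutᴿ = LeftBezout R.ring
  gcdᴿ : ∀ x y → Bezoutᴿ.LeftGcd x y
  gcdᴿ = Bezoutᴿ.leftGcd (λ x → ℤ.∣ nm x ∣) divideᴿ

-- Euclidean division in 𝒪.

module EuclideanOrder where
  open import Data.Integer using (+_)
  import Data.Nat.Tactic.RingSolver as ℕ-Solver
  open import Tactic.RingSolver using (solve-∀)
  open import Data.Vec using ([]; _∷_)
  open Quadruple
  open QuadraticIntegers
  open MaximalOrder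
  open BezoutAndParity
  open EuclideanRing
  open IdentitySolver

  open IntegerRounding

  infix 4 _≟𝒪_
  _≟𝒪_ : (x y : 𝒪) → Dec (x ≡ y)
  ⟪ a , b , c , d ⟫ ≟𝒪 ⟪ a' , b' , c' , d' ⟫ with a ≟ᴿ a' | b ≟ᴿ b' | c ≟ᴿ c' | d ≟ᴿ d'
  ... | yes refl | yes refl | yes refl | yes refl = yes refl
  ... | no ≢ | _ | _ | _ = no λ { refl → ≢ refl }
  ... | _ | no ≢ | _ | _ = no λ { refl → ≢ refl }
  ... | _ | _ | no ≢ | _ = no λ { refl → ≢ refl }
  ... | _ | _ | _ | no ≢ = no λ { refl → ≢ refl }

  -- If q has coordinates t, x, y, z with respect to 1, i, j, k, then
  -- 2 (t , x , y , z) = ℚ-part q + √2 · √2-part q.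
  ℚ-part √2-part : 𝒪 → Quat ℤ
  ℚ-part ⟪ a₀ ⊕√2 a₁ , b₀ ⊕√2 b₁ , c₀ ⊕√2 c₁ , d₀ ⊕√2 d₁ ⟫ =
    ⟪ + 2 ℤ.* a₀ ℤ.+ + 2 ℤ.* (b₁ ℤ.+ c₁) ℤ.+ d₀ , + 2 ℤ.* b₁ ℤ.+ d₀ , + 2 ℤ.* c₁ ℤ.+ d₀ , d₀ ⟫
  √2-part ⟪ a₀ ⊕√2 a₁ , b₀ ⊕√2 b₁ , c₀ ⊕√2 c₁ , d₀ ⊕√2 d₁ ⟫ =
    ⟪ + 2 ℤ.* a₁ ℤ.+ (b₀ ℤ.+ c₀) ℤ.+ d₁ , b₀ ℤ.+ d₁ , c₀ ℤ.+ d₁ , d₁ ⟫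

  √2* : ∀ a b → √2 * (a ⊕√2 b) ≡ + 2 ℤ.* b ⊕√2 a
  √2* a b = cong₂ _⊕√2_ (e₁ a b) (e₂ a b)
    where
    e₁ : ∀ a b → 0ℤ ℤ.* a ℤ.+ + 2 ℤ.* 1ℤ ℤ.* b ≡ + 2 ℤ.* b
    e₁ = ℤ-Solver.solve-∀
    e₂ : ∀ a b → 0ℤ ℤ.* b ℤ.+ 1ℤ ℤ.* a ≡ a
    e₂ = ℤ-Solver.solve-∀

  private
    -- The linear forms being squared are twice the coordinates of q with respect to 1, i, j, k.
    four-squares : ∀ q → let a = co₀ q ; b = co₁ q ; c = co₂ q ; d = co₃ q in
      (2R * a + √2 * (b + c) + d) * (2R * a + √2 * (b + c) + d) + (√2 * b + d) * (√2 * b + d)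
        + (√2 * c + d) * (√2 * c + d) + d * d ≡ int (+ 4) * norm q
    four-squares q = solveS {1} {0}
      ((con 2R :* a :+ con √2 :* (b :+ c) :+ d) :* (con 2R :* a :+ con √2 :* (b :+ c) :+ d) :+ (con √2 :* b :+ d) :* (con √2 :* b :+ d)
        :+ (con √2 :* c :+ d) :* (con √2 :* c :+ d) :+ d :* d) (con (int (+ 4)) :* normᵗ q₀) refl (q ∷ []) []
      where
      a b c d : STerm 1 0
      a = co₀ᵗ q₀
      b = co₁ᵗ q₀
      c = co₂ᵗ q₀
      d = co₃ᵗ q₀

    sum-sq : ∀ a s b t c u d v →
      (a ⊕√2 s) * (a ⊕√2 s) + (b ⊕√2 t) * (b ⊕√2 t) + (c ⊕√2 u) * (c ⊕√2 u) + (d ⊕√2 v) * (d ⊕√2 v)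
        ≡ (⟪ a , b , c , d ⟫ · ⟪ a , b , c , d ⟫ ℤ.+ + 2 ℤ.* ⟪ s , t , u , v ⟫ · ⟪ s , t , u , v ⟫)
          ⊕√2 + 2 ℤ.* ⟪ a , b , c , d ⟫ · ⟪ s , t , u , v ⟫
    sum-sq a s b t c u d v = cong₂ _⊕√2_ (e₁ a s b t c u d v) (e₂ a s b t c u d v)
      where
      e₁ : ∀ a s b t c u d v → (a ℤ.* a ℤ.+ + 2 ℤ.* s ℤ.* s) ℤ.+ (b ℤ.* b ℤ.+ + 2 ℤ.* t ℤ.* t) ℤ.+ (c ℤ.* c ℤ.+ + 2 ℤ.* u ℤ.* u) ℤ.+ (d ℤ.* d ℤ.+ + 2 ℤ.* v ℤ.* v)
        ≡ (a ℤ.* a ℤ.+ b ℤ.* b ℤ.+ c ℤ.* c ℤ.+ d ℤ.* d) ℤ.+ + 2 ℤ.* (s ℤ.* s ℤ.+ t ℤ.* t ℤ.+ u ℤ.* u ℤ.+ v ℤ.* v)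
      e₁ = ℤ-Solver.solve-∀
      e₂ : ∀ a s b t c u d v → (a ℤ.* s ℤ.+ s ℤ.* a) ℤ.+ (b ℤ.* t ℤ.+ t ℤ.* b) ℤ.+ (c ℤ.* u ℤ.+ u ℤ.* c) ℤ.+ (d ℤ.* v ℤ.+ v ℤ.* d)
        ≡ + 2 ℤ.* (a ℤ.* s ℤ.+ b ℤ.* t ℤ.+ c ℤ.* u ℤ.+ d ℤ.* v)
      e₂ = ℤ-Solver.solve-∀

  4*norm : ∀ q → int (+ 4) * norm q ≡
    (ℚ-part q · ℚ-part q ℤ.+ + 2 ℤ.* √2-part q · √2-part q) ⊕√2 + 2 ℤ.* ℚ-part q · √2-part q
  4*norm q@(⟪ a@(a₀ ⊕√2 a₁) , b@(b₀ ⊕√2 b₁) , c@(c₀ ⊕√2 c₁) , d@(d₀ ⊕√2 d₁) ⟫) =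
    trans (sym (four-squares q)) (trans (squares e₀ (e₁ b₀ b₁) (e₁ c₀ c₁))
      (sum-sq (co₀ (ℚ-part q)) (co₀ (√2-part q)) (co₁ (ℚ-part q)) (co₁ (√2-part q)) (co₂ (ℚ-part q)) (co₂ (√2-part q)) d₀ d₁))
    where
    squares : ∀ {x x' y y' z z'} → x ≡ x' → y ≡ y' → z ≡ z' → x * x + y * y + z * z + d * d ≡ x' * x' + y' * y' + z' * z' + d * d
    squares refl refl refl = refl
    e₀ : 2R * a + √2 * (b + c) + d ≡ co₀ (ℚ-part q) ⊕√2 co₀ (√2-part q)
    e₀ = cong (_+ d) (cong₂ _+_ (int-* (+ 2) a₀ a₁) (√2* (b₀ ℤ.+ c₀) (b₁ ℤ.+ c₁)))
    e₁ : ∀ x y → √2 * (x ⊕√2 y) + d ≡ + 2 ℤ.* y ℤ.+ d₀ ⊕√2 x ℤ.+ d₁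
    e₁ x y = cong (_+ d) (√2* x y)

  16*nm-norm : ∀ q → + 16 ℤ.* nm (norm q) ≡ Q (ℚ-part q) (√2-part q)
  16*nm-norm q = trans (sym (nm-* (int (+ 4)) (norm q))) (trans (cong nm (4*norm q)) (e (ℚ-part q · ℚ-part q ℤ.+ + 2 ℤ.* √2-part q · √2-part q) (ℚ-part q · √2-part q)))
    where
    e : ∀ A B → A ℤ.* A ℤ.+ ℤ.- (+ 2 ℤ.* (+ 2 ℤ.* B ℤ.* (+ 2 ℤ.* B))) ≡ A ℤ.* A ℤ.+ ℤ.- (+ 8 ℤ.* (B ℤ.* B))
    e = ℤ-Solver.solve-∀

  -- Together with `0≤re-norm` this expresses that reduced norms are totally nonnegative, which
  -- later decides the sign of a unit.
  0≤nm-norm : ∀ q → 0ℤ ℤ.≤ nm (norm q)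
  0≤nm-norm q = ℤₚ.*-cancelˡ-≤-pos 0ℤ _ (+ 16) (subst (0ℤ ℤ.≤_) (sym (16*nm-norm q)) (0≤Q (ℚ-part q) (√2-part q)))

  0≤re-norm : ∀ q → 0ℤ ℤ.≤ re (norm q)
  0≤re-norm q = ℤₚ.*-cancelˡ-≤-pos 0ℤ _ (+ 4) (subst (0ℤ ℤ.≤_) (trans (cong re (sym (4*norm q))) (re4 (norm q)))
    (0≤+ (0≤· (ℚ-part q)) (0≤* {+ 2} (+≤+ z≤n) (0≤· (√2-part q)))))
    where
    re4 : ∀ x → re (int (+ 4) * x) ≡ + 4 ℤ.* re x
    re4 (a ⊕√2 b) = cong re (int-* (+ 4) a b)

  ·≡0 : ∀ w → w · w ≡ 0ℤ → w ≡ ⟪ 0ℤ , 0ℤ , 0ℤ , 0ℤ ⟫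
  ·≡0 ⟪ a , b , c , d ⟫ eq with sum≡0 (0≤+ (0≤+ (0≤sq a) (0≤sq b)) (0≤sq c)) (0≤sq d) eq
  ... | eq₁ , d≡0 with sum≡0 (0≤+ (0≤sq a) (0≤sq b)) (0≤sq c) eq₁
  ... | eq₂ , c≡0 with sum≡0 (0≤sq a) (0≤sq b) eq₂
  ... | a≡0 , b≡0 = Quat-ext (sq≡0 a a≡0) (sq≡0 b b≡0) (sq≡0 c c≡0) (sq≡0 d d≡0)

  -- The rational part of 4 · norm q is a positively weighted sum of squares, so `ℚ-part` and
  -- `√2-part` vanish, and with them all eight integer coordinates.
  norm≡0⇒≡0 : ∀ q → norm q ≡ 0R → q ≡ scalar 0R
  norm≡0⇒≡0 q eq with sum≡0 (0≤· (ℚ-part q)) (0≤* {+ 2} (+≤+ z≤n) (0≤· (√2-part q)))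
    (cong re (trans (sym (4*norm q)) (trans (cong (int (+ 4) *_) eq) (R.zeroʳ (int (+ 4))))))
  ... | w≡0 , 2u≡0 with ℤₚ.i*j≡0⇒i≡0∨j≡0 (+ 2) 2u≡0
  ... | inj₂ u≡0 = back q (·≡0 (ℚ-part q) w≡0) (·≡0 (√2-part q) u≡0)
    where
    half : ∀ x → + 2 ℤ.* x ≡ 0ℤ → x ≡ 0ℤ
    half x eq = ℤₚ.*-cancelˡ-≡ (+ 2) x 0ℤ eq
    plus0 : ∀ x y → y ≡ 0ℤ → x ℤ.+ y ≡ 0ℤ → x ≡ 0ℤ
    plus0 x y refl eq = trans (sym (ℤₚ.+-identityʳ x)) eq
    back : ∀ q → ℚ-part q ≡ ⟪ 0ℤ , 0ℤ , 0ℤ , 0ℤ ⟫ → √2-part q ≡ ⟪ 0ℤ , 0ℤ , 0ℤ , 0ℤ ⟫ → q ≡ scalar 0R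
    back ⟪ a₀ ⊕√2 a₁ , b₀ ⊕√2 b₁ , c₀ ⊕√2 c₁ , d₀ ⊕√2 d₁ ⟫ eq eq' with cong co₃ eq | cong co₃ eq'
    ... | refl | refl with plus0 b₀ 0ℤ refl (cong co₁ eq') | plus0 c₀ 0ℤ refl (cong co₂ eq')
                         | half b₁ (plus0 _ 0ℤ refl (cong co₁ eq)) | half c₁ (plus0 _ 0ℤ refl (cong co₂ eq))
    ... | refl | refl | refl | refl with half a₀ (plus0 _ 0ℤ refl (plus0 _ 0ℤ refl (cong co₀ eq))) | half a₁ (plus0 _ 0ℤ refl (plus0 _ 0ℤ refl (cong co₀ eq')))
    ... | refl | refl = refl

  private
    module _ (N κ k₀ k₁ k₂ k₃ κ' l₀ l₁ l₂ l₃ : ℤ) where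
      -- The preimage of a pair of lattice vectors: `ℚ-part` and `√2-part` identify 𝒪 with the
      -- product of the lattice of vectors with coordinates of one parity and D₄.
      nearby : 𝒪
      nearby = ⟪ k₀ ℤ.+ ℤ.- k₁ ℤ.+ ℤ.- k₂ ℤ.+ k₃ ⊕√2 l₁ ℤ.+ ℤ.- l₃ , l₀ ℤ.+ ℤ.- l₁ ℤ.+ ℤ.- l₂ ℤ.+ l₃ ⊕√2 k₁ ℤ.+ ℤ.- k₃
               , + 2 ℤ.* l₃ ℤ.+ κ' ⊕√2 k₂ ℤ.+ ℤ.- k₃ , + 2 ℤ.* k₃ ℤ.+ κ ⊕√2 l₂ ℤ.+ ℤ.- l₃ ⟫

    translate-back : ∀ x N ρ w → x ≡ w ℤ.+ ρ ℤ.* N → x ℤ.+ ℤ.- (N ℤ.* ρ) ≡ w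
    translate-back _ N ρ w refl = e N ρ w
      where e : ∀ N ρ w → (w ℤ.+ ρ ℤ.* N) ℤ.+ ℤ.- (N ℤ.* ρ) ≡ w
            e = ℤ-Solver.solve-∀

    -- This and the seven identities that follow compute the coordinates of x - N q in unfolded
    -- form; the products with `0ℤ` come from multiplication by `int N`.
    w-eq₀ : ∀ N x₀ y₁ z₁ t₀ κ k₀ k₁ k₂ k₃ κ' l₀ l₁ l₂ l₃ →
      + 2 ℤ.* (x₀ ℤ.+ ℤ.- (N ℤ.* (k₀ ℤ.+ ℤ.- k₁ ℤ.+ ℤ.- k₂ ℤ.+ k₃) ℤ.+ + 2 ℤ.* 0ℤ ℤ.* (l₁ ℤ.+ ℤ.- l₃))) ℤ.+ + 2 ℤ.* ((y₁ ℤ.+ ℤ.- (N ℤ.* (k₁ ℤ.+ ℤ.- k₃) ℤ.+ 0ℤ ℤ.* (l₀ ℤ.+ ℤ.- l₁ ℤ.+ ℤ.- l₂ ℤ.+ l₃))) ℤ.+ (z₁ ℤ.+ ℤ.- (N ℤ.* (k₂ ℤ.+ ℤ.- k₃) ℤ.+ 0ℤ ℤ.* (+ 2 ℤ.* l₃ ℤ.+ κ')))) ℤ.+ (t₀ ℤ.+ ℤ.- (N ℤ.* (+ 2 ℤ.* k₃ ℤ.+ κ) ℤ.+ + 2 ℤ.* 0ℤ ℤ.* (l₂ ℤ.+ ℤ.- l₃)))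
        ≡ (+ 2 ℤ.* x₀ ℤ.+ + 2 ℤ.* (y₁ ℤ.+ z₁) ℤ.+ t₀) ℤ.+ ℤ.- (N ℤ.* (+ 2 ℤ.* k₀ ℤ.+ κ))
    w-eq₀ = ℤ-Solver.solve-∀

    w-eq₁ : ∀ N y₁ t₀ κ k₁ k₃ l₀ l₁ l₂ l₃ →
      + 2 ℤ.* (y₁ ℤ.+ ℤ.- (N ℤ.* (k₁ ℤ.+ ℤ.- k₃) ℤ.+ 0ℤ ℤ.* (l₀ ℤ.+ ℤ.- l₁ ℤ.+ ℤ.- l₂ ℤ.+ l₃))) ℤ.+ (t₀ ℤ.+ ℤ.- (N ℤ.* (+ 2 ℤ.* k₃ ℤ.+ κ) ℤ.+ + 2 ℤ.* 0ℤ ℤ.* (l₂ ℤ.+ ℤ.- l₃)))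
        ≡ (+ 2 ℤ.* y₁ ℤ.+ t₀) ℤ.+ ℤ.- (N ℤ.* (+ 2 ℤ.* k₁ ℤ.+ κ))
    w-eq₁ = ℤ-Solver.solve-∀

    w-eq₂ : ∀ N z₁ t₀ κ k₂ k₃ κ' l₂ l₃ →
      + 2 ℤ.* (z₁ ℤ.+ ℤ.- (N ℤ.* (k₂ ℤ.+ ℤ.- k₃) ℤ.+ 0ℤ ℤ.* (+ 2 ℤ.* l₃ ℤ.+ κ'))) ℤ.+ (t₀ ℤ.+ ℤ.- (N ℤ.* (+ 2 ℤ.* k₃ ℤ.+ κ) ℤ.+ + 2 ℤ.* 0ℤ ℤ.* (l₂ ℤ.+ ℤ.- l₃)))
        ≡ (+ 2 ℤ.* z₁ ℤ.+ t₀) ℤ.+ ℤ.- (N ℤ.* (+ 2 ℤ.* k₂ ℤ.+ κ))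
    w-eq₂ = ℤ-Solver.solve-∀

    w-eq₃ : ∀ N t₀ κ k₃ l₂ l₃ →
      (t₀ ℤ.+ ℤ.- (N ℤ.* (+ 2 ℤ.* k₃ ℤ.+ κ) ℤ.+ + 2 ℤ.* 0ℤ ℤ.* (l₂ ℤ.+ ℤ.- l₃)))
        ≡ (t₀) ℤ.+ ℤ.- (N ℤ.* (+ 2 ℤ.* k₃ ℤ.+ κ))
    w-eq₃ = ℤ-Solver.solve-∀

    u-eq₀ : ∀ N x₁ y₀ z₀ t₁ κ k₀ k₁ k₂ k₃ κ' l₀ l₁ l₂ l₃ →
      + 2 ℤ.* (x₁ ℤ.+ ℤ.- (N ℤ.* (l₁ ℤ.+ ℤ.- l₃) ℤ.+ 0ℤ ℤ.* (k₀ ℤ.+ ℤ.- k₁ ℤ.+ ℤ.- k₂ ℤ.+ k₃))) ℤ.+ ((y₀ ℤ.+ ℤ.- (N ℤ.* (l₀ ℤ.+ ℤ.- l₁ ℤ.+ ℤ.- l₂ ℤ.+ l₃) ℤ.+ + 2 ℤ.* 0ℤ ℤ.* (k₁ ℤ.+ ℤ.- k₃))) ℤ.+ (z₀ ℤ.+ ℤ.- (N ℤ.* (+ 2 ℤ.* l₃ ℤ.+ κ') ℤ.+ + 2 ℤ.* 0ℤ ℤ.* (k₂ ℤ.+ ℤ.- k₃)))) ℤ.+ (t₁ ℤ.+ ℤ.- (N ℤ.* (l₂ ℤ.+ ℤ.- l₃) ℤ.+ 0ℤ ℤ.* (+ 2 ℤ.* k₃ ℤ.+ κ)))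
        ≡ (+ 2 ℤ.* x₁ ℤ.+ (y₀ ℤ.+ z₀) ℤ.+ t₁) ℤ.+ ℤ.- (N ℤ.* (l₀ ℤ.+ l₁ ℤ.+ κ'))
    u-eq₀ = ℤ-Solver.solve-∀

    u-eq₁ : ∀ N y₀ t₁ κ k₁ k₃ l₀ l₁ l₂ l₃ →
      (y₀ ℤ.+ ℤ.- (N ℤ.* (l₀ ℤ.+ ℤ.- l₁ ℤ.+ ℤ.- l₂ ℤ.+ l₃) ℤ.+ + 2 ℤ.* 0ℤ ℤ.* (k₁ ℤ.+ ℤ.- k₃))) ℤ.+ (t₁ ℤ.+ ℤ.- (N ℤ.* (l₂ ℤ.+ ℤ.- l₃) ℤ.+ 0ℤ ℤ.* (+ 2 ℤ.* k₃ ℤ.+ κ)))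
        ≡ (y₀ ℤ.+ t₁) ℤ.+ ℤ.- (N ℤ.* (l₀ ℤ.+ ℤ.- l₁))
    u-eq₁ = ℤ-Solver.solve-∀

    u-eq₂ : ∀ N z₀ t₁ κ k₂ k₃ κ' l₂ l₃ →
      (z₀ ℤ.+ ℤ.- (N ℤ.* (+ 2 ℤ.* l₃ ℤ.+ κ') ℤ.+ + 2 ℤ.* 0ℤ ℤ.* (k₂ ℤ.+ ℤ.- k₃))) ℤ.+ (t₁ ℤ.+ ℤ.- (N ℤ.* (l₂ ℤ.+ ℤ.- l₃) ℤ.+ 0ℤ ℤ.* (+ 2 ℤ.* k₃ ℤ.+ κ)))
        ≡ (z₀ ℤ.+ t₁) ℤ.+ ℤ.- (N ℤ.* (l₂ ℤ.+ l₃ ℤ.+ κ'))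
    u-eq₂ = ℤ-Solver.solve-∀

    u-eq₃ : ∀ N t₁ κ k₃ l₂ l₃ →
      (t₁ ℤ.+ ℤ.- (N ℤ.* (l₂ ℤ.+ ℤ.- l₃) ℤ.+ 0ℤ ℤ.* (+ 2 ℤ.* k₃ ℤ.+ κ)))
        ≡ (t₁) ℤ.+ ℤ.- (N ℤ.* (l₂ ℤ.+ ℤ.- l₃))
    u-eq₃ = ℤ-Solver.solve-∀

  approximateᴼ : ∀ n → .{{_ : ℕ.NonZero n}} → ∀ x → ∃ λ q → nm (norm (add x (opp (scale (int (+ n)) q)))) ℤ.< (+ n ℤ.* + n) ℤ.* (+ n ℤ.* + n)
  approximateᴼ n x = go x (approximate n (ℚ-part x) (√2-part x))
   where
   go : ∀ x → Approximated (+ n) (ℚ-part x) (√2-part x) → ∃ λ q → nm (norm (add x (opp (scale (int (+ n)) q)))) ℤ.< (+ n ℤ.* + n) ℤ.* (+ n ℤ.* + n)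
   go ⟪ x₀ ⊕√2 x₁ , y₀ ⊕√2 y₁ , z₀ ⊕√2 z₁ , t₀ ⊕√2 t₁ ⟫
     (approximated κ k@(⟪ k₀ , k₁ , k₂ , k₃ ⟫) κ' l@(⟪ l₀ , l₁ , l₂ , l₃ ⟫) w@(⟪ w₀ , w₁ , w₂ , w₃ ⟫) u@(⟪ u₀ , u₁ , u₂ , u₃ ⟫) eq eq' lt) = q ,
    ℤₚ.*-cancelˡ-<-nonNeg (+ 16) (subst₂ ℤ._<_ (trans (cong₂ Q (sym w≡) (sym u≡)) (sym (16*nm-norm r))) (e (+ n ℤ.* + n)) lt)
    where
    N = + n
    X = ⟪ x₀ ⊕√2 x₁ , y₀ ⊕√2 y₁ , z₀ ⊕√2 z₁ , t₀ ⊕√2 t₁ ⟫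
    q = nearby N κ k₀ k₁ k₂ k₃ κ' l₀ l₁ l₂ l₃
    r = add X (opp (scale (int N) q))
    e : ∀ M → (+ 4 ℤ.* M) ℤ.* (+ 4 ℤ.* M) ≡ + 16 ℤ.* (M ℤ.* M)
    e = ℤ-Solver.solve-∀
    w₀≡ : co₀ (ℚ-part r) ≡ w₀
    w₀≡ = trans (w-eq₀ N x₀ y₁ z₁ t₀ κ k₀ k₁ k₂ k₃ κ' l₀ l₁ l₂ l₃) (translate-back _ N (+ 2 ℤ.* k₀ ℤ.+ κ) w₀ (cong co₀ eq))
    w₁≡ : co₁ (ℚ-part r) ≡ w₁
    w₁≡ = trans (w-eq₁ N y₁ t₀ κ k₁ k₃ l₀ l₁ l₂ l₃) (translate-back _ N (+ 2 ℤ.* k₁ ℤ.+ κ) w₁ (cong co₁ eq))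
    w₂≡ : co₂ (ℚ-part r) ≡ w₂
    w₂≡ = trans (w-eq₂ N z₁ t₀ κ k₂ k₃ κ' l₂ l₃) (translate-back _ N (+ 2 ℤ.* k₂ ℤ.+ κ) w₂ (cong co₂ eq))
    w₃≡ : co₃ (ℚ-part r) ≡ w₃
    w₃≡ = trans (w-eq₃ N t₀ κ k₃ l₂ l₃) (translate-back _ N (+ 2 ℤ.* k₃ ℤ.+ κ) w₃ (cong co₃ eq))
    w≡ : ℚ-part r ≡ w
    w≡ = Quat-ext w₀≡ w₁≡ w₂≡ w₃≡
    u₀≡ : co₀ (√2-part r) ≡ u₀
    u₀≡ = trans (u-eq₀ N x₁ y₀ z₀ t₁ κ k₀ k₁ k₂ k₃ κ' l₀ l₁ l₂ l₃) (translate-back _ N (l₀ ℤ.+ l₁ ℤ.+ κ') u₀ (cong co₀ eq'))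
    u₁≡ : co₁ (√2-part r) ≡ u₁
    u₁≡ = trans (u-eq₁ N y₀ t₁ κ k₁ k₃ l₀ l₁ l₂ l₃) (translate-back _ N (l₀ ℤ.+ ℤ.- l₁) u₁ (cong co₁ eq'))
    u₂≡ : co₂ (√2-part r) ≡ u₂
    u₂≡ = trans (u-eq₂ N z₀ t₁ κ k₂ k₃ κ' l₂ l₃) (translate-back _ N (l₂ ℤ.+ l₃ ℤ.+ κ') u₂ (cong co₂ eq'))
    u₃≡ : co₃ (√2-part r) ≡ u₃
    u₃≡ = trans (u-eq₃ N t₁ κ k₃ l₂ l₃) (translate-back _ N (l₂ ℤ.+ ℤ.- l₃) u₃ (cong co₃ eq'))
    u≡ : √2-part r ≡ u
    u≡ = Quat-ext u₀≡ u₁≡ u₂≡ u₃≡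
  size : 𝒪 → ℕ
  size x = ℤ.∣ nm (norm x) ∣

  remainder : ∀ a b q t → scale t (mul (add a (opp (mul q b))) (conj b)) ≡ add (scale t (mul a (conj b))) (opp (scale (norm b * t) q))
  remainder a b q t = solveQ {3} {1} (scaleᵗ s₀ (mulᵗ (addᵗ q₀ (oppᵗ (mulᵗ q₂ q₁))) (conjᵗ q₁))) (addᵗ (scaleᵗ s₀ (mulᵗ q₀ (conjᵗ q₁))) (oppᵗ (scaleᵗ (normᵗ q₁ :* s₀) q₂))) refl (a ∷ b ∷ q ∷ []) (t ∷ [])

  ∣nm∣-* : ∀ x y → ℤ.∣ nm (x * y) ∣ ≡ ℤ.∣ nm x ∣ ℕ.* ℤ.∣ nm y ∣
  ∣nm∣-* x y = trans (cong ℤ.∣_∣ (nm-* x y)) (ℤₚ.abs-* (nm x) (nm y))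

  private
    ℕ-rearrange : ∀ n s → n ℕ.* n ℕ.* (s ℕ.* n) ≡ s ℕ.* (n ℕ.* (n ℕ.* n))
    ℕ-rearrange = ℕ-Solver.solve-∀

  -- With ν = norm b and ν ν' = n, the quotient of a by b is ν' a (conj b) / n. Rounding it makes
  -- the absolute norm of the reduced norm of ν' r (conj b) smaller than n⁴, and this number equals
  -- size r · n³.
  divideᴼ : ∀ a b → b ≡ scalar 0R ⊎ ∃ λ q → size (add a (opp (mul q b))) ℕ.< size b
  divideᴼ a b with b ≟𝒪 scalar 0R
  ... | yes b≡0 = inj₁ b≡0
  ... | no b≢0 with ℤ.∣ nm (norm b) ∣ in nmν | adjugate (norm b) | ∣nm∣≢0 (λ eq → b≢0 (norm≡0⇒≡0 b eq))
  ... | zero | _ | ≢0 = contradiction refl ≢0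
  ... | n@(suc _) | ν' , νν'≡n , ∣nmν'∣≡n | _ with approximateᴼ n (scale ν' (mul a (conj b)))
  ... | q , lt = inj₂ (q , ℕₚ.*-cancelʳ-< (n ℕ.* (n ℕ.* n)) _ n (subst₂ ℕ._<_ size≡ (ℕₚ.*-assoc n n (n ℕ.* n)) lt'))
    where
    r = add a (opp (mul q b))
    rem≡ : scale ν' (mul r (conj b)) ≡ add (scale ν' (mul a (conj b))) (opp (scale (int (+ n)) q))
    rem≡ = trans (remainder a b q ν') (cong (λ t → add (scale ν' (mul a (conj b))) (opp (scale t q))) νν'≡n)
    nonneg<⇒∣∣< : ∀ {z m} → 0ℤ ℤ.≤ z → z ℤ.< + m → ℤ.∣ z ∣ ℕ.< m
    nonneg<⇒∣∣< {+ _} _ (+<+ lt) = lt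
    lt' : ℤ.∣ nm (norm (scale ν' (mul r (conj b)))) ∣ ℕ.< n ℕ.* n ℕ.* (n ℕ.* n)
    lt' = nonneg<⇒∣∣< (0≤nm-norm (scale ν' (mul r (conj b)))) (subst (λ z → nm (norm z) ℤ.< + (n ℕ.* n ℕ.* (n ℕ.* n))) (sym rem≡) lt)
    open ≡-Reasoning
    size≡ : ℤ.∣ nm (norm (scale ν' (mul r (conj b)))) ∣ ≡ size r ℕ.* (n ℕ.* (n ℕ.* n))
    size≡ = begin
      ℤ.∣ nm (norm (scale ν' (mul r (conj b)))) ∣                       ≡⟨ cong (λ z → ℤ.∣ nm z ∣) (norm-scale (mul r (conj b)) ν') ⟩
      ℤ.∣ nm (ν' * ν' * norm (mul r (conj b))) ∣                        ≡⟨ cong (λ z → ℤ.∣ nm (ν' * ν' * z) ∣) (trans (norm-mul r (conj b)) (cong (norm r *_) (norm-conj b))) ⟩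
      ℤ.∣ nm (ν' * ν' * (norm r * norm b)) ∣                            ≡⟨ ∣nm∣-* (ν' * ν') (norm r * norm b) ⟩
      ℤ.∣ nm (ν' * ν') ∣ ℕ.* ℤ.∣ nm (norm r * norm b) ∣                 ≡⟨ cong₂ ℕ._*_ (∣nm∣-* ν' ν') (∣nm∣-* (norm r) (norm b)) ⟩
      ℤ.∣ nm ν' ∣ ℕ.* ℤ.∣ nm ν' ∣ ℕ.* (size r ℕ.* ℤ.∣ nm (norm b) ∣)   ≡⟨ cong₂ (λ x y → x ℕ.* x ℕ.* (size r ℕ.* y)) ∣nmν'∣≡n nmν ⟩
      n ℕ.* n ℕ.* (size r ℕ.* n)                                        ≡⟨ ℕ-rearrange n (size r) ⟩
      size r ℕ.* (n ℕ.* (n ℕ.* n))                                      ∎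

  module Bezoutᴼ = LeftBezout 𝒪-ring
  gcdᴼ : ∀ x y → Bezoutᴼ.LeftGcd x y
  gcdᴼ = Bezoutᴼ.leftGcd size divideᴼ

-- -1 as a sum of two squares modulo odd numbers.

module SumsOfTwoSquares where
  import Data.Nat.Divisibility as ℕᵈ
  open import Data.Nat.Primality using (Prime; euclidsLemma; prime⇒irreducible)
  open import Data.Nat.Primality.Factorisation using (PrimeFactorisation; factorise)
  open import Data.Nat.ListAction using (product)
  open import Data.Fin as Fin using (Fin; toℕ; fromℕ<)
  import Data.Fin.Properties as Finₚ
  open import Data.List using ([]; _∷_)
  open import Data.List.Relation.Unary.All using (All; []; _∷_)
  open import Data.Integer using (+_)
  open import Data.Integer.Divisibility.Signed using (_∣_; divides; ∣-trans; ∣n⇒∣m*n; ∣⇒∣ᵤ)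
  open import Data.Integer.DivMod using (_/ℕ_; _%ℕ_; a≡a%ℕn+[a/ℕn]*n; n%ℕd<d; _/_; _%_; n%d<d; a≡a%n+[a/n]*n)
  open BezoutAndParity

  divideℤ : ∀ a b → b ≡ 0ℤ ⊎ ∃ λ q → ℤ.∣ a ℤ.+ ℤ.- (q ℤ.* b) ∣ ℕ.< ℤ.∣ b ∣
  divideℤ a b with b ℤ.≟ 0ℤ
  ... | yes b≡0 = inj₁ b≡0
  ... | no b≢0 = inj₂ (a / b , subst (λ z → ℤ.∣ z ∣ ℕ.< ℤ.∣ b ∣) (sym rem≡) (n%d<d a b))
    where
    instance
      nz : ℤ.NonZero b
      nz = ℤ.≢-nonZero b≢0
    e : ∀ r s → (r ℤ.+ s) ℤ.+ ℤ.- s ≡ r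
    e = ℤ-Solver.solve-∀
    rem≡ : a ℤ.+ ℤ.- (a / b ℤ.* b) ≡ + (a % b)
    rem≡ = trans (cong (λ z → z ℤ.+ ℤ.- (a / b ℤ.* b)) (a≡a%n+[a/n]*n a b)) (e (+ (a % b)) (a / b ℤ.* b))

  module Bezoutℤ = LeftBezout ℤₚ.+-*-ring
  gcdℤ : ∀ x y → Bezoutℤ.LeftGcd x y
  gcdℤ = Bezoutℤ.leftGcd ℤ.∣_∣ divideℤ

  Coprimeℤ : ℤ → ℤ → Set
  Coprimeℤ m n = ∃₂ λ u v → u ℤ.* m ℤ.+ v ℤ.* n ≡ 1ℤ

  unitℤ : ∀ d → ℤ.∣ d ∣ ≡ 1 → ∃ λ s → s ℤ.* d ≡ 1ℤ
  unitℤ (+ 1) refl = 1ℤ , refl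
  unitℤ -[1+ 0 ] refl = -[1+ 0 ] , refl

  prime-coprime : ∀ {p} n → Prime p → ¬ (p ℕᵈ.∣ ℤ.∣ n ∣) → Coprimeℤ (+ p) n
  prime-coprime {p} n pp p∤n = go (prime⇒irreducible pp (ℕᵈ.divides ℤ.∣ a' ∣ (trans (cong ℤ.∣_∣ a≈) (ℤₚ.abs-* a' d))))
    where
    open Bezoutℤ.LeftGcd (gcdℤ (+ p) n)
    go : ℤ.∣ d ∣ ≡ 1 ⊎ ℤ.∣ d ∣ ≡ p → Coprimeℤ (+ p) n
    go (inj₂ eq) = contradiction (subst (ℕᵈ._∣ ℤ.∣ n ∣) eq (ℕᵈ.divides ℤ.∣ b' ∣ (trans (cong ℤ.∣_∣ b≈) (ℤₚ.abs-* b' d)))) p∤n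
    go (inj₁ eq) with unitℤ d eq
    ... | s , sd≡1 = s ℤ.* u , s ℤ.* v , trans (e s u v (+ p) n) (trans (cong (s ℤ.*_) (sym bezout)) sd≡1)
      where e : ∀ s u v p n → s ℤ.* u ℤ.* p ℤ.+ s ℤ.* v ℤ.* n ≡ s ℤ.* (u ℤ.* p ℤ.+ v ℤ.* n)
            e = ℤ-Solver.solve-∀

  MinusOneIsSumOfSquaresMod : ℕ → Set
  MinusOneIsSumOfSquaresMod n = ∃₂ λ x y → + n ∣ x ℤ.* x ℤ.+ y ℤ.* y ℤ.+ 1ℤ

  private
    Sol = MinusOneIsSumOfSquaresMod

    %-diff : ∀ p → .{{_ : ℕ.NonZero p}} → ∀ a b → a %ℕ p ≡ b %ℕ p → + p ∣ a ℤ.+ ℤ.- b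
    %-diff p a b eq = divides (a /ℕ p ℤ.+ ℤ.- (b /ℕ p))
      (trans (cong₂ (λ x y → x ℤ.+ ℤ.- y) (a≡a%ℕn+[a/ℕn]*n a p) (trans (a≡a%ℕn+[a/ℕn]*n b p) (cong (λ r → + r ℤ.+ (b /ℕ p) ℤ.* + p) (sym eq))))
        (e (+ (a %ℕ p)) (a /ℕ p) (b /ℕ p) (+ p)))
      where e : ∀ r q q' p → (r ℤ.+ q ℤ.* p) ℤ.+ ℤ.- (r ℤ.+ q' ℤ.* p) ≡ (q ℤ.+ ℤ.- q') ℤ.* p
            e = ℤ-Solver.solve-∀

    -- j² - i² = (j - i)(j + i), and both factors lie strictly between 0 and the prime 2h + 1.
    squares-distinct : ∀ h → Prime (suc (h ℕ.+ h)) → ∀ {i j} → i ℕ.< j → j ℕ.≤ h →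
      ¬ (+ suc (h ℕ.+ h) ∣ + j ℤ.* + j ℤ.+ ℤ.- (+ i ℤ.* + i))
    squares-distinct h pp {i} i<j j≤h p∣ with ℕₚ.m≤n⇒∃[o]m+o≡n i<j
    ... | o , refl = go (euclidsLemma (suc o) (i ℕ.+ i ℕ.+ suc o) pp p∣ᵤ)
      where
      p = suc (h ℕ.+ h)
      e : ∀ i d → (i ℤ.+ d) ℤ.* (i ℤ.+ d) ℤ.+ ℤ.- (i ℤ.* i) ≡ d ℤ.* (i ℤ.+ i ℤ.+ d)
      e = ℤ-Solver.solve-∀
      p∣ᵤ : p ℕᵈ.∣ suc o ℕ.* (i ℕ.+ i ℕ.+ suc o)
      p∣ᵤ = subst (p ℕᵈ.∣_) (cong ℤ.∣_∣ (trans (cong (λ j → + j ℤ.* + j ℤ.+ ℤ.- (+ i ℤ.* + i)) (sym (ℕₚ.+-suc i o))) (trans (e (+ i) (+ suc o)) (sym (ℤₚ.pos-* (suc o) (i ℕ.+ i ℕ.+ suc o)))))) (∣⇒∣ᵤ p∣)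
      i+o≤h : i ℕ.+ suc o ℕ.≤ h
      i+o≤h = subst (ℕ._≤ h) (sym (ℕₚ.+-suc i o)) j≤h
      go : p ℕᵈ.∣ suc o ⊎ p ℕᵈ.∣ i ℕ.+ i ℕ.+ suc o → _
      go (inj₁ d) = ℕₚ.<⇒≱ (s≤s (ℕₚ.≤-trans (ℕₚ.≤-trans (ℕₚ.m≤n+m (suc o) i) i+o≤h) (ℕₚ.m≤m+n h h))) (ℕᵈ.∣⇒≤ d)
      go (inj₂ d) = ℕₚ.<⇒≱ (s≤s (subst (ℕ._≤ h ℕ.+ h) (sym (ℕₚ.+-assoc i i (suc o))) (ℕₚ.+-mono-≤ (ℕₚ.≤-trans (ℕₚ.m≤m+n i (suc o)) i+o≤h) i+o≤h)))
                            (ℕᵈ.∣⇒≤ {{ℕ.>-nonZero (ℕₚ.<-≤-trans (s≤s z≤n) (ℕₚ.m≤n+m (suc o) (i ℕ.+ i)))}} d)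

    -- The h + 1 squares i² and the h + 1 numbers -1 - i² with i ≤ h share only 2h + 1 residue
    -- classes, so two of them agree. By `squares-distinct` they come from different families.
    sol-prime : ∀ h → Prime (suc (h ℕ.+ h)) → Sol (suc (h ℕ.+ h))
    sol-prime h pp = collision (Finₚ.pigeonhole (ℕₚ.≤-reflexive (cong suc (sym (ℕₚ.+-suc h h)))) f)
      where
      p = suc (h ℕ.+ h)
      Q : ℕ → ℤ
      Q k with k ℕ.≤? h
      ... | yes _ = + k ℤ.* + k
      ... | no _ = ℤ.- (1ℤ ℤ.+ + (k ℕ.∸ suc h) ℤ.* + (k ℕ.∸ suc h))
      f : Fin (suc h ℕ.+ suc h) → Fin p
      f k = fromℕ< (n%ℕd<d (Q (toℕ k)) p)
      e₁ : ∀ x y → ℤ.- (1ℤ ℤ.+ x) ℤ.+ ℤ.- (ℤ.- (1ℤ ℤ.+ y)) ≡ y ℤ.+ ℤ.- x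
      e₁ = ℤ-Solver.solve-∀
      e₂ : ∀ x y → x ℤ.+ ℤ.- (ℤ.- (1ℤ ℤ.+ y)) ≡ x ℤ.+ y ℤ.+ 1ℤ
      e₂ = ℤ-Solver.solve-∀
      e₃ : ∀ x y → y ℤ.+ ℤ.- x ≡ ℤ.- 1ℤ ℤ.* (x ℤ.+ ℤ.- y)
      e₃ = ℤ-Solver.solve-∀
      case : ∀ i j → i ℕ.< j → j ℕ.< suc h ℕ.+ suc h → + p ∣ Q i ℤ.+ ℤ.- Q j → Sol p
      case i j i<j j< p∣ with i ℕ.≤? h | j ℕ.≤? h
      ... | yes i≤h | yes j≤h = contradiction (subst (+ p ∣_) (sym (e₃ (+ i ℤ.* + i) (+ j ℤ.* + j))) (∣n⇒∣m*n (ℤ.- 1ℤ) p∣)) (squares-distinct h pp i<j j≤h)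
      ... | no i≰h | yes j≤h = contradiction (ℕₚ.≤-trans (ℕₚ.<⇒≤ i<j) j≤h) i≰h
      ... | yes i≤h | no j≰h = + i , + (j ℕ.∸ suc h) , subst (+ p ∣_) (e₂ (+ i ℤ.* + i) (+ (j ℕ.∸ suc h) ℤ.* + (j ℕ.∸ suc h))) p∣
      ... | no i≰h | no j≰h = contradiction (subst (+ p ∣_) (e₁ (+ (i ℕ.∸ suc h) ℤ.* + (i ℕ.∸ suc h)) (+ (j ℕ.∸ suc h) ℤ.* + (j ℕ.∸ suc h))) p∣)
          (squares-distinct h pp (ℕₚ.∸-monoˡ-< i<j (ℕₚ.≰⇒> i≰h)) (ℕₚ.≤-pred (ℕₚ.m<n+o⇒m∸n<o j (suc h) j<)))
      collision : (∃₂ λ i j → i Fin.< j × f i ≡ f j) → Sol p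
      collision (i , j , i<j , fi≡fj) = case (toℕ i) (toℕ j) i<j (Finₚ.toℕ<n j)
        (%-diff p (Q (toℕ i)) (Q (toℕ j)) (trans (sym (Finₚ.toℕ-fromℕ< _)) (trans (cong toℕ fi≡fj) (Finₚ.toℕ-fromℕ< _))))

    -- Hensel's lemma in the form n ↦ n²: multiply the solution (x , y) by 1 + n w with 2 w ≡ c.
    sol-square : ∀ h → Sol (suc (h ℕ.+ h)) → Sol (suc (h ℕ.+ h) ℕ.* suc (h ℕ.+ h))
    sol-square h (x , y , divides c eq) = x ℤ.* t , y ℤ.* t , divides K
      (trans (e₁ x y t) (trans (cong (λ z → (z ℤ.+ ℤ.- 1ℤ) ℤ.* (t ℤ.* t) ℤ.+ 1ℤ) eq) (trans (e₂ (+ h) c)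
        (cong (K ℤ.*_) (sym (ℤₚ.pos-* (suc (h ℕ.+ h)) (suc (h ℕ.+ h))))))))
      where
      n = + suc (h ℕ.+ h)
      w = c ℤ.* (+ h ℤ.+ 1ℤ)
      t = 1ℤ ℤ.+ n ℤ.* w
      K = + 2 ℤ.* c ℤ.* w ℤ.+ n ℤ.* c ℤ.* w ℤ.* w ℤ.+ ℤ.- (w ℤ.* w) ℤ.+ ℤ.- c
      e₁ : ∀ x y t → x ℤ.* t ℤ.* (x ℤ.* t) ℤ.+ y ℤ.* t ℤ.* (y ℤ.* t) ℤ.+ 1ℤ ≡ (x ℤ.* x ℤ.+ y ℤ.* y ℤ.+ 1ℤ ℤ.+ ℤ.- 1ℤ) ℤ.* (t ℤ.* t) ℤ.+ 1ℤ
      e₁ = ℤ-Solver.solve-∀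
      e₂ : ∀ h c → let n = 1ℤ ℤ.+ (h ℤ.+ h) ; w = c ℤ.* (h ℤ.+ 1ℤ) ; t = 1ℤ ℤ.+ n ℤ.* w in
        (c ℤ.* n ℤ.+ ℤ.- 1ℤ) ℤ.* (t ℤ.* t) ℤ.+ 1ℤ ≡ (+ 2 ℤ.* c ℤ.* w ℤ.+ n ℤ.* c ℤ.* w ℤ.* w ℤ.+ ℤ.- (w ℤ.* w) ℤ.+ ℤ.- c) ℤ.* (n ℤ.* n)
      e₂ = ℤ-Solver.solve-∀

    sol-∣ : ∀ {m n} → m ℕᵈ.∣ n → Sol n → Sol m
    sol-∣ {m} (ℕᵈ.divides q refl) (x , y , n∣) = x , y , ∣-trans (divides (+ q) (ℤₚ.pos-* q m)) n∣

    -- Chinese remainders: X and Y agree with x and y modulo m, and with x' and y' modulo n. Then Z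
    -- is divisible by both m and n, hence Z = Z (u m + v n) by their product.
    sol-* : ∀ {m n} → Coprimeℤ (+ m) (+ n) → Sol m → Sol n → Sol (m ℕ.* n)
    sol-* {m} {n} (u , v , um+vn≡1) (x , y , divides c eq) (x' , y' , divides c' eq') = X , Y ,
      divides (v ℤ.* K ℤ.+ u ℤ.* K') (trans (sym (ℤₚ.*-identityʳ Z)) (trans (cong (Z ℤ.*_) (sym um+vn≡1))
        (trans (trans (ℤₚ.*-distribˡ-+ Z (u ℤ.* M) (v ℤ.* N)) (cong₂ (λ a b → a ℤ.* (u ℤ.* M) ℤ.+ b ℤ.* (v ℤ.* N)) Z≡' Z≡))
          (trans (e₄ K K' u v M N) (cong ((v ℤ.* K ℤ.+ u ℤ.* K') ℤ.*_) (sym (ℤₚ.pos-* m n)))))))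
      where
      M = + m
      N = + n
      X = x ℤ.* (v ℤ.* N) ℤ.+ x' ℤ.* (u ℤ.* M)
      Y = y ℤ.* (v ℤ.* N) ℤ.+ y' ℤ.* (u ℤ.* M)
      Z = X ℤ.* X ℤ.+ Y ℤ.* Y ℤ.+ 1ℤ
      e₁ : ∀ x x' s t → x ℤ.* t ℤ.+ x' ℤ.* s ≡ x ℤ.* (s ℤ.+ t) ℤ.+ (x' ℤ.+ ℤ.- x) ℤ.* s
      e₁ = ℤ-Solver.solve-∀
      e₂ : ∀ x x' s t → x ℤ.* t ℤ.+ x' ℤ.* s ≡ x' ℤ.* (s ℤ.+ t) ℤ.+ (x ℤ.+ ℤ.- x') ℤ.* t
      e₂ = ℤ-Solver.solve-∀
      mod-M : ∀ x x' → x ℤ.* (v ℤ.* N) ℤ.+ x' ℤ.* (u ℤ.* M) ≡ x ℤ.+ (x' ℤ.+ ℤ.- x) ℤ.* (u ℤ.* M)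
      mod-M x x' = trans (e₁ x x' (u ℤ.* M) (v ℤ.* N)) (cong (ℤ._+ (x' ℤ.+ ℤ.- x) ℤ.* (u ℤ.* M)) (trans (cong (x ℤ.*_) um+vn≡1) (ℤₚ.*-identityʳ x)))
      mod-N : ∀ x x' → x ℤ.* (v ℤ.* N) ℤ.+ x' ℤ.* (u ℤ.* M) ≡ x' ℤ.+ (x ℤ.+ ℤ.- x') ℤ.* (v ℤ.* N)
      mod-N x x' = trans (e₂ x x' (u ℤ.* M) (v ℤ.* N)) (cong (ℤ._+ (x ℤ.+ ℤ.- x') ℤ.* (v ℤ.* N)) (trans (cong (x' ℤ.*_) um+vn≡1) (ℤₚ.*-identityʳ x')))
      step : ∀ x y a b c w M → x ℤ.* x ℤ.+ y ℤ.* y ℤ.+ 1ℤ ≡ c ℤ.* M →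
        (x ℤ.+ a ℤ.* (w ℤ.* M)) ℤ.* (x ℤ.+ a ℤ.* (w ℤ.* M)) ℤ.+ (y ℤ.+ b ℤ.* (w ℤ.* M)) ℤ.* (y ℤ.+ b ℤ.* (w ℤ.* M)) ℤ.+ 1ℤ
          ≡ (c ℤ.+ w ℤ.* (+ 2 ℤ.* (x ℤ.* a ℤ.+ y ℤ.* b) ℤ.+ (a ℤ.* a ℤ.+ b ℤ.* b) ℤ.* (w ℤ.* M))) ℤ.* M
      step x y a b c w M eq = trans (s₁ x y a b w M) (trans (cong (ℤ._+ w ℤ.* (+ 2 ℤ.* (x ℤ.* a ℤ.+ y ℤ.* b) ℤ.+ (a ℤ.* a ℤ.+ b ℤ.* b) ℤ.* (w ℤ.* M)) ℤ.* M) eq) (sym (ℤₚ.*-distribʳ-+ M c (w ℤ.* (+ 2 ℤ.* (x ℤ.* a ℤ.+ y ℤ.* b) ℤ.+ (a ℤ.* a ℤ.+ b ℤ.* b) ℤ.* (w ℤ.* M))))))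
        where
        s₁ : ∀ x y a b w M → (x ℤ.+ a ℤ.* (w ℤ.* M)) ℤ.* (x ℤ.+ a ℤ.* (w ℤ.* M)) ℤ.+ (y ℤ.+ b ℤ.* (w ℤ.* M)) ℤ.* (y ℤ.+ b ℤ.* (w ℤ.* M)) ℤ.+ 1ℤ
          ≡ (x ℤ.* x ℤ.+ y ℤ.* y ℤ.+ 1ℤ) ℤ.+ w ℤ.* (+ 2 ℤ.* (x ℤ.* a ℤ.+ y ℤ.* b) ℤ.+ (a ℤ.* a ℤ.+ b ℤ.* b) ℤ.* (w ℤ.* M)) ℤ.* M
        s₁ = ℤ-Solver.solve-∀
      K = c ℤ.+ u ℤ.* (+ 2 ℤ.* (x ℤ.* (x' ℤ.+ ℤ.- x) ℤ.+ y ℤ.* (y' ℤ.+ ℤ.- y)) ℤ.+ ((x' ℤ.+ ℤ.- x) ℤ.* (x' ℤ.+ ℤ.- x) ℤ.+ (y' ℤ.+ ℤ.- y) ℤ.* (y' ℤ.+ ℤ.- y)) ℤ.* (u ℤ.* M))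
      K' = c' ℤ.+ v ℤ.* (+ 2 ℤ.* (x' ℤ.* (x ℤ.+ ℤ.- x') ℤ.+ y' ℤ.* (y ℤ.+ ℤ.- y')) ℤ.+ ((x ℤ.+ ℤ.- x') ℤ.* (x ℤ.+ ℤ.- x') ℤ.+ (y ℤ.+ ℤ.- y') ℤ.* (y ℤ.+ ℤ.- y')) ℤ.* (v ℤ.* N))
      Z≡ : Z ≡ K ℤ.* M
      Z≡ = trans (cong₂ (λ a b → a ℤ.* a ℤ.+ b ℤ.* b ℤ.+ 1ℤ) (mod-M x x') (mod-M y y')) (step x y (x' ℤ.+ ℤ.- x) (y' ℤ.+ ℤ.- y) c u M eq)
      Z≡' : Z ≡ K' ℤ.* N
      Z≡' = trans (cong₂ (λ a b → a ℤ.* a ℤ.+ b ℤ.* b ℤ.+ 1ℤ) (mod-N x x') (mod-N y y')) (step x' y' (x ℤ.+ ℤ.- x') (y ℤ.+ ℤ.- y') c' v N eq')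
      e₄ : ∀ K K' u v M N → K' ℤ.* N ℤ.* (u ℤ.* M) ℤ.+ K ℤ.* M ℤ.* (v ℤ.* N) ≡ (v ℤ.* K ℤ.+ u ℤ.* K') ℤ.* (M ℤ.* N)
      e₄ = ℤ-Solver.solve-∀

  Oddℕ : ℕ → Set
  Oddℕ n = ∃ λ h → n ≡ suc (h ℕ.+ h)

  private
    even-or-odd : ∀ n → (∃ λ h → n ≡ h ℕ.+ h) ⊎ Oddℕ n
    even-or-odd zero = inj₁ (0 , refl)
    even-or-odd (suc n) with even-or-odd n
    ... | inj₁ (h , refl) = inj₂ (h , refl)
    ... | inj₂ (h , refl) = inj₁ (suc h , cong suc (sym (ℕₚ.+-suc h h)))

    odd≢even : ∀ h k → suc (h ℕ.+ h) ≢ k ℕ.+ k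
    odd≢even h (suc k) eq = odd≢even k h (sym (trans (ℕₚ.suc-injective eq) (ℕₚ.+-suc k k)))

  odd-factors : ∀ m n → Oddℕ (m ℕ.* n) → Oddℕ m × Oddℕ n
  odd-factors m n (k , eq) with even-or-odd m | even-or-odd n
  ... | inj₂ om | inj₂ on = om , on
  ... | inj₁ (h , refl) | _ = contradiction (trans (sym eq) (ℕₚ.*-distribʳ-+ n h h)) (odd≢even k (h ℕ.* n))
  ... | inj₂ _ | inj₁ (h , refl) = contradiction (trans (sym eq) (ℕₚ.*-distribˡ-+ m h h)) (odd≢even k (m ℕ.* h))

  private
    -- If p divides the product R of the other primes, then p R divides R², so passing from R to its
    -- square covers repeated primes. Otherwise p and R are coprime.
    sol-product : ∀ ps → All Prime ps → Oddℕ (product ps) → Sol (product ps)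
    sol-product [] [] _ = 0ℤ , 0ℤ , divides 1ℤ refl
    sol-product (p ∷ ps) (pp ∷ pps) odd with odd-factors p (product ps) odd
    ... | (h , refl) , (k , ≡k) with sol-product ps pps (k , ≡k) | p ℕᵈ.∣? product ps
    ... | sol | yes p∣ = sol-∣ (ℕᵈ.*-monoˡ-∣ (product ps) p∣) (subst (λ n → Sol (n ℕ.* n)) (sym ≡k) (sol-square k (subst Sol ≡k sol)))
    ... | sol | no p∤ = sol-* (prime-coprime (+ product ps) pp p∤) (sol-prime h pp) sol

  minusOneIsSumOfSquares : ∀ h → Sol (suc (h ℕ.+ h))
  minusOneIsSumOfSquares h = subst Sol (sym isFactorisation) (sol-product factors factorsPrime (h , sym isFactorisation))
    where open PrimeFactorisation (factorise (suc (h ℕ.+ h)))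

-- Divisibility and units of ℤ[√2].

module Units where
  open import Data.Integer using (+_)
  open import Data.Integer.Divisibility.Signed using (_∣_)
  open import Tactic.RingSolver using (solve-∀)
  open QuadraticIntegers
  open MaximalOrder
  open BezoutAndParity
  open EuclideanRing
  open EuclideanOrder
  open SumsOfTwoSquares

  open IntegerRounding

  infix 4 _∣ᴿ_
  _∣ᴿ_ : ℤ[√2] → ℤ[√2] → Set
  δ ∣ᴿ α = ∃ λ γ → α ≡ δ * γ

  ∣-refl : ∀ {x} → x ∣ᴿ x
  ∣-refl {x} = 1R , sym (R.*-identityʳ x)

  ∣-trans : ∀ {x y z} → x ∣ᴿ y → y ∣ᴿ z → x ∣ᴿ z
  ∣-trans {x} (k , refl) (l , refl) = k * l , R.*-assoc x k l

  ∣-+ : ∀ {d x y} → d ∣ᴿ x → d ∣ᴿ y → d ∣ᴿ x + y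
  ∣-+ {d} (k , refl) (l , refl) = k + l , sym (R.distribˡ d k l)

  ∣-neg : ∀ {d x} → d ∣ᴿ x → d ∣ᴿ - x
  ∣-neg {d} (k , refl) = - k , e d k
    where e : ∀ d k → - (d * k) ≡ d * - k
          e = solve-∀ RR

  ∣-minus : ∀ {d x y} → d ∣ᴿ x → d ∣ᴿ y → d ∣ᴿ x - y
  ∣-minus p q = ∣-+ p (∣-neg q)

  ∣-*ˡ : ∀ {d x} y → d ∣ᴿ x → d ∣ᴿ y * x
  ∣-*ˡ {d} y (k , refl) = y * k , e d k y
    where e : ∀ d k y → y * (d * k) ≡ d * (y * k)
          e = solve-∀ RR

  ∣-*ʳ : ∀ {d x} y → d ∣ᴿ x → d ∣ᴿ x * y
  ∣-*ʳ {d} y (k , refl) = k * y , R.*-assoc d k y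

  ∣-subst : ∀ {d x y} → x ≡ y → d ∣ᴿ x → d ∣ᴿ y
  ∣-subst refl p = p

  nm-unit : ∀ {x} → x ∣ᴿ 1R → nm x ≡ 1ℤ ⊎ nm x ≡ -[1+ 0 ]
  nm-unit {x} (y , eq) with trans (cong nm eq) (nm-* x y)
  ... | eq' = go (nm x) (ℕₚ.m*n≡1⇒m≡1 ℤ.∣ nm x ∣ ℤ.∣ nm y ∣ (trans (sym (ℤₚ.abs-* (nm x) (nm y))) (cong ℤ.∣_∣ (sym eq'))))
    where
    go : ∀ z → ℤ.∣ z ∣ ≡ 1 → z ≡ 1ℤ ⊎ z ≡ -[1+ 0 ]
    go (+ 1) refl = inj₁ refl
    go -[1+ 0 ] refl = inj₂ refl

  private
    data UnitSquare (β : ℤ[√2]) : Set where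
      unitSquare : ∀ η η' → η * η' ≡ 1R → β ≡ η * η → UnitSquare β

    -- Divide by (1 + √2)² = 3 + 2√2 until the √2-component vanishes.
    descent : ∀ fuel x y → ℤ.∣ y ∣ ℕ.< fuel → 0ℤ ℤ.≤ x → 0ℤ ℤ.≤ y → x ℤ.* x ≡ + 2 ℤ.* (y ℤ.* y) ℤ.+ 1ℤ → UnitSquare (x ⊕√2 y)
    descent (suc fuel) x (+ zero) _ 0≤x _ eq with x≡1 x 0≤x eq
      where
      x≡1 : ∀ x → 0ℤ ℤ.≤ x → x ℤ.* x ≡ + 2 ℤ.* (0ℤ ℤ.* 0ℤ) ℤ.+ 1ℤ → x ≡ 1ℤ
      x≡1 (+ 1) _ _ = refl
      x≡1 (+ suc (suc n)) _ ()
    ... | refl = unitSquare 1R 1R refl refl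
    descent (suc fuel) x y@(+ suc y') lt 0≤x 0≤y eq = go (descent fuel x₁ y₁ (ℕₚ.<-≤-trans (abs-< 0≤y₁ y₁<y) (ℕₚ.≤-pred lt)) 0≤x₁ 0≤y₁ eq₁)
      where
      x₁ = + 3 ℤ.* x ℤ.+ ℤ.- (+ 4 ℤ.* y)
      y₁ = + 3 ℤ.* y ℤ.+ ℤ.- (+ 2 ℤ.* x)
      0<y : 0ℤ ℤ.< y
      0<y = +<+ (s≤s z≤n)
      abs-< : ∀ {a b} → 0ℤ ℤ.≤ a → a ℤ.< b → ℤ.∣ a ∣ ℕ.< ℤ.∣ b ∣
      abs-< {+ _} {+ _} _ (+<+ lt) = lt
      y<x : y ℤ.< x
      y<x = ℤₚ.≰⇒> λ x≤y → ℤₚ.<⇒≱ (<-by (y ℤ.* y ℤ.+ 1ℤ) (ℤₚ.+-mono-≤-< (0≤sq y) (+<+ (s≤s z≤n))) (trans eq (e (y ℤ.* y)))) (sq-mono-≤ 0≤x x≤y)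
        where e : ∀ s → + 2 ℤ.* s ℤ.+ 1ℤ ≡ s ℤ.+ (s ℤ.+ 1ℤ)
              e = ℤ-Solver.solve-∀
      0≤x₁ : 0ℤ ℤ.≤ x₁
      0≤x₁ = ℤₚ.i≤j⇒0≤j-i {+ 4 ℤ.* y} {+ 3 ℤ.* x} (ℤₚ.≮⇒≥ λ lt → ℤₚ.<⇒≱ (sq-mono-< (0≤* {+ 3} (+≤+ z≤n) 0≤x) lt)
        (≤-by (+ 2 ℤ.* (y ℤ.* y) ℤ.+ + 9) (0≤+ (0≤* {+ 2} (+≤+ z≤n) (0≤sq y)) (+≤+ z≤n)) (trans (e₁ x) (trans (cong (+ 9 ℤ.*_) eq) (e₂ y)))))
        where e₁ : ∀ x → + 3 ℤ.* x ℤ.* (+ 3 ℤ.* x) ≡ + 9 ℤ.* (x ℤ.* x)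
              e₁ = ℤ-Solver.solve-∀
              e₂ : ∀ y → + 9 ℤ.* (+ 2 ℤ.* (y ℤ.* y) ℤ.+ 1ℤ) ≡ + 4 ℤ.* y ℤ.* (+ 4 ℤ.* y) ℤ.+ (+ 2 ℤ.* (y ℤ.* y) ℤ.+ + 9)
              e₂ = ℤ-Solver.solve-∀
      y₁<y : y₁ ℤ.< y
      y₁<y = <-by (+ 2 ℤ.* (x ℤ.+ ℤ.- y)) (0<* {+ 2} (+<+ (s≤s z≤n)) (subst (ℤ._< x ℤ.+ ℤ.- y) (ℤₚ.+-inverseʳ y) (ℤₚ.+-monoˡ-< (ℤ.- y) y<x))) (e x y)
        where e : ∀ x y → y ≡ (+ 3 ℤ.* y ℤ.+ ℤ.- (+ 2 ℤ.* x)) ℤ.+ + 2 ℤ.* (x ℤ.+ ℤ.- y)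
              e = ℤ-Solver.solve-∀
      -- y₁ ≥ 0 amounts to 4 (2y² + 1) ≤ 9y², which holds from y = 2 on; y = 1 would give x² = 3.
      2≤y : + 2 ℤ.≤ y
      2≤y = two y' eq
        where
        two : ∀ y' → x ℤ.* x ≡ + 2 ℤ.* (+ suc y' ℤ.* + suc y') ℤ.+ 1ℤ → + 2 ℤ.≤ + suc y'
        two (suc _) _ = +≤+ (s≤s (s≤s z≤n))
        two zero x²≡3 = contradiction x²≡3 (x²≢3 x)
          where
          x²≢3 : ∀ x → x ℤ.* x ≢ + 3
          x²≢3 (+ 0) ()
          x²≢3 (+ 1) ()
          x²≢3 (+ suc (suc n)) eq = ℕₚ.<⇒≢ (ℕₚ.≤-trans (s≤s (s≤s (s≤s (s≤s z≤n)))) (ℕₚ.*-mono-≤ (s≤s (s≤s (z≤n {n}))) (s≤s (s≤s (z≤n {n}))))) (sym (ℤₚ.+-injective (trans (ℤₚ.pos-* (suc (suc n)) (suc (suc n))) eq)))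
          x²≢3 -[1+ 0 ] ()
          x²≢3 -[1+ suc n ] eq = ℕₚ.<⇒≢ (ℕₚ.≤-trans (s≤s (s≤s (s≤s (s≤s z≤n)))) (ℕₚ.*-mono-≤ (s≤s (s≤s (z≤n {n}))) (s≤s (s≤s (z≤n {n}))))) (sym (ℤₚ.+-injective eq))
      0≤y₁ : 0ℤ ℤ.≤ y₁
      0≤y₁ = ℤₚ.i≤j⇒0≤j-i {+ 2 ℤ.* x} {+ 3 ℤ.* y} (ℤₚ.≮⇒≥ λ lt → ℤₚ.<⇒≱ (sq-mono-< (0≤* {+ 3} (+≤+ z≤n) 0≤y) lt)
        (subst₂ ℤ._≤_ (sym (trans (e₁ x) (cong (+ 4 ℤ.*_) eq))) (sym (e₂ y))
          (subst (ℤ._≤ + 9 ℤ.* (y ℤ.* y)) (e₃ (y ℤ.* y)) (≤-by (y ℤ.* y ℤ.+ ℤ.- (+ 4)) (ℤₚ.i≤j⇒0≤j-i (sq-mono-≤ {+ 2} (+≤+ z≤n) 2≤y)) (e₄ (y ℤ.* y))))))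
        where e₁ : ∀ x → + 2 ℤ.* x ℤ.* (+ 2 ℤ.* x) ≡ + 4 ℤ.* (x ℤ.* x)
              e₁ = ℤ-Solver.solve-∀
              e₂ : ∀ y → + 3 ℤ.* y ℤ.* (+ 3 ℤ.* y) ≡ + 9 ℤ.* (y ℤ.* y)
              e₂ = ℤ-Solver.solve-∀
              e₃ : ∀ s → + 8 ℤ.* s ℤ.+ + 4 ≡ + 4 ℤ.* (+ 2 ℤ.* s ℤ.+ 1ℤ)
              e₃ = ℤ-Solver.solve-∀
              e₄ : ∀ s → + 9 ℤ.* s ≡ (+ 8 ℤ.* s ℤ.+ + 4) ℤ.+ (s ℤ.+ ℤ.- (+ 4))
              e₄ = ℤ-Solver.solve-∀
      eq₁ : x₁ ℤ.* x₁ ≡ + 2 ℤ.* (y₁ ℤ.* y₁) ℤ.+ 1ℤ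
      eq₁ = trans (e₁ x y) (trans (cong (λ z → z ℤ.+ (+ 16 ℤ.* (y ℤ.* y) ℤ.+ + 8 ℤ.* (x ℤ.* x) ℤ.+ ℤ.- (+ 24 ℤ.* (x ℤ.* y)))) eq) (e₂ x y))
        where e₁ : ∀ x y → (+ 3 ℤ.* x ℤ.+ ℤ.- (+ 4 ℤ.* y)) ℤ.* (+ 3 ℤ.* x ℤ.+ ℤ.- (+ 4 ℤ.* y)) ≡ x ℤ.* x ℤ.+ (+ 16 ℤ.* (y ℤ.* y) ℤ.+ + 8 ℤ.* (x ℤ.* x) ℤ.+ ℤ.- (+ 24 ℤ.* (x ℤ.* y)))
              e₁ = ℤ-Solver.solve-∀
              e₂ : ∀ x y → (+ 2 ℤ.* (y ℤ.* y) ℤ.+ 1ℤ) ℤ.+ (+ 16 ℤ.* (y ℤ.* y) ℤ.+ + 8 ℤ.* (x ℤ.* x) ℤ.+ ℤ.- (+ 24 ℤ.* (x ℤ.* y)))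
                ≡ + 2 ℤ.* ((+ 3 ℤ.* y ℤ.+ ℤ.- (+ 2 ℤ.* x)) ℤ.* (+ 3 ℤ.* y ℤ.+ ℤ.- (+ 2 ℤ.* x))) ℤ.+ 1ℤ
              e₂ = ℤ-Solver.solve-∀
      go : UnitSquare (x₁ ⊕√2 y₁) → UnitSquare (x ⊕√2 y)
      go (unitSquare η η' ηη'≡1 eq) = unitSquare (ε * η) (ε⁻¹ * η') (trans (e₁ η η') ηη'≡1)
        (trans (cong₂ _⊕√2_ (e₂ x y) (e₃ x y)) (trans (cong (ε * ε *_) eq) (e₄ η)))
        where
        ε = 1ℤ ⊕√2 1ℤ
        ε⁻¹ = -[1+ 0 ] ⊕√2 1ℤ
        e₁ : ∀ η η' → ((1ℤ ⊕√2 1ℤ) * η) * ((-[1+ 0 ] ⊕√2 1ℤ) * η') ≡ η * η'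
        e₁ = solve-∀ RR
        e₂ : ∀ x y → x ≡ + 3 ℤ.* (+ 3 ℤ.* x ℤ.+ ℤ.- (+ 4 ℤ.* y)) ℤ.+ + 2 ℤ.* + 2 ℤ.* (+ 3 ℤ.* y ℤ.+ ℤ.- (+ 2 ℤ.* x))
        e₂ = ℤ-Solver.solve-∀
        e₃ : ∀ x y → y ≡ + 3 ℤ.* (+ 3 ℤ.* y ℤ.+ ℤ.- (+ 2 ℤ.* x)) ℤ.+ + 2 ℤ.* (+ 3 ℤ.* x ℤ.+ ℤ.- (+ 4 ℤ.* y))
        e₃ = ℤ-Solver.solve-∀
        e₄ : ∀ η → (1ℤ ⊕√2 1ℤ) * (1ℤ ⊕√2 1ℤ) * (η * η) ≡ ((1ℤ ⊕√2 1ℤ) * η) * ((1ℤ ⊕√2 1ℤ) * η)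
        e₄ = solve-∀ RR

    bar-unitSquare : ∀ {x y} → UnitSquare (x ⊕√2 y) → UnitSquare (x ⊕√2 ℤ.- y)
    bar-unitSquare (unitSquare η η' e₁ e₂) = unitSquare (bar η) (bar η') (trans (sym (bar-* η η')) (cong bar e₁)) (trans (cong bar e₂) (bar-* η η))
      where
      bar-* : ∀ x y → bar (x * y) ≡ bar x * bar y
      bar-* (a ⊕√2 b) (c ⊕√2 d) = cong₂ _⊕√2_ (f₁ a b c d) (f₂ a b c d)
        where
        f₁ : ∀ a b c d → a ℤ.* c ℤ.+ + 2 ℤ.* b ℤ.* d ≡ a ℤ.* c ℤ.+ + 2 ℤ.* (ℤ.- b) ℤ.* (ℤ.- d)
        f₁ = ℤ-Solver.solve-∀
        f₂ : ∀ a b c d → ℤ.- (a ℤ.* d ℤ.+ b ℤ.* c) ≡ a ℤ.* (ℤ.- d) ℤ.+ (ℤ.- b) ℤ.* c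
        f₂ = ℤ-Solver.solve-∀

    nonneg-unitSquare : ∀ x y → 0ℤ ℤ.≤ x → nm (x ⊕√2 y) ≡ 1ℤ → UnitSquare (x ⊕√2 y)
    nonneg-unitSquare x y 0≤x eq = go y (pell x y eq)
      where
      pell : ∀ x y → x ℤ.* x ℤ.+ ℤ.- (+ 2 ℤ.* (y ℤ.* y)) ≡ 1ℤ → x ℤ.* x ≡ + 2 ℤ.* (y ℤ.* y) ℤ.+ 1ℤ
      pell x y eq = trans (e (x ℤ.* x) (+ 2 ℤ.* (y ℤ.* y))) (cong (λ z → + 2 ℤ.* (y ℤ.* y) ℤ.+ z) eq)
        where e : ∀ s t → s ≡ t ℤ.+ (s ℤ.+ ℤ.- t)
              e = ℤ-Solver.solve-∀
      go : ∀ y → x ℤ.* x ≡ + 2 ℤ.* (y ℤ.* y) ℤ.+ 1ℤ → UnitSquare (x ⊕√2 y)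
      go (+ y) eq = descent (suc y) x (+ y) (ℕₚ.n<1+n y) 0≤x (+≤+ z≤n) eq
      go -[1+ y ] eq = bar-unitSquare {x} {+ suc y} (descent (suc (suc y)) x (+ suc y) (ℕₚ.n<1+n (suc y)) 0≤x (+≤+ z≤n) eq)

  -- The fundamental unit 1 + √2 has norm -1, so the units of norm 1 are its even powers up to sign.
  unit-of-norm-1 : ∀ β → nm β ≡ 1ℤ → ∃₂ λ η η' → η * η' ≡ 1R × (β ≡ η * η ⊎ β ≡ - (η * η))
  unit-of-norm-1 (+ x ⊕√2 y) eq with nonneg-unitSquare (+ x) y (+≤+ z≤n) eq
  ... | unitSquare η η' ηη'≡1 β≡ = η , η' , ηη'≡1 , inj₁ β≡
  unit-of-norm-1 β@(-[1+ x ] ⊕√2 y) eq with nonneg-unitSquare (+ suc x) (ℤ.- y) (+≤+ z≤n) (trans (nm-neg -[1+ x ] y) eq)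
    where
    nm-neg : ∀ x y → ℤ.- x ℤ.* ℤ.- x ℤ.+ ℤ.- (+ 2 ℤ.* (ℤ.- y ℤ.* ℤ.- y)) ≡ x ℤ.* x ℤ.+ ℤ.- (+ 2 ℤ.* (y ℤ.* y))
    nm-neg = ℤ-Solver.solve-∀
  ... | unitSquare η η' ηη'≡1 β≡ = η , η' , ηη'≡1 , inj₂ (trans (neg-neg β) (cong (λ z → - z) β≡))
    where
    neg-neg : ∀ x → x ≡ - - x
    neg-neg = solve-∀ RR

  -- Total positivity: a positive norm gives both conjugates the same sign, and the rational part is
  -- half their sum.
  record Positive (α : ℤ[√2]) : Set where
    constructor positive
    field
      0<re : 0ℤ ℤ.< re α
      0<nm : 0ℤ ℤ.< nm α

  positive≢0 : ∀ {α} → Positive α → α ≢ 0R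
  positive≢0 (positive 0<re _) refl = ℤₚ.<-irrefl refl 0<re

  -- norm b is totally nonnegative and α totally positive, so the unit β has norm 1 and is not the
  -- negative of a square. Being a square, it is absorbed by rescaling b.
  normalise-norm : ∀ {α β} b → Positive α → β ∣ᴿ 1R → norm b ≡ α * β →
    ∃₂ λ η η' → η * η' ≡ 1R × norm (scale η' b) ≡ α
  normalise-norm {α} {β} b (positive 0<re 0<nm) unit eq = go (nm-unit unit)
    where
    nm≡ : nm (norm b) ≡ nm α ℤ.* nm β
    nm≡ = trans (cong nm eq) (nm-* α β)
    e₁ : ∀ α η η' → η' * η' * (α * (η * η)) ≡ α * ((η * η') * (η * η'))
    e₁ = solve-∀ RR
    e₂ : ∀ α η η' → η' * η' * (α * - (η * η)) ≡ - (α * ((η * η') * (η * η')))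
    e₂ = solve-∀ RR
    e₃ : ∀ α → α * (1R * 1R) ≡ α
    e₃ = solve-∀ RR
    re-neg : ∀ x → re (- x) ≡ ℤ.- re x
    re-neg (a ⊕√2 b) = refl
    go : nm β ≡ 1ℤ ⊎ nm β ≡ -[1+ 0 ] → ∃₂ λ η η' → η * η' ≡ 1R × norm (scale η' b) ≡ α
    go (inj₂ nmβ) = contradiction (0≤nm-norm b) (ℤₚ.<⇒≱ (subst (ℤ._< 0ℤ) (sym (trans nm≡ (trans (cong (nm α ℤ.*_) nmβ) (trans (ℤₚ.*-comm (nm α) -[1+ 0 ]) (ℤₚ.-1*i≡-i (nm α)))))) (ℤₚ.neg-mono-< 0<nm)))
    go (inj₁ nmβ) with unit-of-norm-1 β nmβ
    ... | η , η' , ηη'≡1 , inj₁ refl = η , η' , ηη'≡1 ,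
      trans (norm-scale b η') (trans (cong (η' * η' *_) eq) (trans (e₁ α η η') (trans (cong (λ z → α * (z * z)) ηη'≡1) (e₃ α))))
    ... | η , η' , ηη'≡1 , inj₂ refl = contradiction (0≤re-norm (scale η' b)) (ℤₚ.<⇒≱ (subst (ℤ._< 0ℤ) (sym (trans (cong re norm≡) (re-neg α))) (ℤₚ.neg-mono-< 0<re)))
      where
      norm≡ : norm (scale η' b) ≡ - α
      norm≡ = trans (norm-scale b η') (trans (cong (η' * η' *_) eq) (trans (e₂ α η η') (cong (λ z → - z) (trans (cong (λ z → α * (z * z)) ηη'≡1) (e₃ α)))))

-- Splitting 𝒪 by 2 × 2 matrices modulo a number.

module MatrixSplitting where
  open import Data.Integer using (+_)
  open import Data.Vec using ([]; _∷_)
  open Quadruple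
  open QuadraticIntegers
  open MaximalOrder
  open EuclideanOrder
  open IdentitySolver

  -- A 2 × 2 matrix is stored as ⟪ m₁₁ , m₁₂ , m₂₁ , m₂₂ ⟫. The map ψ sends f and g to
  -- F = ((0 , -1) , (1 , √2)) and G = ((x , y) , (z , √2 - x)), and fg to F G. These satisfy the
  -- relations of f and g, except that G² - √2 G + 1 = κ.
  module Matrices {A : Set} (ops : RingOps A) where
    open RingOps ops
    open Quaternions ops using (add; scale)

    -- This is 1 - det G. The entry y = z - 1 + √2 x is forced by the trace of F G being 1, the
    -- trace of fg, so that det G = 1 is the one equation left for a splitting.
    κ : A → A → A
    κ x z = x ⊠ x ⊞ root2 ⊠ x ⊠ z ⊞ z ⊠ z ⊟ root2 ⊠ x ⊟ z ⊞ one

    ψ ψ⁻¹ : A → A → Quat A → Quat A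
    ψ x z ⟪ a , b , c , d ⟫ =
      ⟪ a ⊞ c ⊠ x ⊟ d ⊠ z
      , c ⊠ (z ⊟ one ⊞ root2 ⊠ x) ⊟ b ⊞ d ⊠ (x ⊟ root2)
      , b ⊞ c ⊠ z ⊞ d ⊠ (x ⊞ root2 ⊠ z)
      , a ⊞ root2 ⊠ b ⊞ c ⊠ (root2 ⊟ x) ⊞ d ⊠ (z ⊞ one) ⟫
    -- inverse of ψ modulo κ
    ψ⁻¹ x z ⟪ p , r , s , u ⟫ =
      ⟪ p ⊠ (z ⊟ one ⊞ root2 ⊠ x) ⊞ r ⊠ (root2 ⊟ x) ⊞ s ⊠ (x ⊟ root2 ⊞ root2 ⊠ z) ⊞ u ⊠ (two ⊟ z ⊟ root2 ⊠ x)
      , p ⊠ (root2 ⊟ x ⊟ root2 ⊠ z) ⊞ r ⊠ (z ⊟ two ⊞ root2 ⊠ x) ⊞ s ⊠ (one ⊟ z) ⊞ u ⊠ (x ⊟ root2 ⊞ root2 ⊠ z)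
      , p ⊠ (root2 ⊟ two ⊠ x ⊟ root2 ⊠ z) ⊞ r ⊠ (root2 ⊠ x ⊟ one) ⊞ s ⊠ (one ⊟ two ⊠ z ⊟ root2 ⊠ x) ⊞ u ⊠ (two ⊠ x ⊟ root2 ⊞ root2 ⊠ z)
      , p ⊠ (two ⊠ z ⊟ one ⊞ root2 ⊠ x) ⊞ r ⊠ (root2 ⊟ two ⊠ x ⊟ root2 ⊠ z) ⊞ s ⊠ (root2 ⊠ z) ⊞ u ⊠ (one ⊟ two ⊠ z ⊟ root2 ⊠ x) ⟫
      where two = one ⊞ one

    mmul : Quat A → Quat A → Quat A
    mmul ⟪ p , r , s , u ⟫ ⟪ p' , r' , s' , u' ⟫ =
      ⟪ p ⊠ p' ⊞ r ⊠ s' , p ⊠ r' ⊞ r ⊠ u' , s ⊠ p' ⊞ u ⊠ s' , s ⊠ r' ⊞ u ⊠ u' ⟫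

    adj : Quat A → Quat A
    adj ⟪ p , r , s , u ⟫ = ⟪ u , neg r , neg s , p ⟫

    det : Quat A → A
    det ⟪ p , r , s , u ⟫ = p ⊠ u ⊟ r ⊠ s

    -- The cofactors are explicit quotients by κ; they turn congruences modulo κ into polynomial
    -- identities over ℤ[√2].
    mul-cofactor : Quat A → Quat A → Quat A
    mul-cofactor ⟪ a , b , c , d ⟫ ⟪ a' , b' , c' , d' ⟫ =
      ⟪ neg (c ⊠ c' ⊞ root2 ⊠ c ⊠ d' ⊞ d ⊠ d') , d ⊠ c' ⊟ c ⊠ d' , c ⊠ d' ⊟ d ⊠ c' , neg (c ⊠ c' ⊞ root2 ⊠ d ⊠ c' ⊞ d ⊠ d') ⟫

    det-cofactor : Quat A → A
    det-cofactor ⟪ a , b , c , d ⟫ = neg (c ⊠ c ⊞ root2 ⊠ c ⊠ d ⊞ d ⊠ d)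

    ψψ⁻¹-cofactor ψ⁻¹ψ-cofactor : Quat A → Quat A
    ψψ⁻¹-cofactor ⟪ p , r , s , u ⟫ =
      ⟪ (one ⊞ one) ⊠ (u ⊟ p) ⊞ root2 ⊠ (r ⊟ s)
      , root2 ⊠ (u ⊟ p) ⊟ (one ⊞ one) ⊠ s
      , root2 ⊠ (p ⊟ u) ⊟ (one ⊞ one) ⊠ r
      , (one ⊞ one) ⊠ (p ⊟ u) ⊞ root2 ⊠ (s ⊟ r) ⟫
    ψ⁻¹ψ-cofactor ⟪ a , b , c , d ⟫ =
      ⟪ root2 ⊠ c , root2 ⊠ d , neg ((one ⊞ one) ⊠ c) , neg ((one ⊞ one) ⊠ d) ⟫

  open Matrices ℤ[√2]-ops public

  -- What remains of det (V + n W) - det V after division by n: the polar form of det at V and W,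
  -- plus n det W.
  det-expand : ℤ[√2] → 𝒪 → 𝒪 → ℤ[√2]
  det-expand n V W = co₀ V * co₃ W + co₀ W * co₃ V - co₁ V * co₂ W - co₁ W * co₂ V + n * det W

  private module _ {k m : ℕ} where
    ψᵗ ψ⁻¹ᵗ : STerm k m → STerm k m → QTerm k m → QTerm k m
    ψᵗ = ssqop record { fun = λ ops → Matrices.ψ ops ; natural = λ { ρ s t ⟪ _ , _ , _ , _ ⟫ → refl } }
    ψ⁻¹ᵗ = ssqop record { fun = λ ops → Matrices.ψ⁻¹ ops ; natural = λ { ρ s t ⟪ _ , _ , _ , _ ⟫ → refl } }

    mmulᵗ mul-cofactorᵗ : QTerm k m → QTerm k m → QTerm k m
    mmulᵗ = qqop record { fun = λ ops → Matrices.mmul ops ; natural = λ { ρ ⟪ _ , _ , _ , _ ⟫ ⟪ _ , _ , _ , _ ⟫ → refl } }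
    mul-cofactorᵗ = qqop record { fun = λ ops → Matrices.mul-cofactor ops ; natural = λ { ρ ⟪ _ , _ , _ , _ ⟫ ⟪ _ , _ , _ , _ ⟫ → refl } }

    adjᵗ ψψ⁻¹-cofactorᵗ ψ⁻¹ψ-cofactorᵗ : QTerm k m → QTerm k m
    adjᵗ = qop record { fun = λ ops → Matrices.adj ops ; natural = λ { ρ ⟪ _ , _ , _ , _ ⟫ → refl } }
    ψψ⁻¹-cofactorᵗ = qop record { fun = λ ops → Matrices.ψψ⁻¹-cofactor ops ; natural = λ { ρ ⟪ _ , _ , _ , _ ⟫ → refl } }
    ψ⁻¹ψ-cofactorᵗ = qop record { fun = λ ops → Matrices.ψ⁻¹ψ-cofactor ops ; natural = λ { ρ ⟪ _ , _ , _ , _ ⟫ → refl } }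

    detᵗ det-cofactorᵗ : QTerm k m → STerm k m
    detᵗ = form record { fun = λ ops → Matrices.det ops ; natural = λ { ρ ⟪ _ , _ , _ , _ ⟫ → refl } }
    det-cofactorᵗ = form record { fun = λ ops → Matrices.det-cofactor ops ; natural = λ { ρ ⟪ _ , _ , _ , _ ⟫ → refl } }

    κᵗ : STerm k m → STerm k m → STerm k m
    κᵗ s t = s :* s :+ con √2 :* s :* t :+ t :* t :- con √2 :* s :- t :+ con 1R

    det-expandᵗ : STerm k m → QTerm k m → QTerm k m → STerm k m
    det-expandᵗ n V W = co₀ᵗ V :* co₃ᵗ W :+ co₀ᵗ W :* co₃ᵗ V :- co₁ᵗ V :* co₂ᵗ W :- co₁ᵗ W :* co₂ᵗ V :+ n :* detᵗ W

  ψ-mul : ∀ q w x z → ψ x z (mul q w) ≡ add (mmul (ψ x z q) (ψ x z w)) (scale (κ x z) (mul-cofactor q w))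
  ψ-mul q w x z = solveQ {2} {2} (ψᵗ s₀ s₁ (mulᵗ q₀ q₁)) (addᵗ (mmulᵗ (ψᵗ s₀ s₁ q₀) (ψᵗ s₀ s₁ q₁)) (scaleᵗ (κᵗ s₀ s₁) (mul-cofactorᵗ q₀ q₁))) refl (q ∷ w ∷ []) (x ∷ z ∷ [])

  det-ψ : ∀ q x z → det (ψ x z q) ≡ norm q + κ x z * det-cofactor q
  det-ψ q x z = solveS {1} {2} (detᵗ (ψᵗ s₀ s₁ q₀)) (normᵗ q₀ :+ κᵗ s₀ s₁ :* det-cofactorᵗ q₀) refl (q ∷ []) (x ∷ z ∷ [])

  ψψ⁻¹ : ∀ v x z → ψ x z (ψ⁻¹ x z v) ≡ add v (scale (κ x z) (ψψ⁻¹-cofactor v))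
  ψψ⁻¹ v x z = solveQ {1} {2} (ψᵗ s₀ s₁ (ψ⁻¹ᵗ s₀ s₁ q₀)) (addᵗ q₀ (scaleᵗ (κᵗ s₀ s₁) (ψψ⁻¹-cofactorᵗ q₀))) refl (v ∷ []) (x ∷ z ∷ [])

  ψ⁻¹ψ : ∀ q x z → ψ⁻¹ x z (ψ x z q) ≡ add q (scale (κ x z) (ψ⁻¹ψ-cofactor q))
  ψ⁻¹ψ q x z = solveQ {1} {2} (ψ⁻¹ᵗ s₀ s₁ (ψᵗ s₀ s₁ q₀)) (addᵗ q₀ (scaleᵗ (κᵗ s₀ s₁) (ψ⁻¹ψ-cofactorᵗ q₀))) refl (q ∷ []) (x ∷ z ∷ [])

  ψ-add : ∀ q w x z → ψ x z (add q w) ≡ add (ψ x z q) (ψ x z w)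
  ψ-add q w x z = solveQ {2} {2} (ψᵗ s₀ s₁ (addᵗ q₀ q₁)) (addᵗ (ψᵗ s₀ s₁ q₀) (ψᵗ s₀ s₁ q₁)) refl (q ∷ w ∷ []) (x ∷ z ∷ [])

  ψ-scale : ∀ q t x z → ψ x z (scale t q) ≡ scale t (ψ x z q)
  ψ-scale q t x z = solveQ {1} {3} (ψᵗ s₁ s₂ (scaleᵗ s₀ q₀)) (scaleᵗ s₀ (ψᵗ s₁ s₂ q₀)) refl (q ∷ []) (t ∷ x ∷ z ∷ [])

  ψ⁻¹-add : ∀ q w x z → ψ⁻¹ x z (add q w) ≡ add (ψ⁻¹ x z q) (ψ⁻¹ x z w)
  ψ⁻¹-add q w x z = solveQ {2} {2} (ψ⁻¹ᵗ s₀ s₁ (addᵗ q₀ q₁)) (addᵗ (ψ⁻¹ᵗ s₀ s₁ q₀) (ψ⁻¹ᵗ s₀ s₁ q₁)) refl (q ∷ w ∷ []) (x ∷ z ∷ [])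

  ψ⁻¹-scale : ∀ q t x z → ψ⁻¹ x z (scale t q) ≡ scale t (ψ⁻¹ x z q)
  ψ⁻¹-scale q t x z = solveQ {1} {3} (ψ⁻¹ᵗ s₁ s₂ (scaleᵗ s₀ q₀)) (scaleᵗ s₀ (ψ⁻¹ᵗ s₁ s₂ q₀)) refl (q ∷ []) (t ∷ x ∷ z ∷ [])

  mmul-assoc : ∀ U V W → mmul (mmul U V) W ≡ mmul U (mmul V W)
  mmul-assoc U V W = solveQ {3} {0} (mmulᵗ (mmulᵗ q₀ q₁) q₂) (mmulᵗ q₀ (mmulᵗ q₁ q₂)) refl (U ∷ V ∷ W ∷ []) []

  mmul-addˡ : ∀ U V W → mmul (add U V) W ≡ add (mmul U W) (mmul V W)
  mmul-addˡ U V W = solveQ {3} {0} (mmulᵗ (addᵗ q₀ q₁) q₂) (addᵗ (mmulᵗ q₀ q₂) (mmulᵗ q₁ q₂)) refl (U ∷ V ∷ W ∷ []) []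

  mmul-approx : ∀ U V W X n → mmul (add U (scale n V)) (add W (scale n X)) ≡ add (mmul U W) (scale n (add (add (mmul U X) (mmul V W)) (scale n (mmul V X))))
  mmul-approx U V W X n = solveQ {4} {1} (mmulᵗ (addᵗ q₀ (scaleᵗ s₀ q₁)) (addᵗ q₂ (scaleᵗ s₀ q₃))) (addᵗ (mmulᵗ q₀ q₂) (scaleᵗ s₀ (addᵗ (addᵗ (mmulᵗ q₀ q₃) (mmulᵗ q₁ q₂)) (scaleᵗ s₀ (mmulᵗ q₁ q₃))))) refl (U ∷ V ∷ W ∷ X ∷ []) (n ∷ [])

  mmul-adj : ∀ U W → mmul (mmul U (adj W)) W ≡ scale (det W) U
  mmul-adj U W = solveQ {2} {0} (mmulᵗ (mmulᵗ q₀ (adjᵗ q₁)) q₁) (scaleᵗ (detᵗ q₁) q₀) refl (U ∷ W ∷ []) []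

  adj-mmul : ∀ V W → mmul (adj V) (mmul V W) ≡ scale (det V) W
  adj-mmul V W = solveQ {2} {0} (mmulᵗ (adjᵗ q₀) (mmulᵗ q₀ q₁)) (scaleᵗ (detᵗ q₀) q₁) refl (V ∷ W ∷ []) []

  det-mmul : ∀ U V → det (mmul U V) ≡ det U * det V
  det-mmul U V = solveS {2} {0} (detᵗ (mmulᵗ q₀ q₁)) (detᵗ q₀ :* detᵗ q₁) refl (U ∷ V ∷ []) []

  det-add : ∀ V W n → det (add V (scale n W)) ≡ det V + n * det-expand n V W
  det-add V W n = solveS {2} {1} (detᵗ (addᵗ q₀ (scaleᵗ s₀ q₁))) (detᵗ q₀ :+ s₀ :* det-expandᵗ s₀ q₀ q₁) refl (V ∷ W ∷ []) (n ∷ [])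

  scale-scale : ∀ q t u → scale t (scale u q) ≡ scale (t * u) q
  scale-scale q t u = solveQ {1} {2} (scaleᵗ s₀ (scaleᵗ s₁ q₀)) (scaleᵗ (s₀ :* s₁) q₀) refl (q ∷ []) (t ∷ u ∷ [])

  scale-add : ∀ q w t → scale t (add q w) ≡ add (scale t q) (scale t w)
  scale-add q w t = solveQ {2} {1} (scaleᵗ s₀ (addᵗ q₀ q₁)) (addᵗ (scaleᵗ s₀ q₀) (scaleᵗ s₀ q₁)) refl (q ∷ w ∷ []) (t ∷ [])

  add-scale-cancel : ∀ q w n → q ≡ add (add q (scale n w)) (scale n (opp w))
  add-scale-cancel q w n = solveQ {2} {1} q₀ (addᵗ (addᵗ q₀ (scaleᵗ s₀ q₁)) (scaleᵗ s₀ (oppᵗ q₁))) refl (q ∷ w ∷ []) (n ∷ [])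

-- Left ideals of 𝒪 from Hermite forms, and their generators.

module LeftIdeals where
  open import Tactic.RingSolver using (solve-∀)
  open Quadruple
  open QuadraticIntegers
  open MaximalOrder
  open BezoutAndParity
  open EuclideanRing
  open EuclideanOrder
  open SumsOfTwoSquares
  open Units
  open MatrixSplitting

  data Gcd₃ (p s α : ℤ[√2]) : Set where
    mkGcd₃ : ∀ g p' s' α' A B Y → p ≡ g * p' → s ≡ g * s' → α ≡ g * α' → g ≡ p * A + s * B + α * Y → Gcd₃ p s α

  gcd₃ : ∀ p s α → Gcd₃ p s α
  gcd₃ p s α = mkGcd₃ H.d (G.a' * H.a') (G.b' * H.a') H.b' (H.u * G.u) (H.u * G.v) H.v
    (trans G.a≈ (trans (cong (G.a' *_) H.a≈) (e₁ G.a' H.a' H.d)))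
    (trans G.b≈ (trans (cong (G.b' *_) H.a≈) (e₁ G.b' H.a' H.d)))
    (trans H.b≈ (R.*-comm H.b' H.d))
    (trans H.bezout (trans (cong (λ d → H.u * d + H.v * α) G.bezout) (e₂ p s α G.u G.v H.u H.v)))
    where
    module G = Bezoutᴿ.LeftGcd (gcdᴿ p s)
    module H = Bezoutᴿ.LeftGcd (gcdᴿ G.d α)
    e₁ : ∀ y d' g → y * (d' * g) ≡ g * (y * d')
    e₁ = solve-∀ RR
    e₂ : ∀ p s α u v u' v' → u' * (u * p + v * s) + v' * α ≡ p * (u' * u) + s * (u' * v) + α * v'
    e₂ = solve-∀ RR

  -- Determinants of `Φ q` give reduced norms only modulo n. Because α² divides n, cancelling α from
  -- such a congruence still leaves one modulo α; the norms of generators and the determinants of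
  -- the matrices V are controlled in this way.
  module RowIdeals (x z n c : ℤ[√2]) (κ≡ : κ x z ≡ n * c)
    (α ν : ℤ[√2]) (α≢0 : α ≢ 0R) (n≡ : n ≡ α * (α * ν)) where

    infix 4 _≈_
    data _≈_ (u v : 𝒪) : Set where
      approx : ∀ w → u ≡ add v (scale n w) → u ≈ v

    Φ Φ⁻¹ : 𝒪 → 𝒪
    Φ = ψ x z
    Φ⁻¹ = ψ⁻¹ x z

    scale-κ : ∀ w → scale (κ x z) w ≡ scale n (scale c w)
    scale-κ w = trans (cong (λ t → scale t w) κ≡) (sym (scale-scale w n c))

    ≡⇒≈ : ∀ {u v} w → u ≡ add v (scale (κ x z) w) → u ≈ v
    ≡⇒≈ {v = v} w eq = approx (scale c w) (trans eq (cong (add v) (scale-κ w)))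

    ≈-reflexive : ∀ {u v} → u ≡ v → u ≈ v
    ≈-reflexive {u} refl = approx (scalar 0R) (add-0 u)
      where
      e : ∀ a n → a ≡ a + n * 0R
      e = solve-∀ RR
      add-0 : ∀ u → u ≡ add u (scale n (scalar 0R))
      add-0 ⟪ a , b , c , d ⟫ = Quat-ext (e a n) (e b n) (e c n) (e d n)

    ≈-sym : ∀ {u v} → u ≈ v → v ≈ u
    ≈-sym {v = v} (approx w refl) = approx (opp w) (add-scale-cancel v w n)

    ≈-trans : ∀ {u v w} → u ≈ v → v ≈ w → u ≈ w
    ≈-trans {w = w} (approx a refl) (approx b refl) = approx (add b a) (trans (add-assoc w (scale n b) (scale n a)) (cong (add w) (sym (scale-add b a n))))

    mmul-≈ : ∀ {u u' v v'} → u ≈ u' → v ≈ v' → mmul u v ≈ mmul u' v'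
    mmul-≈ {u' = u'} {v' = v'} (approx a refl) (approx b refl) =
      approx (add (add (mmul u' b) (mmul a v')) (scale n (mmul a b))) (mmul-approx u' a v' b n)

    Φ⁻¹-≈ : ∀ {u v} → u ≈ v → Φ⁻¹ u ≈ Φ⁻¹ v
    Φ⁻¹-≈ {v = v} (approx w refl) = approx (Φ⁻¹ w) (trans (ψ⁻¹-add v (scale n w) x z) (cong (add (Φ⁻¹ v)) (ψ⁻¹-scale w n x z)))

    Φ-mul : ∀ q w → Φ (mul q w) ≈ mmul (Φ q) (Φ w)
    Φ-mul q w = ≡⇒≈ (mul-cofactor q w) (ψ-mul q w x z)

    ΦΦ⁻¹ : ∀ v → Φ (Φ⁻¹ v) ≈ v
    ΦΦ⁻¹ v = ≡⇒≈ (ψψ⁻¹-cofactor v) (ψψ⁻¹ v x z)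

    Φ⁻¹Φ : ∀ q → Φ⁻¹ (Φ q) ≈ q
    Φ⁻¹Φ q = ≡⇒≈ (ψ⁻¹ψ-cofactor q) (ψ⁻¹ψ q x z)

    det-Φ : ∀ q → det (Φ q) ≡ norm q + n * (c * det-cofactor q)
    det-Φ q = trans (det-ψ q x z) (cong (norm q +_) (trans (cong (_* det-cofactor q) κ≡) (R.*-assoc n c (det-cofactor q))))

    hermite : (γ t δ : ℤ[√2]) → Quat ℤ[√2]
    hermite γ t δ = ⟪ γ , t , 0R , δ ⟫

    -- the left ideal of the q such that both rows of Φ q lie in the lattice spanned by (γ , t) and (0 , δ)
    data InIdeal (γ t δ : ℤ[√2]) (q : 𝒪) : Set where
      combination : ∀ V → Φ q ≡ mmul V (hermite γ t δ) → InIdeal γ t δ q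

    det-hermite : ∀ γ t δ → det (hermite γ t δ) ≡ γ * δ
    det-hermite = e
      where e : ∀ γ t δ → γ * δ - t * 0R ≡ γ * δ
            e = solve-∀ RR

    module _ {γ t δ : ℤ[√2]} (γδ≡α : γ * δ ≡ α) where
      private
        h = hermite γ t δ
        det-h : det h ≡ α
        det-h = trans (det-hermite γ t δ) γδ≡α

      scale-α-in : ∀ W → scale α W ≡ mmul (mmul W (adj h)) h
      scale-α-in W = trans (cong (λ s → scale s W) (sym det-h)) (sym (mmul-adj W h))

      scale-n-in : ∀ W → scale n W ≡ mmul (mmul (scale (α * ν) W) (adj h)) h
      scale-n-in W = trans (cong (λ s → scale s W) n≡) (trans (sym (scale-scale W α (α * ν))) (scale-α-in (scale (α * ν) W)))

      -- n is a multiple of α, and α W = (W adj h) h, so multiples of n already lie in the row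
      -- lattice and membership depends on `Φ q` modulo n only.
      ≈-in : ∀ {q V} → Φ q ≈ mmul V h → InIdeal γ t δ q
      ≈-in {q} {V} (approx W eq) = combination (add V U) (trans eq (trans (cong (add (mmul V h)) (scale-n-in W)) (sym (mmul-addˡ V U h))))
        where U = mmul (scale (α * ν) W) (adj h)

      in-add : ∀ {q w} → InIdeal γ t δ q → InIdeal γ t δ w → InIdeal γ t δ (add q w)
      in-add {q} {w} (combination V eq) (combination W eq') = combination (add V W) (trans (ψ-add q w x z) (trans (cong₂ add eq eq') (sym (mmul-addˡ V W h))))

      in-mul : ∀ y {q} → InIdeal γ t δ q → InIdeal γ t δ (mul y q)
      in-mul y {q} (combination V eq) = ≈-in {mul y q} {mmul (Φ y) V}
        (≈-trans (Φ-mul y q) (≈-reflexive (trans (cong (mmul (Φ y)) eq) (sym (mmul-assoc (Φ y) V h)))))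

      in-α : ∀ y → InIdeal γ t δ (mul y (scalar α))
      in-α y = combination (mmul (Φ y) (adj h)) (trans (cong Φ (mul-scalar y α)) (trans (ψ-scale y α x z) (scale-α-in (Φ y))))

      det-in : ∀ q V → Φ q ≡ mmul V h → det (Φ q) ≡ α * det V
      det-in q V eq = trans (cong det eq) (trans (det-mmul V h) (trans (R.*-comm (det V) (det h)) (cong (_* det V) det-h)))

      -- det (Φ q) = α det V, and it differs from norm q by a multiple of n.
      α∣norm : ∀ {q} → InIdeal γ t δ q → α ∣ᴿ norm q
      α∣norm {q} (combination V eq) = det V - α * ν * (c * det-cofactor q) ,
        trans (e (norm q) (n * (c * det-cofactor q))) (trans (cong₂ (λ a b → a - b * (c * det-cofactor q)) (trans (sym (det-Φ q)) (det-in q V eq)) n≡) (e' α (det V) ν (c * det-cofactor q)))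
        where
        e : ∀ a b → a ≡ (a + b) - b
        e = solve-∀ RR
        e' : ∀ α d ν k → α * d - α * (α * ν) * k ≡ α * (d - α * ν * k)
        e' = solve-∀ RR

      -- A lift x₀ of h generates the ideal up to multiples of n, hence up to multiples of α, and α
      -- itself lies in the ideal. The left gcd b₀ of α and x₀ is therefore a generator.
      private module _ (x₀ : 𝒪) (Φx₀≈h : Φ x₀ ≈ h) where
        norm-x₀ : ∃ λ k → norm x₀ ≡ α * (1R + α * k)
        norm-x₀ = go Φx₀≈h
          where
          F = c * det-cofactor x₀
          e : ∀ a b → a ≡ (a + b) - b
          e = solve-∀ RR
          e₁ : ∀ α n d k → (α + n * d) - n * k ≡ α + n * (d - k)
          e₁ = solve-∀ RR
          e₂ : ∀ α ν k → α + α * (α * ν) * k ≡ α * (1R + α * (ν * k))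
          e₂ = solve-∀ RR
          go : Φ x₀ ≈ h → ∃ λ k → norm x₀ ≡ α * (1R + α * k)
          go (approx W eq) = ν * (E - F) ,
            trans (e (norm x₀) (n * F)) (trans (cong (λ y → y - n * F) (trans (sym (det-Φ x₀)) (trans (cong det eq) (trans (det-add h W n) (cong (λ y → y + n * E) det-h)))))
              (trans (e₁ α n E F) (trans (cong (λ m → α + m * (E - F)) n≡) (e₂ α ν (E - F)))))
            where
            E = det-expand n h W

        x₀-in : InIdeal γ t δ x₀
        x₀-in = ≈-in {x₀} {unit-matrix} (≈-trans Φx₀≈h (≈-reflexive one-mmul))
          where
          unit-matrix = ⟪ 1R , 0R , 0R , 1R ⟫
          e : ∀ a b → a ≡ 1R * a + 0R * b
          e = solve-∀ RR
          e' : ∀ a b → a ≡ 0R * b + 1R * a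
          e' = solve-∀ RR
          one-mmul : h ≡ mmul unit-matrix h
          one-mmul = Quat-ext (e γ 0R) (e t δ) (e' 0R γ) (e' δ t)

        open Bezoutᴼ.LeftGcd (gcdᴼ (scalar α) x₀) renaming (d to b₀)

        b₀-in : InIdeal γ t δ b₀
        b₀-in = subst (InIdeal γ t δ) (sym bezout) (in-add (in-α u) (in-mul v x₀-in))

        -- If Φ q = V h, then q is congruent to Φ⁻¹ V · x₀ modulo n, and both x₀ and n are left
        -- multiples of b₀.
        in-multiple : ∀ q → InIdeal γ t δ q → ∃ λ y → q ≡ mul y b₀
        in-multiple q (combination V eq) = go
          (≈-trans (≈-sym (Φ⁻¹Φ q)) (≈-trans (Φ⁻¹-≈ (≈-trans (≈-reflexive eq) (≈-sym (≈-trans (Φ-mul (Φ⁻¹ V) x₀) (mmul-≈ (ΦΦ⁻¹ V) Φx₀≈h))))) (Φ⁻¹Φ (mul (Φ⁻¹ V) x₀))))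
          where
          e₁ : mul (Φ⁻¹ V) x₀ ≡ mul (mul (Φ⁻¹ V) b') b₀
          e₁ = trans (cong (mul (Φ⁻¹ V)) b≈) (sym (mul-assoc (Φ⁻¹ V) b' b₀))
          e₂ : ∀ w → scale n w ≡ mul (mul (scale (α * ν) w) a') b₀
          e₂ w = trans (cong (λ s → scale s w) n≡) (trans (sym (scale-scale w α (α * ν))) (trans (sym (mul-scalar (scale (α * ν) w) α))
            (trans (cong (mul (scale (α * ν) w)) a≈) (sym (mul-assoc (scale (α * ν) w) a' b₀)))))
          go : q ≈ mul (Φ⁻¹ V) x₀ → ∃ λ y → q ≡ mul y b₀
          go (approx w q≡) = add (mul (Φ⁻¹ V) b') (mul (scale (α * ν) w) a') , trans q≡ (trans (cong₂ add e₁ (e₂ w)) (sym (mul-distribʳ b₀ (mul (Φ⁻¹ V) b') (mul (scale (α * ν) w) a'))))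

        -- b₀ is a right divisor of x₀ and of α. Taking norms and cancelling α, β divides 1 + α k,
        -- where norm x₀ = α (1 + α k), and it divides α; so it divides 1.
        norm-b₀ : ∃ λ β → norm b₀ ≡ α * β × β ∣ᴿ 1R
        norm-b₀ with α∣norm b₀-in
        ... | β , norm≡ = β , norm≡ , norm b' - norm a' * k ,
          trans (e (α * k)) (trans (cong₂ _-_ 1+αk (cong (_* k) α≡)) (e' β (norm b') (norm a') k))
          where
          k = proj₁ norm-x₀
          e : ∀ y → 1R ≡ (1R + y) - y
          e = solve-∀ RR
          e' : ∀ β p q k → p * β - q * β * k ≡ β * (p - q * k)
          e' = solve-∀ RR
          e₁ : ∀ α β m → m * (α * β) ≡ α * (m * β)
          e₁ = solve-∀ RR
          1+αk : 1R + α * k ≡ norm b' * β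
          1+αk = *-cancelˡ α≢0 (trans (sym (proj₂ norm-x₀)) (trans (cong norm b≈) (trans (norm-mul b' b₀) (trans (cong (norm b' *_) norm≡) (e₁ α β (norm b'))))))
          α≡ : α ≡ norm a' * β
          α≡ = *-cancelˡ α≢0 (trans (sym (norm-scalar α)) (trans (cong norm a≈) (trans (norm-mul a' b₀) (trans (cong (norm a' *_) norm≡) (e₁ α β (norm a'))))))

        generator′ : Positive α → ∃ λ b → norm b ≡ α × InIdeal γ t δ b × (∀ q → InIdeal γ t δ q → ∃ λ y → q ≡ mul y b)
        generator′ pos = go (proj₁ (proj₂ nb)) (proj₂ (proj₂ nb))
          where
          nb = norm-b₀
          go : norm b₀ ≡ α * proj₁ nb → proj₁ nb ∣ᴿ 1R → ∃ λ b → norm b ≡ α × InIdeal γ t δ b × (∀ q → InIdeal γ t δ q → ∃ λ y → q ≡ mul y b)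
          go norm≡ unit = go′ (normalise-norm b₀ pos unit norm≡)
            where
            go′ : (∃₂ λ η η' → η * η' ≡ 1R × norm (scale η' b₀) ≡ α) → ∃ λ b → norm b ≡ α × InIdeal γ t δ b × (∀ q → InIdeal γ t δ q → ∃ λ y → q ≡ mul y b)
            go′ (η , η' , ηη'≡1 , norm-b) = scale η' b₀ , norm-b , subst (InIdeal γ t δ) (scalar-mul b₀ η') (in-mul (scalar η') b₀-in) ,
                λ q q-in → multiple (in-multiple q q-in)
              where
              b₀≡ : b₀ ≡ mul (scalar η) (scale η' b₀)
              b₀≡ = sym (trans (scalar-mul (scale η' b₀) η) (trans (scale-scale b₀ η η') (trans (cong (λ s → scale s b₀) ηη'≡1) (scale-one b₀))))
              multiple : ∀ {q} → (∃ λ y → q ≡ mul y b₀) → ∃ λ y → q ≡ mul y (scale η' b₀)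
              multiple (y , q≡) = mul y (scalar η) , trans q≡ (trans (cong (mul y) b₀≡) (sym (mul-assoc y (scalar η) (scale η' b₀))))

      generator : Positive α → ∃ λ b → norm b ≡ α × InIdeal γ t δ b × (∀ q → InIdeal γ t δ q → ∃ λ y → q ≡ mul y b)
      generator = generator′ (Φ⁻¹ h) (ΦΦ⁻¹ h)

      -- Changing t modulo δ adds a multiple of the row (0 , δ) to the row (γ , t), which leaves the
      -- lattice unchanged.
      in-shift : ∀ {t' q} → δ ∣ᴿ t - t' → InIdeal γ t δ q → InIdeal γ t' δ q
      in-shift {t'} {q} (k , t-t'≡δk) (combination ⟪ m , v , m' , v' ⟫ eq) = combination ⟪ m , v + m * k , m' , v' + m' * k ⟫ (trans eq
        (Quat-ext (e₀ m v γ k) (e₁ m v) (e₀ m' v' γ k) (e₁ m' v')))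
        where
        e₀ : ∀ m v γ k → m * γ + v * 0R ≡ m * γ + (v + m * k) * 0R
        e₀ = solve-∀ RR
        s₁ : ∀ m v t t' δ → m * t + v * δ ≡ m * t' + v * δ + m * (t - t')
        s₁ = solve-∀ RR
        s₂ : ∀ m v t' δ k → m * t' + v * δ + m * (δ * k) ≡ m * t' + (v + m * k) * δ
        s₂ = solve-∀ RR
        e₁ : ∀ m v → m * t + v * δ ≡ m * t' + (v + m * k) * δ
        e₁ m v = trans (s₁ m v t t' δ) (trans (cong (λ s → m * t' + v * δ + m * s) t-t'≡δk) (s₂ m v t' δ k))

    -- Comparing the two Hermite forms h, h' of Φ q = V h = V' h': (det V) h is a multiple of h',
    -- and det V ≡ 1 modulo α.
    module _ {γ t δ γ' t' δ' : ℤ[√2]} (γδ≡α : γ * δ ≡ α) (γ'δ'≡α : γ' * δ' ≡ α) {q : 𝒪} (norm-q : norm q ≡ α) where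
      private
        h = hermite γ t δ
        h' = hermite γ' t' δ'
        factor≢0 : ∀ {a b} → a * b ≡ α → a ≢ 0R
        factor≢0 {b = b} eq refl = α≢0 (trans (sym eq) (R.zeroˡ b))

        compare : InIdeal γ t δ q → InIdeal γ' t' δ' q → ∃₂ λ k U → scale (1R + α * k) h ≡ mmul U h'
        compare (combination V eq) (combination V' eq') = ν * (c * det-cofactor q) , mmul (adj V) V' ,
          trans (cong (λ s → scale s h) (sym det-V)) (trans (sym (adj-mmul V h)) (trans (cong (mmul (adj V)) (trans (sym eq) eq')) (sym (mmul-assoc (adj V) V' h'))))
          where
          e : ∀ α ν k → α + α * (α * ν) * k ≡ α * (1R + α * (ν * k))
          e = solve-∀ RR
          det-V : det V ≡ 1R + α * (ν * (c * det-cofactor q))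
          det-V = *-cancelˡ α≢0 (trans (sym (det-in γδ≡α q V eq)) (trans (det-Φ q) (trans (cong₂ (λ a m → a + m * (c * det-cofactor q)) norm-q n≡) (e α ν (c * det-cofactor q)))))

      -- U has lower left entry 0, so (1 + α k) δ is a multiple of δ'. So is α k δ, because γ' δ' =
      -- α.
      δ'∣δ : InIdeal γ t δ q → InIdeal γ' t' δ' q → δ' ∣ᴿ δ
      δ'∣δ i i' with compare i i'
      ... | k , ⟪ p , r , s , u ⟫ , eq = u - γ' * (k * δ) , trans (e₁ α k δ) (trans (cong₂ (λ a b → a - b * (k * δ)) (trans (cong co₃ eq) (trans (cong (λ s → s * t' + u * δ') s≡0) (e₂ t' u δ'))) (sym γ'δ'≡α)) (e₃ u γ' δ' (k * δ)))
        where
        e₀ : ∀ s u γ' → γ' * s ≡ s * γ' + u * 0R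
        e₀ = solve-∀ RR
        s≡0 : s ≡ 0R
        s≡0 = x*y≡0⇒y≡0 (factor≢0 γ'δ'≡α) (trans (e₀ s u γ') (trans (sym (cong co₂ eq)) (R.zeroʳ (1R + α * k))))
        e₁ : ∀ α k δ → δ ≡ (1R + α * k) * δ - α * (k * δ)
        e₁ = solve-∀ RR
        e₂ : ∀ t' u δ' → 0R * t' + u * δ' ≡ u * δ'
        e₂ = solve-∀ RR
        e₃ : ∀ u γ' δ' k → u * δ' - γ' * δ' * k ≡ δ' * (u - γ' * k)
        e₃ = solve-∀ RR

    -- V and V' have the same first column (p , s), since γ is not 0. Comparing second columns, δ
    -- divides p (t - t') and s (t - t'), hence det V · (t - t'). Here det V is 1 modulo α, and δ
    -- divides α.
    same-shift : ∀ {γ t t' δ q} → γ * δ ≡ α → norm q ≡ α → InIdeal γ t δ q → InIdeal γ t' δ q → δ ∣ᴿ t - t'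
    same-shift {γ} {t} {t'} {δ} {q} γδ≡α norm-q (combination V eq) (combination V' eq') = shift V V' (trans (sym eq) eq') (det-V V eq)
      where
      γ≢0 : γ ≢ 0R
      γ≢0 refl = α≢0 (trans (sym γδ≡α) (R.zeroˡ δ))
      det-V : ∀ V → Φ q ≡ mmul V (hermite γ t δ) → ∃ λ k → det V ≡ 1R + α * k
      det-V V eq = ν * (c * det-cofactor q) , *-cancelˡ α≢0 (trans (sym (det-in γδ≡α q V eq)) (trans (det-Φ q) (trans (cong₂ (λ a m → a + m * (c * det-cofactor q)) norm-q n≡) (e α ν (c * det-cofactor q)))))
        where
        e : ∀ α ν k → α + α * (α * ν) * k ≡ α * (1R + α * (ν * k))
        e = solve-∀ RR
      shift : ∀ V V' → mmul V (hermite γ t δ) ≡ mmul V' (hermite γ t' δ) → (∃ λ k → det V ≡ 1R + α * k) → δ ∣ᴿ t - t'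
      shift ⟪ p , r , s , u ⟫ ⟪ p' , r' , s' , u' ⟫ rows (k , D≡) =
        u * (r' - r) - r * (u' - u) - γ * (k * (t - t')) , trans (e₁ α k (t - t')) (trans (cong₂ (λ a b → a * (t - t') - b * (k * (t - t'))) (sym D≡) (sym γδ≡α))
          (trans (cong (_- γ * δ * (k * (t - t'))) (trans (e₂ p r s u t t') (cong₂ (λ a b → u * a - r * b) (row p r p' r' p≡p' (cong co₁ rows)) (row s u s' u' s≡s' (cong co₃ rows))))) (e₃ u r (r' - r) (u' - u) γ δ (k * (t - t')))))
        where
        e₀ : ∀ a b γ → γ * a ≡ a * γ + b * 0R
        e₀ = solve-∀ RR
        p≡p' : p ≡ p'
        p≡p' = *-cancelˡ γ≢0 (trans (e₀ p r γ) (trans (cong co₀ rows) (sym (e₀ p' r' γ))))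
        s≡s' : s ≡ s'
        s≡s' = *-cancelˡ γ≢0 (trans (e₀ s u γ) (trans (cong co₂ rows) (sym (e₀ s' u' γ))))
        row : ∀ p r p' r' → p ≡ p' → p * t + r * δ ≡ p' * t' + r' * δ → p * (t - t') ≡ δ * (r' - r)
        row p r .p r' refl eq = trans (f₁ p r t t' δ) (trans (cong (_- (p * t' + r * δ)) eq) (f₂ p r r' t' δ))
          where
          f₁ : ∀ p r t t' δ → p * (t - t') ≡ (p * t + r * δ) - (p * t' + r * δ)
          f₁ = solve-∀ RR
          f₂ : ∀ p r r' t' δ → (p * t' + r' * δ) - (p * t' + r * δ) ≡ δ * (r' - r)
          f₂ = solve-∀ RR
        e₁ : ∀ α k y → y ≡ (1R + α * k) * y - α * (k * y)
        e₁ = solve-∀ RR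
        e₂ : ∀ p r s u t t' → (p * u - r * s) * (t - t') ≡ u * (p * (t - t')) - r * (s * (t - t'))
        e₂ = solve-∀ RR
        e₃ : ∀ u r a b γ δ k → u * (δ * a) - r * (δ * b) - γ * δ * k ≡ δ * (u * a - r * b - γ * k)
        e₃ = solve-∀ RR

    -- The combination of the first column of `Φ q` that gives γ is applied to the second column,
    -- which yields t = A r + B u. From det (Φ q) = α D it then follows that the rows of `Φ q`
    -- differ from multiples of (γ , t) by multiples of (0 , δ).
    hermite-form : ∀ {γ δ A B Y p' s'} q → γ * δ ≡ α → norm q ≡ α →
      co₀ (Φ q) ≡ γ * p' → co₂ (Φ q) ≡ γ * s' → γ ≡ co₀ (Φ q) * A + co₂ (Φ q) * B + α * Y →
      ∃ λ t → InIdeal γ t δ q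
    hermite-form {γ} {δ} {A} {B} {Y} {p'} {s'} q γδ≡α norm-q p≡ s≡ γ≡ =
      let (t , V , eq) = go (Φ q) (det-Φ q) p≡ s≡ γ≡ in t , combination V eq
      where
      γ≢0 : γ ≢ 0R
      γ≢0 refl = α≢0 (trans (sym γδ≡α) (R.zeroˡ δ))
      D = 1R + α * (ν * (c * det-cofactor q))
      go : ∀ M → det M ≡ norm q + n * (c * det-cofactor q) → co₀ M ≡ γ * p' → co₂ M ≡ γ * s' → γ ≡ co₀ M * A + co₂ M * B + α * Y →
        ∃ λ t → ∃ λ V → M ≡ mmul V (hermite γ t δ)
      go ⟪ p , r , s , u ⟫ det-M p≡ s≡ γ≡ = A * r + B * u , ⟪ p' , Y * r - B * D , s' , A * D + Y * u ⟫ ,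
        Quat-ext (trans p≡ (f₀ γ p' (Y * r - B * D))) row₁ (trans s≡ (f₀ γ s' (A * D + Y * u))) row₂
        where
        f₀ : ∀ γ p v → γ * p ≡ p * γ + v * 0R
        f₀ = solve-∀ RR
        e : ∀ α ν k → α + α * (α * ν) * k ≡ α * (1R + α * (ν * k))
        e = solve-∀ RR
        αD≡ : p * u - r * s ≡ α * D
        αD≡ = trans det-M (trans (cong₂ (λ a m → a + m * (c * det-cofactor q)) norm-q n≡) (e α ν (c * det-cofactor q)))
        g₁ : ∀ p r s u A B αY → (p * A + s * B + αY) * r ≡ p * (A * r + B * u) + (αY * r - B * (p * u - r * s))
        g₁ = solve-∀ RR
        g₂ : ∀ p r s u A B αY → (p * A + s * B + αY) * u ≡ s * (A * r + B * u) + (A * (p * u - r * s) + αY * u)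
        g₂ = solve-∀ RR
        h₁ : ∀ γ δ p' t Y r B D → γ * p' * t + (γ * δ * Y * r - B * (γ * δ * D)) ≡ γ * (p' * t + (Y * r - B * D) * δ)
        h₁ = solve-∀ RR
        h₂ : ∀ γ δ s' t Y u A D → γ * s' * t + (A * (γ * δ * D) + γ * δ * Y * u) ≡ γ * (s' * t + (A * D + Y * u) * δ)
        h₂ = solve-∀ RR
        row₁ : r ≡ p' * (A * r + B * u) + (Y * r - B * D) * δ
        row₁ = *-cancelˡ γ≢0 (trans (cong (_* r) γ≡) (trans (g₁ p r s u A B (α * Y)) (trans (cong₂ (λ a b → a * (A * r + B * u) + (α * Y * r - B * b)) p≡ αD≡)
          (trans (cong (λ a → γ * p' * (A * r + B * u) + (a * Y * r - B * (a * D))) (sym γδ≡α)) (h₁ γ δ p' (A * r + B * u) Y r B D)))))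
        row₂ : u ≡ s' * (A * r + B * u) + (A * D + Y * u) * δ
        row₂ = *-cancelˡ γ≢0 (trans (cong (_* u) γ≡) (trans (g₂ p r s u A B (α * Y)) (trans (cong₂ (λ a b → a * (A * r + B * u) + (A * b + α * Y * u)) s≡ αD≡)
          (trans (cong (λ a → γ * s' * (A * r + B * u) + (A * (a * D) + a * Y * u)) (sym γδ≡α)) (h₂ γ δ s' (A * r + B * u) Y u A D)))))

    -- gcd of α and the first column, adjusted by a unit so that the codivisor is the prescribed δ
    has-hermite-form : ∀ q → norm q ≡ α → ∃₂ λ γ₀ δ₀ → γ₀ * δ₀ ≡ α ×
      (∀ {δ η η'} → δ ≡ δ₀ * η → δ₀ ≡ δ * η' → γ₀ * η' * δ ≡ α × ∃ λ t → InIdeal (γ₀ * η') t δ q)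
    has-hermite-form q norm-q = go (gcd₃ (co₀ (Φ q)) (co₂ (Φ q)) α)
      where
      go : Gcd₃ (co₀ (Φ q)) (co₂ (Φ q)) α → ∃₂ λ γ₀ δ₀ → γ₀ * δ₀ ≡ α ×
        (∀ {δ η η'} → δ ≡ δ₀ * η → δ₀ ≡ δ * η' → γ₀ * η' * δ ≡ α × ∃ λ t → InIdeal (γ₀ * η') t δ q)
      go (mkGcd₃ g p' s' δ₀ A B Y p≡ s≡ α≡ g≡) = g , δ₀ , sym α≡ , adjust
        where
        e₀ : ∀ g η' δ → g * η' * δ ≡ g * (δ * η')
        e₀ = solve-∀ RR
        e₁ : ∀ δ₀ η η' → δ₀ * (η * η') ≡ δ₀ * η * η'
        e₁ = solve-∀ RR
        e₂ : ∀ p s α A B Y η' → (p * A + s * B + α * Y) * η' ≡ p * (A * η') + s * (B * η') + α * (Y * η')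
        e₂ = solve-∀ RR
        e₃ : ∀ g η η' y → g * y * (η * η') ≡ g * η' * (y * η)
        e₃ = solve-∀ RR
        δ₀≢0 : δ₀ ≢ 0R
        δ₀≢0 δ₀≡0 = α≢0 (trans α≡ (trans (cong (g *_) δ₀≡0) (R.zeroʳ g)))
        adjust : ∀ {δ η η'} → δ ≡ δ₀ * η → δ₀ ≡ δ * η' → g * η' * δ ≡ α × ∃ λ t → InIdeal (g * η') t δ q
        adjust {δ} {η} {η'} δ≡ δ₀≡ = γδ≡α , hermite-form {g * η'} {δ} {A * η'} {B * η'} {Y * η'} {p' * η} {s' * η} q γδ≡α norm-q
            (multiple p≡) (multiple s≡) (trans (cong (_* η') g≡) (e₂ (co₀ (Φ q)) (co₂ (Φ q)) α A B Y η'))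
          where
          γδ≡α : g * η' * δ ≡ α
          γδ≡α = trans (e₀ g η' δ) (trans (cong (g *_) (sym δ₀≡)) (sym α≡))
          ηη'≡1 : η * η' ≡ 1R
          ηη'≡1 = *-cancelˡ δ₀≢0 (trans (e₁ δ₀ η η') (trans (cong (_* η') (sym δ≡)) (trans (sym δ₀≡) (sym (R.*-identityʳ δ₀)))))
          multiple : ∀ {m y} → m ≡ g * y → m ≡ g * η' * (y * η)
          multiple {m} {y} m≡ = trans m≡ (trans (sym (R.*-identityʳ (g * y))) (trans (cong (g * y *_) (sym ηη'≡1)) (e₃ g η η' y)))

-- Finite cardinalities of predicates.

module Counting where
  open import Data.Nat.ListAction using (sum)
  open import Data.Sum using () renaming ([_,_] to either)
  open import Data.List using (List; []; _∷_; _++_; length; map; filter)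
  import Data.List.Properties as Listₚ
  open import Data.List.Membership.Propositional using (_∈_)
  open import Data.List.Membership.Propositional.Properties using (∈-map⁺; ∈-map⁻; ∈-++⁺ˡ; ∈-++⁺ʳ; ∈-++⁻; ∈-filter⁺; ∈-filter⁻)
  open import Data.List.Membership.Propositional.Properties.WithK using (unique∧set⇒bag)
  open import Data.List.Relation.Binary.BagAndSetEquality using (∼bag⇒↭)
  open import Data.List.Relation.Binary.Permutation.Propositional.Properties using (↭-length)
  open import Data.List.Relation.Unary.Any using (here; there)
  open import Data.List.Relation.Unary.All as All using (All; []; _∷_)
  open import Data.List.Relation.Unary.AllPairs using ([]; _∷_)
  open import Data.List.Relation.Unary.Unique.Propositional using (Unique)
  import Data.List.Relation.Unary.Unique.Propositional.Properties as Uniqueₚ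
  open import Function.Bundles using (mk⇔)
  open import Relation.Nullary using (¬?)

  record Card {A : Set} (P : A → Set) (n : ℕ) : Set where
    constructor card
    field
      elements : List A
      unique : Unique elements
      sound : ∀ x → x ∈ elements → P x
      complete : ∀ x → P x → x ∈ elements
      length≡ : length elements ≡ n
  open Card

  card-cong : ∀ {A : Set} {P Q : A → Set} {n} → (∀ x → P x → Q x) → (∀ x → Q x → P x) → Card P n → Card Q n
  card-cong f g (card xs u s c l) = card xs u (λ x x∈ → f x (s x x∈)) (λ x q → c x (g x q)) l

  card-≡ : ∀ {A : Set} {P : A → Set} {m n} → m ≡ n → Card P m → Card P n
  card-≡ refl c = c

  -- Duplicate-free lists with the same members are permutations of each other. This makes the count
  -- independent of the enumeration.
  card-unique : ∀ {A : Set} {P : A → Set} {m n} → Card P m → Card P n → m ≡ n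
  card-unique (card xs u s c l) (card ys v s' c' l') = trans (sym l) (trans
    (↭-length (∼bag⇒↭ (unique∧set⇒bag u v λ {x} → mk⇔ (λ x∈ → c' x (s x x∈)) (λ x∈ → c x (s' x x∈))))) l')

  card-map : ∀ {A B : Set} {P : A → Set} {Q : B → Set} {n} (f : A → B) → (∀ {x y} → f x ≡ f y → x ≡ y) →
    (∀ x → P x → Q (f x)) → (∀ y → Q y → ∃ λ x → P x × y ≡ f x) → Card P n → Card Q n
  card-map {Q = Q} f inj to from (card xs u s c l) = card (map f xs) (Uniqueₚ.map⁺ inj u)
    (λ y y∈ → let (x , x∈ , y≡) = ∈-map⁻ f y∈ in subst Q (sym y≡) (to x (s x x∈)))
    (λ y q → let (x , p , y≡) = from y q in subst (_∈ map f xs) (sym y≡) (∈-map⁺ f (c x p)))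
    (trans (Listₚ.length-map f xs) l)

  card-empty : ∀ {A : Set} {P : A → Set} → (∀ x → ¬ P x) → Card P 0
  card-empty none = card [] [] (λ _ ()) (λ x p → contradiction p (none x)) refl

  card-⊎ : ∀ {A : Set} {P Q : A → Set} {m n} → (∀ x → P x → ¬ Q x) → Card P m → Card Q n → Card (λ x → P x ⊎ Q x) (m ℕ.+ n)
  card-⊎ disjoint (card xs u s c l) (card ys v s' c' l') = card (xs ++ ys)
    (Uniqueₚ.++⁺ u v λ { {x} (x∈ , y∈) → disjoint x (s x x∈) (s' x y∈) })
    (λ x x∈ → either (λ p → inj₁ (s x p)) (λ p → inj₂ (s' x p)) (∈-++⁻ xs x∈))
    (λ x → either (λ p → ∈-++⁺ˡ (c x p)) (λ q → ∈-++⁺ʳ xs (c' x q)))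
    (trans (Listₚ.length-++ xs) (cong₂ ℕ._+_ l l'))

  private
    length-filter-¬ : ∀ {A : Set} {P : A → Set} (P? : ∀ x → Dec (P x)) xs →
      length (filter P? xs) ℕ.+ length (filter (λ x → ¬? (P? x)) xs) ≡ length xs
    length-filter-¬ P? [] = refl
    length-filter-¬ P? (x ∷ xs) with P? x
    ... | yes _ = cong suc (length-filter-¬ P? xs)
    ... | no _ = trans (ℕₚ.+-suc _ _) (cong suc (length-filter-¬ P? xs))

  card-filter : ∀ {A : Set} {P R : A → Set} {n} (R? : ∀ x → Dec (R x)) (c : Card P n) → Card (λ x → P x × R x) (length (filter R? (elements c)))
  card-filter R? (card xs u s c l) = card (filter R? xs) (Uniqueₚ.filter⁺ R? u)
    (λ x x∈ → let (x∈xs , r) = ∈-filter⁻ R? {xs = xs} x∈ in s x x∈xs , r) (λ x (p , r) → ∈-filter⁺ R? (c x p) r) refl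

  card-split : ∀ {A : Set} {P R : A → Set} {n} → (∀ x → Dec (R x)) → Card P n →
    ∃₂ λ k l → Card (λ x → P x × R x) k × Card (λ x → P x × ¬ R x) l × k ℕ.+ l ≡ n
  card-split R? c = _ , _ , card-filter R? c , card-filter (λ x → ¬? (R? x)) c , trans (length-filter-¬ R? (elements c)) (length≡ c)

  -- Inclusion-exclusion, with the intersection on the side of the union so that no subtraction of
  -- naturals occurs.
  card-∪ : ∀ {A : Set} {P Q : A → Set} {m n k} → (∀ x → Dec (P x)) → Card P m → Card Q n → Card (λ x → P x × Q x) k →
    ∃ λ l → Card (λ x → P x ⊎ Q x) l × l ℕ.+ k ≡ m ℕ.+ n
  card-∪ {P = P} {Q} {m} {n} {k} P? cp cq cpq with card-split P? cq
  ... | k' , l' , cqp , cq¬p , k'+l'≡n = m ℕ.+ l' ,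
    card-cong (λ x → either inj₁ (λ (q , _) → inj₂ q)) back (card-⊎ (λ x p (q , ¬p) → ¬p p) cp cq¬p) ,
    trans (ℕₚ.+-assoc m l' k) (cong (m ℕ.+_) (trans (ℕₚ.+-comm l' k) (trans (cong (ℕ._+ l') k≡k') k'+l'≡n)))
    where
    k≡k' : k ≡ k'
    k≡k' = card-unique cpq (card-cong (λ x (q , p) → p , q) (λ x (p , q) → q , p) cqp)
    back : ∀ x → P x ⊎ Q x → P x ⊎ Q x × ¬ P x
    back x (inj₁ p) = inj₁ p
    back x (inj₂ q) with P? x
    ... | yes p = inj₁ p
    ... | no ¬p = inj₂ (q , ¬p)

  private
    card-fibres′ : ∀ {A K : Set} {P : A → Set} {_~_ : A → K → Set} (size : K → ℕ) (ks : List K) → Unique ks →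
      (∀ {k k'} x → k ∈ ks → k' ∈ ks → P x → x ~ k → x ~ k' → k ≡ k') →
      (∀ {k} → k ∈ ks → Card (λ x → P x × x ~ k) (size k)) →
      Card (λ x → P x × ∃ λ k → k ∈ ks × x ~ k) (sum (map size ks))
    card-fibres′ size [] _ _ _ = card-empty λ { x (_ , _ , () , _) }
    card-fibres′ {P = P} {_~_} size (k ∷ ks) (k∉ ∷ u) disjoint fibre = card-cong to from
      (card-⊎ (λ x (p , x~k) (_ , k' , k'∈ , x~k') → All.lookup k∉ k'∈ (disjoint x (here refl) (there k'∈) p x~k x~k'))
        (fibre (here refl)) (card-fibres′ size ks u (λ x k∈ k'∈ → disjoint x (there k∈) (there k'∈)) (λ k∈ → fibre (there k∈))))
      where
      to : ∀ x → (P x × x ~ k) ⊎ (P x × ∃ λ k' → k' ∈ ks × x ~ k') → P x × ∃ λ k' → k' ∈ k ∷ ks × x ~ k'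
      to x (inj₁ (p , x~k)) = p , k , here refl , x~k
      to x (inj₂ (p , k' , k'∈ , x~k')) = p , k' , there k'∈ , x~k'
      from : ∀ x → (P x × ∃ λ k' → k' ∈ k ∷ ks × x ~ k') → (P x × x ~ k) ⊎ (P x × ∃ λ k' → k' ∈ ks × x ~ k')
      from x (p , k' , here refl , x~k) = inj₁ (p , x~k)
      from x (p , k' , there k'∈ , x~k') = inj₂ (p , k' , k'∈ , x~k')

  -- `_~_` is a relation instead of a map to K, because the keys in use, a codivisor or a residue,
  -- come from existence statements.
  card-fibres : ∀ {A K : Set} {P : A → Set} {_~_ : A → K → Set} (size : K → ℕ) (ks : List K) → Unique ks →
    (∀ {k k'} x → k ∈ ks → k' ∈ ks → P x → x ~ k → x ~ k' → k ≡ k') →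
    (∀ {k} → k ∈ ks → Card (λ x → P x × x ~ k) (size k)) →
    (∀ x → P x → ∃ λ k → k ∈ ks × x ~ k) →
    Card P (sum (map size ks))
  card-fibres size ks u disjoint fibre cover = card-cong (λ x → proj₁) (λ x p → p , cover x p) (card-fibres′ size ks u disjoint fibre)

-- Residues modulo an element of ℤ[√2].

module ResidueSystems where
  import Data.Nat.Divisibility as ℕᵈ
  open import Data.List using (List; []; _∷_; length; map; upTo; cartesianProductWith)
  import Data.List.Properties as Listₚ
  open import Data.List.Membership.Propositional using (_∈_)
  open import Data.List.Membership.Propositional.Properties using (∈-cartesianProductWith⁺; ∈-cartesianProductWith⁻; ∈-upTo⁺; ∈-upTo⁻)
  open import Data.List.Relation.Unary.Unique.Propositional using (Unique)
  import Data.List.Relation.Unary.Unique.Propositional.Properties as Uniqueₚ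
  open import Relation.Binary.Definitions using (tri<; tri≈; tri>)
  open import Data.Integer using (+_)
  open import Data.Integer.DivMod using (_/ℕ_; _%ℕ_; a≡a%ℕn+[a/ℕn]*n; n%ℕd<d)
  open import Data.Integer.Divisibility.Signed using (_∣_; divides; ∣⇒∣ᵤ; ∣ᵤ⇒∣)
  open import Tactic.RingSolver using (solve-∀)
  open QuadraticIntegers
  open BezoutAndParity
  open EuclideanRing
  open SumsOfTwoSquares
  open Units

  private
    length-product : ∀ {A B C : Set} (f : A → B → C) xs ys → length (cartesianProductWith f xs ys) ≡ length xs ℕ.* length ys
    length-product f [] ys = refl
    length-product f (x ∷ xs) ys = trans (Listₚ.length-++ (map (f x) ys)) (cong₂ ℕ._+_ (Listₚ.length-map (f x) ys) (length-product f xs ys))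

    residues-distinct : ∀ {n i j} → i ℕ.< n → j ℕ.< n → + n ∣ + i ℤ.+ ℤ.- + j → i ≡ j
    residues-distinct {n} {i} {j} i<n j<n n∣ with ℕₚ.<-cmp i j
    ... | tri≈ _ eq _ = eq
    ... | tri< i<j _ _ = contradiction (ℕᵈ.∣⇒≤ {{ℕ.≢-nonZero (λ eq → ℕₚ.<⇒≱ i<j (ℕₚ.m∸n≡0⇒m≤n eq))}} (subst (n ℕᵈ.∣_) (trans (cong ℤ.∣_∣ (e (+ i) (+ j))) (trans (ℤₚ.∣-i∣≡∣i∣ (+ j ℤ.+ ℤ.- + i)) (cong ℤ.∣_∣ (trans (ℤₚ.m-n≡m⊖n j i) (ℤₚ.⊖-≥ (ℕₚ.<⇒≤ i<j)))))) (∣⇒∣ᵤ n∣))) (ℕₚ.<⇒≱ (ℕₚ.≤-<-trans (ℕₚ.m∸n≤m j i) j<n))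
      where e : ∀ i j → i ℤ.+ ℤ.- j ≡ ℤ.- (j ℤ.+ ℤ.- i)
            e = ℤ-Solver.solve-∀
    ... | tri> _ _ j<i = contradiction (ℕᵈ.∣⇒≤ {{ℕ.≢-nonZero (λ eq → ℕₚ.<⇒≱ j<i (ℕₚ.m∸n≡0⇒m≤n eq))}} (subst (n ℕᵈ.∣_) (cong ℤ.∣_∣ (trans (ℤₚ.m-n≡m⊖n i j) (ℤₚ.⊖-≥ (ℕₚ.<⇒≤ j<i)))) (∣⇒∣ᵤ n∣))) (ℕₚ.<⇒≱ (ℕₚ.≤-<-trans (ℕₚ.m∸n≤m i j) i<n))

  record Residues (δ : ℤ[√2]) : Set where
    field
      residues : List ℤ[√2]
      unique : Unique residues
      length≡ : length residues ≡ ℤ.∣ nm δ ∣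
      incongruent : ∀ {r r'} → r ∈ residues → r' ∈ residues → δ ∣ᴿ r - r' → r ≡ r'
      complete : ∀ s → ∃ λ r → r ∈ residues × δ ∣ᴿ s - r

  -- If δ = g (x' + y' √2) with x', y' coprime, the residues are i + j √2 with j < |g| and i < |g (x'² - 2 y'²)|.
  private
    module _ (δ : ℤ[√2]) (g x' y' u v : ℤ) (δ≡ : δ ≡ int g * (x' ⊕√2 y')) (coprime : u ℤ.* x' ℤ.+ v ℤ.* y' ≡ 1ℤ) (δ≢0 : δ ≢ 0R) where
      ξ : ℤ[√2]
      ξ = x' ⊕√2 y'
      G m : ℕ
      G = ℤ.∣ g ∣
      m = ℤ.∣ nm ξ ∣

      nmδ : ℤ.∣ nm δ ∣ ≡ G ℕ.* m ℕ.* G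
      nmδ = trans (cong (λ z → ℤ.∣ nm z ∣) δ≡) (trans (cong ℤ.∣_∣ (trans (nm-* (int g) ξ) (cong (ℤ._* nm ξ) (nm-int g)))) (trans (ℤₚ.abs-* (g ℤ.* g) (nm ξ)) (trans (cong (ℕ._* m) (ℤₚ.abs-* g g)) (trans (ℕₚ.*-assoc G G m) (trans (cong (G ℕ.*_) (ℕₚ.*-comm G m)) (sym (ℕₚ.*-assoc G m G)))))))

      Gm≢0 : G ℕ.* m ≢ 0
      Gm≢0 eq = ∣nm∣≢0 δ≢0 (trans nmδ (cong (ℕ._* G) eq))
      G≢0 : G ≢ 0
      G≢0 eq = ∣nm∣≢0 δ≢0 (trans nmδ (trans (cong (G ℕ.* m ℕ.*_) eq) (ℕₚ.*-zeroʳ (G ℕ.* m))))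

      residue : ℕ → ℕ → ℤ[√2]
      residue i j = + i ⊕√2 + j

      list : List ℤ[√2]
      list = cartesianProductWith residue (upTo (G ℕ.* m)) (upTo G)

      -- The ideal of δ has a triangular ℤ-basis, g nm ξ and g (t + √2) with t as in `complete`.
      -- Accordingly g bounds second coordinates from below, and g nm ξ the first ones when the
      -- second is 0.
      δ∣⇒ : ∀ a b → δ ∣ᴿ a ⊕√2 b → g ∣ b × (b ≡ 0ℤ → g ℤ.* nm ξ ∣ a)
      δ∣⇒ a b (p ⊕√2 r , eq) = divides (x' ℤ.* r ℤ.+ y' ℤ.* p) (trans (cong im eq₁) (ℤₚ.*-comm g _)) , first
        where
        eq₁ : a ⊕√2 b ≡ g ℤ.* (x' ℤ.* p ℤ.+ + 2 ℤ.* y' ℤ.* r) ⊕√2 g ℤ.* (x' ℤ.* r ℤ.+ y' ℤ.* p)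
        eq₁ = trans eq (trans (cong (_* (p ⊕√2 r)) δ≡) (trans (R.*-assoc (int g) ξ (p ⊕√2 r)) (int-* g (x' ℤ.* p ℤ.+ + 2 ℤ.* y' ℤ.* r) (x' ℤ.* r ℤ.+ y' ℤ.* p))))
        g≢0 : g ≢ 0ℤ
        g≢0 refl = G≢0 refl
        first : b ≡ 0ℤ → g ℤ.* nm ξ ∣ a
        first refl = divides (u ℤ.* p ℤ.+ ℤ.- (v ℤ.* r)) (trans (cong re eq₁) (trans (cong (g ℤ.*_) P≡) (e₃ g (nm ξ) (u ℤ.* p ℤ.+ ℤ.- (v ℤ.* r)))))
          where
          P₀ = x' ℤ.* p ℤ.+ + 2 ℤ.* y' ℤ.* r
          R₀ = x' ℤ.* r ℤ.+ y' ℤ.* p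
          R≡0 : R₀ ≡ 0ℤ
          R≡0 = zero-product (ℤₚ.i*j≡0⇒i≡0∨j≡0 g (sym (cong im eq₁)))
            where
            open import Data.Sum using (_⊎_; inj₁; inj₂)
            zero-product : g ≡ 0ℤ ⊎ R₀ ≡ 0ℤ → R₀ ≡ 0ℤ
            zero-product (inj₁ g≡0) = contradiction g≡0 g≢0
            zero-product (inj₂ R≡0) = R≡0
          e₁ : ∀ x y p r u v → let P₀ = x ℤ.* p ℤ.+ + 2 ℤ.* y ℤ.* r ; R₀ = x ℤ.* r ℤ.+ y ℤ.* p in
            P₀ ℤ.* (u ℤ.* x ℤ.+ v ℤ.* y) ≡ (x ℤ.* x ℤ.+ ℤ.- (+ 2 ℤ.* (y ℤ.* y))) ℤ.* (u ℤ.* p ℤ.+ ℤ.- (v ℤ.* r)) ℤ.+ R₀ ℤ.* (+ 2 ℤ.* u ℤ.* y ℤ.+ v ℤ.* x)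
          e₁ = ℤ-Solver.solve-∀
          P≡ : P₀ ≡ nm ξ ℤ.* (u ℤ.* p ℤ.+ ℤ.- (v ℤ.* r))
          P≡ = trans (sym (ℤₚ.*-identityʳ P₀)) (trans (cong (P₀ ℤ.*_) (sym coprime)) (trans (e₁ x' y' p r u v)
            (trans (cong (λ z → nm ξ ℤ.* (u ℤ.* p ℤ.+ ℤ.- (v ℤ.* r)) ℤ.+ z ℤ.* (+ 2 ℤ.* u ℤ.* y' ℤ.+ v ℤ.* x')) R≡0) (ℤₚ.+-identityʳ _))))
          e₃ : ∀ g n k → g ℤ.* (n ℤ.* k) ≡ k ℤ.* (g ℤ.* n)
          e₃ = ℤ-Solver.solve-∀

      abs∣ : ∀ {a b} → a ∣ b → + ℤ.∣ a ∣ ∣ b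
      abs∣ d = ∣ᵤ⇒∣ (∣⇒∣ᵤ d)

      distinct : ∀ {r r'} → r ∈ list → r' ∈ list → δ ∣ᴿ r - r' → r ≡ r'
      distinct r∈ r'∈ δ∣ with ∈-cartesianProductWith⁻ residue (upTo (G ℕ.* m)) (upTo G) r∈ | ∈-cartesianProductWith⁻ residue (upTo (G ℕ.* m)) (upTo G) r'∈
      ... | i , j , i∈ , j∈ , refl | i' , j' , i'∈ , j'∈ , refl = cong₂ residue i≡i' j≡j'
        where
        parts = δ∣⇒ (+ i ℤ.+ ℤ.- + i') (+ j ℤ.+ ℤ.- + j') δ∣
        j≡j' : j ≡ j'
        j≡j' = residues-distinct (∈-upTo⁻ j∈) (∈-upTo⁻ j'∈) (abs∣ (proj₁ parts))
        i≡i' : i ≡ i'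
        i≡i' = residues-distinct (∈-upTo⁻ i∈) (∈-upTo⁻ i'∈) (subst (λ n → + n ∣ + i ℤ.+ ℤ.- + i') (ℤₚ.abs-* g (nm ξ))
          (abs∣ (proj₂ parts (ℤₚ.i≡j⇒i-j≡0 (cong +_ j≡j')))))

      -- Integer division is by the absolute value of b; the sign moves into the quotient.
      signed : ∀ a b → ∃ λ s → a ℤ.* + ℤ.∣ b ∣ ≡ a ℤ.* s ℤ.* b
      signed a (+ b) = 1ℤ , cong (ℤ._* + b) (sym (ℤₚ.*-identityʳ a))
      signed a -[1+ b ] = -[1+ 0 ] , e a (+ suc b)
        where e : ∀ a b → a ℤ.* b ≡ a ℤ.* -[1+ 0 ] ℤ.* (ℤ.- b)
              e = ℤ-Solver.solve-∀

      -- Both coordinates are reduced by subtracting multiples of δ (v + u √2) = g (t + √2) and then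
      -- of δ · bar ξ = g nm ξ.
      complete : ∀ s → ∃ λ r → r ∈ list × δ ∣ᴿ s - r
      complete (a ⊕√2 b) = residue (a₁ %ℕ (G ℕ.* m)) (b %ℕ G) ,
        ∈-cartesianProductWith⁺ residue (∈-upTo⁺ (n%ℕd<d a₁ (G ℕ.* m))) (∈-upTo⁺ (n%ℕd<d b G)) ,
        ∣-subst (sym split) (∣-+ (∣-*ˡ (int k) ∣first) (∣-*ˡ (int l) ∣second))
        where
        instance
          nzG : ℕ.NonZero G
          nzG = ℕ.≢-nonZero G≢0
          nzGm : ℕ.NonZero (G ℕ.* m)
          nzGm = ℕ.≢-nonZero Gm≢0
        k = proj₁ (signed (b /ℕ G) g) ℤ.* (b /ℕ G)
        t = x' ℤ.* v ℤ.+ + 2 ℤ.* y' ℤ.* u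
        a₁ = a ℤ.+ ℤ.- (k ℤ.* (g ℤ.* t))
        l = (a₁ /ℕ (G ℕ.* m)) ℤ.* proj₁ (signed (a₁ /ℕ (G ℕ.* m)) (g ℤ.* nm ξ))
        ∣first : δ ∣ᴿ g ℤ.* t ⊕√2 g
        ∣first = v ⊕√2 u , sym (trans (cong (_* (v ⊕√2 u)) δ≡) (trans (R.*-assoc (int g) ξ (v ⊕√2 u)) (trans (int-* g t (x' ℤ.* u ℤ.+ y' ℤ.* v))
          (cong (g ℤ.* t ⊕√2_) (trans (cong (g ℤ.*_) (trans (e x' u y' v) coprime)) (ℤₚ.*-identityʳ g))))))
          where e : ∀ x u y v → x ℤ.* u ℤ.+ y ℤ.* v ≡ u ℤ.* x ℤ.+ v ℤ.* y
                e = ℤ-Solver.solve-∀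
        ∣second : δ ∣ᴿ g ℤ.* nm ξ ⊕√2 0ℤ
        ∣second = bar ξ , sym (trans (cong (_* bar ξ) δ≡) (trans (R.*-assoc (int g) ξ (bar ξ)) (trans (cong (int g *_) (*-bar ξ)) (int-int g (nm ξ)))))
        b≡ : b ≡ + (b %ℕ G) ℤ.+ k ℤ.* g
        b≡ = trans (a≡a%ℕn+[a/ℕn]*n b G) (cong (λ z → + (b %ℕ G) ℤ.+ z) (trans (proj₂ (signed (b /ℕ G) g)) (cong (ℤ._* g) (ℤₚ.*-comm (b /ℕ G) (proj₁ (signed (b /ℕ G) g))))))
        a₁≡ : a₁ ≡ + (a₁ %ℕ (G ℕ.* m)) ℤ.+ l ℤ.* (g ℤ.* nm ξ)
        a₁≡ = trans (a≡a%ℕn+[a/ℕn]*n a₁ (G ℕ.* m)) (cong (λ z → + (a₁ %ℕ (G ℕ.* m)) ℤ.+ z)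
          (trans (cong (λ n → (a₁ /ℕ (G ℕ.* m)) ℤ.* + n) (sym (ℤₚ.abs-* g (nm ξ)))) (proj₂ (signed (a₁ /ℕ (G ℕ.* m)) (g ℤ.* nm ξ)))))
        split : (a ⊕√2 b) - residue (a₁ %ℕ (G ℕ.* m)) (b %ℕ G) ≡ int k * (g ℤ.* t ⊕√2 g) + int l * (g ℤ.* nm ξ ⊕√2 0ℤ)
        split = trans (cong₂ _⊕√2_ (first a (k ℤ.* (g ℤ.* t)) (+ (a₁ %ℕ (G ℕ.* m))) (l ℤ.* (g ℤ.* nm ξ)) a₁≡) (second b (+ (b %ℕ G)) (k ℤ.* g) l b≡))
          (sym (cong₂ _+_ (int-* k (g ℤ.* t) g) (int-* l (g ℤ.* nm ξ) 0ℤ)))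
          where
          first : ∀ a x r y → a ℤ.+ ℤ.- x ≡ r ℤ.+ y → a ℤ.+ ℤ.- r ≡ x ℤ.+ y
          first a x r y eq = trans (e₁ a x r) (trans (cong (λ z → z ℤ.+ (x ℤ.+ ℤ.- r)) eq) (e₂ x r y))
            where e₁ : ∀ a x r → a ℤ.+ ℤ.- r ≡ (a ℤ.+ ℤ.- x) ℤ.+ (x ℤ.+ ℤ.- r)
                  e₁ = ℤ-Solver.solve-∀
                  e₂ : ∀ x r y → (r ℤ.+ y) ℤ.+ (x ℤ.+ ℤ.- r) ≡ x ℤ.+ y
                  e₂ = ℤ-Solver.solve-∀
          second : ∀ b r y l → b ≡ r ℤ.+ y → b ℤ.+ ℤ.- r ≡ y ℤ.+ l ℤ.* 0ℤ
          second _ r y l refl = e r y l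
            where e : ∀ r y l → (r ℤ.+ y) ℤ.+ ℤ.- r ≡ y ℤ.+ l ℤ.* 0ℤ
                  e = ℤ-Solver.solve-∀

      residuesOf : Residues δ
      residuesOf = record
        { residues = list
        ; unique = Uniqueₚ.cartesianProductWith⁺ residue (λ { refl → refl , refl }) (Uniqueₚ.upTo⁺ (G ℕ.* m)) (Uniqueₚ.upTo⁺ G)
        ; length≡ = trans (length-product residue (upTo (G ℕ.* m)) (upTo G)) (trans (cong₂ ℕ._*_ (Listₚ.length-upTo (G ℕ.* m)) (Listₚ.length-upTo G)) (sym nmδ))
        ; incongruent = distinct
        ; complete = complete
        }

  residuesMod : ∀ δ → δ ≢ 0R → Residues δ
  residuesMod δ@(x ⊕√2 y) δ≢0 = residuesOf δ d a' b' u v δ≡ coprime δ≢0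
    where
    open Bezoutℤ.LeftGcd (gcdℤ x y)
    δ≡ : δ ≡ int d * (a' ⊕√2 b')
    δ≡ = trans (cong₂ _⊕√2_ (trans a≈ (ℤₚ.*-comm a' d)) (trans b≈ (ℤₚ.*-comm b' d))) (sym (int-* d a' b'))
    d≢0 : d ≢ 0ℤ
    d≢0 d≡0 = δ≢0 (cong₂ _⊕√2_ (trans a≈ (trans (cong (a' ℤ.*_) d≡0) (ℤₚ.*-zeroʳ a'))) (trans b≈ (trans (cong (b' ℤ.*_) d≡0) (ℤₚ.*-zeroʳ b'))))
    coprime : u ℤ.* a' ℤ.+ v ℤ.* b' ≡ 1ℤ
    coprime = ℤₚ.*-cancelˡ-≡ d _ _ {{ℤ.≢-nonZero d≢0}} (trans (e d u v a' b') (trans (cong₂ (λ s t → u ℤ.* s ℤ.+ v ℤ.* t) (sym a≈) (sym b≈)) (trans (sym bezout) (sym (ℤₚ.*-identityʳ d)))))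
      where e : ∀ d u v a b → d ℤ.* (u ℤ.* a ℤ.+ v ℤ.* b) ≡ u ℤ.* (a ℤ.* d) ℤ.+ v ℤ.* (b ℤ.* d)
            e = ℤ-Solver.solve-∀

-- Reduction modulo √2 and the level of a quaternion.

module Levels where
  open import Data.Bool using (Bool; true; false; _xor_; _∧_)
  open import Data.Fin as Fin using (Fin; zero; suc)
  open import Data.Fin.Patterns using (0F; 1F; 2F; 3F)
  open import Data.Vec as Vec using (Vec; []; _∷_; lookup)
  import Data.Vec.Properties as Vecₚ
  open import Data.Integer using (+_)
  open import Tactic.RingSolver using (solve-∀)
  open Quadruple
  open QuadraticIntegers
  open MaximalOrder
  open BezoutAndParity
  open EuclideanRing
  open EuclideanOrder
  open Units
  open IdentitySolver

  -- Reduction modulo the prime √2, whose residue field is 𝔽₂.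
  parity : ℤ[√2] → Bool
  parity (a ⊕√2 b) = parityℤ a

  Bool-ops : RingOps Bool
  Bool-ops = record { _⊞_ = _xor_ ; _⊠_ = _∧_ ; neg = λ x → x ; nil = false ; one = true ; root2 = false }

  -- A map respecting the operations commutes with the evaluation of terms. This carries quaternion
  -- formulas to 𝔽₂ along `parity` and to K along `ιᴿ`.
  data Term (n : ℕ) : Set where
    var : Fin n → Term n
    plus times : Term n → Term n → Term n
    minus : Term n → Term n
    nil′ one′ root2′ : Term n

  Term-ops : ∀ n → RingOps (Term n)
  Term-ops n = record { _⊞_ = plus ; _⊠_ = times ; neg = minus ; nil = nil′ ; one = one′ ; root2 = root2′ }

  eval : ∀ {A n} → RingOps A → Vec A n → Term n → A
  eval ops ρ (var i) = lookup ρ i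
  eval ops ρ (plus s t) = RingOps._⊞_ ops (eval ops ρ s) (eval ops ρ t)
  eval ops ρ (times s t) = RingOps._⊠_ ops (eval ops ρ s) (eval ops ρ t)
  eval ops ρ (minus t) = RingOps.neg ops (eval ops ρ t)
  eval ops ρ nil′ = RingOps.nil ops
  eval ops ρ one′ = RingOps.one ops
  eval ops ρ root2′ = RingOps.root2 ops

  parity-+ : ∀ x y → parity (x + y) ≡ parity x xor parity y
  parity-+ (a ⊕√2 b) (c ⊕√2 d) = parityℤ-+ a c

  parity-* : ∀ x y → parity (x * y) ≡ parity x ∧ parity y
  parity-* (a ⊕√2 b) (c ⊕√2 d) = trans (parityℤ-+ (a ℤ.* c) (+ 2 ℤ.* b ℤ.* d)) (trans (cong₂ _xor_ (parityℤ-* a c)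
    (trans (parityℤ-* (+ 2 ℤ.* b) d) (cong (_∧ parityℤ d) (parityℤ-* (+ 2) b)))) (xor-false (parityℤ a ∧ parityℤ c)))
    where
    xor-false : ∀ x → x xor false ≡ x
    xor-false false = refl
    xor-false true = refl

  parity-neg : ∀ x → parity (- x) ≡ parity x
  parity-neg (a ⊕√2 b) = parityℤ-neg a

  record RingOpsHom {A B : Set} (ops : RingOps A) (ops′ : RingOps B) (φ : A → B) : Set where
    private
      module A = RingOps ops
      module B = RingOps ops′
    field
      φ-+ : ∀ x y → φ (x A.⊞ y) ≡ φ x B.⊞ φ y
      φ-* : ∀ x y → φ (x A.⊠ y) ≡ φ x B.⊠ φ y
      φ-neg : ∀ x → φ (A.neg x) ≡ B.neg (φ x)
      φ-0 : φ A.nil ≡ B.nil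
      φ-1 : φ A.one ≡ B.one
      φ-√2 : φ A.root2 ≡ B.root2

  eval-hom : ∀ {A B n} {ops : RingOps A} {ops′ : RingOps B} {φ : A → B} → RingOpsHom ops ops′ φ →
    ∀ (ρ : Vec A n) t → φ (eval ops ρ t) ≡ eval ops′ (Vec.map φ ρ) t
  eval-hom {ops = ops} {ops′} {φ} hom ρ = go
    where
    open RingOps ops′
    open RingOpsHom hom
    go : ∀ t → φ (eval ops ρ t) ≡ eval ops′ (Vec.map φ ρ) t
    go (var i) = sym (Vecₚ.lookup-map i φ ρ)
    go (plus s t) = trans (φ-+ (eval ops ρ s) (eval ops ρ t)) (cong₂ _⊞_ (go s) (go t))
    go (times s t) = trans (φ-* (eval ops ρ s) (eval ops ρ t)) (cong₂ _⊠_ (go s) (go t))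
    go (minus t) = trans (φ-neg (eval ops ρ t)) (cong neg (go t))
    go nil′ = φ-0
    go one′ = φ-1
    go root2′ = φ-√2

  parity-eval : ∀ {n} (ρ : Vec ℤ[√2] n) t → parity (eval ℤ[√2]-ops ρ t) ≡ eval Bool-ops (Vec.map parity ρ) t
  parity-eval = eval-hom record { φ-+ = parity-+ ; φ-* = parity-* ; φ-neg = parity-neg ; φ-0 = refl ; φ-1 = refl ; φ-√2 = refl }

  module B = Quaternions Bool-ops
  module T {n} = Quaternions (Term-ops n)

  bits : 𝒪 → Quat Bool
  bits ⟪ a , b , c , d ⟫ = ⟪ parity a , parity b , parity c , parity d ⟫

  private
    generic : Quat (Term 4)
    generic = ⟪ var 0F , var 1F , var 2F , var 3F ⟫

  parity-norm : ∀ q → parity (norm q) ≡ B.norm (bits q)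
  parity-norm ⟪ a , b , c , d ⟫ = parity-eval (a ∷ b ∷ c ∷ d ∷ []) (T.norm generic)

  parity-ℓ : ∀ q → parity (ℓ q) ≡ B.ℓ (bits q)
  parity-ℓ ⟪ a , b , c , d ⟫ = parity-eval (a ∷ b ∷ c ∷ d ∷ []) (T.ℓ generic)

  parity-ul : ∀ q → parity (ul q) ≡ B.ul (bits q)
  parity-ul ⟪ a , b , c , d ⟫ = parity-eval (a ∷ b ∷ c ∷ d ∷ []) (T.ul generic)

  parity-lr : ∀ q → parity (lr q) ≡ B.lr (bits q)
  parity-lr ⟪ a , b , c , d ⟫ = parity-eval (a ∷ b ∷ c ∷ d ∷ []) (T.lr generic)

  √2∣⇒even : ∀ {x} → √2 ∣ᴿ x → parity x ≡ false
  √2∣⇒even (y , refl) = parity-* √2 y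

  even⇒√2∣ : ∀ {x} → parity x ≡ false → √2 ∣ᴿ x
  even⇒√2∣ {a ⊕√2 b} eq with even⇒double a eq
  ... | k , refl = b ⊕√2 k , sym (√2* b k)

  √2≢0 : √2 ≢ 0R
  √2≢0 ()

  √2^ᴿ : ℕ → ℤ[√2]
  √2^ᴿ zero = 1R
  √2^ᴿ (suc n) = √2 * √2^ᴿ n

  √2^≢0 : ∀ n → √2^ᴿ n ≢ 0R
  √2^≢0 zero ()
  √2^≢0 (suc n) eq = √2^≢0 n (x*y≡0⇒y≡0 √2≢0 eq)

  √2^-+ : ∀ m n → √2^ᴿ (m ℕ.+ n) ≡ √2^ᴿ m * √2^ᴿ n
  √2^-+ zero n = sym (R.*-identityˡ (√2^ᴿ n))
  √2^-+ (suc m) n = trans (cong (√2 *_) (√2^-+ m n)) (sym (R.*-assoc √2 (√2^ᴿ m) (√2^ᴿ n)))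

  √2^-∣ : ∀ {m n} → m ℕ.≤ n → √2^ᴿ m ∣ᴿ √2^ᴿ n
  √2^-∣ {m} m≤n with ℕₚ.m≤n⇒∃[o]m+o≡n m≤n
  ... | o , refl = √2^ᴿ o , √2^-+ m o

  √2^∣? : ∀ n x → Dec (√2^ᴿ n ∣ᴿ x)
  √2^∣? zero x = yes (x , sym (R.*-identityˡ x))
  √2^∣? (suc n) x with parity x in eq
  ... | true = no λ { (y , refl) → contradiction (trans (sym eq) (trans (cong parity (R.*-assoc √2 (√2^ᴿ n) y)) (parity-* √2 (√2^ᴿ n * y)))) λ () }
  ... | false with even⇒√2∣ {x} eq
  ... | y , refl with √2^∣? n y
  ... | yes (k , refl) = yes (k , sym (R.*-assoc √2 (√2^ᴿ n) k))
  ... | no ∤ = no λ { (k , eq) → ∤ (k , *-cancelˡ √2≢0 (trans eq (R.*-assoc √2 (√2^ᴿ n) k))) }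

  -- Primality of √2, applied n times.
  odd-cancel : ∀ n {x a} → parity a ≡ true → √2^ᴿ n ∣ᴿ x * a → √2^ᴿ n ∣ᴿ x
  odd-cancel zero {x} _ _ = x , sym (R.*-identityˡ x)
  odd-cancel (suc n) {x} {a} odd (k , eq) = go (even⇒√2∣ {x} (∧-true (parity x) (parity a) odd (trans (sym (parity-* x a)) (√2∣⇒even (√2^ᴿ n * k , trans eq (R.*-assoc √2 (√2^ᴿ n) k))))))
    where
    ∧-true : ∀ x y → y ≡ true → x ∧ y ≡ false → x ≡ false
    ∧-true false _ _ _ = refl
    ∧-true true true _ ()
    go : √2 ∣ᴿ x → √2^ᴿ (suc n) ∣ᴿ x
    go (y , x≡) = let (l , y≡) = odd-cancel n {y} {a} odd (k , *-cancelˡ √2≢0 (trans (sym (R.*-assoc √2 y a)) (trans (cong (_* a) (sym x≡)) (trans eq (R.*-assoc √2 (√2^ᴿ n) k))))) in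
      l , trans x≡ (trans (cong (√2 *_) y≡) (sym (R.*-assoc √2 (√2^ᴿ n) l)))

  -- 𝒢 is level 3; locally at √2 the level N elements are the matrices whose lower left entry is divisible by √2ᴺ.
  Level : ℕ → 𝒪 → Set
  Level n q = √2^ᴿ n ∣ᴿ ℓ q

  Level? : ∀ n q → Dec (Level n q)
  Level? n q = √2^∣? n (ℓ q)

  Level-≤ : ∀ {m n q} → m ℕ.≤ n → Level n q → Level m q
  Level-≤ m≤n = ∣-trans (√2^-∣ m≤n)

  Level-0 : ∀ q → Level 0 q
  Level-0 q = ℓ q , sym (R.*-identityˡ (ℓ q))

  -- The rule for the lower left entry of a matrix product, with an error divisible by √2³; up to
  -- level 3 the error is invisible.
  ℓ-mul : ∀ q w → ℓ (mul q w) ≡ ℓ q * ul w + lr q * ℓ w + √2 * (√2 * (√2 * 1R)) * (co₁ q * co₂ w - co₂ q * co₁ w)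
  ℓ-mul q w = solveS {2} {0} (ℓᵗ (mulᵗ q₀ q₁)) (ℓᵗ q₀ :* ulᵗ q₁ :+ lrᵗ q₀ :* ℓᵗ q₁ :+ (con √2) :* ((con √2) :* ((con √2) :* (con 1R))) :* (co₁ᵗ q₀ :* co₂ᵗ q₁ :- co₂ᵗ q₀ :* co₁ᵗ q₁)) refl (q ∷ w ∷ []) []

  Level⇒even : ∀ {q} → Level 1 q → parity (ℓ q) ≡ false
  Level⇒even {q} (k , eq) = √2∣⇒even (k , trans eq (cong (_* k) (R.*-identityʳ √2)))

  even⇒Level : ∀ {q} → parity (ℓ q) ≡ false → Level 1 q
  even⇒Level {q} eq with even⇒√2∣ {ℓ q} eq
  ... | k , eq' = k , trans eq' (cong (_* k) (sym (R.*-identityʳ √2)))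

  -- modulo √2, the reduced norm of an upper triangular matrix is the product of its diagonal entries
  norm-triangular : ∀ q → Level 1 q → parity (norm q) ≡ parity (ul q) ∧ parity (lr q)
  norm-triangular q lev = trans (parity-norm q) (trans (table (bits q) (trans (sym (parity-ℓ q)) (Level⇒even {q} lev))) (sym (cong₂ _∧_ (parity-ul q) (parity-lr q))))
    where
    table : ∀ v → B.ℓ v ≡ false → B.norm v ≡ B.ul v ∧ B.lr v
    table ⟪ false , false , false , false ⟫ _ = refl
    table ⟪ false , false , true , true ⟫ _ = refl
    table ⟪ false , true , false , true ⟫ _ = refl
    table ⟪ false , true , true , false ⟫ _ = refl
    table ⟪ true , false , false , false ⟫ _ = refl
    table ⟪ true , false , true , true ⟫ _ = refl
    table ⟪ true , true , false , true ⟫ _ = refl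
    table ⟪ true , true , true , false ⟫ _ = refl

  private
    ∧-true⁻ : ∀ {x y} → x ∧ y ≡ true → x ≡ true × y ≡ true
    ∧-true⁻ {true} {true} _ = refl , refl

  odd-diagonal : ∀ {q} → Level 1 q → parity (norm q) ≡ true → parity (ul q) ≡ true × parity (lr q) ≡ true
  odd-diagonal {q} lev odd = ∧-true⁻ (trans (sym (norm-triangular q lev)) odd)

  Level-mul : ∀ {n} u {b} → n ℕ.≤ 3 → Level 3 b → Level n u → Level n (mul u b)
  Level-mul {n} u {b} n≤3 lb lu = ∣-subst (sym (ℓ-mul u b)) (∣-+ (∣-+ (∣-*ʳ (ul b) lu) (∣-*ˡ (lr u) (Level-≤ {q = b} n≤3 lb))) (∣-*ʳ (co₁ u * co₂ b - co₂ u * co₁ b) (√2^-∣ n≤3)))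

  -- Modulo √2ⁿ the formula for `ℓ` reduces to ℓ u · ul b, and ul b is odd because b is triangular
  -- of odd norm.
  Level-mul⁻ : ∀ {n} u {b} → n ℕ.≤ 3 → Level 3 b → parity (norm b) ≡ true → Level n (mul u b) → Level n u
  Level-mul⁻ {n} u {b} n≤3 lb odd l = odd-cancel n {ℓ u} {ul b} (proj₁ (odd-diagonal {b} (Level-≤ {1} {3} {b} (s≤s z≤n) lb) odd))
    (∣-subst (e (ℓ u * ul b) (lr u * ℓ b) (√2 * (√2 * (√2 * 1R)) * (co₁ u * co₂ b - co₂ u * co₁ b)))
      (∣-minus (∣-minus (∣-subst (ℓ-mul u b) l) (∣-*ʳ (co₁ u * co₂ b - co₂ u * co₁ b) (√2^-∣ n≤3))) (∣-*ˡ (lr u) (Level-≤ {q = b} n≤3 lb))))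
    where
    e : ∀ x y z → x + y + z - z - y ≡ x
    e = solve-∀ RR

  private
    odd+odd : ∀ {x y} → parity x ≡ true → parity y ≡ true → parity (x + y) ≡ false
    odd+odd {x} {y} p q = trans (parity-+ x y) (cong₂ _xor_ p q)

    odd*odd : ∀ {x y} → parity x ≡ true → parity y ≡ true → parity (x * y) ≡ true
    odd*odd {x} {y} p q = trans (parity-* x y) (cong₂ _∧_ p q)

    -- If the level of b is exactly n, then ℓ b = √2ⁿ k with k odd. Up to a multiple of √2³, ℓ (v b)
    -- is √2ⁿ times m · ul b + lr v · k, a sum of two odd numbers.
    raise : ∀ n v m → suc n ℕ.≤ 3 → norm v ≡ 1R → ℓ v ≡ √2^ᴿ n * m → parity m ≡ true → parity (lr v) ≡ true →
      ∀ b → parity (norm b) ≡ true → parity (ul b) ≡ true → Level n b → ∃ λ u → norm u ≡ 1R × Level (suc n) (mul u b)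
    raise n v m n<3 norm-v ℓv oddm oddlr b odd oddul lev with Level? (suc n) b
    ... | yes l = scalar 1R , refl , subst (Level (suc n)) (sym (trans (scalar-mul b 1R) (scale-one b))) l
    ... | no ∤ = v , norm-v , raised lev
      where
      h = co₁ v * co₂ b - co₂ v * co₁ b
      e : ∀ p m A D k → p * m * A + D * (p * k) ≡ p * (m * A + D * k)
      e = solve-∀ RR
      raised : Level n b → Level (suc n) (mul v b)
      raised (k , ℓb) = ∣-subst (sym (ℓ-mul v b)) (∣-+ (∣-subst (sym (trans (cong₂ (λ s t → s * ul b + lr v * t) ℓv ℓb) (e (√2^ᴿ n) m (ul b) (lr v) k))) sum∣) (∣-*ʳ h (√2^-∣ n<3)))
        where
        oddk : parity k ≡ true
        oddk with parity k in eq
        ... | true = refl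
        ... | false with even⇒√2∣ {k} eq
        ... | l , refl = contradiction (l , trans ℓb (trans (e' (√2^ᴿ n) l) refl)) ∤
          where e' : ∀ p l → p * (√2 * l) ≡ √2 * p * l
                e' = solve-∀ RR
        sum∣ : √2^ᴿ (suc n) ∣ᴿ √2^ᴿ n * (m * ul b + lr v * k)
        sum∣ with even⇒√2∣ {m * ul b + lr v * k} (odd+odd {m * ul b} {lr v * k} (odd*odd {m} {ul b} oddm oddul) (odd*odd {lr v} {k} oddlr oddk))
        ... | l , eq = l , trans (cong (√2^ᴿ n *_) eq) (e' (√2^ᴿ n) l)
          where e' : ∀ p l → p * (√2 * l) ≡ √2 * p * l
                e' = solve-∀ RR

    -- ℓ (f b) has the parity of ul b, and ℓ (g b) that of ul b + ℓ b, so one of the multipliers 1,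
    -- f, g produces an even value.
    raise-0 : ∀ b → parity (norm b) ≡ true → ∃ λ u → norm u ≡ 1R × Level 1 (mul u b)
    raise-0 b odd with parity (ul b) in eq | Level? 1 b
    ... | _ | yes l = scalar 1R , refl , subst (Level 1) (sym (trans (scalar-mul b 1R) (scale-one b))) l
    ... | false | no _ = ⟪ 0R , 1R , 0R , 0R ⟫ , refl , even⇒Level {mul ⟪ 0R , 1R , 0R , 0R ⟫ b}
      (trans (cong parity (ℓ-mul ⟪ 0R , 1R , 0R , 0R ⟫ b)) (trans (parity-ev 1R √2 (ul b) (ℓ b) _) (cong (λ x → (true ∧ x) xor (false ∧ parity (ℓ b)) xor false) eq)))
      where
      parity-ev : ∀ x y A l h → parity (x * A + y * l + √2 * (√2 * (√2 * 1R)) * h) ≡ (parity x ∧ parity A) xor (parity y ∧ parity l) xor false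
      parity-ev x y A l h = trans (parity-eval (x ∷ y ∷ A ∷ l ∷ h ∷ []) (plus (plus (times (var 0F) (var 2F)) (times (var 1F) (var 3F))) (times (times root2′ (times root2′ (times root2′ one′))) (var (suc 3F)))))
        (xor-assoc (parity x ∧ parity A) (parity y ∧ parity l))
        where
        xor-assoc : ∀ x y → (x xor y) xor false ≡ x xor y xor false
        xor-assoc false y = refl
        xor-assoc true false = refl
        xor-assoc true true = refl
    ... | true | no ∤ = ⟪ 0R , 0R , 1R , 0R ⟫ , refl , even⇒Level {mul ⟪ 0R , 0R , 1R , 0R ⟫ b}
      (trans (cong parity (ℓ-mul ⟪ 0R , 0R , 1R , 0R ⟫ b)) (trans (parity-+ (- 1R * ul b + (1R + √2) * ℓ b) (√2 * (√2 * (√2 * 1R)) * h)) (trans (cong₂ _xor_ (odd+odd { - 1R * ul b} {(1R + √2) * ℓ b} (odd*odd { - 1R} {ul b} refl eq) (odd*odd {1R + √2} {ℓ b} refl oddℓ)) (parity-* (√2 * (√2 * (√2 * 1R))) h)) refl)))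
      where
      h = co₁ ⟪ 0R , 0R , 1R , 0R ⟫ * co₂ b - co₂ ⟪ 0R , 0R , 1R , 0R ⟫ * co₁ b
      oddℓ : parity (ℓ b) ≡ true
      oddℓ with parity (ℓ b) in eq
      ... | true = refl
      ... | false = contradiction (even⇒Level {b} eq) ∤

  private
    odd-mul : ∀ u b → norm u ≡ 1R → parity (norm b) ≡ true → parity (norm (mul u b)) ≡ true
    odd-mul u b nu odd = trans (cong parity (trans (norm-mul u b) (cong (_* norm b) nu))) (trans (parity-* 1R (norm b)) odd)

  -- The multipliers are 1, f or g, then 1 or 1 - √2 f = -i, then 1 or f - g: twelve products, as
  -- many as the index of the level 3 units among all units.
  associate-in-𝒢 : ∀ b → parity (norm b) ≡ true → ∃ λ u → norm u ≡ 1R × Level 3 (mul u b)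
  associate-in-𝒢 b odd with raise-0 b odd
  ... | u₁ , n₁ , l₁ with odd-mul u₁ b n₁ odd
  ... | odd₁ with raise 1 ⟪ 1R , - √2 , 0R , 0R ⟫ (- 1R) (s≤s (s≤s z≤n)) refl refl refl refl (mul u₁ b) odd₁ (proj₁ (odd-diagonal {mul u₁ b} l₁ odd₁)) l₁
  ... | u₂ , n₂ , l₂ with odd-mul u₂ (mul u₁ b) n₂ odd₁
  ... | odd₂ with raise 2 ⟪ 0R , 1R , - 1R , 0R ⟫ 1R (s≤s (s≤s (s≤s z≤n))) refl refl refl refl (mul u₂ (mul u₁ b)) odd₂ (proj₁ (odd-diagonal {mul u₂ (mul u₁ b)} (Level-≤ {1} {2} {mul u₂ (mul u₁ b)} (s≤s z≤n) l₂) odd₂)) l₂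
  ... | u₃ , n₃ , l₃ = mul u₃ (mul u₂ u₁) , trans (norm-mul u₃ (mul u₂ u₁)) (trans (cong₂ _*_ n₃ (trans (norm-mul u₂ u₁) (cong₂ _*_ n₂ n₁))) refl) ,
    subst (Level 3) (sym (trans (mul-assoc u₃ (mul u₂ u₁) b) (cong (mul u₃) (mul-assoc u₂ u₁ b)))) l₃

-- Enumeration of the units of each level.

module UnitGroup where
  open import Data.Bool using (true; false)
  open import Data.List using (List; []; _∷_; _++_; length; map; filter; concatMap; deduplicate)
  open import Data.List.Membership.Propositional using (_∈_; lose)
  open import Data.List.Membership.Propositional.Properties using (∈-map⁺; ∈-concatMap⁺; ∈-filter⁺; ∈-filter⁻; ∈-deduplicate⁺; ∈-deduplicate⁻)
  open import Data.List.Relation.Unary.Any using (here; there)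
  import Data.List.Relation.Unary.Unique.DecPropositional.Properties as UniqueDec
  open import Relation.Nullary using (_×-dec_)
  open import Data.Integer using (+_)
  open import Data.Integer.DivMod using (_/ℕ_; _%ℕ_; a≡a%ℕn+[a/ℕn]*n; n%ℕd<d)
  open Quadruple
  open QuadraticIntegers
  open MaximalOrder
  open BezoutAndParity
  open EuclideanRing
  open EuclideanOrder
  open Units
  open Counting
  open Levels

  open IntegerRounding

  private
    Pair = ℤ × ℤ

    cost : Pair → ℕ
    cost (w , u) = ℤ.∣ w ∣ ℕ.* ℤ.∣ w ∣ ℕ.+ 2 ℕ.* (ℤ.∣ u ∣ ℕ.* ℤ.∣ u ∣)

    -- All pairs of a given cost. For an element of norm 1 the costs of its four coordinates add up
    -- to 4, so larger costs do not occur.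
    pairs : ℕ → List Pair
    pairs 0 = (+ 0 , + 0) ∷ []
    pairs 1 = (+ 1 , + 0) ∷ (-[1+ 0 ] , + 0) ∷ []
    pairs 2 = (+ 0 , + 1) ∷ (+ 0 , -[1+ 0 ]) ∷ []
    pairs 3 = (+ 1 , + 1) ∷ (+ 1 , -[1+ 0 ]) ∷ (-[1+ 0 ] , + 1) ∷ (-[1+ 0 ] , -[1+ 0 ]) ∷ []
    pairs 4 = (+ 2 , + 0) ∷ (-[1+ 1 ] , + 0) ∷ []
    pairs _ = []

    all-pairs : List Pair
    all-pairs = pairs 0 ++ pairs 1 ++ pairs 2 ++ pairs 3 ++ pairs 4

    big-w : ∀ n u → ¬ (suc (suc (suc n)) ℕ.* suc (suc (suc n)) ℕ.+ u ℕ.≤ 4)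
    big-w n u le = ℕₚ.<⇒≱ (ℕₚ.≤-trans (s≤s (s≤s (s≤s (s≤s (s≤s z≤n))))) (ℕₚ.≤-trans (ℕₚ.*-mono-≤ {3} {suc (suc (suc n))} {3} {suc (suc (suc n))} (s≤s (s≤s (s≤s z≤n))) (s≤s (s≤s (s≤s z≤n)))) (ℕₚ.m≤m+n _ u))) le

    big-u : ∀ w n → ¬ (w ℕ.+ 2 ℕ.* (suc (suc n) ℕ.* suc (suc n)) ℕ.≤ 4)
    big-u w n le = ℕₚ.<⇒≱ (ℕₚ.≤-trans (s≤s (s≤s (s≤s (s≤s (s≤s z≤n))))) (ℕₚ.≤-trans (ℕₚ.*-monoʳ-≤ 2 (ℕₚ.*-mono-≤ {2} {suc (suc n)} {2} {suc (suc n)} (s≤s (s≤s z≤n)) (s≤s (s≤s z≤n)))) (ℕₚ.m≤n+m _ w))) le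

    ∈-pairs : ∀ p → cost p ℕ.≤ 4 → p ∈ pairs (cost p)
    ∈-pairs (+ 0 , + 0) _ = here refl
    ∈-pairs (+ 0 , + 1) _ = here refl
    ∈-pairs (+ 0 , -[1+ 0 ]) _ = there (here refl)
    ∈-pairs (+ 1 , + 0) _ = here refl
    ∈-pairs (+ 1 , + 1) _ = here refl
    ∈-pairs (+ 1 , -[1+ 0 ]) _ = there (here refl)
    ∈-pairs (-[1+ 0 ] , + 0) _ = there (here refl)
    ∈-pairs (-[1+ 0 ] , + 1) _ = there (there (here refl))
    ∈-pairs (-[1+ 0 ] , -[1+ 0 ]) _ = there (there (there (here refl)))
    ∈-pairs (+ 2 , + 0) _ = here refl
    ∈-pairs (-[1+ 1 ] , + 0) _ = there (here refl)
    ∈-pairs (+ 2 , + suc u) le = contradiction le (ℕₚ.<⇒≱ (ℕₚ.+-monoʳ-≤ 4 (s≤s z≤n)))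
    ∈-pairs (+ 2 , -[1+ u ]) le = contradiction le (ℕₚ.<⇒≱ (ℕₚ.+-monoʳ-≤ 4 (s≤s z≤n)))
    ∈-pairs (-[1+ 1 ] , + suc u) le = contradiction le (ℕₚ.<⇒≱ (ℕₚ.+-monoʳ-≤ 4 (s≤s z≤n)))
    ∈-pairs (-[1+ 1 ] , -[1+ u ]) le = contradiction le (ℕₚ.<⇒≱ (ℕₚ.+-monoʳ-≤ 4 (s≤s z≤n)))
    ∈-pairs (+ suc (suc (suc n)) , u) le = contradiction le (big-w n _)
    ∈-pairs (-[1+ suc (suc n) ] , u) le = contradiction le (big-w n _)
    ∈-pairs (+ 0 , + suc (suc n)) le = contradiction le (big-u 0 n)
    ∈-pairs (+ 0 , -[1+ suc n ]) le = contradiction le (big-u 0 n)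
    ∈-pairs (+ 1 , + suc (suc n)) le = contradiction le (big-u 1 n)
    ∈-pairs (+ 1 , -[1+ suc n ]) le = contradiction le (big-u 1 n)
    ∈-pairs (-[1+ 0 ] , + suc (suc n)) le = contradiction le (big-u 1 n)
    ∈-pairs (-[1+ 0 ] , -[1+ suc n ]) le = contradiction le (big-u 1 n)

    pairs⊆all : ∀ c {p} → c ℕ.≤ 4 → p ∈ pairs c → p ∈ all-pairs
    pairs⊆all 0 _ (here refl) = here refl
    pairs⊆all 1 _ (here refl) = there (here refl)
    pairs⊆all 1 _ (there (here refl)) = there (there (here refl))
    pairs⊆all 2 _ (here refl) = there (there (there (here refl)))
    pairs⊆all 2 _ (there (here refl)) = there (there (there (there (here refl))))
    pairs⊆all 3 _ (here refl) = there (there (there (there (there (here refl)))))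
    pairs⊆all 3 _ (there (here refl)) = there (there (there (there (there (there (here refl))))))
    pairs⊆all 3 _ (there (there (here refl))) = there (there (there (there (there (there (there (here refl)))))))
    pairs⊆all 3 _ (there (there (there (here refl)))) = there (there (there (there (there (there (there (there (here refl))))))))
    pairs⊆all 4 _ (here refl) = there (there (there (there (there (there (there (there (there (here refl)))))))))
    pairs⊆all 4 _ (there (here refl)) = there (there (there (there (there (there (there (there (there (there (here refl))))))))))
    pairs⊆all (suc (suc (suc (suc (suc c))))) (s≤s (s≤s (s≤s (s≤s ())))) _

    ∈-all-pairs : ∀ p → cost p ℕ.≤ 4 → p ∈ all-pairs
    ∈-all-pairs p le = pairs⊆all (cost p) le (∈-pairs p le)

    half : ℤ → ℤ
    half x = x /ℕ 2

    half-double : ∀ k → half (+ 2 ℤ.* k) ≡ k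
    half-double k = go (+ 2 ℤ.* k %ℕ 2) (half (+ 2 ℤ.* k)) (n%ℕd<d (+ 2 ℤ.* k) 2) (a≡a%ℕn+[a/ℕn]*n (+ 2 ℤ.* k) 2)
      where
      e : ∀ r q → r ℤ.+ q ℤ.* + 2 ≡ + 2 ℤ.* q ℤ.+ r
      e = ℤ-Solver.solve-∀
      go : ∀ r q → r ℕ.< 2 → + 2 ℤ.* k ≡ + r ℤ.+ q ℤ.* + 2 → q ≡ k
      go 0 q _ eq = sym (ℤₚ.*-cancelˡ-≡ (+ 2) k q (trans eq (trans (e 0ℤ q) (ℤₚ.+-identityʳ (+ 2 ℤ.* q)))))
      go 1 q _ eq = contradiction (bit-unique false true k q (trans (ℤₚ.+-identityʳ (+ 2 ℤ.* k)) (trans eq (e 1ℤ q)))) λ ()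
      go (suc (suc _)) q (s≤s (s≤s ())) _

    -- Inverts `ℚ-part` and `√2-part`. Halving is a parameter of which only the values on even
    -- numbers matter; candidates with wrong parities give arbitrary elements, and filtering and
    -- deduplication take care of them.
    recover-with : (ℤ → ℤ) → Pair → Pair → Pair → Pair → 𝒪
    recover-with half (w₀ , u₀) (w₁ , u₁) (w₂ , u₂) (w₃ , u₃) =
      ⟪ half (w₀ ℤ.+ ℤ.- w₁ ℤ.+ ℤ.- w₂ ℤ.+ w₃) ⊕√2 half (u₀ ℤ.+ ℤ.- u₁ ℤ.+ ℤ.- u₂ ℤ.+ u₃)
      , u₁ ℤ.+ ℤ.- u₃ ⊕√2 half (w₁ ℤ.+ ℤ.- w₃)
      , u₂ ℤ.+ ℤ.- u₃ ⊕√2 half (w₂ ℤ.+ ℤ.- w₃)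
      , w₃ ⊕√2 u₃ ⟫

    coordinate : (co : Quat ℤ → ℤ) → 𝒪 → Pair
    coordinate co q = co (ℚ-part q) , co (√2-part q)

    recover : Pair → Pair → Pair → Pair → 𝒪
    recover = recover-with half

    module _ (h : ℤ → ℤ) (h-double : ∀ k → h (+ 2 ℤ.* k) ≡ k) where
      private
        recovered : 𝒪 → 𝒪
        recovered q = recover-with h (coordinate co₀ q) (coordinate co₁ q) (coordinate co₂ q) (coordinate co₃ q)

        halve-to : ∀ x k → x ≡ + 2 ℤ.* k → h x ≡ k
        halve-to x k eq = trans (cong h eq) (h-double k)

        e₁ : ∀ a₀ b₁ c₁ d₀ → (+ 2 ℤ.* a₀ ℤ.+ + 2 ℤ.* (b₁ ℤ.+ c₁) ℤ.+ d₀) ℤ.+ ℤ.- (+ 2 ℤ.* b₁ ℤ.+ d₀) ℤ.+ ℤ.- (+ 2 ℤ.* c₁ ℤ.+ d₀) ℤ.+ d₀ ≡ + 2 ℤ.* a₀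
        e₁ = ℤ-Solver.solve-∀
        e₂ : ∀ a₁ b₀ c₀ d₁ → (+ 2 ℤ.* a₁ ℤ.+ (b₀ ℤ.+ c₀) ℤ.+ d₁) ℤ.+ ℤ.- (b₀ ℤ.+ d₁) ℤ.+ ℤ.- (c₀ ℤ.+ d₁) ℤ.+ d₁ ≡ + 2 ℤ.* a₁
        e₂ = ℤ-Solver.solve-∀
        e₃ : ∀ x y → (x ℤ.+ y) ℤ.+ ℤ.- y ≡ x
        e₃ = ℤ-Solver.solve-∀

        recovered₀ : ∀ q → co₀ (recovered q) ≡ co₀ q
        recovered₀ ⟪ a₀ ⊕√2 a₁ , b₀ ⊕√2 b₁ , c₀ ⊕√2 c₁ , d₀ ⊕√2 d₁ ⟫ = cong₂ _⊕√2_
          (halve-to ((+ 2 ℤ.* a₀ ℤ.+ + 2 ℤ.* (b₁ ℤ.+ c₁) ℤ.+ d₀) ℤ.+ ℤ.- (+ 2 ℤ.* b₁ ℤ.+ d₀) ℤ.+ ℤ.- (+ 2 ℤ.* c₁ ℤ.+ d₀) ℤ.+ d₀) a₀ (e₁ a₀ b₁ c₁ d₀))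
          (halve-to ((+ 2 ℤ.* a₁ ℤ.+ (b₀ ℤ.+ c₀) ℤ.+ d₁) ℤ.+ ℤ.- (b₀ ℤ.+ d₁) ℤ.+ ℤ.- (c₀ ℤ.+ d₁) ℤ.+ d₁) a₁ (e₂ a₁ b₀ c₀ d₁))
        recovered₁ : ∀ q → co₁ (recovered q) ≡ co₁ q
        recovered₁ ⟪ a₀ ⊕√2 a₁ , b₀ ⊕√2 b₁ , c₀ ⊕√2 c₁ , d₀ ⊕√2 d₁ ⟫ =
          cong₂ _⊕√2_ (e₃ b₀ d₁) (halve-to ((+ 2 ℤ.* b₁ ℤ.+ d₀) ℤ.+ ℤ.- d₀) b₁ (e₃ (+ 2 ℤ.* b₁) d₀))
        recovered₂ : ∀ q → co₂ (recovered q) ≡ co₂ q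
        recovered₂ ⟪ a₀ ⊕√2 a₁ , b₀ ⊕√2 b₁ , c₀ ⊕√2 c₁ , d₀ ⊕√2 d₁ ⟫ =
          cong₂ _⊕√2_ (e₃ c₀ d₁) (halve-to ((+ 2 ℤ.* c₁ ℤ.+ d₀) ℤ.+ ℤ.- d₀) c₁ (e₃ (+ 2 ℤ.* c₁) d₀))
        recovered₃ : ∀ q → co₃ (recovered q) ≡ co₃ q
        recovered₃ ⟪ a₀ ⊕√2 a₁ , b₀ ⊕√2 b₁ , c₀ ⊕√2 c₁ , d₀ ⊕√2 d₁ ⟫ = refl

      recover-coordinates : ∀ q → recover-with h (coordinate co₀ q) (coordinate co₁ q) (coordinate co₂ q) (coordinate co₃ q) ≡ q
      recover-coordinates q = Quat-ext (recovered₀ q) (recovered₁ q) (recovered₂ q) (recovered₃ q)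

    -- The fourth coordinate has to use up the cost left by the first three, which shortens the
    -- search; the argument is the cost already spent.
    remaining : ℕ → List Pair
    remaining 0 = pairs 4
    remaining 1 = pairs 3
    remaining 2 = pairs 2
    remaining 3 = pairs 1
    remaining 4 = pairs 0
    remaining _ = []

    pairs≡remaining : ∀ s c → s ℕ.+ c ≡ 4 → pairs c ≡ remaining s
    pairs≡remaining 0 .4 refl = refl
    pairs≡remaining 1 .3 refl = refl
    pairs≡remaining 2 .2 refl = refl
    pairs≡remaining 3 .1 refl = refl
    pairs≡remaining 4 .0 refl = refl
    pairs≡remaining (suc (suc (suc (suc (suc s))))) c ()

    candidates₃ : Pair → Pair → Pair → List 𝒪
    candidates₃ p₀ p₁ p₂ = map (recover p₀ p₁ p₂) (remaining (cost p₀ ℕ.+ cost p₁ ℕ.+ cost p₂))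

    candidates₂ : Pair → Pair → List 𝒪
    candidates₂ p₀ p₁ = concatMap (candidates₃ p₀ p₁) all-pairs

    candidates₁ : Pair → List 𝒪
    candidates₁ p₀ = concatMap (candidates₂ p₀) all-pairs

    candidates : List 𝒪
    candidates = concatMap candidates₁ all-pairs

    ∈-candidates : ∀ p₀ p₁ p₂ p₃ → cost p₀ ℕ.+ cost p₁ ℕ.+ cost p₂ ℕ.+ cost p₃ ≡ 4 → recover p₀ p₁ p₂ p₃ ∈ candidates
    ∈-candidates p₀ p₁ p₂ p₃ eq =
      ∈-concatMap⁺ candidates₁ (lose (∈-all-pairs p₀ (≤4 (ℕₚ.≤-trans (ℕₚ.m≤m+n (cost p₀) (cost p₁)) (ℕₚ.m≤m+n (cost p₀ ℕ.+ cost p₁) (cost p₂)))))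
      (∈-concatMap⁺ (candidates₂ p₀) (lose (∈-all-pairs p₁ (≤4 (ℕₚ.≤-trans (ℕₚ.m≤n+m (cost p₁) (cost p₀)) (ℕₚ.m≤m+n (cost p₀ ℕ.+ cost p₁) (cost p₂)))))
      (∈-concatMap⁺ (candidates₃ p₀ p₁) (lose (∈-all-pairs p₂ (≤4 (ℕₚ.m≤n+m (cost p₂) (cost p₀ ℕ.+ cost p₁))))
      (∈-map⁺ (recover p₀ p₁ p₂) (subst (p₃ ∈_) (pairs≡remaining (cost p₀ ℕ.+ cost p₁ ℕ.+ cost p₂) (cost p₃) eq)
        (∈-pairs p₃ (subst (cost p₃ ℕ.≤_) eq (ℕₚ.m≤n+m (cost p₃) (cost p₀ ℕ.+ cost p₁ ℕ.+ cost p₂)))))))))))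
      where
      ≤4 : ∀ {c} → c ℕ.≤ cost p₀ ℕ.+ cost p₁ ℕ.+ cost p₂ → c ℕ.≤ 4
      ≤4 {c} le = subst (c ℕ.≤_) eq (ℕₚ.≤-trans le (ℕₚ.m≤m+n (cost p₀ ℕ.+ cost p₁ ℕ.+ cost p₂) (cost p₃)))

    total-cost : ∀ q → norm q ≡ 1R → cost (coordinate co₀ q) ℕ.+ cost (coordinate co₁ q) ℕ.+ cost (coordinate co₂ q) ℕ.+ cost (coordinate co₃ q) ≡ 4
    total-cost q norm≡1 = ℤₚ.+-injective (trans (sum4 (ℚ-part q) (√2-part q)) (cong re (trans (sym (4*norm q)) (cong (int (+ 4) *_) norm≡1))))
      where
      pos-cost : ∀ w u → + cost (w , u) ≡ w ℤ.* w ℤ.+ + 2 ℤ.* (u ℤ.* u)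
      pos-cost w u = cong₂ ℤ._+_ (sq w) (trans (ℤₚ.pos-* 2 (ℤ.∣ u ∣ ℕ.* ℤ.∣ u ∣)) (cong (+ 2 ℤ.*_) (sq u)))
        where
        sq : ∀ x → + (ℤ.∣ x ∣ ℕ.* ℤ.∣ x ∣) ≡ x ℤ.* x
        sq (+ n) = ℤₚ.pos-* n n
        sq -[1+ n ] = refl
      e : ∀ a b c d s t u v → (a ℤ.* a ℤ.+ + 2 ℤ.* (s ℤ.* s)) ℤ.+ (b ℤ.* b ℤ.+ + 2 ℤ.* (t ℤ.* t)) ℤ.+ (c ℤ.* c ℤ.+ + 2 ℤ.* (u ℤ.* u)) ℤ.+ (d ℤ.* d ℤ.+ + 2 ℤ.* (v ℤ.* v))
        ≡ (a ℤ.* a ℤ.+ b ℤ.* b ℤ.+ c ℤ.* c ℤ.+ d ℤ.* d) ℤ.+ + 2 ℤ.* (s ℤ.* s ℤ.+ t ℤ.* t ℤ.+ u ℤ.* u ℤ.+ v ℤ.* v)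
      e = ℤ-Solver.solve-∀
      sum4 : ∀ w u → + (cost (co₀ w , co₀ u) ℕ.+ cost (co₁ w , co₁ u) ℕ.+ cost (co₂ w , co₂ u) ℕ.+ cost (co₃ w , co₃ u)) ≡ w · w ℤ.+ + 2 ℤ.* u · u
      sum4 ⟪ a , b , c , d ⟫ ⟪ s , t , u , v ⟫ = trans (cong₂ ℤ._+_ (cong₂ ℤ._+_ (cong₂ ℤ._+_ (pos-cost a s) (pos-cost b t)) (pos-cost c u)) (pos-cost d v)) (e a b c d s t u v)

  IsUnit : ℕ → 𝒪 → Set
  IsUnit n u = norm u ≡ 1R × Level n u

  private
    IsUnit? : ∀ n u → Dec (IsUnit n u)
    IsUnit? n u = (norm u ≟ᴿ 1R) ×-dec Level? n u

    units : ℕ → List 𝒪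
    units n = deduplicate _≟𝒪_ (filter (IsUnit? n) candidates)

    card-units′ : ∀ n → Card (IsUnit n) (length (units n))
    card-units′ n = card (units n) (UniqueDec.deduplicate-! _≟𝒪_ _)
      (λ u u∈ → proj₂ (∈-filter⁻ (IsUnit? n) {xs = candidates} (∈-deduplicate⁻ _≟𝒪_ (filter (IsUnit? n) candidates) u∈)))
      (λ u unit → ∈-deduplicate⁺ _≟𝒪_ (∈-filter⁺ (IsUnit? n) (subst (_∈ candidates) (recover-coordinates half half-double u) (∈-candidates (coordinate co₀ u) (coordinate co₁ u) (coordinate co₂ u) (coordinate co₃ u) (total-cost u (proj₁ unit)))) unit))
      refl

    -- By evaluation of the search. The group of order 48 is the binary octahedral group.
    length-units : length (units 0) ≡ 48 × length (units 1) ≡ 16 × length (units 2) ≡ 8 × length (units 3) ≡ 4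
    length-units = refl , refl , refl , refl

  card-units : Card (IsUnit 0) 48 × Card (IsUnit 1) 16 × Card (IsUnit 2) 8 × Card (IsUnit 3) 4
  card-units = card-≡ (proj₁ length-units) (card-units′ 0) , card-≡ (proj₁ (proj₂ length-units)) (card-units′ 1) ,
    card-≡ (proj₁ (proj₂ (proj₂ length-units))) (card-units′ 2) , card-≡ (proj₂ (proj₂ (proj₂ length-units))) (card-units′ 3)

-- Elements of odd reduced norm.

module OddNorms where
  open import Data.Nat.ListAction using (sum)
  open import Data.Bool using (Bool; true)
  open import Data.List using (List; []; _∷_; length; map)
  open import Data.List.Membership.Propositional using (_∈_)
  open import Data.List.Relation.Unary.Unique.Propositional using (Unique)
  open import Data.Integer using (+_)
  open import Data.Integer.Divisibility.Signed using (divides)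
  open import Tactic.RingSolver using (solve-∀)
  open Quadruple
  open QuadraticIntegers
  open MaximalOrder
  open BezoutAndParity
  open EuclideanRing
  open EuclideanOrder
  open SumsOfTwoSquares
  open Units
  open MatrixSplitting
  open LeftIdeals
  open Counting
  open ResidueSystems
  open Levels
  open UnitGroup

  -- Completing the square, 2κ = (√2 x + z - 1)² + z² + 1, turns a solution of a² + b² + 1 ≡ 0 into a zero of κ.
  conic : ∀ H a b k → int a * int a + int b * int b + 1R ≡ int k * (2R * H - 1R) →
    κ (√2 * H * (int a - int b + 1R)) (int b) ≡ (2R * H - 1R) * (H * (int k + 2R * int a * (int a - int b + 1R) + (2R * H - 1R) * ((int a - int b + 1R) * (int a - int b + 1R))) - κ (√2 * H * (int a - int b + 1R)) (int b))
  conic H a b k eq = conic′ H (int a) (int b) (int k) (κ (√2 * H * (int a - int b + 1R)) (int b)) twice eq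
    where
    -- H inverts 2 modulo 2H - 1. With z = b this x has √2 x congruent to a - b + 1, so the
    -- completed square is a² up to multiples of 2H - 1.
    twice : 2R * κ (√2 * H * (int a - int b + 1R)) (int b) ≡
      (int a + (2R * H - 1R) * (int a - int b + 1R)) * (int a + (2R * H - 1R) * (int a - int b + 1R)) + int b * int b + 1R
    twice = e H (int a) (int b)
      where
      e : ∀ H a b → let x = √2 * H * (a - b + 1R) in
        2R * (x * x + √2 * x * b + b * b - √2 * x - b + 1R) ≡ (a + (2R * H - 1R) * (a - b + 1R)) * (a + (2R * H - 1R) * (a - b + 1R)) + b * b + 1R
      e = solve-∀ RR
    -- K = H (2K) - (2H - 1) K is divisible by 2H - 1 as soon as 2K is.
    conic′ : ∀ H a b k K → 2R * K ≡ (a + (2R * H - 1R) * (a - b + 1R)) * (a + (2R * H - 1R) * (a - b + 1R)) + b * b + 1R →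
      a * a + b * b + 1R ≡ k * (2R * H - 1R) →
      K ≡ (2R * H - 1R) * (H * (k + 2R * a * (a - b + 1R) + (2R * H - 1R) * ((a - b + 1R) * (a - b + 1R))) - K)
    conic′ H a b k K 2K≡ sq≡ = trans (e₁ H K) (trans (cong (λ y → H * y - (2R * H - 1R) * K) (trans 2K≡ (trans (e₂ H a b (a - b + 1R)) (cong (λ y → y + (2R * H - 1R) * (2R * a * (a - b + 1R) + (2R * H - 1R) * ((a - b + 1R) * (a - b + 1R)))) sq≡))))
      (e₃ H k (2R * a * (a - b + 1R)) ((a - b + 1R) * (a - b + 1R)) K))
      where
      e₁ : ∀ H K → K ≡ H * (2R * K) - (2R * H - 1R) * K
      e₁ = solve-∀ RR
      e₂ : ∀ H a b t → (a + (2R * H - 1R) * t) * (a + (2R * H - 1R) * t) + b * b + 1R ≡ (a * a + b * b + 1R) + (2R * H - 1R) * (2R * a * t + (2R * H - 1R) * (t * t))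
      e₂ = solve-∀ RR
      e₃ : ∀ H k s t K → H * (k * (2R * H - 1R) + (2R * H - 1R) * (s + (2R * H - 1R) * t)) - (2R * H - 1R) * K ≡ (2R * H - 1R) * (H * (k + s + (2R * H - 1R) * t) - K)
      e₃ = solve-∀ RR

  record Splitting (α : ℤ[√2]) : Set where
    field
      {x z n c ν} : ℤ[√2]
      κ≡ : κ x z ≡ n * c
      n≡ : n ≡ α * (α * ν)

  -- The modulus is n = (nm α)² = α² (bar α)²: an odd positive integer, so that -1 is a sum of two
  -- squares modulo n, and a multiple of α².
  splitting : ∀ α → parity α ≡ true → Splitting α
  splitting α odd = go (odd-abs (nm α) odd-nm)
    where
    odd-nm : parityℤ (nm α) ≡ true
    odd-nm = nm-parity α odd
      where
      nm-parity : ∀ α → parity α ≡ true → parityℤ (nm α) ≡ true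
      nm-parity (a ⊕√2 b) odd = trans (parityℤ-+ (a ℤ.* a) (ℤ.- (+ 2 ℤ.* (b ℤ.* b)))) (trans (cong₂ Data.Bool._xor_ (trans (parityℤ-* a a) (cong₂ Data.Bool._∧_ odd odd)) (trans (parityℤ-neg (+ 2 ℤ.* (b ℤ.* b))) (parityℤ-* (+ 2) (b ℤ.* b)))) refl)
    odd-abs : ∀ z → parityℤ z ≡ true → ∃ λ h → z ℤ.* z ≡ + suc (h ℕ.+ h)
    odd-abs z odd with halve (z ℤ.* z)
    ... | halved b k eq with trans (sym (parityℤ-unique b k eq)) (trans (parityℤ-* z z) (cong₂ Data.Bool._∧_ odd odd))
    ... | refl = go k (IntegerRounding.0≤sq z) eq
      where
      go : ∀ k {s} → 0ℤ ℤ.≤ s → s ≡ + 2 ℤ.* k ℤ.+ 1ℤ → ∃ λ h → s ≡ + suc (h ℕ.+ h)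
      go (+ h) _ eq = h , trans eq (e (+ h))
        where e : ∀ h → + 2 ℤ.* h ℤ.+ 1ℤ ≡ 1ℤ ℤ.+ (h ℤ.+ h)
              e = ℤ-Solver.solve-∀
      go -[1+ h ] 0≤s refl = contradiction 0≤s (ℤₚ.<⇒≱ (subst (ℤ._< 0ℤ) (sym (e (+ h))) ℤ.-<+))
        where e : ∀ h → + 2 ℤ.* ℤ.- (1ℤ ℤ.+ h) ℤ.+ 1ℤ ≡ ℤ.- (1ℤ ℤ.+ (h ℤ.+ h))
              e = ℤ-Solver.solve-∀
    go : (∃ λ h → nm α ℤ.* nm α ≡ + suc (h ℕ.+ h)) → Splitting α
    go (h , n²≡) = from-sum-of-squares (minusOneIsSumOfSquares h)
      where
      H : ℤ[√2]
      H = int (+ h ℤ.+ 1ℤ)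
      n≡int : 2R * H - 1R ≡ int (nm α ℤ.* nm α)
      n≡int = trans (cong (_- 1R) (int-* (+ 2) (+ h ℤ.+ 1ℤ) 0ℤ)) (cong₂ _⊕√2_ (trans (e (+ h)) (sym n²≡)) refl)
        where e : ∀ h → + 2 ℤ.* (h ℤ.+ 1ℤ) ℤ.+ ℤ.- 1ℤ ≡ 1ℤ ℤ.+ (h ℤ.+ h)
              e = ℤ-Solver.solve-∀
      n≡α²ν : 2R * H - 1R ≡ α * (α * (bar α * bar α))
      n≡α²ν = trans n≡int (trans (sym (int-int (nm α) (nm α))) (trans (cong₂ _*_ (sym (*-bar α)) (sym (*-bar α))) (e α (bar α))))
        where e : ∀ α β → (α * β) * (α * β) ≡ α * (α * (β * β))
              e = solve-∀ RR
      from-sum-of-squares : MinusOneIsSumOfSquaresMod (suc (h ℕ.+ h)) → Splitting α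
      from-sum-of-squares (a , b , divides k eq) = record
        { x = √2 * H * (int a - int b + 1R) ; z = int b ; n = 2R * H - 1R ; ν = bar α * bar α
        ; c = H * (int k + 2R * int a * (int a - int b + 1R) + (2R * H - 1R) * ((int a - int b + 1R) * (int a - int b + 1R))) - κ (√2 * H * (int a - int b + 1R)) (int b)
        ; κ≡ = conic H a b k squares ; n≡ = n≡α²ν }
        where
        squares : int a * int a + int b * int b + 1R ≡ int k * (2R * H - 1R)
        squares = trans (cong₂ (λ s t → s + t + 1R) (int-int a a) (int-int b b)) (trans (cong int eq) (trans (sym (int-int k (+ suc (h ℕ.+ h)))) (cong (int k *_) (trans (cong int (sym n²≡)) (sym n≡int)))))

  Represents : ℕ → ℤ[√2] → 𝒪 → Set
  Represents N α q = norm q ≡ α × Level N q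

  record DivisorSystem (α : ℤ[√2]) (ds : List ℤ[√2]) : Set where
    field
      unique : Unique ds
      divisor : ∀ {δ} → δ ∈ ds → δ ∣ᴿ α
      inequivalent : ∀ {δ δ'} → δ ∈ ds → δ' ∈ ds → δ ∣ᴿ δ' → δ' ∣ᴿ δ → δ ≡ δ'
      exhaustive : ∀ δ → δ ∣ᴿ α → ∃ λ δ' → δ' ∈ ds × δ ∣ᴿ δ' × δ' ∣ᴿ δ

  -- Right multiplication by conj b turns b into the scalar norm b.
  mul-cancelʳ : ∀ {b u u'} → norm b ≢ 0R → mul u b ≡ mul u' b → u ≡ u'
  mul-cancelʳ {b} {u} {u'} nb≢0 eq = Quat-ext (coordinate co₀ (λ { ⟪ _ , _ , _ , _ ⟫ → refl })) (coordinate co₁ (λ { ⟪ _ , _ , _ , _ ⟫ → refl })) (coordinate co₂ (λ { ⟪ _ , _ , _ , _ ⟫ → refl })) (coordinate co₃ (λ { ⟪ _ , _ , _ , _ ⟫ → refl }))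
    where
    back : ∀ v → mul (mul v b) (conj b) ≡ scale (norm b) v
    back v = trans (mul-assoc v b (conj b)) (trans (cong (mul v) (mul-conj b)) (mul-scalar v (norm b)))
    scaled : scale (norm b) u ≡ scale (norm b) u'
    scaled = trans (sym (back u)) (trans (cong (λ v → mul v (conj b)) eq) (back u'))
    coordinate : (co : 𝒪 → ℤ[√2]) → (∀ v → co (scale (norm b) v) ≡ norm b * co v) → co u ≡ co u'
    coordinate co eq' = *-cancelˡ nb≢0 (trans (sym (eq' u)) (trans (cong co scaled) (eq' u')))

  module _ {α : ℤ[√2]} (pos : Positive α) (odd : parity α ≡ true) (N : ℕ) (N≤3 : N ℕ.≤ 3) {w : ℕ} (units : Card (IsUnit N) w) where
    open Splitting (splitting α odd)

    private
      α≢0 : α ≢ 0R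
      α≢0 = positive≢0 pos

    open RowIdeals x z n c κ≡ α ν α≢0 n≡

    private
      _~_ : 𝒪 → ℤ[√2] → Set
      q ~ δ = ∃₂ λ γ t → γ * δ ≡ α × InIdeal γ t δ q

      module _ {γ δ : ℤ[√2]} (γδ≡α : γ * δ ≡ α) where
        -- The elements of norm α in one ideal are the products u b of a generator b with the units
        -- u. A generator in 𝒢 gives u b level N exactly when u has it, so the units of level N are
        -- counted.
        fibre : ∀ t → Card (λ q → Represents N α q × InIdeal γ t δ q) w
        fibre t = build (generator γδ≡α pos)
          where
          build : (∃ λ b → norm b ≡ α × InIdeal γ t δ b × (∀ q → InIdeal γ t δ q → ∃ λ y → q ≡ mul y b)) → Card (λ q → Represents N α q × InIdeal γ t δ q) w
          build (b₁ , norm-b₁ , b₁-in , multiple) = adjust (associate-in-𝒢 b₁ (trans (cong parity norm-b₁) odd))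
            where
            adjust : (∃ λ v → norm v ≡ 1R × Level 3 (mul v b₁)) → Card (λ q → Represents N α q × InIdeal γ t δ q) w
            adjust (v , norm-v , lev) = card-map (λ u → mul u b) (mul-cancelʳ {b} nb≢0) to from units
              where
              b : 𝒪
              b = mul v b₁
              norm-b : norm b ≡ α
              norm-b = trans (norm-mul v b₁) (trans (cong₂ _*_ norm-v norm-b₁) (R.*-identityˡ α))
              nb≢0 : norm b ≢ 0R
              nb≢0 eq = α≢0 (trans (sym norm-b) eq)
              b-in : InIdeal γ t δ b
              b-in = in-mul γδ≡α v b₁-in
              to : ∀ u → IsUnit N u → Represents N α (mul u b) × InIdeal γ t δ (mul u b)
              to u (norm-u , lev-u) = (trans (norm-mul u b) (trans (cong₂ _*_ norm-u norm-b) (R.*-identityˡ α)) , Level-mul u {b} N≤3 lev lev-u) , in-mul γδ≡α u b-in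
              b₁≡ : b₁ ≡ mul (conj v) b
              b₁≡ = sym (trans (sym (mul-assoc (conj v) v b₁)) (trans (cong (λ s → mul s b₁) (trans (conj-mul-self v) (cong scalar norm-v))) (trans (scalar-mul b₁ 1R) (scale-one b₁))))
              from : ∀ q → Represents N α q × InIdeal γ t δ q → ∃ λ u → IsUnit N u × q ≡ mul u b
              from q ((norm-q , lev-q) , q-in) = let (y , q≡) = multiple q q-in in finish (mul y (conj v)) (trans q≡ (trans (cong (mul y) b₁≡) (sym (mul-assoc y (conj v) b))))
                where
                finish : ∀ y → q ≡ mul y b → ∃ λ u → IsUnit N u × q ≡ mul u b
                finish y q≡ = y , (norm-y , Level-mul⁻ y {b} N≤3 lev (trans (cong parity norm-b) odd) (subst (Level N) q≡ lev-q)) , q≡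
                  where
                  norm-y : norm y ≡ 1R
                  norm-y = *-cancelˡ α≢0 (trans (R.*-comm α (norm y)) (trans (cong (norm y *_) (sym norm-b)) (trans (sym (norm-mul y b)) (trans (cong norm (sym q≡)) (trans norm-q (sym (R.*-identityʳ α)))))))

        δ≢0 : δ ≢ 0R
        δ≢0 refl = α≢0 (trans (sym γδ≡α) (R.zeroʳ γ))

        -- By `same-shift` incongruent t give disjoint fibres, and by `in-shift` the residues modulo
        -- δ reach all of them.
        class : Card (λ q → Represents N α q × q ~ δ) (ℤ.∣ nm δ ∣ ℕ.* w)
        class = card-≡ (trans (sum-const residues) (cong (ℕ._* w) length≡))
          (card-fibres {_~_ = λ q t → InIdeal γ t δ q} (λ _ → w) residues unique
            (λ q t∈ t'∈ ((norm-q , _) , _) i i' → incongruent t∈ t'∈ (same-shift γδ≡α norm-q i i'))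
            (λ {t} t∈ → card-cong (λ q (r , i) → (r , γ , t , γδ≡α , i) , i) (λ q ((r , _) , i) → r , i) (fibre t))
            cover)
          where
          open Residues (residuesMod δ δ≢0)
          sum-const : ∀ (ts : List ℤ[√2]) → sum (map (λ _ → w) ts) ≡ length ts ℕ.* w
          sum-const [] = refl
          sum-const (_ ∷ ts) = cong (w ℕ.+_) (sum-const ts)
          cover : ∀ q → Represents N α q × q ~ δ → ∃ λ t → t ∈ residues × InIdeal γ t δ q
          cover q (_ , γ' , t , γ'δ≡α , i) = let (r , r∈ , δ∣) = complete t in r , r∈ , in-shift γδ≡α δ∣ (subst (λ γ → InIdeal γ t δ q) γ'≡γ i)
            where
            γ'≡γ : γ' ≡ γ
            γ'≡γ = *-cancelˡ δ≢0 (trans (R.*-comm δ γ') (trans γ'δ≡α (trans (sym γδ≡α) (R.*-comm γ δ))))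

    odd-count : ∀ {ds} → DivisorSystem α ds → Card (Represents N α) (sum (map (λ δ → ℤ.∣ nm δ ∣ ℕ.* w) ds))
    odd-count {ds} system = card-fibres {_~_ = _~_} (λ δ → ℤ.∣ nm δ ∣ ℕ.* w) ds unique disjoint (λ δ∈ → let (γ , α≡) = divisor δ∈ in class (trans (R.*-comm γ _) (sym α≡))) cover
      where
      open DivisorSystem system
      disjoint : ∀ {δ δ'} q → δ ∈ ds → δ' ∈ ds → Represents N α q → q ~ δ → q ~ δ' → δ ≡ δ'
      disjoint q δ∈ δ'∈ (norm-q , _) (γ , t , γδ≡α , i) (γ' , t' , γ'δ'≡α , i') =
        inequivalent δ∈ δ'∈ (δ'∣δ γ'δ'≡α γδ≡α norm-q i' i) (δ'∣δ γδ≡α γ'δ'≡α norm-q i i')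
      cover : ∀ q → Represents N α q → ∃ λ δ → δ ∈ ds × q ~ δ
      cover q (norm-q , _) = let (γ₀ , δ₀ , γ₀δ₀≡α , form) = has-hermite-form q norm-q
                                 (δ , δ∈ , (η , δ≡) , (η' , δ₀≡)) = exhaustive δ₀ (γ₀ , trans (sym γ₀δ₀≡α) (R.*-comm γ₀ δ₀))
                                 (γδ≡α , t , i) = form {δ} {η} {η'} δ≡ δ₀≡
                             in δ , δ∈ , γ₀ * η' , t , γδ≡α , i

-- Division by elements of norm π.

module EvenNorms where
  open import Data.Bool using (Bool; true; false; _∧_)
  import Data.Bool as Bool
  open import Data.Fin.Patterns using (0F; 1F; 2F; 3F; 4F; 5F; 6F; 7F)
  open import Data.Vec as Vec using ([]; _∷_)
  open import Data.Sum using () renaming ([_,_] to either)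
  open import Relation.Nullary using (_×-dec_)
  open import Data.Integer using (+_)
  open import Tactic.RingSolver using (solve-∀)
  open Quadruple
  open QuadraticIntegers
  open MaximalOrder
  open EuclideanRing
  open EuclideanOrder
  open Units
  open Counting
  open Levels
  open OddNorms
  open IdentitySolver

  -- the totally positive generator of √2 ℤ[√2]
  π : ℤ[√2]
  π = + 2 ⊕√2 + 1

  -- Locally at √2, right multiplication by 𝔰 is right multiplication by diag(√2 , 1), and 𝔴 generates the normaliser of level 1.
  𝔰 𝔴 : 𝒪
  𝔰 = ⟪ 1R , 1R , 0R , - 1R - √2 ⟫
  𝔴 = ⟪ 1R , 1R , 1R , - √2 ⟫

  private
    𝔰ᵗ 𝔴ᵗ : ∀ {k m} → QTerm k m
    𝔰ᵗ = :⟪ con 1R , con 1R , con 0R , con (- 1R - √2) ⟫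
    𝔴ᵗ = :⟪ con 1R , con 1R , con 1R , con (- √2) ⟫

  Even : ℤ[√2] → Set
  Even x = parity x ≡ false

  -- c, d, m, k parametrise the q with ul q = √2 m and ℓ q = √2 k; the left factor is q (conj 𝔰) / π
  -- written out.
  𝔰-factor : ∀ c d m k → ⟪ c - d + √2 * m , c + (1R - √2) * d + √2 * k , c , d ⟫ ≡ mul ⟪ c - √2 * c + d - √2 * d - k + √2 * k , c - √2 * c + int (+ 3) * d - 2R * √2 * d - 2R * k + √2 * k + m - √2 * m , c - √2 * c - k , 2R * c + d - √2 * d + √2 * k + m ⟫ 𝔰
  𝔰-factor c d m k = solveQ {0} {4} (:⟪ s₀ :- s₁ :+ (con √2) :* s₂ , s₀ :+ ((con 1R) :- (con √2)) :* s₁ :+ (con √2) :* s₃ , s₀ , s₁ ⟫) (mulᵗ :⟪ s₀ :- (con √2) :* s₀ :+ s₁ :- (con √2) :* s₁ :- s₃ :+ (con √2) :* s₃ , s₀ :- (con √2) :* s₀ :+ (con (int (+ 3))) :* s₁ :- (con 2R) :* (con √2) :* s₁ :- (con 2R) :* s₃ :+ (con √2) :* s₃ :+ s₂ :- (con √2) :* s₂ , s₀ :- (con √2) :* s₀ :- s₃ , (con 2R) :* s₀ :+ s₁ :- (con √2) :* s₁ :+ (con √2) :* s₃ :+ s₂ ⟫ 𝔰ᵗ) refl [] (c ∷ d ∷ m ∷ k ∷ [])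

  -- Here ul q = √2 m, ℓ q = √2 l, and the last coordinate √2 k is even too.
  𝔴-factor : ∀ c k l m → ⟪ c - √2 * k + √2 * m , c + (1R - √2) * (√2 * k) + √2 * l , c , √2 * k ⟫ ≡ mul ⟪ c - int (+ 4) * k + 2R * √2 * k - l + √2 * l + m , √2 * l - int (+ 4) * k + int (+ 3) * √2 * k - l + m - √2 * m , c - √2 * c - int (+ 4) * k + int (+ 3) * √2 * k - 2R * l + √2 * l + m - √2 * m , c - int (+ 4) * k + int (+ 3) * √2 * k - l + √2 * l + 2R * m - √2 * m ⟫ 𝔴
  𝔴-factor c k l m = solveQ {0} {4} (:⟪ s₀ :- (con √2) :* s₁ :+ (con √2) :* s₃ , s₀ :+ ((con 1R) :- (con √2)) :* ((con √2) :* s₁) :+ (con √2) :* s₂ , s₀ , (con √2) :* s₁ ⟫) (mulᵗ :⟪ s₀ :- (con (int (+ 4))) :* s₁ :+ (con 2R) :* (con √2) :* s₁ :- s₂ :+ (con √2) :* s₂ :+ s₃ , (con √2) :* s₂ :- (con (int (+ 4))) :* s₁ :+ (con (int (+ 3))) :* (con √2) :* s₁ :- s₂ :+ s₃ :- (con √2) :* s₃ , s₀ :- (con √2) :* s₀ :- (con (int (+ 4))) :* s₁ :+ (con (int (+ 3))) :* (con √2) :* s₁ :- (con 2R) :* s₂ :+ (con √2) :* s₂ :+ s₃ :- (con √2) :* s₃ , s₀ :- (con (int (+ 4))) :* s₁ :+ (con (int (+ 3))) :* (con √2) :* s₁ :- s₂ :+ (con √2) :* s₂ :+ (con 2R) :*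 s₃ :- (con √2) :* s₃ ⟫ 𝔴ᵗ) refl [] (c ∷ k ∷ l ∷ m ∷ [])

  -- Right multiplication by 𝔰 raises a level of at most 2 by one, and division lowers it by one:
  -- the error term is a multiple of 2 = √2².
  ℓ-𝔰 : ∀ q → ℓ (mul q 𝔰) ≡ √2 * (- ℓ q - 2R * co₂ q)
  ℓ-𝔰 q = solveS {1} {0} (ℓᵗ (mulᵗ q₀ 𝔰ᵗ)) ((con √2) :* (:neg ℓᵗ q₀ :- (con 2R) :* co₂ᵗ q₀)) refl (q ∷ []) []

  ul-𝔰 : ∀ q → ul (mul q 𝔰) ≡ √2 * (co₂ q - co₀ q - 2R * √2 * co₁ q - 2R * co₁ q - co₃ q)
  ul-𝔰 q = solveS {1} {0} (ulᵗ (mulᵗ q₀ 𝔰ᵗ)) ((con √2) :* (co₂ᵗ q₀ :- co₀ᵗ q₀ :- (con 2R) :* (con √2) :* co₁ᵗ q₀ :- (con 2R) :* co₁ᵗ q₀ :- co₃ᵗ q₀)) refl (q ∷ []) []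

  ℓ-conj : ∀ q → ℓ (conj q) ≡ (- 1R) * ℓ q
  ℓ-conj q = solveS {1} {0} (ℓᵗ (conjᵗ q₀)) ((:neg (con 1R)) :* ℓᵗ q₀) refl (q ∷ []) []

  ul-conj : ∀ q → ul (conj q) ≡ lr q
  ul-conj q = solveS {1} {0} (ulᵗ (conjᵗ q₀)) (lrᵗ q₀) refl (q ∷ []) []

  lr-conj : ∀ q → lr (conj q) ≡ ul q
  lr-conj q = solveS {1} {0} (lrᵗ (conjᵗ q₀)) (ulᵗ q₀) refl (q ∷ []) []

  parity-ul-mul : ∀ q r → parity (ul (mul q r)) ≡ B.ul (B.mul (bits q) (bits r))
  parity-ul-mul ⟪ a , b , c , d ⟫ ⟪ a' , b' , c' , d' ⟫ = parity-eval (a ∷ b ∷ c ∷ d ∷ a' ∷ b' ∷ c' ∷ d' ∷ [])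
    (T.ul (T.mul ⟪ var 0F , var 1F , var 2F , var 3F ⟫ ⟪ var 4F , var 5F , var 6F , var 7F ⟫))

  parity-lr-mul : ∀ q r → parity (lr (mul q r)) ≡ B.lr (B.mul (bits q) (bits r))
  parity-lr-mul ⟪ a , b , c , d ⟫ ⟪ a' , b' , c' , d' ⟫ = parity-eval (a ∷ b ∷ c ∷ d ∷ a' ∷ b' ∷ c' ∷ d' ∷ [])
    (T.lr (T.mul ⟪ var 0F , var 1F , var 2F , var 3F ⟫ ⟪ var 4F , var 5F , var 6F , var 7F ⟫))

  parity-ℓ-mul : ∀ q r → parity (ℓ (mul q r)) ≡ B.ℓ (B.mul (bits q) (bits r))
  parity-ℓ-mul ⟪ a , b , c , d ⟫ ⟪ a' , b' , c' , d' ⟫ = parity-eval (a ∷ b ∷ c ∷ d ∷ a' ∷ b' ∷ c' ∷ d' ∷ [])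
    (T.ℓ (T.mul ⟪ var 0F , var 1F , var 2F , var 3F ⟫ ⟪ var 4F , var 5F , var 6F , var 7F ⟫))

  π≢0 : π ≢ 0R
  π≢0 ()

  even-π* : ∀ β → Even (π * β)
  even-π* β = parity-* π β

  UpperEven LowerEven : ℕ → ℤ[√2] → 𝒪 → Set
  UpperEven N β q = Represents N (π * β) q × Even (ul q)
  LowerEven N β q = Represents N (π * β) q × Even (lr q)

  private
    norm-𝔰 : ∀ y β → norm y ≡ β → norm (mul y 𝔰) ≡ π * β
    norm-𝔰 y β eq = trans (norm-mul y 𝔰) (trans (cong (_* π) eq) (R.*-comm β π))

    norm-𝔰⁻ : ∀ y β → norm (mul y 𝔰) ≡ π * β → norm y ≡ β
    norm-𝔰⁻ y β eq = *-cancelˡ π≢0 (trans (R.*-comm π (norm y)) (trans (sym (norm-mul y 𝔰)) eq))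

    norm-𝔴 : ∀ y β → norm y ≡ β → norm (mul y 𝔴) ≡ π * β
    norm-𝔴 y β eq = trans (norm-mul y 𝔴) (trans (cong (_* π) eq) (R.*-comm β π))

    norm-𝔴⁻ : ∀ y β → norm (mul y 𝔴) ≡ π * β → norm y ≡ β
    norm-𝔴⁻ y β eq = *-cancelˡ π≢0 (trans (R.*-comm π (norm y)) (trans (sym (norm-mul y 𝔴)) eq))

    mul-𝔰-injective : ∀ {y y'} → mul y 𝔰 ≡ mul y' 𝔰 → y ≡ y'
    mul-𝔰-injective = mul-cancelʳ {𝔰} λ ()

    mul-𝔴-injective : ∀ {y y'} → mul y 𝔴 ≡ mul y' 𝔴 → y ≡ y'
    mul-𝔴-injective = mul-cancelʳ {𝔴} λ ()

    solve-a : ∀ {a c d x} → a - c + d ≡ x → a ≡ c - d + x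
    solve-a {a} {c} {d} refl = e a c d
      where e : ∀ a c d → a ≡ c - d + (a - c + d)
            e = solve-∀ RR

    solve-b : ∀ {b c d x} → b - c - (1R - √2) * d ≡ x → b ≡ c + (1R - √2) * d + x
    solve-b {b} {c} {d} refl = e b c d
      where e : ∀ b c d → b ≡ c + (1R - √2) * d + (b - c - (1R - √2) * d)
            e = solve-∀ RR

    divide-𝔰 : ∀ q → Even (ul q) → Even (ℓ q) → ∃ λ y → q ≡ mul y 𝔰
    divide-𝔰 ⟪ a , b , c , d ⟫ ul-even ℓ-even = go (even⇒√2∣ {a - c + d} ul-even) (even⇒√2∣ {b - c - (1R - √2) * d} ℓ-even)
      where
      go : √2 ∣ᴿ a - c + d → √2 ∣ᴿ b - c - (1R - √2) * d → ∃ λ y → ⟪ a , b , c , d ⟫ ≡ mul y 𝔰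
      go (m , ul≡) (k , ℓ≡) = ⟪ c - √2 * c + d - √2 * d - k + √2 * k , c - √2 * c + int (+ 3) * d - 2R * √2 * d - 2R * k + √2 * k + m - √2 * m , c - √2 * c - k , 2R * c + d - √2 * d + √2 * k + m ⟫ ,
        trans (cong₂ (λ a b → ⟪ a , b , c , d ⟫) (solve-a {a} {c} {d} ul≡) (solve-b {b} {c} {d} ℓ≡)) (𝔰-factor c d m k)

    divide-𝔴 : ∀ q → Even (ul q) → Even (ℓ q) → Even (co₃ q) → ∃ λ y → q ≡ mul y 𝔴
    divide-𝔴 ⟪ a , b , c , d ⟫ ul-even ℓ-even d-even = go (even⇒√2∣ {a - c + d} ul-even) (even⇒√2∣ {b - c - (1R - √2) * d} ℓ-even) (even⇒√2∣ {d} d-even)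
      where
      go : √2 ∣ᴿ a - c + d → √2 ∣ᴿ b - c - (1R - √2) * d → √2 ∣ᴿ d → ∃ λ y → ⟪ a , b , c , d ⟫ ≡ mul y 𝔴
      go (m , ul≡) (l , ℓ≡) (k , refl) = ⟪ c - int (+ 4) * k + 2R * √2 * k - l + √2 * l + m , √2 * l - int (+ 4) * k + int (+ 3) * √2 * k - l + m - √2 * m , c - √2 * c - int (+ 4) * k + int (+ 3) * √2 * k - 2R * l + √2 * l + m - √2 * m , c - int (+ 4) * k + int (+ 3) * √2 * k - l + √2 * l + 2R * m - √2 * m ⟫ ,
        trans (cong₂ (λ a b → ⟪ a , b , c , √2 * k ⟫) (solve-a {a} {c} {√2 * k} ul≡) (solve-b {b} {c} {√2 * k} ℓ≡)) (𝔴-factor c k l m)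

    Level-𝔰 : ∀ n y → n ℕ.≤ 2 → Level n y → Level (suc n) (mul y 𝔰)
    Level-𝔰 n y n≤2 lev = ∣-subst (sym (ℓ-𝔰 y)) (times-√2 (∣-minus (∣-neg lev) (∣-*ʳ (co₂ y) (√2^-∣ n≤2))))
      where
      times-√2 : ∀ {x} → √2^ᴿ n ∣ᴿ x → √2^ᴿ (suc n) ∣ᴿ √2 * x
      times-√2 (k , refl) = k , sym (R.*-assoc √2 (√2^ᴿ n) k)

    Level-𝔰⁻ : ∀ n y → n ℕ.≤ 2 → Level (suc n) (mul y 𝔰) → Level n y
    Level-𝔰⁻ n y n≤2 (k , eq) = ∣-subst (e (ℓ y) (2R * co₂ y)) (∣-neg (∣-+ (k , *-cancelˡ √2≢0 (trans (sym (ℓ-𝔰 y)) (trans eq (R.*-assoc √2 (√2^ᴿ n) k)))) (∣-*ʳ (co₂ y) (√2^-∣ n≤2))))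
      where
      e : ∀ x z → - (- x - z + z) ≡ x
      e = solve-∀ RR

    Level-1 : ∀ n q → Level (suc n) q → Level 1 q
    Level-1 n q = Level-≤ {1} {suc n} {q} (s≤s z≤n)

  -- With `ul` and `ℓ` even the first column of the local matrix vanishes modulo √2, which is
  -- divisibility by diag(√2 , 1) on the right.
  card-UpperEven : ∀ {n β w} → n ℕ.≤ 2 → Card (Represents n β) w → Card (UpperEven (suc n) β) w
  card-UpperEven {n} {β} n≤2 = card-map (λ y → mul y 𝔰) mul-𝔰-injective to from
    where
    to : ∀ y → Represents n β y → UpperEven (suc n) β (mul y 𝔰)
    to y (norm-y , lev) = (norm-𝔰 y β norm-y , Level-𝔰 n y n≤2 lev) , √2∣⇒even {ul (mul y 𝔰)} (_ , ul-𝔰 y)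
    from : ∀ q → UpperEven (suc n) β q → ∃ λ y → Represents n β y × q ≡ mul y 𝔰
    from q ((norm-q , lev) , ul-even) = go (divide-𝔰 q ul-even (Level⇒even {q} (Level-1 n q lev)))
      where
      go : (∃ λ y → q ≡ mul y 𝔰) → ∃ λ y → Represents n β y × q ≡ mul y 𝔰
      go (y , q≡) = y , (norm-𝔰⁻ y β (trans (cong norm (sym q≡)) norm-q) , Level-𝔰⁻ n y n≤2 (subst (Level (suc n)) q≡ lev)) , q≡

  Level-conj : ∀ n q → Level n q → Level n (conj q)
  Level-conj n q lev = ∣-subst (sym (ℓ-conj q)) (∣-*ˡ (- 1R) lev)

  -- Conjugation exchanges the diagonal entries and keeps norm and level.
  card-conj : ∀ {N β w} → Card (UpperEven N β) w → Card (LowerEven N β) w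
  card-conj {N} {β} = card-map conj (λ {x} {y} eq → trans (sym (conj-conj x)) (trans (cong conj eq) (conj-conj y)))
    (λ q ((norm-q , lev) , even) → (trans (norm-conj q) norm-q , Level-conj N q lev) , trans (cong parity (lr-conj q)) even)
    (λ q ((norm-q , lev) , even) → conj q , ((trans (norm-conj q) norm-q , Level-conj N q lev) , trans (cong parity (ul-conj q)) even) , sym (conj-conj q))

  BothEven : ℕ → ℤ[√2] → 𝒪 → Set
  BothEven N β q = UpperEven N β q × LowerEven N β q

  private
    Even? : ∀ x → Dec (Even x)
    Even? x = parity x Bool.≟ false

    Represents? : ∀ N β q → Dec (Represents N β q)
    Represents? N β q = (norm q ≟ᴿ β) ×-dec Level? N q

    upper-or-lower : ∀ {n β} q → Represents (suc n) (π * β) q → UpperEven (suc n) β q ⊎ LowerEven (suc n) β q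
    upper-or-lower {n} {β} q r@(norm-q , lev) with parity (ul q) in eq | parity (lr q) in eq'
    ... | false | _ = inj₁ (r , refl)
    ... | true | false = inj₂ (r , refl)
    ... | true | true = contradiction (trans (sym (cong₂ _∧_ eq eq')) (trans (sym (norm-triangular q (Level-1 n q lev))) (trans (cong parity norm-q) (even-π* β)))) λ ()

  -- The matrix is triangular modulo √2 and its norm is even, so one diagonal entry is even. The two
  -- cases have equal size by conjugation and are combined by inclusion-exclusion.
  card-level : ∀ {n β w k} → n ℕ.≤ 2 → Card (Represents n β) w → Card (BothEven (suc n) β) k →
    ∃ λ l → Card (Represents (suc n) (π * β)) l × l ℕ.+ k ≡ w ℕ.+ w
  card-level {n} {β} {w} {k} n≤2 c both = finish (card-∪ {P = UpperEven (suc n) β} {Q = LowerEven (suc n) β} UpperEven? (card-UpperEven n≤2 c) (card-conj {suc n} {β} (card-UpperEven n≤2 c)) both)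
    where
    UpperEven? : ∀ q → Dec (UpperEven (suc n) β q)
    UpperEven? q = Represents? (suc n) (π * β) q ×-dec Even? (ul q)
    finish : (∃ λ l → Card (λ q → UpperEven (suc n) β q ⊎ LowerEven (suc n) β q) l × l ℕ.+ k ≡ w ℕ.+ w) →
      ∃ λ l → Card (Represents (suc n) (π * β)) l × l ℕ.+ k ≡ w ℕ.+ w
    finish (l , cl , eq) = l , card-cong (λ q → either proj₁ proj₁) (upper-or-lower {n} {β}) cl , eq

  private
    lr-𝔰-table : ∀ v → B.ℓ v ≡ false → B.lr (B.mul v (bits 𝔰)) ≡ B.lr v
    lr-𝔰-table ⟪ false , false , false , false ⟫ _ = refl
    lr-𝔰-table ⟪ false , false , true , true ⟫ _ = refl
    lr-𝔰-table ⟪ false , true , false , true ⟫ _ = refl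
    lr-𝔰-table ⟪ false , true , true , false ⟫ _ = refl
    lr-𝔰-table ⟪ true , false , false , false ⟫ _ = refl
    lr-𝔰-table ⟪ true , false , true , true ⟫ _ = refl
    lr-𝔰-table ⟪ true , true , false , true ⟫ _ = refl
    lr-𝔰-table ⟪ true , true , true , false ⟫ _ = refl

    lr-𝔰 : ∀ y → Level 1 y → parity (lr (mul y 𝔰)) ≡ parity (lr y)
    lr-𝔰 y lev = trans (parity-lr-mul y 𝔰) (trans (lr-𝔰-table (bits y) (trans (sym (parity-ℓ y)) (Level⇒even {y} lev))) (sym (parity-lr y)))

  -- From level 1 on, right multiplication by 𝔰 keeps the parity of the lower right entry, so this
  -- condition passes to the quotient.
  card-BothEven : ∀ {n β w} → n ℕ.≤ 1 → Card (λ q → Represents (suc n) β q × Even (lr q)) w → Card (BothEven (suc (suc n)) β) w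
  card-BothEven {n} {β} n≤1 = card-map (λ y → mul y 𝔰) mul-𝔰-injective to from
    where
    to : ∀ y → Represents (suc n) β y × Even (lr y) → BothEven (suc (suc n)) β (mul y 𝔰)
    to y ((norm-y , lev) , even) = (r , √2∣⇒even {ul (mul y 𝔰)} (_ , ul-𝔰 y)) , (r , trans (lr-𝔰 y (Level-1 n y lev)) even)
      where r = norm-𝔰 y β norm-y , Level-𝔰 (suc n) y (s≤s n≤1) lev
    from : ∀ q → BothEven (suc (suc n)) β q → ∃ λ y → (Represents (suc n) β y × Even (lr y)) × q ≡ mul y 𝔰
    from q (((norm-q , lev) , ul-even) , (_ , lr-even)) = go (divide-𝔰 q ul-even (Level⇒even {q} (Level-1 (suc n) q lev)))
      where
      go : (∃ λ y → q ≡ mul y 𝔰) → ∃ λ y → (Represents (suc n) β y × Even (lr y)) × q ≡ mul y 𝔰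
      go (y , q≡) = y , ((norm-𝔰⁻ y β (trans (cong norm (sym q≡)) norm-q) , lev-y) , trans (sym (lr-𝔰 y (Level-1 n y lev-y))) (trans (cong (λ q → parity (lr q)) (sym q≡)) lr-even)) , q≡
        where
        lev-y : Level (suc n) y
        lev-y = Level-𝔰⁻ (suc n) y (s≤s n≤1) (subst (Level (suc (suc n))) q≡ lev)

  card-lr-even-odd : ∀ {n β} → parity β ≡ true → Card (λ q → Represents (suc n) β q × Even (lr q)) 0
  card-lr-even-odd {n} odd = card-empty λ { q ((norm-q , lev) , even) → contradiction (trans (sym even) (proj₂ (odd-diagonal {q} (Level-1 n q lev) (trans (cong parity norm-q) odd)))) λ () }

  private
    ω-table : ∀ v → B.ul (B.mul v (bits 𝔴)) ≡ false × B.ℓ (B.mul v (bits 𝔴)) ≡ false × B.lr (B.mul v (bits 𝔴)) ≡ B.ℓ v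
    ω-table ⟪ false , false , false , false ⟫ = refl , refl , refl
    ω-table ⟪ false , false , false , true ⟫ = refl , refl , refl
    ω-table ⟪ false , false , true , false ⟫ = refl , refl , refl
    ω-table ⟪ false , false , true , true ⟫ = refl , refl , refl
    ω-table ⟪ false , true , false , false ⟫ = refl , refl , refl
    ω-table ⟪ false , true , false , true ⟫ = refl , refl , refl
    ω-table ⟪ false , true , true , false ⟫ = refl , refl , refl
    ω-table ⟪ false , true , true , true ⟫ = refl , refl , refl
    ω-table ⟪ true , false , false , false ⟫ = refl , refl , refl
    ω-table ⟪ true , false , false , true ⟫ = refl , refl , refl
    ω-table ⟪ true , false , true , false ⟫ = refl , refl , refl
    ω-table ⟪ true , false , true , true ⟫ = refl , refl , refl
    ω-table ⟪ true , true , false , false ⟫ = refl , refl , refl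
    ω-table ⟪ true , true , false , true ⟫ = refl , refl , refl
    ω-table ⟪ true , true , true , false ⟫ = refl , refl , refl
    ω-table ⟪ true , true , true , true ⟫ = refl , refl , refl

    -- ul + lr is congruent to the last coordinate modulo √2.
    diagonal-table : ∀ v → B.ul v ≡ false → B.lr v ≡ false → co₃ v ≡ false
    diagonal-table ⟪ _ , _ , _ , false ⟫ _ _ = refl
    diagonal-table ⟪ false , false , false , true ⟫ () _
    diagonal-table ⟪ false , false , true , true ⟫ _ ()
    diagonal-table ⟪ false , true , false , true ⟫ () _
    diagonal-table ⟪ false , true , true , true ⟫ _ ()
    diagonal-table ⟪ true , false , false , true ⟫ _ ()
    diagonal-table ⟪ true , false , true , true ⟫ () _
    diagonal-table ⟪ true , true , false , true ⟫ _ ()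
    diagonal-table ⟪ true , true , true , true ⟫ () _

    co₃-bits : ∀ q → co₃ (bits q) ≡ parity (co₃ q)
    co₃-bits ⟪ _ , _ , _ , _ ⟫ = refl

  -- Division by 𝔰 would end at level 0, where the parity of `lr` is not inherited. Multiplication
  -- of any y by 𝔴 makes `ul` and `ℓ` even and gives `lr` the parity of ℓ y, so the quotients are
  -- exactly the elements of level 1.
  card-BothEven-1 : ∀ {β w} → Card (Represents 1 β) w → Card (BothEven 1 β) w
  card-BothEven-1 {β} = card-map (λ y → mul y 𝔴) mul-𝔴-injective to from
    where
    to : ∀ y → Represents 1 β y → BothEven 1 β (mul y 𝔴)
    to y (norm-y , lev) = (r , trans (parity-ul-mul y 𝔴) (proj₁ (ω-table (bits y)))) ,
      (r , trans (parity-lr-mul y 𝔴) (trans (proj₂ (proj₂ (ω-table (bits y)))) (trans (sym (parity-ℓ y)) (Level⇒even {y} lev))))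
      where r = norm-𝔴 y β norm-y , even⇒Level {mul y 𝔴} (trans (parity-ℓ-mul y 𝔴) (proj₁ (proj₂ (ω-table (bits y)))))
    from : ∀ q → BothEven 1 β q → ∃ λ y → Represents 1 β y × q ≡ mul y 𝔴
    from q (((norm-q , lev) , ul-even) , (_ , lr-even)) = go (divide-𝔴 q ul-even (Level⇒even {q} lev)
        (trans (sym (co₃-bits q)) (diagonal-table (bits q) (trans (sym (parity-ul q)) ul-even) (trans (sym (parity-lr q)) lr-even))))
      where
      go : (∃ λ y → q ≡ mul y 𝔴) → ∃ λ y → Represents 1 β y × q ≡ mul y 𝔴
      go (y , q≡) = y , (norm-𝔴⁻ y β (trans (cong norm (sym q≡)) norm-q) , even⇒Level {y} (trans (parity-ℓ y)
        (trans (sym (proj₂ (proj₂ (ω-table (bits y))))) (trans (sym (parity-lr-mul y 𝔴)) (trans (cong (λ q → parity (lr q)) (sym q≡)) lr-even))))) , q≡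

  -- An element of 𝒪 of even norm kills one of the three lines modulo √2, and two of them only if it is divisible by √2.
  KillsLine : ℤ[√2] → 𝒪 → 𝒪 → Set
  KillsLine β u q = Represents 0 (π * β) q × Even (ul (mul q u)) × Even (ℓ (mul q u))

  Vanishes : ℤ[√2] → 𝒪 → Set
  Vanishes β q = Represents 0 (π * β) q × bits q ≡ ⟪ false , false , false , false ⟫

  -- Right translation by u moves the line to the first coordinate line, and the elements killing
  -- that one are the level 1 elements with even `ul`.
  card-KillsLine : ∀ {β w} u → norm u ≡ 1R → Card (Represents 0 β) w → Card (KillsLine β u) w
  card-KillsLine {β} u norm-u c = card-map (λ q → mul q (conj u)) injective to from (card-UpperEven z≤n c)
    where
    undo : ∀ q v → norm v ≡ 1R → mul (mul q (conj v)) v ≡ q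
    undo q v nv = trans (mul-assoc q (conj v) v) (trans (cong (mul q) (trans (conj-mul-self v) (cong scalar nv))) (trans (mul-scalar q 1R) (scale-one q)))
    undo′ : ∀ q → mul (mul q u) (conj u) ≡ q
    undo′ q = trans (mul-assoc q u (conj u)) (trans (cong (mul q) (trans (mul-conj u) (cong scalar norm-u))) (trans (mul-scalar q 1R) (scale-one q)))
    injective : ∀ {x y} → mul x (conj u) ≡ mul y (conj u) → x ≡ y
    injective {x} {y} eq = trans (sym (undo x u norm-u)) (trans (cong (λ z → mul z u) eq) (undo y u norm-u))
    to : ∀ q → UpperEven 1 β q → KillsLine β u (mul q (conj u))
    to q ((norm-q , lev) , even) = (trans (norm-mul q (conj u)) (trans (cong₂ _*_ norm-q (trans (norm-conj u) norm-u)) (R.*-identityʳ (π * β))) , Level-0 (mul q (conj u))) ,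
      trans (cong (λ z → parity (ul z)) (undo q u norm-u)) even , trans (cong (λ z → parity (ℓ z)) (undo q u norm-u)) (Level⇒even {q} lev)
    from : ∀ q → KillsLine β u q → ∃ λ y → UpperEven 1 β y × q ≡ mul y (conj u)
    from q ((norm-q , _) , ul-even , ℓ-even) = mul q u , ((trans (norm-mul q u) (trans (cong₂ _*_ norm-q norm-u) (R.*-identityʳ (π * β))) , even⇒Level {mul q u} ℓ-even) , ul-even) , sym (undo′ q)

  private
    -- The first columns (`ul` , `ℓ`) of 1, f and g modulo √2 are (1 , 0), (0 , 1) and (1 , 1): the
    -- three lines of the plane over 𝔽₂.
    𝔣 𝔤 : 𝒪
    𝔣 = ⟪ 0R , 1R , 0R , 0R ⟫
    𝔤 = ⟪ 0R , 0R , 1R , 0R ⟫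

    Kills : Quat Bool → Quat Bool → Set
    Kills u v = B.ul (B.mul v u) ≡ false × B.ℓ (B.mul v u) ≡ false

    zeroᴮ = ⟪ false , false , false , false ⟫

    lines-cover : ∀ v → B.norm v ≡ false → Kills (bits (scalar 1R)) v ⊎ Kills (bits 𝔣) v ⊎ Kills (bits 𝔤) v
    lines-cover ⟪ false , false , false , false ⟫ _ = inj₁ (refl , refl)
    lines-cover ⟪ false , false , true , true ⟫ _ = inj₁ (refl , refl)
    lines-cover ⟪ true , true , false , true ⟫ _ = inj₁ (refl , refl)
    lines-cover ⟪ true , true , true , false ⟫ _ = inj₁ (refl , refl)
    lines-cover ⟪ false , true , false , true ⟫ _ = inj₂ (inj₁ (refl , refl))
    lines-cover ⟪ true , false , true , false ⟫ _ = inj₂ (inj₁ (refl , refl))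
    lines-cover ⟪ true , true , true , true ⟫ _ = inj₂ (inj₁ (refl , refl))
    lines-cover ⟪ false , true , true , true ⟫ _ = inj₂ (inj₂ (refl , refl))
    lines-cover ⟪ true , false , true , true ⟫ _ = inj₂ (inj₂ (refl , refl))
    lines-cover ⟪ true , true , false , false ⟫ _ = inj₂ (inj₂ (refl , refl))

    lines-meet : ∀ v →
      (Kills (bits (scalar 1R)) v → Kills (bits 𝔣) v → v ≡ zeroᴮ) ×
      ((Kills (bits (scalar 1R)) v ⊎ Kills (bits 𝔣) v) → Kills (bits 𝔤) v → v ≡ zeroᴮ)
    lines-meet ⟪ false , false , false , false ⟫ = (λ _ _ → refl) , λ _ _ → refl
    lines-meet ⟪ false , false , false , true ⟫ = (λ { (() , _) _ }) , λ { _ (_ , ()) }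
    lines-meet ⟪ false , false , true , false ⟫ = (λ { (() , _) _ }) , λ { _ (() , _) }
    lines-meet ⟪ false , false , true , true ⟫ = (λ { _ (() , _) }) , λ { _ (() , _) }
    lines-meet ⟪ false , true , false , false ⟫ = (λ { (_ , ()) _ }) , λ { _ (() , _) }
    lines-meet ⟪ false , true , false , true ⟫ = (λ { (() , _) _ }) , λ { _ (() , _) }
    lines-meet ⟪ false , true , true , false ⟫ = (λ { (() , _) _ }) , λ { _ (_ , ()) }
    lines-meet ⟪ false , true , true , true ⟫ = (λ { (_ , ()) _ }) , λ { (inj₁ (_ , ())) ; (inj₂ (_ , ())) }
    lines-meet ⟪ true , false , false , false ⟫ = (λ { (() , _) _ }) , λ { _ (() , _) }
    lines-meet ⟪ true , false , false , true ⟫ = (λ { (_ , ()) _ }) , λ { _ (() , _) }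
    lines-meet ⟪ true , false , true , false ⟫ = (λ { (_ , ()) _ }) , λ { _ (_ , ()) }
    lines-meet ⟪ true , false , true , true ⟫ = (λ { (() , _) _ }) , λ { (inj₁ (() , _)) ; (inj₂ (() , _)) }
    lines-meet ⟪ true , true , false , false ⟫ = (λ { (() , _) _ }) , λ { (inj₁ (() , _)) ; (inj₂ (() , _)) }
    lines-meet ⟪ true , true , false , true ⟫ = (λ { _ (_ , ()) }) , λ { _ (_ , ()) }
    lines-meet ⟪ true , true , true , false ⟫ = (λ { _ (() , _) }) , λ { _ (() , _) }
    lines-meet ⟪ true , true , true , true ⟫ = (λ { (() , _) _ }) , λ { _ (() , _) }

    lines-vanish : ∀ u → Kills u zeroᴮ
    lines-vanish ⟪ _ , _ , _ , _ ⟫ = refl , refl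

    toᴮ : ∀ {q u} → Even (ul (mul q u)) × Even (ℓ (mul q u)) → Kills (bits u) (bits q)
    toᴮ {q} {u} (p , r) = trans (sym (parity-ul-mul q u)) p , trans (sym (parity-ℓ-mul q u)) r

    fromᴮ : ∀ {q u} → Kills (bits u) (bits q) → Even (ul (mul q u)) × Even (ℓ (mul q u))
    fromᴮ {q} {u} (p , r) = trans (parity-ul-mul q u) p , trans (parity-ℓ-mul q u) r

    KillsLine? : ∀ β u q → Dec (KillsLine β u q)
    KillsLine? β u q = Represents? 0 (π * β) q ×-dec (Even? (ul (mul q u)) ×-dec Even? (ℓ (mul q u)))

    vanish-kills : ∀ {β u} q → Vanishes β q → KillsLine β u q
    vanish-kills {β} {u} q (r , eq) = r , fromᴮ {q} {u} (subst (Kills (bits u)) (sym eq) (lines-vanish (bits u)))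

  -- All pairwise intersections coincide with the triple one, so the union of the three sets has 3w
  -- - 3z + z elements.
  card-level-0 : ∀ {β w z} → Card (Represents 0 β) w → Card (Vanishes β) z →
    ∃ λ l → Card (Represents 0 (π * β)) l × l ℕ.+ (z ℕ.+ z) ≡ w ℕ.+ w ℕ.+ w
  card-level-0 {β} {w} {z} c cz = combine (card-∪ {P = KillsLine β (scalar 1R)} {Q = KillsLine β 𝔣} (KillsLine? β (scalar 1R)) (card-KillsLine (scalar 1R) refl c) (card-KillsLine 𝔣 refl c)
      (card-cong (λ q v → vanish-kills {u = scalar 1R} q v , vanish-kills {u = 𝔣} q v) (λ { q ((r , k) , (_ , k')) → r , proj₁ (lines-meet (bits q)) (toᴮ {q} {scalar 1R} k) (toᴮ {q} {𝔣} k') }) cz))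
    where
    combine : (∃ λ l → Card (λ q → KillsLine β (scalar 1R) q ⊎ KillsLine β 𝔣 q) l × l ℕ.+ z ≡ w ℕ.+ w) →
      ∃ λ l → Card (Represents 0 (π * β)) l × l ℕ.+ (z ℕ.+ z) ≡ w ℕ.+ w ℕ.+ w
    combine (l₁ , c₁ , eq₁) = combine′ (card-∪ {P = λ q → KillsLine β (scalar 1R) q ⊎ KillsLine β 𝔣 q} {Q = KillsLine β 𝔤} decide c₁ (card-KillsLine 𝔤 refl c)
        (card-cong (λ q v → inj₁ (vanish-kills {u = scalar 1R} q v) , vanish-kills {u = 𝔤} q v)
          (λ { q (inj₁ (r , k) , (_ , k')) → r , proj₂ (lines-meet (bits q)) (inj₁ (toᴮ {q} {scalar 1R} k)) (toᴮ {q} {𝔤} k')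
             ; q (inj₂ (r , k) , (_ , k')) → r , proj₂ (lines-meet (bits q)) (inj₂ (toᴮ {q} {𝔣} k)) (toᴮ {q} {𝔤} k') }) cz))
      where
      decide : ∀ q → Dec (KillsLine β (scalar 1R) q ⊎ KillsLine β 𝔣 q)
      decide q with KillsLine? β (scalar 1R) q | KillsLine? β 𝔣 q
      ... | yes p | _ = yes (inj₁ p)
      ... | no _ | yes p = yes (inj₂ p)
      ... | no ¬p | no ¬q = no (either ¬p ¬q)
      combine′ : (∃ λ l → Card (λ q → (KillsLine β (scalar 1R) q ⊎ KillsLine β 𝔣 q) ⊎ KillsLine β 𝔤 q) l × l ℕ.+ z ≡ l₁ ℕ.+ w) →
        ∃ λ l → Card (Represents 0 (π * β)) l × l ℕ.+ (z ℕ.+ z) ≡ w ℕ.+ w ℕ.+ w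
      combine′ (l₂ , c₂ , eq₂) = l₂ , card-cong (λ q → either (either proj₁ proj₁) proj₁) cover c₂ ,
        trans (sym (ℕₚ.+-assoc l₂ z z)) (trans (cong (ℕ._+ z) eq₂) (trans (ℕₚ.+-assoc l₁ w z) (trans (cong (l₁ ℕ.+_) (ℕₚ.+-comm w z)) (trans (sym (ℕₚ.+-assoc l₁ z w)) (cong (ℕ._+ w) eq₁)))))
        where
        cover : ∀ q → Represents 0 (π * β) q → (KillsLine β (scalar 1R) q ⊎ KillsLine β 𝔣 q) ⊎ KillsLine β 𝔤 q
        cover q r@(norm-q , _) with lines-cover (bits q) (trans (sym (parity-norm q)) (trans (cong parity norm-q) (even-π* β)))
        ... | inj₁ k = inj₁ (inj₁ (r , fromᴮ {q} {scalar 1R} k))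
        ... | inj₂ (inj₁ k) = inj₁ (inj₂ (r , fromᴮ {q} {𝔣} k))
        ... | inj₂ (inj₂ k) = inj₂ (r , fromᴮ {q} {𝔤} k)

  private
    even⇒π∣ : ∀ {x} → Even x → π ∣ᴿ x
    even⇒π∣ {x} even with even⇒√2∣ {x} even
    -- π is √2 times the unit 1 + √2, whose inverse is -1 + √2.
    ... | k , refl = (-[1+ 0 ] ⊕√2 + 1) * k , e k
      where e : ∀ k → √2 * k ≡ (+ 2 ⊕√2 + 1) * ((-[1+ 0 ] ⊕√2 + 1) * k)
            e = solve-∀ RR

    vanishing⇒scaled : ∀ q → bits q ≡ zeroᴮ → ∃ λ y → q ≡ scale π y
    vanishing⇒scaled ⟪ a , b , c , d ⟫ eq with even⇒π∣ {a} (cong co₀ eq) | even⇒π∣ {b} (cong co₁ eq) | even⇒π∣ {c} (cong co₂ eq) | even⇒π∣ {d} (cong co₃ eq)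
    ... | a' , refl | b' , refl | c' , refl | d' , refl = ⟪ a' , b' , c' , d' ⟫ , refl

    scaled⇒vanishing : ∀ y → bits (scale π y) ≡ zeroᴮ
    scaled⇒vanishing ⟪ a , b , c , d ⟫ = Quat-ext (parity-* π a) (parity-* π b) (parity-* π c) (parity-* π d)

  card-Vanishes : ∀ {γ w} → Card (Represents 0 γ) w → Card (Vanishes (π * γ)) w
  card-Vanishes {γ} = card-map (scale π) injective to from
    where
    injective : ∀ {x y} → scale π x ≡ scale π y → x ≡ y
    injective {⟪ _ , _ , _ , _ ⟫} {⟪ _ , _ , _ , _ ⟫} eq = Quat-ext (*-cancelˡ π≢0 (cong co₀ eq)) (*-cancelˡ π≢0 (cong co₁ eq)) (*-cancelˡ π≢0 (cong co₂ eq)) (*-cancelˡ π≢0 (cong co₃ eq))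
    norm-π : ∀ y → norm (scale π y) ≡ π * (π * norm y)
    norm-π y = trans (norm-scale y π) (R.*-assoc π π (norm y))
    to : ∀ y → Represents 0 γ y → Vanishes (π * γ) (scale π y)
    to y (norm-y , _) = (trans (norm-π y) (cong (λ n → π * (π * n)) norm-y) , Level-0 (scale π y)) , scaled⇒vanishing y
    from : ∀ q → Vanishes (π * γ) q → ∃ λ y → Represents 0 γ y × q ≡ scale π y
    from q ((norm-q , _) , eq) = go (vanishing⇒scaled q eq)
      where
      go : (∃ λ y → q ≡ scale π y) → ∃ λ y → Represents 0 γ y × q ≡ scale π y
      go (y , q≡) = y , (*-cancelˡ π≢0 (*-cancelˡ π≢0 (trans (sym (norm-π y)) (trans (cong norm (sym q≡)) norm-q))) , Level-0 y) , q≡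

  card-Vanishes-odd : ∀ {β} → parity β ≡ true → Card (Vanishes β) 0
  card-Vanishes-odd {β} odd = card-empty λ { q ((norm-q , _) , eq) → none q norm-q (vanishing⇒scaled q eq) }
    where
    none : ∀ q → norm q ≡ π * β → ¬ (∃ λ y → q ≡ scale π y)
    none q norm-q (y , refl) = contradiction (trans (sym odd) (trans (cong parity (*-cancelˡ π≢0 (trans (sym norm-q) (trans (norm-scale y π) (R.*-assoc π π (norm y)))))) (even-π* (norm y)))) λ ()

-- Solving the recursion in the exponent of √2.

module Recursion where
  import Data.Nat.Tactic.RingSolver as ℕ-Solver
  open import Data.Nat.ListAction using (sum)
  open import Data.Bool using (true)
  open import Data.List using (List; []; _∷_; map)
  open import Data.Integer using (+_)
  open QuadraticIntegers
  open MaximalOrder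
  open EuclideanRing
  open Units
  open Counting
  open Levels
  open UnitGroup
  open OddNorms
  open EvenNorms

  infix 8 π^_∙_
  π^_∙_ : ℕ → ℤ[√2] → ℤ[√2]
  π^ zero ∙ β = β
  π^ suc k ∙ β = π * (π^ k ∙ β)

  private
    sum-*ʳ : ∀ (ds : List ℤ[√2]) w → sum (map (λ δ → ℤ.∣ nm δ ∣ ℕ.* w) ds) ≡ sum (map (λ δ → ℤ.∣ nm δ ∣) ds) ℕ.* w
    sum-*ʳ [] w = refl
    sum-*ʳ (δ ∷ ds) w = trans (cong (ℤ.∣ nm δ ∣ ℕ.* w ℕ.+_) (sum-*ʳ ds w)) (sym (ℕₚ.*-distribʳ-+ w ℤ.∣ nm δ ∣ (sum (map (λ δ → ℤ.∣ nm δ ∣) ds))))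

    -- The closed forms at levels 0 and 1 hold for all k. At level 2, and for the count of even `lr`
    -- at level 2, they start with k = 1, at level 3 with k = 2; hence the exceptional values of
    -- `factor2` at 0 and 1.
    Count₂ Count₃ LowerCount₂ : (σ k n : ℕ) → Set
    Count₂ σ zero n = n ≡ σ ℕ.* 8
    Count₂ σ k@(suc _) n = n ℕ.+ σ ℕ.* 48 ≡ σ ℕ.* 2 ℕ.^ k ℕ.* 40
    Count₃ σ zero n = n ≡ σ ℕ.* 4
    Count₃ σ (suc zero) n = n ≡ σ ℕ.* 16
    Count₃ σ k@(suc (suc _)) n = n ℕ.+ σ ℕ.* 48 ≡ σ ℕ.* 2 ℕ.^ k ℕ.* 24
    LowerCount₂ σ zero n = n ≡ 0
    LowerCount₂ σ k@(suc _) n = n ℕ.+ σ ℕ.* 48 ≡ σ ℕ.* 2 ℕ.^ k ℕ.* 32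

    -- The cardinalities for β = πᵏ α with α odd, where σ is the sum of the norms of the divisors of α and
    -- 𝒪 has 48 units, with all sides arranged so that no subtraction occurs.
    record Counts (σ k : ℕ) (β : ℤ[√2]) : Set where
      field
        {n₀ n₁ n₂ n₃ y₁ y₂ z} : ℕ
        card₀ : Card (Represents 0 β) n₀
        card₁ : Card (Represents 1 β) n₁
        card₂ : Card (Represents 2 β) n₂
        card₃ : Card (Represents 3 β) n₃
        lower₁ : Card (λ q → Represents 1 β q × Even (lr q)) y₁
        lower₂ : Card (λ q → Represents 2 β q × Even (lr q)) y₂
        vanishing : Card (Vanishes β) z
        n₀≡ : n₀ ℕ.+ σ ℕ.* 48 ≡ σ ℕ.* 2 ℕ.^ k ℕ.* 96
        n₁≡ : n₁ ℕ.+ σ ℕ.* 48 ≡ σ ℕ.* 2 ℕ.^ k ℕ.* 64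
        n₂≡ : Count₂ σ k n₂
        n₃≡ : Count₃ σ k n₃
        y₁≡ : y₁ ℕ.+ σ ℕ.* 48 ≡ σ ℕ.* 2 ℕ.^ k ℕ.* 48
        y₂≡ : LowerCount₂ σ k y₂
        z≡ : z ℕ.+ σ ℕ.* 48 ≡ σ ℕ.* 2 ℕ.^ k ℕ.* 48

    double : ∀ σ p c m s → m ℕ.+ s ≡ σ ℕ.* p ℕ.* (2 ℕ.* c) → m ℕ.+ s ≡ σ ℕ.* (2 ℕ.* p) ℕ.* c
    double σ p c m s eq = trans eq (e σ p c)
      where e : ∀ σ p c → σ ℕ.* p ℕ.* (2 ℕ.* c) ≡ σ ℕ.* (2 ℕ.* p) ℕ.* c
            e = ℕ-Solver.solve-∀

    -- l + k = 2w is preserved when s is added to each of l, k and w, and likewise l + 2z = 3w in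
    -- `solve-level-0`. Shifted by s = 48σ, the counts become multiples of σ 2ᵏ.
    solve-level : ∀ l k w s a b c → l ℕ.+ k ≡ w ℕ.+ w → k ℕ.+ s ≡ a → w ℕ.+ s ≡ b → c ℕ.+ a ≡ b ℕ.+ b → l ℕ.+ s ≡ c
    solve-level l k w s a b c eq refl refl eq' = ℕₚ.+-cancelʳ-≡ (k ℕ.+ s) (l ℕ.+ s) c (trans (e₁ l k s) (trans (cong (ℕ._+ (s ℕ.+ s)) eq) (trans (e₂ w s) (sym eq'))))
      where
      e₁ : ∀ l k s → (l ℕ.+ s) ℕ.+ (k ℕ.+ s) ≡ (l ℕ.+ k) ℕ.+ (s ℕ.+ s)
      e₁ = ℕ-Solver.solve-∀
      e₂ : ∀ w s → (w ℕ.+ w) ℕ.+ (s ℕ.+ s) ≡ (w ℕ.+ s) ℕ.+ (w ℕ.+ s)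
      e₂ = ℕ-Solver.solve-∀

    solve-level-0 : ∀ l z w s a b c → l ℕ.+ (z ℕ.+ z) ≡ w ℕ.+ w ℕ.+ w → z ℕ.+ s ≡ a → w ℕ.+ s ≡ b → c ℕ.+ (a ℕ.+ a) ≡ b ℕ.+ b ℕ.+ b → l ℕ.+ s ≡ c
    solve-level-0 l z w s a b c eq refl refl eq' = ℕₚ.+-cancelʳ-≡ ((z ℕ.+ s) ℕ.+ (z ℕ.+ s)) (l ℕ.+ s) c (trans (e₁ l z s) (trans (cong (ℕ._+ (s ℕ.+ s ℕ.+ s)) eq) (trans (e₂ w s) (sym eq'))))
      where
      e₁ : ∀ l z s → (l ℕ.+ s) ℕ.+ ((z ℕ.+ s) ℕ.+ (z ℕ.+ s)) ≡ (l ℕ.+ (z ℕ.+ z)) ℕ.+ (s ℕ.+ s ℕ.+ s)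
      e₁ = ℕ-Solver.solve-∀
      e₂ : ∀ w s → (w ℕ.+ w ℕ.+ w) ℕ.+ (s ℕ.+ s ℕ.+ s) ≡ (w ℕ.+ s) ℕ.+ (w ℕ.+ s) ℕ.+ (w ℕ.+ s)
      e₂ = ℕ-Solver.solve-∀

    counts : ∀ {α ds} → Positive α → parity α ≡ true → DivisorSystem α ds → ∀ k →
      Counts (sum (map (λ δ → ℤ.∣ nm δ ∣) ds)) k (π^ k ∙ α)
    counts {α} {ds} pos odd system zero = record
      { n₀ = σ ℕ.* 48 ; n₁ = σ ℕ.* 16 ; n₂ = σ ℕ.* 8 ; n₃ = σ ℕ.* 4 ; y₁ = 0 ; y₂ = 0 ; z = 0
      ; card₀ = base 0 z≤n (proj₁ card-units)
      ; card₁ = base 1 (s≤s z≤n) (proj₁ (proj₂ card-units))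
      ; card₂ = base 2 (s≤s (s≤s z≤n)) (proj₁ (proj₂ (proj₂ card-units)))
      ; card₃ = base 3 (s≤s (s≤s (s≤s z≤n))) (proj₂ (proj₂ (proj₂ card-units)))
      ; lower₁ = card-lr-even-odd {0} {α} odd
      ; lower₂ = card-lr-even-odd {1} {α} odd
      ; vanishing = card-Vanishes-odd odd
      ; n₀≡ = e₀ σ ; n₁≡ = e₁ σ ; n₂≡ = refl ; n₃≡ = refl ; y₁≡ = e₂ σ ; y₂≡ = refl ; z≡ = e₂ σ
      }
      where
      σ = sum (map (λ δ → ℤ.∣ nm δ ∣) ds)
      base : ∀ N → N ℕ.≤ 3 → ∀ {w} → Card (IsUnit N) w → Card (Represents N α) (σ ℕ.* w)
      base N N≤3 {w} units = card-≡ (sum-*ʳ ds w) (odd-count pos odd N N≤3 units system)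
      e₀ : ∀ σ → σ ℕ.* 48 ℕ.+ σ ℕ.* 48 ≡ σ ℕ.* 1 ℕ.* 96
      e₀ = ℕ-Solver.solve-∀
      e₁ : ∀ σ → σ ℕ.* 16 ℕ.+ σ ℕ.* 48 ≡ σ ℕ.* 1 ℕ.* 64
      e₁ = ℕ-Solver.solve-∀
      e₂ : ∀ σ → 0 ℕ.+ σ ℕ.* 48 ≡ σ ℕ.* 1 ℕ.* 48
      e₂ = ℕ-Solver.solve-∀
    counts {α} {ds} pos odd system (suc k) = step (counts pos odd system k)
      where
      σ = sum (map (λ δ → ℤ.∣ nm δ ∣) ds)
      p = 2 ℕ.^ k
      β = π^ k ∙ α
      step : Counts σ k β → Counts σ (suc k) (π * β)
      step c = record
        -- The last three counts for π β are old counts for β: division by 𝔰 after conjugation gives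
        -- y₁ = n₀ and y₂ = n₁, and division by the scalar π gives z = n₀ one step later.
        { n₀ = l₀ ; n₁ = l₁ ; n₂ = l₂ ; n₃ = l₃ ; y₁ = n₀ ; y₂ = n₁ ; z = n₀
        ; card₀ = proj₁ (proj₂ level₀) ; card₁ = proj₁ (proj₂ level₁) ; card₂ = proj₁ (proj₂ level₂) ; card₃ = proj₁ (proj₂ level₃)
        ; lower₁ = card-conj {1} {β} (card-UpperEven z≤n card₀)
        ; lower₂ = card-conj {2} {β} (card-UpperEven (s≤s z≤n) card₁)
        ; vanishing = card-Vanishes card₀
        ; n₀≡ = solve-level-0 l₀ z n₀ (σ ℕ.* 48) (σ ℕ.* p ℕ.* 48) (σ ℕ.* p ℕ.* 96) (σ ℕ.* (2 ℕ.* p) ℕ.* 96) (proj₂ (proj₂ level₀)) z≡ n₀≡ (e₀ σ p)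
        ; n₁≡ = solve-level l₁ n₁ n₀ (σ ℕ.* 48) (σ ℕ.* p ℕ.* 64) (σ ℕ.* p ℕ.* 96) (σ ℕ.* (2 ℕ.* p) ℕ.* 64) (proj₂ (proj₂ level₁)) n₁≡ n₀≡ (e₁ σ p)
        ; n₂≡ = solve-level l₂ y₁ n₁ (σ ℕ.* 48) (σ ℕ.* p ℕ.* 48) (σ ℕ.* p ℕ.* 64) (σ ℕ.* (2 ℕ.* p) ℕ.* 40) (proj₂ (proj₂ level₂)) y₁≡ n₁≡ (e₂ σ p)
        ; n₃≡ = n₃′ k l₃ y₂ n₂ n₂≡ y₂≡ (proj₂ (proj₂ level₃))
        ; y₁≡ = double σ p 48 n₀ (σ ℕ.* 48) n₀≡
        ; y₂≡ = double σ p 32 n₁ (σ ℕ.* 48) n₁≡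
        ; z≡ = double σ p 48 n₀ (σ ℕ.* 48) n₀≡
        }
        where
        open Counts c
        level₀ = card-level-0 card₀ vanishing
        level₁ = card-level z≤n card₀ (card-BothEven-1 card₁)
        level₂ = card-level (s≤s z≤n) card₁ (card-BothEven z≤n lower₁)
        level₃ = card-level (s≤s (s≤s z≤n)) card₂ (card-BothEven (s≤s z≤n) lower₂)
        l₀ = proj₁ level₀
        l₁ = proj₁ level₁
        l₂ = proj₁ level₂
        l₃ = proj₁ level₃
        e₀ : ∀ σ p → σ ℕ.* (2 ℕ.* p) ℕ.* 96 ℕ.+ (σ ℕ.* p ℕ.* 48 ℕ.+ σ ℕ.* p ℕ.* 48) ≡ σ ℕ.* p ℕ.* 96 ℕ.+ σ ℕ.* p ℕ.* 96 ℕ.+ σ ℕ.* p ℕ.* 96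
        e₀ = ℕ-Solver.solve-∀
        e₁ : ∀ σ p → σ ℕ.* (2 ℕ.* p) ℕ.* 64 ℕ.+ σ ℕ.* p ℕ.* 64 ≡ σ ℕ.* p ℕ.* 96 ℕ.+ σ ℕ.* p ℕ.* 96
        e₁ = ℕ-Solver.solve-∀
        e₂ : ∀ σ p → σ ℕ.* (2 ℕ.* p) ℕ.* 40 ℕ.+ σ ℕ.* p ℕ.* 48 ≡ σ ℕ.* p ℕ.* 64 ℕ.+ σ ℕ.* p ℕ.* 64
        e₂ = ℕ-Solver.solve-∀
        n₃′ : ∀ k l y n → Count₂ σ k n → LowerCount₂ σ k y → l ℕ.+ y ≡ n ℕ.+ n → Count₃ σ (suc k) l
        n₃′ zero l .0 .(σ ℕ.* 8) refl refl eq = trans (trans (sym (ℕₚ.+-identityʳ l)) eq) (e σ)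
          where e : ∀ σ → σ ℕ.* 8 ℕ.+ σ ℕ.* 8 ≡ σ ℕ.* 16
                e = ℕ-Solver.solve-∀
        n₃′ (suc k) l y n n≡ y≡ eq = solve-level l y n (σ ℕ.* 48) (σ ℕ.* 2 ℕ.^ suc k ℕ.* 32) (σ ℕ.* 2 ℕ.^ suc k ℕ.* 40) (σ ℕ.* (2 ℕ.* 2 ℕ.^ suc k) ℕ.* 24) eq y≡ n≡ (e σ (2 ℕ.^ suc k))
          where e : ∀ σ p → σ ℕ.* (2 ℕ.* p) ℕ.* 24 ℕ.+ σ ℕ.* p ℕ.* 32 ≡ σ ℕ.* p ℕ.* 40 ℕ.+ σ ℕ.* p ℕ.* 40
                e = ℕ-Solver.solve-∀

  open import Defs using (factor2; sumPow2From2)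

  private
    sumPow : ∀ n → sumPow2From2 (suc n) ℕ.+ 4 ≡ 2 ℕ.* 2 ℕ.^ suc n
    sumPow zero = refl
    sumPow (suc n) = trans (e (sumPow2From2 (suc n)) (2 ℕ.^ suc (suc n))) (trans (cong (ℕ._+ 2 ℕ.^ suc (suc n)) (sumPow n)) (e' (2 ℕ.^ suc n)))
      where
      e : ∀ s t → s ℕ.+ t ℕ.+ 4 ≡ s ℕ.+ 4 ℕ.+ t
      e = ℕ-Solver.solve-∀
      e' : ∀ t → 2 ℕ.* t ℕ.+ 2 ℕ.* t ≡ 2 ℕ.* (2 ℕ.* t)
      e' = ℕ-Solver.solve-∀

    -- The powers from 2² to 2ᵉ add up to 2 · 2ᵉ - 4, so the case e ≥ 3 collapses to 6 · 2ᵉ - 12; e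
    -- = 2 obeys the same formula.
    factor2+12 : ∀ e → factor2 (suc (suc e)) ℕ.+ 12 ≡ 2 ℕ.^ suc (suc e) ℕ.* 6
    factor2+12 zero = refl
    factor2+12 (suc e) = trans (∸4+12 (2 ℕ.* S ℕ.+ 2 ℕ.* T) 4≤) (trans (e₁ S T) (trans (cong (λ s → 2 ℕ.* s ℕ.+ 2 ℕ.* T) (sumPow (suc (suc e)))) (e₂ T)))
      where
      S = sumPow2From2 (suc (suc (suc e)))
      T = 2 ℕ.^ suc (suc (suc e))
      ∸4+12 : ∀ x → 4 ℕ.≤ x → x ℕ.∸ 4 ℕ.+ 12 ≡ x ℕ.+ 8
      ∸4+12 x 4≤x = trans (sym (ℕₚ.+-assoc (x ℕ.∸ 4) 4 8)) (cong (ℕ._+ 8) (ℕₚ.m∸n+n≡m 4≤x))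
      -- Ensures that the truncated subtraction in `factor2` is a genuine one.
      4≤ : 4 ℕ.≤ 2 ℕ.* S ℕ.+ 2 ℕ.* T
      4≤ = ℕₚ.≤-trans (ℕₚ.*-monoʳ-≤ 2 (ℕₚ.^-monoʳ-≤ 2 {1} {suc (suc (suc e))} (s≤s z≤n))) (ℕₚ.m≤n+m (2 ℕ.* T) (2 ℕ.* S))
      e₁ : ∀ S T → 2 ℕ.* S ℕ.+ 2 ℕ.* T ℕ.+ 8 ≡ 2 ℕ.* (S ℕ.+ 4) ℕ.+ 2 ℕ.* T
      e₁ = ℕ-Solver.solve-∀
      e₂ : ∀ T → 2 ℕ.* (2 ℕ.* T) ℕ.+ 2 ℕ.* T ≡ T ℕ.* 6
      e₂ = ℕ-Solver.solve-∀

    count₃≡ : ∀ σ e {n} → Count₃ σ e n → n ≡ 4 ℕ.* σ ℕ.* factor2 e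
    count₃≡ σ zero refl = e σ
      where e : ∀ σ → σ ℕ.* 4 ≡ 4 ℕ.* σ ℕ.* 1
            e = ℕ-Solver.solve-∀
    count₃≡ σ (suc zero) refl = e σ
      where e : ∀ σ → σ ℕ.* 16 ≡ 4 ℕ.* σ ℕ.* 4
            e = ℕ-Solver.solve-∀
    count₃≡ σ (suc (suc k)) {n} eq = ℕₚ.+-cancelʳ-≡ (σ ℕ.* 48) n (4 ℕ.* σ ℕ.* F) (trans eq (trans (e₁ σ P) (trans (cong (4 ℕ.* σ ℕ.*_) (sym (factor2+12 k))) (e₂ σ F))))
      where
      F = factor2 (suc (suc k))
      P = 2 ℕ.^ suc (suc k)
      e₁ : ∀ σ P → σ ℕ.* P ℕ.* 24 ≡ 4 ℕ.* σ ℕ.* (P ℕ.* 6)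
      e₁ = ℕ-Solver.solve-∀
      e₂ : ∀ σ F → 4 ℕ.* σ ℕ.* (F ℕ.+ 12) ≡ 4 ℕ.* σ ℕ.* F ℕ.+ σ ℕ.* 48
      e₂ = ℕ-Solver.solve-∀

  card-level-3 : ∀ {α ds} → Positive α → parity α ≡ true → DivisorSystem α ds → ∀ e →
    Card (Represents 3 (π^ e ∙ α)) (4 ℕ.* sum (map (λ δ → ℤ.∣ nm δ ∣) ds) ℕ.* factor2 e)
  card-level-3 {ds = ds} pos odd system e = card-≡ (count₃≡ (sum (map (λ δ → ℤ.∣ nm δ ∣) ds)) e n₃≡) card₃
    where open Counts (counts pos odd system e)

-- From 𝒪 to the quaternion algebra over K.

module Embedding where
  open import Data.Fin.Patterns using (0F; 1F; 2F; 3F)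
  open import Data.Vec as Vec using (Vec; []; _∷_)
  open import Relation.Nullary.Decidable using (dec⇒maybe)
  open import Data.Integer using (+_)
  open import Data.Rational as ℚ using (ℚ; 0ℚ; 1ℚ; ½; mkℚ)
  import Data.Rational.Properties as ℚₚ
  open import Data.Nat.Coprimality using (1-coprimeTo)
  import Data.Nat.Coprimality as Coprimality
  open import Tactic.RingSolver using (solve-∀)
  open import Tactic.RingSolver.Core.AlmostCommutativeRing using (AlmostCommutativeRing; fromCommutativeRing)
  open import Tactic.RingSolver.Core.Expression using (Expr; Κ; _⊕_; _⊗_; ⊝_)
  open import Defs
  open Quadruple
  open QuadraticIntegers hiding (_+_; _*_; -_; _-_)
  open MaximalOrder
  open Units
  open Counting
  open Levels
  open OddNorms

  ℚ-ring : AlmostCommutativeRing _ _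
  ℚ-ring = fromCommutativeRing ℚₚ.+-*-commutativeRing (λ q → dec⇒maybe (0ℚ ℚ.≟ q))

  open import Tactic.RingSolver.NonReflective ℚ-ring using () renaming (solve to solve-ℚ)

  private
    -- `x / 1` normalises through a gcd and is stuck for variable x; this is its value in lowest
    -- terms, on which numerators compute.
    fromℤ : ℤ → ℚ
    fromℤ x = mkℚ x 0 (Coprimality.sym (1-coprimeTo ℤ.∣ x ∣))

    /1 : ∀ x → x ℚ./ 1 ≡ fromℤ x
    /1 x = ℚₚ.↥p/↧p≡p (fromℤ x)

    /1-injective : ∀ {x y} → x ℚ./ 1 ≡ y ℚ./ 1 → x ≡ y
    /1-injective {x} {y} eq = cong ℚ.numerator (trans (sym (/1 x)) (trans eq (/1 y)))

    /1-+ : ∀ x y → (x ℤ.+ y) ℚ./ 1 ≡ x ℚ./ 1 ℚ.+ y ℚ./ 1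
    /1-+ x y = sym (trans (cong₂ ℚ._+_ (/1 x) (/1 y)) (cong₂ (λ a b → (a ℤ.+ b) ℚ./ 1) (ℤₚ.*-identityʳ x) (ℤₚ.*-identityʳ y)))

    /1-* : ∀ x y → (x ℤ.* y) ℚ./ 1 ≡ (x ℚ./ 1) ℚ.* (y ℚ./ 1)
    /1-* x y = sym (cong₂ ℚ._*_ (/1 x) (/1 y))

    /1-neg : ∀ x → (ℤ.- x) ℚ./ 1 ≡ ℚ.- (x ℚ./ 1)
    /1-neg x = trans (/1 (ℤ.- x)) (trans (neg x) (cong ℚ.-_ (sym (/1 x))))
      where
      neg : ∀ x → fromℤ (ℤ.- x) ≡ ℚ.- fromℤ x
      neg x = sym (trans (sym (ℚₚ.↥p/↧p≡p (ℚ.- fromℤ x))) (trans (num x) (/1 (ℤ.- x))))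
        where
        num : ∀ x → ℚ.numerator (ℚ.- fromℤ x) ℚ./ suc (ℚ.denominator-1 (ℚ.- fromℤ x)) ≡ (ℤ.- x) ℚ./ 1
        num (+ zero) = refl
        num (+ suc n) = refl
        num -[1+ n ] = refl

  negₖ : K → K
  negₖ (mkK r s) = mkK (ℚ.- r) (ℚ.- s)

  K-ops : RingOps K
  K-ops = record { _⊞_ = _+ₖ_ ; _⊠_ = _*ₖ_ ; neg = negₖ ; nil = 0K ; one = 1K ; root2 = mkK 0ℚ 1ℚ }

  ιᴿ : ℤ[√2] → K
  ιᴿ (a ⊕√2 b) = mkK (a ℚ./ 1) (b ℚ./ 1)

  ιᴿ-injective : ∀ {x y} → ιᴿ x ≡ ιᴿ y → x ≡ y
  ιᴿ-injective {a ⊕√2 b} {c ⊕√2 d} eq = cong₂ _⊕√2_ (/1-injective (cong K.re eq)) (/1-injective (cong K.im eq))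

  ιᴿ-eval : ∀ {n} (ρ : Vec ℤ[√2] n) t → ιᴿ (eval ℤ[√2]-ops ρ t) ≡ eval K-ops (Vec.map ιᴿ ρ) t
  ιᴿ-eval = eval-hom record { φ-+ = hom-+ ; φ-* = hom-* ; φ-neg = hom-neg ; φ-0 = refl ; φ-1 = refl ; φ-√2 = refl }
    where
    hom-+ : ∀ x y → ιᴿ (x QuadraticIntegers.+ y) ≡ ιᴿ x +ₖ ιᴿ y
    hom-+ (a ⊕√2 b) (c ⊕√2 d) = cong₂ mkK (/1-+ a c) (/1-+ b d)
    hom-* : ∀ x y → ιᴿ (x QuadraticIntegers.* y) ≡ ιᴿ x *ₖ ιᴿ y
    hom-* (a ⊕√2 b) (c ⊕√2 d) = cong₂ mkK
      (trans (/1-+ (a ℤ.* c) (+ 2 ℤ.* b ℤ.* d)) (cong₂ ℚ._+_ (/1-* a c) (trans (/1-* (+ 2 ℤ.* b) d) (cong (ℚ._* (d ℚ./ 1)) (/1-* (+ 2) b)))))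
      (trans (/1-+ (a ℤ.* d) (b ℤ.* c)) (cong₂ ℚ._+_ (/1-* a d) (/1-* b c)))
    hom-neg : ∀ x → ιᴿ (QuadraticIntegers.- x) ≡ negₖ (ιᴿ x)
    hom-neg (a ⊕√2 b) = cong₂ mkK (/1-neg a) (/1-neg b)

  module KQ = Quaternions K-ops

  -- coordinates with respect to 1, i, j, k, and back
  embed : Quat K → H
  embed ⟪ mkK a₀ a₁ , mkK b₀ b₁ , mkK c₀ c₁ , mkK d₀ d₁ ⟫ = quat
    (mkK (a₀ ℚ.+ (b₁ ℚ.+ c₁) ℚ.+ ½ ℚ.* d₀) (a₁ ℚ.+ ½ ℚ.* (b₀ ℚ.+ c₀) ℚ.+ ½ ℚ.* d₁))
    (mkK (b₁ ℚ.+ ½ ℚ.* d₀) (½ ℚ.* b₀ ℚ.+ ½ ℚ.* d₁))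
    (mkK (c₁ ℚ.+ ½ ℚ.* d₀) (½ ℚ.* c₀ ℚ.+ ½ ℚ.* d₁))
    (mkK (½ ℚ.* d₀) (½ ℚ.* d₁))

  private
    2ℚ : ℚ
    2ℚ = + 2 ℚ./ 1

    unembed : H → Quat K
    unembed (quat (mkK t₀ t₁) (mkK x₀ x₁) (mkK y₀ y₁) (mkK z₀ z₁)) =
      ⟪ mkK (t₀ ℚ.+ ℚ.- x₀ ℚ.+ ℚ.- y₀ ℚ.+ z₀) (t₁ ℚ.+ ℚ.- x₁ ℚ.+ ℚ.- y₁ ℚ.+ z₁)
      , mkK (2ℚ ℚ.* (x₁ ℚ.+ ℚ.- z₁)) (x₀ ℚ.+ ℚ.- z₀) , mkK (2ℚ ℚ.* (y₁ ℚ.+ ℚ.- z₁)) (y₀ ℚ.+ ℚ.- z₀)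
      , mkK (2ℚ ℚ.* z₀) (2ℚ ℚ.* z₁) ⟫

    double-half : ∀ x → 2ℚ ℚ.* (½ ℚ.* x) ≡ x
    double-half = solve-∀ ℚ-ring

    un₁ : ∀ b d → 2ℚ ℚ.* ((½ ℚ.* b ℚ.+ ½ ℚ.* d) ℚ.+ ℚ.- (½ ℚ.* d)) ≡ b
    un₁ = solve-∀ ℚ-ring

    un₂ : ∀ b d → (b ℚ.+ ½ ℚ.* d) ℚ.+ ℚ.- (½ ℚ.* d) ≡ b
    un₂ = solve-∀ ℚ-ring

    un₃ : ∀ a b c d → (a ℚ.+ (b ℚ.+ c) ℚ.+ ½ ℚ.* d) ℚ.+ ℚ.- (b ℚ.+ ½ ℚ.* d) ℚ.+ ℚ.- (c ℚ.+ ½ ℚ.* d) ℚ.+ ½ ℚ.* d ≡ a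
    un₃ = solve-∀ ℚ-ring

    un₄ : ∀ a b c d → (a ℚ.+ ½ ℚ.* (b ℚ.+ c) ℚ.+ ½ ℚ.* d) ℚ.+ ℚ.- (½ ℚ.* b ℚ.+ ½ ℚ.* d) ℚ.+ ℚ.- (½ ℚ.* c ℚ.+ ½ ℚ.* d) ℚ.+ ½ ℚ.* d ≡ a
    un₄ = solve-∀ ℚ-ring

    ⟪⟫-cong : ∀ {A : Set} {a a' b b' c c' d d' : A} → a ≡ a' → b ≡ b' → c ≡ c' → d ≡ d' → ⟪ a , b , c , d ⟫ ≡ ⟪ a' , b' , c' , d' ⟫
    ⟪⟫-cong refl refl refl refl = refl

    unembed-embed : ∀ v → unembed (embed v) ≡ v
    unembed-embed ⟪ mkK a₀ a₁ , mkK b₀ b₁ , mkK c₀ c₁ , mkK d₀ d₁ ⟫ = ⟪⟫-cong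
      (cong₂ mkK (un₃ a₀ b₁ c₁ d₀) (un₄ a₁ b₀ c₀ d₁)) (cong₂ mkK (un₁ b₀ d₁) (un₂ b₁ d₀)) (cong₂ mkK (un₁ c₀ d₁) (un₂ c₁ d₀)) (cong₂ mkK (double-half d₀) (double-half d₁))

    -- An element of K as a pair of solver expressions over ℚ, so that identities in K split into a
    -- rational and an irrational part.
    PE : ℕ → Set
    PE n = Expr ℚ n × Expr ℚ n

    PE-ops : ∀ n → RingOps (PE n)
    PE-ops n = record
      { _⊞_ = λ (a , b) (c , d) → (a ⊕ c) , (b ⊕ d)
      ; _⊠_ = λ (a , b) (c , d) → ((a ⊗ c) ⊕ (Κ 2ℚ ⊗ b ⊗ d)) , ((a ⊗ d) ⊕ (b ⊗ c))
      ; neg = λ (a , b) → (⊝ a) , (⊝ b)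
      ; nil = Κ 0ℚ , Κ 0ℚ ; one = Κ 1ℚ , Κ 0ℚ ; root2 = Κ 0ℚ , Κ 1ℚ }

    module _ {n : ℕ} where
      open RingOps (PE-ops n)
      open Quaternions (PE-ops n) using () renaming (norm to normᴱ)

      tᴱ xᴱ yᴱ zᴱ : (a₀ a₁ b₀ b₁ c₀ c₁ d₀ d₁ : Expr ℚ n) → PE n
      tᴱ a₀ a₁ b₀ b₁ c₀ c₁ d₀ d₁ = (a₀ ⊕ (b₁ ⊕ c₁) ⊕ Κ ½ ⊗ d₀) , (a₁ ⊕ Κ ½ ⊗ (b₀ ⊕ c₀) ⊕ Κ ½ ⊗ d₁)
      xᴱ a₀ a₁ b₀ b₁ c₀ c₁ d₀ d₁ = (b₁ ⊕ Κ ½ ⊗ d₀) , (Κ ½ ⊗ b₀ ⊕ Κ ½ ⊗ d₁)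
      yᴱ a₀ a₁ b₀ b₁ c₀ c₁ d₀ d₁ = (c₁ ⊕ Κ ½ ⊗ d₀) , (Κ ½ ⊗ c₀ ⊕ Κ ½ ⊗ d₁)
      zᴱ a₀ a₁ b₀ b₁ c₀ c₁ d₀ d₁ = (Κ ½ ⊗ d₀) , (Κ ½ ⊗ d₁)

      nrdᴱ normQᴱ : (a₀ a₁ b₀ b₁ c₀ c₁ d₀ d₁ : Expr ℚ n) → PE n
      nrdᴱ a₀ a₁ b₀ b₁ c₀ c₁ d₀ d₁ = ((t ⊠ t) ⊞ (x ⊠ x)) ⊞ ((y ⊠ y) ⊞ (z ⊠ z))
        where
        t = tᴱ a₀ a₁ b₀ b₁ c₀ c₁ d₀ d₁
        x = xᴱ a₀ a₁ b₀ b₁ c₀ c₁ d₀ d₁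
        y = yᴱ a₀ a₁ b₀ b₁ c₀ c₁ d₀ d₁
        z = zᴱ a₀ a₁ b₀ b₁ c₀ c₁ d₀ d₁
      normQᴱ a₀ a₁ b₀ b₁ c₀ c₁ d₀ d₁ = normᴱ ⟪ (a₀ , a₁) , (b₀ , b₁) , (c₀ , c₁) , (d₀ , d₁) ⟫

    K-ext : ∀ {x y : K} → K.re x ≡ K.re y → K.im x ≡ K.im y → x ≡ y
    K-ext refl refl = refl

    nrd-re : ∀ a₀ a₁ b₀ b₁ c₀ c₁ d₀ d₁ → let v = ⟪ mkK a₀ a₁ , mkK b₀ b₁ , mkK c₀ c₁ , mkK d₀ d₁ ⟫ in K.re (nrd (embed v)) ≡ K.re (KQ.norm v)
    nrd-re = solve-ℚ 8 (λ a₀ a₁ b₀ b₁ c₀ c₁ d₀ d₁ → proj₁ (nrdᴱ a₀ a₁ b₀ b₁ c₀ c₁ d₀ d₁) , proj₁ (normQᴱ a₀ a₁ b₀ b₁ c₀ c₁ d₀ d₁)) refl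

    nrd-im : ∀ a₀ a₁ b₀ b₁ c₀ c₁ d₀ d₁ → let v = ⟪ mkK a₀ a₁ , mkK b₀ b₁ , mkK c₀ c₁ , mkK d₀ d₁ ⟫ in K.im (nrd (embed v)) ≡ K.im (KQ.norm v)
    nrd-im = solve-ℚ 8 (λ a₀ a₁ b₀ b₁ c₀ c₁ d₀ d₁ → proj₂ (nrdᴱ a₀ a₁ b₀ b₁ c₀ c₁ d₀ d₁) , proj₂ (normQᴱ a₀ a₁ b₀ b₁ c₀ c₁ d₀ d₁)) refl

    nrd-embed : ∀ v → nrd (embed v) ≡ KQ.norm v
    nrd-embed ⟪ mkK a₀ a₁ , mkK b₀ b₁ , mkK c₀ c₁ , mkK d₀ d₁ ⟫ = K-ext (nrd-re a₀ a₁ b₀ b₁ c₀ c₁ d₀ d₁) (nrd-im a₀ a₁ b₀ b₁ c₀ c₁ d₀ d₁)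

  -- the element with coordinates c₀, …, c₃ with respect to the basis g₀, …, g₃ of 𝒢
  module Basis {A : Set} (ops : RingOps A) where
    open RingOps ops

    fromBasis : Quat A → Quat A
    fromBasis ⟪ c₀ , c₁ , c₂ , c₃ ⟫ =
      ⟪ c₀ ⊟ (one ⊞ one) ⊠ c₁ ⊟ root2 ⊠ c₂ ⊞ c₃ , root2 ⊠ (root2 ⊠ (root2 ⊠ one)) ⊠ c₁ ⊞ c₂ ⊞ (one ⊟ root2) ⊠ c₃ , c₂ , c₃ ⟫

  open Basis ℤ[√2]-ops using (fromBasis)
  module KB = Basis K-ops

  combination𝒢 : Quat K → H
  combination𝒢 ⟪ c₀ , c₁ , c₂ , c₃ ⟫ = ((c₀ ·ₕ g₀) +ₕ (c₁ ·ₕ g₁)) +ₕ ((c₂ ·ₕ g₂) +ₕ (c₃ ·ₕ g₃))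

  mapQ : ∀ {A B : Set} → (A → B) → Quat A → Quat B
  mapQ φ ⟪ a , b , c , d ⟫ = ⟪ φ a , φ b , φ c , φ d ⟫

  embedᴿ : 𝒪 → H
  embedᴿ q = embed (mapQ ιᴿ q)

  private
    module _ {n : ℕ} where
      open RingOps (PE-ops n)

      combinationᴱ : (p₀ p₁ p₂ p₃ : Expr ℚ n × Expr ℚ n) → (c₀ c₁ c₂ c₃ : PE n) → PE n
      combinationᴱ p₀ p₁ p₂ p₃ c₀ c₁ c₂ c₃ = ((c₀ ⊠ p₀) ⊞ (c₁ ⊠ p₁)) ⊞ ((c₂ ⊠ p₂) ⊞ (c₃ ⊠ p₃))

      embeddedᴱ : ((a₀ a₁ b₀ b₁ c₀ c₁ d₀ d₁ : Expr ℚ n) → PE n) → (c₀ c₁ c₂ c₃ : PE n) → PE n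
      embeddedᴱ co c₀ c₁ c₂ c₃ with Basis.fromBasis (PE-ops n) ⟪ c₀ , c₁ , c₂ , c₃ ⟫
      ... | ⟪ (a₀ , a₁) , (b₀ , b₁) , (c₀ , c₁) , (d₀ , d₁) ⟫ = co a₀ a₁ b₀ b₁ c₀ c₁ d₀ d₁

      0ᴱ 1ᴱ 2ᴱ : PE n
      0ᴱ = Κ 0ℚ , Κ 0ℚ
      1ᴱ = Κ 1ℚ , Κ 0ℚ
      2ᴱ = Κ 2ℚ , Κ 0ℚ

    Pair-statement : (H → ℚ) → Set
    Pair-statement co = ∀ a₀ a₁ b₀ b₁ c₀ c₁ d₀ d₁ → let v = ⟪ mkK a₀ a₁ , mkK b₀ b₁ , mkK c₀ c₁ , mkK d₀ d₁ ⟫ in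
      co (combination𝒢 v) ≡ co (embed (KB.fromBasis v))

    t-re : Pair-statement (λ h → K.re (H.t h))
    t-re = solve-ℚ 8 (λ a₀ a₁ b₀ b₁ c₀ c₁ d₀ d₁ → proj₁ (combinationᴱ 1ᴱ 0ᴱ 0ᴱ (Κ ½ , Κ ½) (a₀ , a₁) (b₀ , b₁) (c₀ , c₁) (d₀ , d₁)) , proj₁ (embeddedᴱ tᴱ (a₀ , a₁) (b₀ , b₁) (c₀ , c₁) (d₀ , d₁))) refl

    t-im : Pair-statement (λ h → K.im (H.t h))
    t-im = solve-ℚ 8 (λ a₀ a₁ b₀ b₁ c₀ c₁ d₀ d₁ → proj₂ (combinationᴱ 1ᴱ 0ᴱ 0ᴱ (Κ ½ , Κ ½) (a₀ , a₁) (b₀ , b₁) (c₀ , c₁) (d₀ , d₁)) , proj₂ (embeddedᴱ tᴱ (a₀ , a₁) (b₀ , b₁) (c₀ , c₁) (d₀ , d₁))) refl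

    x-re : Pair-statement (λ h → K.re (H.x h))
    x-re = solve-ℚ 8 (λ a₀ a₁ b₀ b₁ c₀ c₁ d₀ d₁ → proj₁ (combinationᴱ 0ᴱ 2ᴱ (Κ 0ℚ , Κ ½) (Κ (ℚ.- ½) , Κ ½) (a₀ , a₁) (b₀ , b₁) (c₀ , c₁) (d₀ , d₁)) , proj₁ (embeddedᴱ xᴱ (a₀ , a₁) (b₀ , b₁) (c₀ , c₁) (d₀ , d₁))) refl

    x-im : Pair-statement (λ h → K.im (H.x h))
    x-im = solve-ℚ 8 (λ a₀ a₁ b₀ b₁ c₀ c₁ d₀ d₁ → proj₂ (combinationᴱ 0ᴱ 2ᴱ (Κ 0ℚ , Κ ½) (Κ (ℚ.- ½) , Κ ½) (a₀ , a₁) (b₀ , b₁) (c₀ , c₁) (d₀ , d₁)) , proj₂ (embeddedᴱ xᴱ (a₀ , a₁) (b₀ , b₁) (c₀ , c₁) (d₀ , d₁))) refl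

    y-re : Pair-statement (λ h → K.re (H.y h))
    y-re = solve-ℚ 8 (λ a₀ a₁ b₀ b₁ c₀ c₁ d₀ d₁ → proj₁ (combinationᴱ 0ᴱ 0ᴱ (Κ 0ℚ , Κ ½) (Κ ½ , Κ 0ℚ) (a₀ , a₁) (b₀ , b₁) (c₀ , c₁) (d₀ , d₁)) , proj₁ (embeddedᴱ yᴱ (a₀ , a₁) (b₀ , b₁) (c₀ , c₁) (d₀ , d₁))) refl

    y-im : Pair-statement (λ h → K.im (H.y h))
    y-im = solve-ℚ 8 (λ a₀ a₁ b₀ b₁ c₀ c₁ d₀ d₁ → proj₂ (combinationᴱ 0ᴱ 0ᴱ (Κ 0ℚ , Κ ½) (Κ ½ , Κ 0ℚ) (a₀ , a₁) (b₀ , b₁) (c₀ , c₁) (d₀ , d₁)) , proj₂ (embeddedᴱ yᴱ (a₀ , a₁) (b₀ , b₁) (c₀ , c₁) (d₀ , d₁))) refl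

    z-re : Pair-statement (λ h → K.re (H.z h))
    z-re = solve-ℚ 8 (λ a₀ a₁ b₀ b₁ c₀ c₁ d₀ d₁ → proj₁ (combinationᴱ 0ᴱ 0ᴱ 0ᴱ (Κ ½ , Κ 0ℚ) (a₀ , a₁) (b₀ , b₁) (c₀ , c₁) (d₀ , d₁)) , proj₁ (embeddedᴱ zᴱ (a₀ , a₁) (b₀ , b₁) (c₀ , c₁) (d₀ , d₁))) refl

    z-im : Pair-statement (λ h → K.im (H.z h))
    z-im = solve-ℚ 8 (λ a₀ a₁ b₀ b₁ c₀ c₁ d₀ d₁ → proj₂ (combinationᴱ 0ᴱ 0ᴱ 0ᴱ (Κ ½ , Κ 0ℚ) (a₀ , a₁) (b₀ , b₁) (c₀ , c₁) (d₀ , d₁)) , proj₂ (embeddedᴱ zᴱ (a₀ , a₁) (b₀ , b₁) (c₀ , c₁) (d₀ , d₁))) refl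

    combination≡embed : ∀ v → combination𝒢 v ≡ embed (KB.fromBasis v)
    combination≡embed ⟪ mkK a₀ a₁ , mkK b₀ b₁ , mkK c₀ c₁ , mkK d₀ d₁ ⟫ = H-ext
      (K-ext (t-re a₀ a₁ b₀ b₁ c₀ c₁ d₀ d₁) (t-im a₀ a₁ b₀ b₁ c₀ c₁ d₀ d₁)) (K-ext (x-re a₀ a₁ b₀ b₁ c₀ c₁ d₀ d₁) (x-im a₀ a₁ b₀ b₁ c₀ c₁ d₀ d₁))
      (K-ext (y-re a₀ a₁ b₀ b₁ c₀ c₁ d₀ d₁) (y-im a₀ a₁ b₀ b₁ c₀ c₁ d₀ d₁)) (K-ext (z-re a₀ a₁ b₀ b₁ c₀ c₁ d₀ d₁) (z-im a₀ a₁ b₀ b₁ c₀ c₁ d₀ d₁))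
      where
      H-ext : ∀ {x y : H} → H.t x ≡ H.t y → H.x x ≡ H.x y → H.y x ≡ H.y y → H.z x ≡ H.z y → x ≡ y
      H-ext refl refl refl refl = refl

    mapQ-fromBasis : ∀ v → mapQ ιᴿ (fromBasis v) ≡ KB.fromBasis (mapQ ιᴿ v)
    mapQ-fromBasis ⟪ a , b , c , d ⟫ = ⟪⟫-cong (ιᴿ-eval (a ∷ b ∷ c ∷ d ∷ []) (co₀ t)) (ιᴿ-eval (a ∷ b ∷ c ∷ d ∷ []) (co₁ t)) refl refl
      where t = Basis.fromBasis (Term-ops 4) ⟪ var 0F , var 1F , var 2F , var 3F ⟫

    nrd-embedᴿ : ∀ q → nrd (embedᴿ q) ≡ ιᴿ (norm q)
    nrd-embedᴿ ⟪ a , b , c , d ⟫ = trans (nrd-embed ⟪ ιᴿ a , ιᴿ b , ιᴿ c , ιᴿ d ⟫) (sym (ιᴿ-eval (a ∷ b ∷ c ∷ d ∷ []) (T.norm ⟪ var 0F , var 1F , var 2F , var 3F ⟫)))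

    embedᴿ-injective : ∀ {x y} → embedᴿ x ≡ embedᴿ y → x ≡ y
    embedᴿ-injective {x} {y} eq = mapQ-injective x y (trans (sym (unembed-embed (mapQ ιᴿ x))) (trans (cong unembed eq) (unembed-embed (mapQ ιᴿ y))))
      where
      mapQ-injective : ∀ x y → mapQ ιᴿ x ≡ mapQ ιᴿ y → x ≡ y
      mapQ-injective ⟪ a , b , c , d ⟫ ⟪ a' , b' , c' , d' ⟫ eq =
        ⟪⟫-cong (ιᴿ-injective (cong co₀ eq)) (ιᴿ-injective (cong co₁ eq)) (ιᴿ-injective (cong co₂ eq)) (ιᴿ-injective (cong co₃ eq))

  toᴿ : OK → ℤ[√2]
  toᴿ (ok x y) = x ⊕√2 y

  fromᴿ : ℤ[√2] → OK
  fromᴿ (x ⊕√2 y) = ok x y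

  private
    ι-fromᴿ : ∀ x → ι (fromᴿ x) ≡ ιᴿ x
    ι-fromᴿ (x ⊕√2 y) = refl

    ι≡ιᴿ : ∀ x → ι x ≡ ιᴿ (toᴿ x)
    ι≡ιᴿ (ok x y) = refl

    -- In the basis 1, f, g, fg the generators of 𝒢 are 1, √2³ f - 2, f + g - √2 and 1 + (1 - √2) f
    -- + fg. Only the second has a nonzero `ℓ`, namely √2³.
    Level-fromBasis : ∀ v → Level 3 (fromBasis v)
    Level-fromBasis ⟪ c₀ , c₁ , c₂ , c₃ ⟫ = c₁ , e c₁ c₂ c₃
      where
      open QuadraticIntegers
      e : ∀ c₁ c₂ c₃ → √2 * (√2 * (√2 * 1R)) * c₁ + c₂ + (1R - √2) * c₃ - c₂ - (1R - √2) * c₃ ≡ √2 * (√2 * (√2 * 1R)) * c₁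
      e = solve-∀ RR

    Level-3⇒basis : ∀ q → Level 3 q → ∃ λ v → q ≡ fromBasis v
    Level-3⇒basis ⟪ a , b , c , d ⟫ (k , eq) = ⟪ a + 2R * k + √2 * c - d , k , c , d ⟫ , ⟪⟫-cong (e₁ a k c d) (trans (e₂ b c d) (cong (λ z → z + c + (1R - √2) * d) eq)) refl refl
      where
      open QuadraticIntegers
      e₁ : ∀ a k c d → a ≡ (a + 2R * k + √2 * c - d) - (1R + 1R) * k - √2 * c + d
      e₁ = solve-∀ RR
      e₂ : ∀ b c d → b ≡ (b - c - (1R - √2) * d) + c + (1R - √2) * d
      e₂ = solve-∀ RR

  card-𝒢 : ∀ α {w} → Card (Represents 3 (toᴿ α)) w → Card (λ h → In𝒢 h × nrd h ≡ ι α) w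
  card-𝒢 α = card-map embedᴿ embedᴿ-injective to from
    where
    in𝒢 : ∀ v → In𝒢 (embedᴿ (fromBasis v))
    in𝒢 v@(⟪ c₀ , c₁ , c₂ , c₃ ⟫) = fromᴿ c₀ , fromᴿ c₁ , fromᴿ c₂ , fromᴿ c₃ ,
      trans (cong embed (mapQ-fromBasis v)) (trans (sym (combination≡embed (mapQ ιᴿ v))) (cong combination𝒢 (⟪⟫-cong (sym (ι-fromᴿ c₀)) (sym (ι-fromᴿ c₁)) (sym (ι-fromᴿ c₂)) (sym (ι-fromᴿ c₃)))))
    to : ∀ q → Represents 3 (toᴿ α) q → In𝒢 (embedᴿ q) × nrd (embedᴿ q) ≡ ι α
    to q (norm-q , lev) = let (v , q≡) = Level-3⇒basis q lev in
      subst (λ q → In𝒢 (embedᴿ q)) (sym q≡) (in𝒢 v) , trans (nrd-embedᴿ q) (trans (cong ιᴿ norm-q) (sym (ι≡ιᴿ α)))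
    from : ∀ h → In𝒢 h × nrd h ≡ ι α → ∃ λ q → Represents 3 (toᴿ α) q × h ≡ embedᴿ q
    from h ((c₀ , c₁ , c₂ , c₃ , h≡) , nrd-h) = fromBasis v , (ιᴿ-injective (trans (sym (nrd-embedᴿ (fromBasis v))) (trans (cong nrd (sym embed≡)) (trans nrd-h (ι≡ιᴿ α)))) , Level-fromBasis v) , embed≡
      where
      v = ⟪ toᴿ c₀ , toᴿ c₁ , toᴿ c₂ , toᴿ c₃ ⟫
      embed≡ : h ≡ embedᴿ (fromBasis v)
      embed≡ = trans h≡ (trans (combination≡embed ⟪ ι c₀ , ι c₁ , ι c₂ , ι c₃ ⟫) (sym (cong embed (mapQ-fromBasis v))))

-- Positivity, divisors of the odd part, and the conclusion.

import Data.Nat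
open import Data.Nat.ListAction using (sum)
open import Data.Bool using (true; false)
open import Data.List using (List; _∷_; length; map)
import Data.List.Properties as Listₚ
open import Data.List.Membership.Propositional using (_∈_; find)
open import Data.List.Membership.Propositional.Properties using (∈-map⁺; ∈-map⁻)
open import Data.List.Relation.Unary.Any using (here; there)
open import Data.List.Relation.Unary.All as All using (All; _∷_)
open import Data.List.Relation.Unary.AllPairs as AllPairs using (AllPairs; _∷_)
import Data.List.Relation.Unary.AllPairs.Properties as AllPairsₚ
open import Function.Bundles using (Equivalence)
open import Data.Integer using (+_)
open import Tactic.RingSolver using (solve-∀)
open import Defs
open Quadruple
open QuadraticIntegers
open EuclideanRing
open Units
open Counting
open Levels
open OddNorms
open EvenNorms
open Recursion
open Embedding

open IntegerRounding

private
  ∣ₒ⇒∣ᴿ : ∀ δ α → δ ∣ₒ α → toᴿ δ ∣ᴿ toᴿ α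
  ∣ₒ⇒∣ᴿ δ α (γ , eq) = toᴿ γ , cong toᴿ eq

  ∣ᴿ⇒∣ₒ : ∀ δ α → toᴿ δ ∣ᴿ toᴿ α → δ ∣ₒ α
  ∣ᴿ⇒∣ₒ δ α ((x ⊕√2 y) , eq) = ok x y , cong fromᴿ {toᴿ α} {toᴿ δ * (x ⊕√2 y)} eq

  toᴿ-√2^ : ∀ e → toᴿ (√2^ e) ≡ √2^ᴿ e
  toᴿ-√2^ zero = refl
  toᴿ-√2^ (suc e) = cong (√2 *_) (toᴿ-√2^ e)

  Nm≡ : ∀ δ → Nm δ ≡ ℤ.∣ nm (toᴿ δ) ∣
  Nm≡ (ok x y) = cong (λ z → ℤ.∣ x ℤ.* x ℤ.+ ℤ.- z ∣) (ℤₚ.*-assoc (+ 2) y y)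

  0<nm′ : ∀ x y → + 2 ℤ.* y ℤ.* y ℤ.< x ℤ.* x → 0ℤ ℤ.< x ℤ.* x ℤ.+ ℤ.- (+ 2 ℤ.* (y ℤ.* y))
  0<nm′ x y lt = subst₂ ℤ._<_ (ℤₚ.+-inverseʳ (+ 2 ℤ.* (y ℤ.* y))) refl (ℤₚ.+-monoˡ-< (ℤ.- (+ 2 ℤ.* (y ℤ.* y))) (subst (ℤ._< x ℤ.* x) (ℤₚ.*-assoc (+ 2) y y) lt))

  neg-sq : ∀ y → + 2 ℤ.* (ℤ.- y) ℤ.* (ℤ.- y) ≡ + 2 ℤ.* y ℤ.* y
  neg-sq = ℤ-Solver.solve-∀

  -- Unless y = 0, one of the two conjugates supplies the comparison 2y² < x²; the other sign
  -- patterns contradict each other.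
  positive′ : ∀ {α} → TotallyPositive α → Positive (toᴿ α)
  positive′ {ok x y} (inj₁ (0≤x , 0≤y , ≢0) , inj₁ (_ , 0≤-y , _)) = positive 0<x (subst (0ℤ ℤ.<_) (trans (sym (ℤₚ.+-identityʳ (x ℤ.* x))) (cong (λ y → x ℤ.* x ℤ.+ ℤ.- (+ 2 ℤ.* (y ℤ.* y))) (sym y≡0))) (0<* 0<x 0<x))
    where
    y≡0 : y ≡ 0ℤ
    y≡0 = ℤₚ.≤-antisym (subst (ℤ._≤ 0ℤ) (ℤₚ.neg-involutive y) (ℤₚ.neg-mono-≤ 0≤-y)) 0≤y
    0<x : 0ℤ ℤ.< x
    0<x = ℤₚ.≤∧≢⇒< 0≤x λ 0≡x → ≢0 (sym 0≡x , y≡0)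
  positive′ {ok x y} (inj₁ _ , inj₂ (inj₁ (0<x , _ , lt))) = positive 0<x (0<nm′ x y (subst (ℤ._< x ℤ.* x) (neg-sq y) lt))
  positive′ {ok x y} (inj₁ (0≤x , _) , inj₂ (inj₂ (x<0 , _))) = contradiction 0≤x (ℤₚ.<⇒≱ x<0)
  positive′ {ok x y} (inj₂ (inj₁ (0<x , _ , lt)) , _) = positive 0<x (0<nm′ x y lt)
  positive′ {ok x y} (inj₂ (inj₂ (x<0 , _)) , inj₁ (0≤x , _)) = contradiction 0≤x (ℤₚ.<⇒≱ x<0)
  positive′ {ok x y} (inj₂ (inj₂ (x<0 , _)) , inj₂ (inj₁ (0<x , _))) = contradiction 0<x (ℤₚ.<-asym x<0)
  positive′ {ok x y} (inj₂ (inj₂ (_ , 0<y , _)) , inj₂ (inj₂ (_ , 0<-y , _))) = contradiction (subst (ℤ._< 0ℤ) (ℤₚ.neg-involutive y) (ℤₚ.neg-mono-< 0<-y)) (ℤₚ.<-asym 0<y)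

  -- nm π = 2 is positive. If x ≤ 0, then re (π β) = 2 (x + y) > 0 forces y > -x ≥ 0, and nm β could
  -- not be positive.
  positive-π⁻ : ∀ {β} → Positive (π * β) → Positive β
  positive-π⁻ {x ⊕√2 y} (positive 0<re 0<nm) = positive (ℤₚ.≰⇒> x≰0) 0<nmβ
    where
    0<nmβ : 0ℤ ℤ.< nm (x ⊕√2 y)
    0<nmβ = ℤₚ.*-cancelˡ-<-nonNeg {0ℤ} {nm (x ⊕√2 y)} (+ 2) (subst (0ℤ ℤ.<_) (nm-* π (x ⊕√2 y)) 0<nm)
    e : ∀ x y → + 2 ℤ.* x ℤ.+ + 2 ℤ.* 1ℤ ℤ.* y ≡ + 2 ℤ.* (y ℤ.+ ℤ.- (ℤ.- x))
    e = ℤ-Solver.solve-∀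
    x≰0 : ¬ (x ℤ.≤ 0ℤ)
    x≰0 x≤0 = ℤₚ.<⇒≱ 0<nmβ (nonpos x y (ℤₚ.neg-mono-≤ x≤0) (ℤₚ.*-cancelˡ-<-nonNeg {0ℤ} {y ℤ.+ ℤ.- (ℤ.- x)} (+ 2) (subst (0ℤ ℤ.<_) (e x y) 0<re)))
      where
      nonpos : ∀ x y → 0ℤ ℤ.≤ ℤ.- x → 0ℤ ℤ.< y ℤ.+ ℤ.- (ℤ.- x) → x ℤ.* x ℤ.+ ℤ.- (+ 2 ℤ.* (y ℤ.* y)) ℤ.≤ 0ℤ
      nonpos x y 0≤-x 0<y+x = ≤-by ((y ℤ.* y ℤ.+ ℤ.- (ℤ.- x ℤ.* ℤ.- x)) ℤ.+ y ℤ.* y)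
          (0≤+ (ℤₚ.i≤j⇒0≤j-i {ℤ.- x ℤ.* ℤ.- x} {y ℤ.* y} (sq-mono-≤ {ℤ.- x} {y} 0≤-x (ℤₚ.0≤i-j⇒j≤i {y} {ℤ.- x} (ℤₚ.<⇒≤ 0<y+x)))) (0≤sq y)) (e′ x y)
        where e′ : ∀ x y → 0ℤ ≡ (x ℤ.* x ℤ.+ ℤ.- (+ 2 ℤ.* (y ℤ.* y))) ℤ.+ ((y ℤ.* y ℤ.+ ℤ.- (ℤ.- x ℤ.* ℤ.- x)) ℤ.+ y ℤ.* y)
              e′ = ℤ-Solver.solve-∀

  positive-π^⁻ : ∀ e {β} → Positive (π^ e ∙ β) → Positive β
  positive-π^⁻ zero pos = pos
  positive-π^⁻ (suc e) {β} pos = positive-π^⁻ e (positive-π⁻ {π^ e ∙ β} pos)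

  ε⁻¹ : ℤ[√2]
  ε⁻¹ = -[1+ 0 ] ⊕√2 + 1

  π^-*ˡ : ∀ e u y → π^ e ∙ (u * y) ≡ u * (π^ e ∙ y)
  π^-*ˡ zero u y = refl
  π^-*ˡ (suc e) u y = trans (cong (π *_) (π^-*ˡ e u y)) (swap (π^ e ∙ y) u)
    where swap : ∀ z u → π * (u * z) ≡ u * (π * z)
          swap z u = trans (sym (R.*-assoc π u z)) (trans (cong (_* z) (R.*-comm π u)) (R.*-assoc u π z))

  -- The recursion multiplies by π to stay totally positive, while e counts factors √2. Since π = √2
  -- (1 + √2), the powers are exchanged at the cost of a unit in the cofactor.
  record OddPart (e : ℕ) (x : ℤ[√2]) : Set where
    field
      y : ℤ[√2]
      √2^≡π^ : √2^ᴿ e * x ≡ π^ e ∙ y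
      x∣y : x ∣ᴿ y
      y∣x : y ∣ᴿ x

  oddPart : ∀ e x → OddPart e x
  oddPart zero x = record { y = x ; √2^≡π^ = R.*-identityˡ x ; x∣y = ∣-refl ; y∣x = ∣-refl }
  oddPart (suc e) x = record
    { y = ε⁻¹ * y
    ; √2^≡π^ = trans (R.*-assoc √2 (√2^ᴿ e) x) (trans (cong (√2 *_) √2^≡π^) (trans (e₁ (π^ e ∙ y)) (cong (π *_) (sym (π^-*ˡ e ε⁻¹ y)))))
    ; x∣y = ∣-*ˡ ε⁻¹ x∣y
    ; y∣x = ∣-trans ((1ℤ ⊕√2 1ℤ) , e₂ y) y∣x }
    where
    open OddPart (oddPart e x)
    e₁ : ∀ z → √2 * z ≡ (+ 2 ⊕√2 + 1) * ((-[1+ 0 ] ⊕√2 + 1) * z)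
    e₁ = solve-∀ RR
    e₂ : ∀ y → y ≡ ((-[1+ 0 ] ⊕√2 + 1) * y) * (1ℤ ⊕√2 1ℤ)
    e₂ = solve-∀ RR

  odd-∣ : ∀ {x y} → x ∣ᴿ y → parity y ≡ true → parity x ≡ true
  odd-∣ {x} (k , refl) odd with parity x | parity-* x k
  ... | true | _ = refl
  ... | false | eq = trans (sym eq) odd

  not-even : ∀ {x} → ¬ (√2 ∣ᴿ x) → parity x ≡ true
  not-even {x} ∤ with parity x in eq
  ... | true = refl
  ... | false = contradiction (even⇒√2∣ {x} eq) ∤

  same-∈ : ∀ {ds δ δ'} → AllPairs (λ δ δ' → ¬ SameIdeal δ δ') ds → δ ∈ ds → δ' ∈ ds → SameIdeal δ δ' → δ ≡ δ'
  same-∈ (_ ∷ _) (here refl) (here refl) _ = refl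
  same-∈ (distinct ∷ _) (here refl) (there δ'∈) same = contradiction same (All.lookup distinct δ'∈)
  same-∈ (distinct ∷ _) (there δ∈) (here refl) (p , q) = contradiction (q , p) (All.lookup distinct δ∈)
  same-∈ (_ ∷ rest) (there δ∈) (there δ'∈) same = same-∈ rest δ∈ δ'∈ same

  SameIdeal-refl : ∀ δ → SameIdeal δ δ
  SameIdeal-refl δ = ∣ᴿ⇒∣ₒ δ δ ∣-refl , ∣ᴿ⇒∣ₒ δ δ ∣-refl

  -- The divisors of α that are prime to √2 are the divisors of its odd part.
  divisorSystem : ∀ {α e x y ds} → toᴿ α ≡ √2^ᴿ e * x → parity y ≡ true → x ∣ᴿ y → y ∣ᴿ x → DivisorIdeals α ds → DivisorSystem y (map toᴿ ds)
  divisorSystem {α} {e} {x} {y} {ds} α≡ odd x∣y y∣x (divisors , distinct , exhaustive) = record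
    { unique = AllPairsₚ.map⁺ (AllPairs.map (λ {δ} {δ'} ≁ eq → ≁ (subst (SameIdeal δ) (cong fromᴿ {toᴿ δ} {toᴿ δ'} eq) (SameIdeal-refl δ))) distinct)
    ; divisor = λ δ∈ → let (δ , δ∈ds , δ≡) = ∈-map⁻ toᴿ δ∈ in subst (_∣ᴿ y) (sym δ≡) (divisor δ (All.lookup divisors δ∈ds))
    ; inequivalent = λ δ∈ δ'∈ → inequivalent (∈-map⁻ toᴿ δ∈) (∈-map⁻ toᴿ δ'∈)
    ; exhaustive = exhaustive′
    }
    where
    divisor : ∀ δ → δ ∣ₒ α × ¬ (√2ₒ ∣ₒ δ) → toᴿ δ ∣ᴿ y
    divisor δ (δ∣α , √2∤δ) = go (∣ₒ⇒∣ᴿ δ α δ∣α)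
      where
      go : toᴿ δ ∣ᴿ toᴿ α → toᴿ δ ∣ᴿ y
      go (γ , eq) = go′ (odd-cancel e {γ} {toᴿ δ} (not-even λ √2∣ → √2∤δ (∣ᴿ⇒∣ₒ √2ₒ δ √2∣)) (x , trans (R.*-comm γ (toᴿ δ)) (trans (sym eq) α≡)))
        where
        go′ : √2^ᴿ e ∣ᴿ γ → toᴿ δ ∣ᴿ y
        go′ (k , γ≡) = ∣-trans (k , *-cancelˡ (√2^≢0 e) (trans (sym α≡) (trans eq (trans (cong (toᴿ δ *_) γ≡) (swap (toᴿ δ) (√2^ᴿ e) k))))) x∣y
          where swap : ∀ d p k → d * (p * k) ≡ p * (d * k)
                swap = solve-∀ RR
    inequivalent : ∀ {δ δ'} → (∃ λ δ₀ → δ₀ ∈ ds × δ ≡ toᴿ δ₀) → (∃ λ δ₀ → δ₀ ∈ ds × δ' ≡ toᴿ δ₀) → δ ∣ᴿ δ' → δ' ∣ᴿ δ → δ ≡ δ'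
    inequivalent (δ₀ , δ₀∈ , refl) (δ₁ , δ₁∈ , refl) p q = cong toᴿ (same-∈ distinct δ₀∈ δ₁∈ (∣ᴿ⇒∣ₒ δ₀ δ₁ p , ∣ᴿ⇒∣ₒ δ₁ δ₀ q))
    exhaustive′ : ∀ δ → δ ∣ᴿ y → ∃ λ δ' → δ' ∈ map toᴿ ds × δ ∣ᴿ δ' × δ' ∣ᴿ δ
    exhaustive′ δ@(a ⊕√2 b) δ∣y = result (find (exhaustive (ok a b) (∣ᴿ⇒∣ₒ (ok a b) α (∣-subst (sym α≡) (∣-*ˡ (√2^ᴿ e) (∣-trans δ∣y y∣x))))
        (λ √2∣ → contradiction (trans (sym (odd-∣ {δ} δ∣y odd)) (√2∣⇒even (∣ₒ⇒∣ᴿ √2ₒ (ok a b) √2∣))) λ ())))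
      where
      result : (∃ λ δ' → δ' ∈ ds × SameIdeal (ok a b) δ') → ∃ λ δ' → δ' ∈ map toᴿ ds × δ ∣ᴿ δ' × δ' ∣ᴿ δ
      result (δ' , δ'∈ , p , q) = toᴿ δ' , ∈-map⁺ toᴿ δ'∈ , ∣ₒ⇒∣ᴿ (ok a b) δ' p , ∣ₒ⇒∣ᴿ δ' (ok a b) q

theorem3p34 : (α : OK) → TotallyPositive α → (e : ℕ) →
    InPow√2 e α → ¬ InPow√2 (Data.Nat.suc e) α →
    (qs : List H) → Enumerates-r𝒢 α qs →
    (ds : List OK) → DivisorIdeals α ds →
    length qs ≡ 4 ℕ.* sum (map Nm ds) ℕ.* factor2 e
theorem3p34 α tp e (γ , α≡γ) ∤ qs (unique , mem) ds system = trans
  -- The given enumeration and the constructed one have the same members, hence the same length.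
  (card-unique (card qs unique (λ h → Equivalence.to (mem h)) (λ h → Equivalence.from (mem h)) refl)
    (card-𝒢 α (subst (λ β → Card (Represents 3 β) (4 ℕ.* sum (map (λ δ → ℤ.∣ nm δ ∣) (map toᴿ ds)) ℕ.* factor2 e)) (sym (trans α≡ √2^≡π^))
      (card-level-3 (positive-π^⁻ e (subst Positive (trans α≡ √2^≡π^) (positive′ tp))) odd-y (divisorSystem {α} {e} α≡ odd-y x∣y y∣x system) e))))
  (cong (λ s → 4 ℕ.* sum s ℕ.* factor2 e) (trans (sym (Listₚ.map-∘ ds)) (Listₚ.map-cong (λ δ → sym (Nm≡ δ)) ds)))
  where
  open OddPart (oddPart e (toᴿ γ))
  α≡ : toᴿ α ≡ √2^ᴿ e * toᴿ γ
  α≡ = trans (cong toᴿ α≡γ) (cong (_* toᴿ γ) (toᴿ-√2^ e))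
  odd-γ : parity (toᴿ γ) ≡ true
  odd-γ = not-even λ (k , γ≡) → ∤ (∣ᴿ⇒∣ₒ (√2^ (suc e)) α (k , trans α≡ (trans (cong (√2^ᴿ e *_) γ≡) (trans (swap (√2^ᴿ e) k) (cong (λ p → √2 * p * k) (sym (toᴿ-√2^ e)))))))
    where swap : ∀ p k → p * (√2 * k) ≡ √2 * p * k
          swap = solve-∀ RR
  odd-y : parity y ≡ true
  odd-y = odd-∣ {y} y∣x odd-γ
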